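{- A simple binary matroid $M$ is a binary comatroid if and only if neither $M$ nor $M^c$ has a flat $F$ such that the restriction to $F$ is isomorphic to one of the following: a circuit $U_{n-1,n}$ with $n\ge 6$; the matroid $P(U_{3,4},U_{3,4})$; or the cycle matroid of one of the following six graphs on $5$ vertices: the $5$-cycle $C_5$; $C_5$ with one chord; $C_5$ with two chords sharing a vertex; $C_5$ with two chords sharing no vertex; $K_{2,3}$; and $K_{2,3}$ with an added edge joining its two vertices of degree $3$.
   Context: All matroids are simple. Every simple binary matroid $M$ is uniquely $GF(2)$-representable, so for $k\ge r(M)$ one can write $M\cong PG(k-1,2)|T$, and the $(GF(2),k)$-complement of $M$ is $PG(k-1,2)\backslash T$ (well defined up to isomorphism). $M^c$ denotes the $(GF(2),r(M))$-complement of $M$. Binary comatroids ($GF(2)$-comatroids) are defined recursively: $U_{0,0}$ is one; the direct sum of two is one; and the $(GF(2),t)$-complement of one is one for every $t\ge r(M)$. $P(U_{3,4},U_{3,4})$ is the parallel connection of two $4$-element circuits; it is the cycle matroid of a $6$-cycle with one chord, where the chord lies in two $4$-cycles. -}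

module Defs where

open import Data.Nat using (ℕ; zero; suc; _≤_; _<_)
open import Data.Bool using (Bool; true; false; _xor_; if_then_else_)
open import Data.Fin using (Fin; zero; suc; #_; _≟_)
open import Data.Fin.Subset using (Subset; _∈_; _∉_; _⊆_; _∪_; ⁅_⁆; ∣_∣; Nonempty) renaming (⊥ to ∅)
open import Data.Fin.Subset.Properties using (_∈?_)
open import Data.Fin.Properties using (any?)
open import Data.Vec using (Vec; []; _∷_; lookup; tabulate; replicate; zipWith; take; drop)
open import Data.List using (List; []; _∷_; _++_; length)
open import Data.List.Relation.Unary.Linked using (Linked)
open import Data.List.Relation.Unary.Unique.Propositional using (Unique)
open import Data.Product using (Σ; ∃; ∃-syntax; _×_; _,_)
open import Data.Sum using (_⊎_)
open import Relation.Nullary using (¬_; Dec; yes; no)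
open import Relation.Nullary.Decidable using (⌊_⌋; _×-dec_)
open import Relation.Binary.PropositionalEquality using (_≡_; _≢_)
open import Function using (_∘_)
open import Function.Bundles using (_⇔_)
open import Function.Definitions using (Injective; Bijective)

record IndepSys : Set₁ where
  field
    size  : ℕ
    Indep : Subset size → Set

record Matroid : Set₁ where
  field
    sys      : IndepSys
  field
    indep-∅  : IndepSys.Indep sys ∅
    indep-⊆  : ∀ X Y → X ⊆ Y → IndepSys.Indep sys Y → IndepSys.Indep sys X
    exchange : ∀ X Y → IndepSys.Indep sys X → IndepSys.Indep sys Y → ∣ X ∣ < ∣ Y ∣ →
               ∃[ e ] (e ∈ Y × e ∉ X × IndepSys.Indep sys (X ∪ ⁅ e ⁆))
open Matroid public
open IndepSys public

E : Matroid → ℕ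
E M = size (sys M)

Ind : (M : Matroid) → Subset (E M) → Set
Ind M = Indep (sys M)

RankOf : (M : Matroid) → Subset (E M) → ℕ → Set
RankOf M X r =
  (∃[ I ] (I ⊆ X × Ind M I × ∣ I ∣ ≡ r)) ×
  (∀ I → I ⊆ X → Ind M I → ∣ I ∣ ≤ r)

RankIs : Matroid → ℕ → Set
RankIs M r = RankOf M Data.Fin.Subset.⊤ r

Flat : (M : Matroid) → Subset (E M) → Set
Flat M F = ∀ e → e ∉ F → ∀ r s → RankOf M F r → RankOf M (F ∪ ⁅ e ⁆) s → r < s

Simple : Matroid → Set
Simple M = ∀ X → ∣ X ∣ ≤ 2 → Ind M X

preimage : ∀ {n m} → (Fin n → Fin m) → Subset m → Subset n
preimage σ Y = tabulate (λ i → lookup Y (σ i))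

image : ∀ {n m} → (Fin n → Fin m) → Subset n → Subset m
image {n} f Y = tabulate (λ i → ⌊ any? (λ j → (j ∈? Y) ×-dec (f j ≟ i)) ⌋)

_≅_ : IndepSys → IndepSys → Set
A ≅ B = Σ (Fin (size A) → Fin (size B)) λ σ →
  Bijective _≡_ _≡_ σ × (∀ Y → Indep B Y ⇔ Indep A (preimage σ Y))

RestrIso : (M : Matroid) → Subset (E M) → IndepSys → Set
RestrIso M F N = Σ (Fin (size N) → Fin (E M)) λ f →
  Injective _≡_ _≡_ f ×
  (∀ i → (i ∈ F) ⇔ (∃[ j ] (f j ≡ i))) ×
  (∀ Y → Indep N Y ⇔ Ind M (image f Y))

IsDirectSum : Matroid → Matroid → Matroid → Set
IsDirectSum M M₁ M₂ =
  Σ (Fin (Data.Nat._+_ (E M₁) (E M₂)) → Fin (E M)) λ σ →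
  Bijective _≡_ _≡_ σ ×
  (∀ Y → Ind M Y ⇔ (Ind M₁ (take (E M₁) (preimage σ Y)) × Ind M₂ (drop (E M₁) (preimage σ Y))))

-- GF(2) vectors (Bool with xor = addition in GF(2)), binary representations

zeros : (k : ℕ) → Vec Bool k
zeros k = replicate k false

vsum : ∀ {n k} → (Fin n → Vec Bool k) → Subset n → Vec Bool k
vsum {zero}  {k} φ []      = zeros k
vsum {suc n} {k} φ (b ∷ Y) =
  zipWith _xor_ (if b then φ zero else zeros k) (vsum (φ ∘ suc) Y)

LinIndep : ∀ {n k} → (Fin n → Vec Bool k) → Subset n → Set
LinIndep {k = k} φ X = ∀ Y → Y ⊆ X → Nonempty Y → vsum φ Y ≢ zeros k

Represents : ∀ {k} (M : Matroid) → (Fin (E M) → Vec Bool k) → Set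
Represents M φ = ∀ X → Ind M X ⇔ LinIndep φ X

Binary : Matroid → Set
Binary M = ∃[ k ] Σ (Fin (E M) → Vec Bool k) (Represents M)

-- N is (isomorphic to) the (GF(2),t)-complement of M:
-- M ≅ PG(t-1,2)|T via φ and N ≅ PG(t-1,2)\T via ψ.
IsComplement : Matroid → Matroid → ℕ → Set
IsComplement M N t =
  Σ (Fin (E M) → Vec Bool t) λ φ → Σ (Fin (E N) → Vec Bool t) λ ψ →
  Represents M φ × Represents N ψ ×
  Injective _≡_ _≡_ φ × Injective _≡_ _≡_ ψ ×
  (∀ i → φ i ≢ zeros t) × (∀ j → ψ j ≢ zeros t) ×
  (∀ i j → φ i ≢ ψ j) ×
  (∀ v → v ≢ zeros t → (∃[ i ] (φ i ≡ v)) ⊎ (∃[ j ] (ψ j ≡ v)))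

data Comatroid : Matroid → Set₁ where
  empty : ∀ M → E M ≡ 0 → Comatroid M
  dsum  : ∀ {M M₁ M₂} → Comatroid M₁ → Comatroid M₂ → IsDirectSum M M₁ M₂ → Comatroid M
  compl : ∀ {M N} r t → Comatroid M → RankIs M r → r ≤ t → IsComplement M N t → Comatroid N

Uniform : ℕ → ℕ → IndepSys
Uniform r n = record { size = n ; Indep = λ X → ∣ X ∣ ≤ r }

-- simple graph on vertex set Fin v with m edges, edge e has ends (ends e)
record Graph : Set where
  field
    v    : ℕ
    m    : ℕ
    ends : Vec (Fin v × Fin v) m
open Graph public

module _ (G : Graph) where
  Adj : Subset (m G) → Fin (v G) → Fin (v G) → Set
  Adj X a b = ∃[ e ] (e ∈ X × (lookup (ends G) e ≡ (a , b) ⊎ lookup (ends G) e ≡ (b , a)))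

  HasCycle : Subset (m G) → Set
  HasCycle X = Σ (Fin (v G)) λ x → Σ (List (Fin (v G))) λ xs →
    2 ≤ length xs × Unique (x ∷ xs) × Linked (Adj X) (x ∷ xs ++ x ∷ [])

  CycleMatroid : IndepSys
  CycleMatroid = record { size = m G ; Indep = λ X → ¬ HasCycle X }

mkGraph : ∀ {m} → Vec (Fin 5 × Fin 5) m → Graph
mkGraph {m} es = record { v = 5 ; m = m ; ends = es }

C5 C5-chord C5-2chords-meet C5-2chords-disjoint K23 K23+e : Graph
C5 = mkGraph ((# 0 , # 1) ∷ (# 1 , # 2) ∷ (# 2 , # 3) ∷ (# 3 , # 4) ∷ (# 4 , # 0) ∷ [])
C5-chord = mkGraph ((# 0 , # 1) ∷ (# 1 , # 2) ∷ (# 2 , # 3) ∷ (# 3 , # 4) ∷ (# 4 , # 0) ∷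
                    (# 0 , # 2) ∷ [])
C5-2chords-meet = mkGraph ((# 0 , # 1) ∷ (# 1 , # 2) ∷ (# 2 , # 3) ∷ (# 3 , # 4) ∷ (# 4 , # 0) ∷
                           (# 0 , # 2) ∷ (# 0 , # 3) ∷ [])
C5-2chords-disjoint = mkGraph ((# 0 , # 1) ∷ (# 1 , # 2) ∷ (# 2 , # 3) ∷ (# 3 , # 4) ∷ (# 4 , # 0) ∷
                               (# 0 , # 2) ∷ (# 1 , # 3) ∷ [])
-- K_{2,3} with parts {0,1} and {2,3,4}; 0 and 1 are the vertices of degree 3
K23 = mkGraph ((# 0 , # 2) ∷ (# 0 , # 3) ∷ (# 0 , # 4) ∷ (# 1 , # 2) ∷ (# 1 , # 3) ∷ (# 1 , # 4) ∷ [])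
K23+e = mkGraph ((# 0 , # 2) ∷ (# 0 , # 3) ∷ (# 0 , # 4) ∷ (# 1 , # 2) ∷ (# 1 , # 3) ∷ (# 1 , # 4) ∷
                 (# 0 , # 1) ∷ [])

-- P(U_{3,4},U_{3,4}): 6-cycle 0-1-2-3-4-5-0 with chord 0-3 (lying in the 4-cycles 0123 and 0345)
PUU : Graph
PUU = record { v = 6 ; m = 7 ; ends =
  (# 0 , # 1) ∷ (# 1 , # 2) ∷ (# 2 , # 3) ∷ (# 3 , # 4) ∷ (# 4 , # 5) ∷ (# 5 , # 0) ∷
  (# 0 , # 3) ∷ [] }

data Excluded : Set where
  circuit : (n : ℕ) → 6 ≤ n → Excluded
  pUU c5 c5c c5cc-meet c5cc-disj k23 k23e : Excluded

excluded : Excluded → IndepSys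
excluded (circuit n _) = Uniform (Data.Nat.pred n) n
excluded pUU       = CycleMatroid PUU
excluded c5        = CycleMatroid C5
excluded c5c       = CycleMatroid C5-chord
excluded c5cc-meet = CycleMatroid C5-2chords-meet
excluded c5cc-disj = CycleMatroid C5-2chords-disjoint
excluded k23       = CycleMatroid K23
excluded k23e      = CycleMatroid K23+e

HasExcludedFlat : Matroid → Set
HasExcludedFlat M = ∃[ F ] (Flat M F × ∃[ X ] RestrIso M F (excluded X))

module Submission where

-- Colour the nonzero vectors of GF(2)^r green on M and red off M. In a comatroid no subspace of rank at least 2 is spanned
-- and connected in both colours: this passes to complements and direct sums, whereas each excluded flat spans such a subspace.
-- Conversely, a minimal subspace connected in both colours contains an excluded flat. Otherwise an ear decomposition gives, from
-- rank 4 on, a connected hyperplane for each colour; from rank 6 on two such hyperplanes contradict minimality, and the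
-- ranks up to 5 are finite checks. So if there is no excluded flat, one of the colours splits, and M arises from
-- smaller comatroids by a direct sum, preceded or not by a complement.

open import Defs
open import Data.Nat as ℕ using (ℕ; zero; suc; _+_; _∸_; _^_; _≤_; _<_; z≤n; s≤s)
open import Data.Nat.Properties as ℕₚ using (≤-refl; ≤-trans; ≤-reflexive)
open import Data.Nat.Induction using (<-rec)
open import Data.Bool as Bool using (Bool; true; false; not; _∧_; _xor_; if_then_else_)
open import Data.Bool.Properties as Boolₚ using ()
open import Data.Fin as Fin using (Fin; zero; suc; _↑ˡ_; _↑ʳ_)
open import Data.Fin.Properties as Finₚ using ()
open import Data.Fin.Subset using (Subset; ⁅_⁆; ∣_∣; _∪_; Nonempty) renaming (_∈_ to _∈ₛ_; _∉_ to _∉ₛ_; _⊆_ to _⊆ₛ_; ⊥ to ∅; ⊤ to full)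
open import Data.Fin.Subset.Properties as Subₚ using ()
open import Data.Vec as Vec using (Vec; []; _∷_; lookup; tabulate; zipWith; map; take; drop; _++_; here; there; _[_]=_)
open import Data.Vec.Properties as Vecₚ using (≡-dec; lookup∘tabulate; tabulate∘lookup; tabulate-cong; lookup-map)
open import Data.List as List using (List; []; _∷_; length)
open import Data.List.Relation.Unary.All using (All; []; _∷_)
open import Data.List.Relation.Unary.Any as Any using (Any; here; there)
open import Data.List.Relation.Unary.AllPairs using ([]; _∷_)
open import Data.List.Relation.Unary.Linked as Linked using (Linked; []; [-]; _∷_)
open import Data.List.Relation.Unary.Unique.Propositional using (Unique)
open import Data.List.Membership.Propositional using () renaming (_∈_ to _∈ₗ_)
open import Data.List.Membership.Propositional.Properties using (∈-++⁻; ∈-map⁻)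
open import Data.Maybe using (Maybe; just; nothing)
open import Data.Product using (Σ; ∃; ∃-syntax; _×_; _,_; proj₁; proj₂)
open import Data.Product.Properties as Productₚ using ()
open import Data.Sum as Sum using (_⊎_; inj₁; inj₂; [_,_]′)
open import Data.Empty using (⊥; ⊥-elim)
open import Data.Unit using (⊤; tt)
open import Function using (_∘_; id; _$_)
open import Function.Bundles using (_⇔_; mk⇔; Equivalence; Inverse)
open import Function.Definitions using (Surjective; Bijective)
open import Relation.Nullary using (¬_; Dec; yes; no; contradiction)
open import Relation.Nullary.Decidable as Dec using (⌊_⌋; _×-dec_; _⊎-dec_; _→-dec_; ¬?; decidable-stable)
open import Relation.Binary.PropositionalEquality using (_≡_; _≢_; refl; sym; trans; cong; cong₂; subst; module ≡-Reasoning)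

-- Connectedness is tested by linear maps rather than circuits (`Conn`): this makes it decidable by
-- search, lets it pass along linear isomorphisms, and turns a disconnection into an explicit
-- decomposition (`split⇒join`). The colours interact through one fact: if one colour splits, the
-- other contains every sum across the decomposition, and from dimension 4 on this alone makes it
-- connected. The bound 6 comes from a count. In a minimal space connected in both colours, a
-- hyperplane H connected in one colour is split by the other, and at least two vectors of the first
-- colour lie outside H. A second hyperplane through these two is connected in the first colour,
-- provided that its intersection with H, of dimension at least 4, is still split. The split is lost
-- on at most one such hyperplane. Both colours together give four vectors to contain; from rank 6
-- on at least three hyperplanes do so, and one of them keeps both splits, against minimality. Rank
-- 5 has no such room, hence the enumeration.

private variable
  k l r n p q : ℕ

-- Vectors over GF(2) and their linear combinations

V : ℕ → Set
V = Vec Bool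

infixl 6 _⊕_
_⊕_ : ∀ {n} → V n → V n → V n
_⊕_ = zipWith _xor_

𝟘 : ∀ {n} → V n
𝟘 {n} = zeros n

infixr 7 _·_
_·_ : ∀ {n} → Bool → V n → V n
b · v = if b then v else 𝟘

Mat : ℕ → ℕ → Set
Mat r n = Vec (V n) r

comb : ∀ {r n} → Mat r n → V r → V n
comb []      []      = 𝟘
comb (v ∷ φ) (b ∷ x) = b · v ⊕ comb φ x

-- `Subset n` is the same type as `V n`: singletons are unit vectors, `full` is the all-ones vector,
-- and symmetric difference is `_⊕_`.
units : ∀ n → Mat n n
units n = tabulate ⁅_⁆

_≟V_ : ∀ {n} (u v : V n) → Dec (u ≡ v)
_≟V_ = ≡-dec Bool._≟_

⊕-assoc : (u v w : V n) → (u ⊕ v) ⊕ w ≡ u ⊕ (v ⊕ w)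
⊕-assoc = Vecₚ.zipWith-assoc Boolₚ.xor-assoc

⊕-comm : (u v : V n) → u ⊕ v ≡ v ⊕ u
⊕-comm = Vecₚ.zipWith-comm Boolₚ.xor-comm

⊕-idˡ : (v : V n) → 𝟘 ⊕ v ≡ v
⊕-idˡ = Vecₚ.zipWith-identityˡ Boolₚ.xor-identityˡ

⊕-idʳ : (v : V n) → v ⊕ 𝟘 ≡ v
⊕-idʳ = Vecₚ.zipWith-identityʳ Boolₚ.xor-identityʳ

⊕-self : (v : V n) → v ⊕ v ≡ 𝟘
⊕-self []      = refl
⊕-self (b ∷ v) = cong₂ _∷_ (Boolₚ.xor-same b) (⊕-self v)

⊕-interchange : (a b c d : V n) → (a ⊕ b) ⊕ (c ⊕ d) ≡ (a ⊕ c) ⊕ (b ⊕ d)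
⊕-interchange a b c d =
  trans (⊕-assoc a b (c ⊕ d)) (trans (cong (a ⊕_) (trans (sym (⊕-assoc b c d))
    (trans (cong (_⊕ d) (⊕-comm b c)) (⊕-assoc c b d)))) (sym (⊕-assoc a c (b ⊕ d))))

·-distrib : ∀ b c (v : V n) → (b xor c) · v ≡ b · v ⊕ c · v
·-distrib true  true  v = sym (⊕-self v)
·-distrib true  false v = sym (⊕-idʳ v)
·-distrib false c     v = sym (⊕-idˡ (c · v))

comb-⊕ : (φ : Mat r n) (x y : V r) → comb φ (x ⊕ y) ≡ comb φ x ⊕ comb φ y
comb-⊕ []      []      []      = sym (⊕-idˡ 𝟘)
comb-⊕ (v ∷ φ) (b ∷ x) (c ∷ y) =
  trans (cong₂ _⊕_ (·-distrib b c v) (comb-⊕ φ x y)) (⊕-interchange (b · v) (c · v) (comb φ x) (comb φ y))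

comb-𝟘 : (φ : Mat r n) → comb φ 𝟘 ≡ 𝟘
comb-𝟘 []      = refl
comb-𝟘 (v ∷ φ) = trans (⊕-idˡ _) (comb-𝟘 φ)

comb-unit : (φ : Mat r n) (i : Fin r) → comb φ ⁅ i ⁆ ≡ lookup φ i
comb-unit (v ∷ φ) zero    = trans (cong (v ⊕_) (comb-𝟘 φ)) (⊕-idʳ v)
comb-unit (v ∷ φ) (suc i) = trans (⊕-idˡ _) (comb-unit φ i)

bit-xor : (X Y : Subset n) (i : Fin n) → lookup (X ⊕ Y) i ≡ lookup X i xor lookup Y i
bit-xor X Y i = Vecₚ.lookup-zipWith _xor_ i X Y

true-or-false : ∀ b → b ≡ true ⊎ b ≡ false
true-or-false true  = inj₁ refl
true-or-false false = inj₂ refl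

-- Equations between sums of vectors are decided by comparing coefficient vectors over GF(2).

infixl 6 _:+_
data Expr (k : ℕ) : Set where
  var  : Fin k → Expr k
  _:+_ : Expr k → Expr k → Expr k
  :0   : Expr k

coeffs : Expr k → V k
coeffs (var i)  = ⁅ i ⁆
coeffs (a :+ b) = coeffs a ⊕ coeffs b
coeffs :0       = 𝟘

⟦_⟧ : Expr k → Mat k n → V n
⟦ var i  ⟧ ρ = lookup ρ i
⟦ a :+ b ⟧ ρ = ⟦ a ⟧ ρ ⊕ ⟦ b ⟧ ρ
⟦ :0     ⟧ ρ = 𝟘

⟦⟧-coeffs : (e : Expr k) (ρ : Mat k n) → ⟦ e ⟧ ρ ≡ comb ρ (coeffs e)
⟦⟧-coeffs (var i)  ρ = sym (comb-unit ρ i)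
⟦⟧-coeffs (a :+ b) ρ = trans (cong₂ _⊕_ (⟦⟧-coeffs a ρ) (⟦⟧-coeffs b ρ)) (sym (comb-⊕ ρ (coeffs a) (coeffs b)))
⟦⟧-coeffs :0       ρ = sym (comb-𝟘 ρ)

xor-solve : (ρ : Mat k n) (a b : Expr k) → coeffs a ≡ coeffs b → ⟦ a ⟧ ρ ≡ ⟦ b ⟧ ρ
xor-solve ρ a b eq = trans (⟦⟧-coeffs a ρ) (trans (cong (comb ρ) eq) (sym (⟦⟧-coeffs b ρ)))

pattern x₀ = var zero
pattern x₁ = var (suc zero)
pattern x₂ = var (suc (suc zero))
pattern x₃ = var (suc (suc (suc zero)))
pattern x₄ = var (suc (suc (suc (suc zero))))
pattern x₅ = var (suc (suc (suc (suc (suc zero)))))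

⊕-≡𝟘 : {u v : V n} → u ⊕ v ≡ 𝟘 → u ≡ v
⊕-≡𝟘 {u = u} {v} eq = trans (xor-solve (u ∷ v ∷ []) x₀ (x₁ :+ (x₀ :+ x₁)) refl) (trans (cong (v ⊕_) eq) (⊕-idʳ v))

⊕-cancel : (u v : V n) → u ⊕ (u ⊕ v) ≡ v
⊕-cancel u v = xor-solve (u ∷ v ∷ []) (x₀ :+ (x₀ :+ x₁)) x₁ refl

-- Linear maps; over GF(2) additivity is linearity

record _⊸_ (r n : ℕ) : Set where
  field
    ap  : V r → V n
    add : ∀ u v → ap (u ⊕ v) ≡ ap u ⊕ ap v
open _⊸_ public

infixr 1 _⊸_

ap-𝟘 : (h : r ⊸ n) → ap h 𝟘 ≡ 𝟘
ap-𝟘 h = trans (sym (⊕-cancel (ap h 𝟘) (ap h 𝟘)))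
  (trans (cong (ap h 𝟘 ⊕_) (trans (sym (add h 𝟘 𝟘)) (cong (ap h) (⊕-idˡ 𝟘)))) (⊕-self _))

ap-· : (h : r ⊸ n) (b : Bool) (v : V r) → ap h (b · v) ≡ b · ap h v
ap-· h true  v = refl
ap-· h false v = ap-𝟘 h

ap-comb : (h : r ⊸ n) (φ : Mat k r) (x : V k) → ap h (comb φ x) ≡ comb (map (ap h) φ) x
ap-comb h []      []      = ap-𝟘 h
ap-comb h (v ∷ φ) (b ∷ x) = trans (add h (b · v) (comb φ x)) (cong₂ _⊕_ (ap-· h b v) (ap-comb h φ x))

lin : Mat r n → r ⊸ n
lin φ = record { ap = comb φ ; add = comb-⊕ φ }

idL : n ⊸ n
idL = record { ap = id ; add = λ _ _ → refl }

_∘L_ : (l ⊸ n) → (r ⊸ l) → r ⊸ n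
g ∘L h = record { ap = ap g ∘ ap h ; add = λ u v → trans (cong (ap g) (add h u v)) (add g _ _) }

_+L_ : (r ⊸ n) → (r ⊸ n) → r ⊸ n
g +L h = record
  { ap  = λ v → ap g v ⊕ ap h v
  ; add = λ u v → trans (cong₂ _⊕_ (add g u v) (add h u v)) (⊕-interchange (ap g u) (ap g v) (ap h u) (ap h v)) }

comb-map-false : (φ : Mat r n) (x : V r) → comb (map (false ∷_) φ) x ≡ false ∷ comb φ x
comb-map-false []      []          = refl
comb-map-false (v ∷ φ) (true ∷ x)  = cong ((false ∷ v) ⊕_) (comb-map-false φ x)
comb-map-false (v ∷ φ) (false ∷ x) = cong (𝟘 ⊕_) (comb-map-false φ x)

comb-units : (x : V n) → comb (units n) x ≡ x
comb-units []      = refl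
comb-units {suc n} (b ∷ x) = begin
  b · (true ∷ 𝟘) ⊕ comb (tabulate (λ i → false ∷ ⁅ i ⁆)) x
    ≡⟨ cong (λ φ → b · (true ∷ 𝟘) ⊕ comb φ x) (Vecₚ.tabulate-∘ (false ∷_) ⁅_⁆) ⟩
  b · (true ∷ 𝟘) ⊕ comb (map (false ∷_) (units n)) x
    ≡⟨ cong (b · (true ∷ 𝟘) ⊕_) (trans (comb-map-false (units n) x) (cong (false ∷_) (comb-units x))) ⟩
  b · (true ∷ 𝟘) ⊕ (false ∷ x)
    ≡⟨ head-tail b ⟩
  b ∷ x ∎
  where
  open ≡-Reasoning
  head-tail : ∀ b → b · (true ∷ 𝟘) ⊕ (false ∷ x) ≡ b ∷ x
  head-tail true  = cong (true ∷_) (⊕-idˡ x)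
  head-tail false = cong (false ∷_) (⊕-idˡ x)

-- Maps are functions and cannot be searched through; their matrices can, and they agree with the
-- maps on every vector.
matrix : (r ⊸ n) → Mat r n
matrix h = map (ap h) (units _)

comb-matrix : (h : r ⊸ n) (x : V r) → comb (matrix h) x ≡ ap h x
comb-matrix h x = trans (sym (ap-comb h (units _) x)) (cong (ap h) (comb-units x))

-- Exhaustive search over vectors and matrices

Searchable : Set → Set₁
Searchable A = {P : A → Set} → (∀ a → Dec (P a)) → Dec (∃ P)

search-Bool : Searchable Bool
search-Bool P? with P? true | P? false
... | yes p | _     = yes (true , p)
... | no _  | yes p = yes (false , p)
... | no ¬t | no ¬f = no λ { (true , p) → ¬t p ; (false , p) → ¬f p }

abstract
  search-Vec : ∀ {A} → Searchable A → Searchable (Vec A n)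
  search-Vec {zero} s P? with P? []
  ... | yes p = yes ([] , p)
  ... | no ¬p = no λ { ([] , p) → ¬p p }
  search-Vec {suc n} s P? with s (λ a → search-Vec s (λ v → P? (a ∷ v)))
  ... | yes (a , v , p) = yes (a ∷ v , p)
  ... | no ¬p           = no λ { (a ∷ v , p) → ¬p (a , v , p) }

abstract
  search-V : Searchable (V n)
  search-V = search-Vec search-Bool

abstract
  search-Mat : Searchable (Mat r n)
  search-Mat = search-Vec search-V

abstract
  all-V? : {P : V n → Set} → (∀ v → Dec (P v)) → Dec (∀ v → P v)
  all-V? P? with search-V (λ v → ¬? (P? v))
  ... | yes (v , ¬p) = no λ f → ¬p (f v)
  ... | no ¬∃        = yes λ v → decidable-stable (P? v) λ ¬p → ¬∃ (v , ¬p)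

-- Independence, spanning and dimension

record Inj {r n} (φ : Mat r n) : Set where
  constructor mkInj
  field ker : ∀ x → comb φ x ≡ 𝟘 → x ≡ 𝟘
open Inj public

infix 4 _∈im_
record _∈im_ {r n} (v : V n) (φ : Mat r n) : Set where
  constructor _,_
  field
    coeff : V r
    eval  : comb φ coeff ≡ v
open _∈im_ public

abstract
  _∈im?_ : (v : V n) (φ : Mat r n) → Dec (v ∈im φ)
  v ∈im? φ = Dec.map′ (λ (x , e) → x , e) (λ (x , e) → x , e) (search-V (λ x → comb φ x ≟V v))

Inj-≡ : {φ : Mat r n} → Inj φ → ∀ {x y} → comb φ x ≡ comb φ y → x ≡ y
Inj-≡ {φ = φ} inj {x} {y} eq =
  ⊕-≡𝟘 (ker inj _ (trans (comb-⊕ φ x y) (trans (cong (_⊕ comb φ y) eq) (⊕-self _))))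

Inj-∷ : {φ : Mat r n} {v : V n} → Inj φ → ¬ v ∈im φ → Inj (v ∷ φ)
Inj-∷ inj v∉ = mkInj λ
  { (true  ∷ x) eq → contradiction (x , sym (⊕-≡𝟘 eq)) v∉
  ; (false ∷ x) eq → cong (false ∷_) (ker inj x (trans (sym (⊕-idˡ _)) eq)) }

V-code : V n → Fin (2 ^ n)
V-code v = Fin.funToFin (λ i → Inverse.from Finₚ.2↔Bool (lookup v i))

V-decode : Fin (2 ^ n) → V n
V-decode j = tabulate (λ i → Inverse.to Finₚ.2↔Bool (Fin.finToFun j i))

V-decode-code : (v : V n) → V-decode (V-code v) ≡ v
V-decode-code {n} v = trans
  (tabulate-cong λ i → trans (cong (Inverse.to Finₚ.2↔Bool) (Finₚ.finToFun-funToFin (λ i → Inverse.from Finₚ.2↔Bool (lookup v i)) i))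
                             (Inverse.strictlyInverseˡ Finₚ.2↔Bool (lookup v i)))
  (tabulate∘lookup v)

V-code-decode : (j : Fin (2 ^ n)) → V-code {n} (V-decode j) ≡ j
V-code-decode {n} j = trans
  (funToFin-cong n λ i → trans (cong (Inverse.from Finₚ.2↔Bool) (lookup∘tabulate _ i))
                             (Inverse.strictlyInverseʳ Finₚ.2↔Bool (Fin.finToFun j i)))
  (Finₚ.funToFin-finToFin {n} {2} j)
  where
  funToFin-cong : ∀ n {f g : Fin n → Fin 2} → (∀ i → f i ≡ g i) → Fin.funToFin f ≡ Fin.funToFin g
  funToFin-cong zero    eq = refl
  funToFin-cong (suc n) eq = cong₂ Fin.combine (eq zero) (funToFin-cong n (eq ∘ suc))

abstract
  -- Dimension theory by counting instead of elimination: of the `2 ^ r` coefficient vectors two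
  -- have the same combination, and their sum is the kernel element.
  kernel : n < r → (φ : Mat r n) → ∃[ x ] (x ≢ 𝟘 × comb φ x ≡ 𝟘)
  kernel {n} {r} n<r φ
    with i , j , i<j , eq ← Finₚ.pigeonhole (ℕₚ.^-monoʳ-< 2 (s≤s (s≤s z≤n)) n<r) (λ i → V-code (comb φ (V-decode {r} i)))
    = x ⊕ y , x⊕y≢𝟘 , trans (comb-⊕ φ x y) (trans (cong (_⊕ comb φ y) φx≡φy) (⊕-self _))
    where
    x y : V r
    x = V-decode {r} i
    y = V-decode {r} j
    φx≡φy : comb φ x ≡ comb φ y
    φx≡φy = trans (sym (V-decode-code _)) (trans (cong V-decode eq) (V-decode-code _))
    x⊕y≢𝟘 : x ⊕ y ≢ 𝟘
    x⊕y≢𝟘 eq₀ = Finₚ.<⇒≢ i<j (trans (sym (V-code-decode {r} i)) (trans (cong (V-code {r}) (⊕-≡𝟘 eq₀)) (V-code-decode {r} j)))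

abstract
  Inj-size : {φ : Mat r n} → Inj φ → r ≤ n
  Inj-size {φ = φ} inj = ℕₚ.≮⇒≥ λ n<r → let x , x≢𝟘 , eq = kernel n<r φ in x≢𝟘 (ker inj x eq)

abstract
  -- Take preimages of the unit vectors. If r were less than n they would be dependent, and φ would
  -- carry the dependency over to the unit vectors.
  spanning-size : {φ : Mat r n} → (∀ v → v ∈im φ) → n ≤ r
  spanning-size {r} {n} {φ} sp = ℕₚ.≮⇒≥ λ r<n →
    let ψ = map (coeff ∘ sp) (units n)
        x , x≢𝟘 , eq = kernel r<n ψ
        φψ : (u : Mat k n) (x : V k) → comb φ (comb (map (coeff ∘ sp) u) x) ≡ comb u x
        φψ u x = trans (ap-comb (lin φ) (map (coeff ∘ sp) u) x) (cong (λ a → comb a x)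
                   (trans (sym (Vecₚ.map-∘ (comb φ) (coeff ∘ sp) u)) (trans (Vecₚ.map-cong (λ v → eval (sp v)) u) (Vecₚ.map-id u))))
    in x≢𝟘 (trans (sym (comb-units x)) (trans (sym (φψ (units n) x)) (trans (cong (comb φ) eq) (comb-𝟘 φ))))

-- A and B are kept apart so that one can complete with green rows until the whole space, green or
-- not, is spanned.
Completion : Mat k n → (A B : V n → Set) → Set
Completion {n = n} φ A B = ∃[ q ] Σ (Mat q n) λ c → (∀ i → A (lookup c i)) × Inj (c ++ φ) × (∀ v → B v → v ∈im (c ++ φ))

abstract
  -- Greedy extension; fuel n is enough because independent rows number at most n. The choice of the
  -- next row is left to the caller, since for A different from B the claim that none is missing
  -- takes an argument of its own.
  complete : (φ : Mat k n) → Inj φ → {A B : V n → Set} →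
    (∀ {j} (ψ : Mat j n) → (∀ i → A (lookup ψ i)) → Inj (ψ ++ φ) →
       (∃[ v ] (A v × ¬ v ∈im (ψ ++ φ))) ⊎ (∀ v → B v → v ∈im (ψ ++ φ))) →
    Completion φ A B
  complete {k} {n} φ φ-inj {A} {B} step = go n [] (λ ()) φ-inj (ℕₚ.m≤m+n n k)
    where
    go : ∀ fuel {j} (ψ : Mat j n) → (∀ i → A (lookup ψ i)) → Inj (ψ ++ φ) → n ≤ fuel + (j + k) →
      Completion φ A B
    go fuel ψ Aψ inj le with step ψ Aψ inj
    go fuel ψ Aψ inj le | inj₂ done = _ , ψ , Aψ , inj , done
    go zero ψ Aψ inj le | inj₁ (v , Av , v∉) = ⊥-elim (ℕₚ.<⇒≱ (Inj-size (Inj-∷ inj v∉)) le)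
    go (suc fuel) {j} ψ Aψ inj le | inj₁ (v , Av , v∉) =
      go fuel (v ∷ ψ) (λ { zero → Av ; (suc i) → Aψ i }) (Inj-∷ inj v∉) (≤-trans le (≤-reflexive (sym (ℕₚ.+-suc fuel (j + k)))))

abstract
  complete-dec : (φ : Mat k n) → Inj φ → {A : V n → Set} → (∀ v → Dec (A v)) →
    Completion φ A A
  complete-dec φ inj {A} A? = complete φ inj step
    where
    step : ∀ {j} (ψ : Mat j _) → (∀ i → A (lookup ψ i)) → Inj (ψ ++ φ) →
      (∃[ v ] (A v × ¬ v ∈im (ψ ++ φ))) ⊎ (∀ v → A v → v ∈im (ψ ++ φ))
    step ψ _ _ with search-V (λ v → A? v ×-dec ¬? (v ∈im? (ψ ++ φ)))
    ... | yes r = inj₁ r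
    ... | no ¬r = inj₂ λ v Av → decidable-stable (v ∈im? (ψ ++ φ)) λ v∉ → ¬r (v , Av , v∉)

comb-++ : (c : Mat q n) (φ : Mat r n) (s : V q) (y : V r) → comb (c ++ φ) (s ++ y) ≡ comb c s ⊕ comb φ y
comb-++ []      φ []      y = sym (⊕-idˡ _)
comb-++ (v ∷ c) φ (b ∷ s) y = trans (cong (b · v ⊕_) (comb-++ c φ s y)) (sym (⊕-assoc (b · v) (comb c s) (comb φ y)))

++-⊕ : (s s′ : V q) (y y′ : V r) → (s ++ y) ⊕ (s′ ++ y′) ≡ (s ⊕ s′) ++ (y ⊕ y′)
++-⊕ []      []       y y′ = refl
++-⊕ (b ∷ s) (c ∷ s′) y y′ = cong ((b xor c) ∷_) (++-⊕ s s′ y y′)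

++-𝟘 : ∀ k → 𝟘 {k} ++ 𝟘 {l} ≡ 𝟘
++-𝟘 zero    = refl
++-𝟘 (suc k) = cong (false ∷_) (++-𝟘 k)

++-≡𝟘 : (s : V q) (y : V r) → s ++ y ≡ 𝟘 → s ≡ 𝟘 × y ≡ 𝟘
++-≡𝟘 []      y eq = refl , eq
++-≡𝟘 (b ∷ s) y eq with refl ← cong Vec.head eq | p , r ← ++-≡𝟘 s y (cong Vec.tail eq) = cong (false ∷_) p , r

-- Coordinates along complementary subspaces

record Coord {n q r} (c : Mat q n) (φ : Mat r n) : Set where
  field
    α      : n ⊸ q
    β      : n ⊸ r
    expand : ∀ v → comb c (ap α v) ⊕ comb φ (ap β v) ≡ v
    unique : ∀ s y → comb c s ⊕ comb φ y ≡ 𝟘 → s ≡ 𝟘 × y ≡ 𝟘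

  unique₂ : ∀ {s y s′ y′} → comb c s ⊕ comb φ y ≡ comb c s′ ⊕ comb φ y′ → s ≡ s′ × y ≡ y′
  unique₂ {s} {y} {s′} {y′} eq =
    let p , r = unique (s ⊕ s′) (y ⊕ y′) (trans (cong₂ _⊕_ (comb-⊕ c s s′) (comb-⊕ φ y y′))
                  (trans (⊕-interchange (comb c s) (comb c s′) (comb φ y) (comb φ y′)) (trans (cong (_⊕ _) eq) (⊕-self _))))
    in ⊕-≡𝟘 p , ⊕-≡𝟘 r

  α-eval : ∀ s y → ap α (comb c s ⊕ comb φ y) ≡ s
  α-eval s y = proj₁ (unique₂ (expand (comb c s ⊕ comb φ y)))

  β-eval : ∀ s y → ap β (comb c s ⊕ comb φ y) ≡ y
  β-eval s y = proj₂ (unique₂ (expand (comb c s ⊕ comb φ y)))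

  β-φ : ∀ y → ap β (comb φ y) ≡ y
  β-φ y = trans (cong (ap β) (sym (trans (cong (_⊕ comb φ y) (comb-𝟘 c)) (⊕-idˡ _)))) (β-eval 𝟘 y)

  α-φ : ∀ y → ap α (comb φ y) ≡ 𝟘
  α-φ y = trans (cong (ap α) (sym (trans (cong (_⊕ comb φ y) (comb-𝟘 c)) (⊕-idˡ _)))) (α-eval 𝟘 y)

  α-c : ∀ s → ap α (comb c s) ≡ s
  α-c s = trans (cong (ap α) (sym (trans (cong (comb c s ⊕_) (comb-𝟘 φ)) (⊕-idʳ _)))) (α-eval s 𝟘)

  β-c : ∀ s → ap β (comb c s) ≡ 𝟘
  β-c s = trans (cong (ap β) (sym (trans (cong (comb c s ⊕_) (comb-𝟘 φ)) (⊕-idʳ _)))) (β-eval s 𝟘)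

inverse : (ψ : Mat r n) → Inj ψ → (∀ v → v ∈im ψ) → n ⊸ r
inverse ψ inj sp = record
  { ap  = coeff ∘ sp
  ; add = λ u v → Inj-≡ inj (trans (eval (sp (u ⊕ v))) (sym (trans (comb-⊕ ψ _ _) (cong₂ _⊕_ (eval (sp u)) (eval (sp v)))))) }

takeL : ∀ q → (q + r) ⊸ q
takeL q = record { ap = take q ; add = λ u v → Vecₚ.take-zipWith _xor_ u v }

dropL : ∀ q → (q + r) ⊸ r
dropL q = record { ap = drop q ; add = λ u v → Vecₚ.drop-zipWith _xor_ u v }

abstract
  coord : (c : Mat q n) (φ : Mat r n) → Inj (c ++ φ) → (∀ v → v ∈im (c ++ φ)) → Coord c φ
  coord {q} c φ inj sp = record
    { α = takeL q ∘L inverse (c ++ φ) inj sp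
    ; β = dropL q ∘L inverse (c ++ φ) inj sp
    ; expand = λ v → trans (sym (comb-++ c φ _ _)) (trans (cong (comb (c ++ φ)) (Vecₚ.take++drop≡id q (coeff (sp v)))) (eval (sp v)))
    ; unique = λ s y eq → ++-≡𝟘 s y (ker inj (s ++ y) (trans (comb-++ c φ s y) eq)) }

abstract
  frame : (φ : Mat r n) → Inj φ → ∃[ q ] Σ (Mat q n) λ c → Coord c φ
  frame φ inj with q , c , _ , ci , sp ← complete-dec φ inj {λ _ → ⊤} (λ _ → yes tt) = q , c , coord c φ ci (λ v → sp v tt)

abstract
  outside : r < n → (φ : Mat r n) → ∃[ v ] ¬ v ∈im φ
  outside r<n φ with search-V (λ v → ¬? (v ∈im? φ))
  ... | yes found = found
  ... | no none   = ⊥-elim (ℕₚ.<⇒≱ r<n (spanning-size {φ = φ} λ v → decidable-stable (v ∈im? φ) λ v∉ → none (v , v∉)))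

-- Colourings and connectedness of a colour in a subspace

Colouring : ℕ → Set
Colouring n = V n → Bool

opp : Colouring n → Colouring n
opp T v = not (T v)

Cls : (n ⊸ n) → V n → Set
Cls π v = ap π v ≡ 𝟘 ⊎ ap π v ≡ v

Cls? : (π : n ⊸ n) (v : V n) → Dec (Cls π v)
Cls? π v = (ap π v ≟V 𝟘) ⊎-dec (ap π v ≟V v)

Resp : Colouring n → (V n → Set) → (n ⊸ n) → Set
Resp T W π = ∀ v → W v → T v ≡ true → Cls π v

Triv : (V n → Set) → (n ⊸ n) → Set
Triv W π = (∀ v → W v → ap π v ≡ 𝟘) ⊎ (∀ v → W v → ap π v ≡ v)

-- A linear map acting on every vector of colour T in W as 0 or as the identity encodes a decomposition of W
-- with T in the union of the two parts, so Conn T W says that T spans W and that T ∩ W is a connected matroid.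
record Conn (T : Colouring n) (W : V n → Set) : Set where
  constructor mkConn
  field triv : ∀ π → Resp T W π → Triv W π
open Conn public

BiConn : Colouring n → (V n → Set) → Set
BiConn T W = Conn T W × Conn (opp T) W

Whole : V n → Set
Whole _ = ⊤

-- Adding the identity exchanges the killed and the fixed vectors. By this symmetry proofs of
-- connectedness only treat maps that kill something given.
coL : (n ⊸ n) → n ⊸ n
coL π = idL +L π

co-fixed : (π : n ⊸ n) {v : V n} → ap π v ≡ v → ap (coL π) v ≡ 𝟘
co-fixed π {v} eq = trans (cong (v ⊕_) eq) (⊕-self v)

co-killed : (π : n ⊸ n) {v : V n} → ap π v ≡ 𝟘 → ap (coL π) v ≡ v
co-killed π {v} eq = trans (cong (v ⊕_) eq) (⊕-idʳ v)

co-unfix : (π : n ⊸ n) {v : V n} → ap (coL π) v ≡ 𝟘 → ap π v ≡ v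
co-unfix π eq = sym (⊕-≡𝟘 eq)

Cls-co : (π : n ⊸ n) {v : V n} → Cls π v → Cls (coL π) v
Cls-co π (inj₁ z) = inj₂ (co-killed π z)
Cls-co π (inj₂ f) = inj₁ (co-fixed π f)

-- After passing to `coL π` if necessary, the map kills the anchor a.
conn-anchored : {T : Colouring n} {W : V n → Set} (a : V n) → (∀ π → Resp T W π → Cls π a) →
  (∀ π → Resp T W π → ap π a ≡ 𝟘 → ∀ v → W v → ap π v ≡ 𝟘) → Conn T W
conn-anchored {T = T} {W} a cls kill = mkConn triv′
  where
  triv′ : ∀ π → Resp T W π → Triv W π
  triv′ π resp with cls π resp
  ... | inj₁ z = inj₁ (kill π resp z)
  ... | inj₂ f = inj₂ λ v Wv → co-unfix π (kill (coL π) (λ u Wu Tu → Cls-co π (resp u Wu Tu)) (co-fixed π f) v Wv)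

-- The form in which connected subspaces are enlarged: π is trivial on F, and by symmetry it may be
-- assumed to kill F.
conn-extend : {T : Colouring n} {F W : V n → Set} → Conn T F → (∀ v → F v → W v) →
  (∀ π → Resp T W π → (∀ v → F v → ap π v ≡ 𝟘) → ∀ v → W v → ap π v ≡ 𝟘) → Conn T W
conn-extend {T = T} {F} {W} cF F⊆W kill = mkConn triv′
  where
  triv′ : ∀ π → Resp T W π → Triv W π
  triv′ π resp with triv cF π (λ v Fv → resp v (F⊆W v Fv))
  ... | inj₁ z = inj₁ (kill π resp z)
  ... | inj₂ f = inj₂ λ v Wv → co-unfix π
    (kill (coL π) (λ u Wu Tu → Cls-co π (resp u Wu Tu)) (λ u Fu → co-fixed π (f u Fu)) v Wv)

-- Agreement is asked off 𝟘 only: 𝟘 is no point of the projective space, and every linear map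
-- satisfies `Cls` there.
conn-cong : {T T′ : Colouring n} {W W′ : V n → Set} → (∀ v → W v → W′ v) → (∀ v → W′ v → W v) →
  (∀ v → v ≢ 𝟘 → W v → T v ≡ true → T′ v ≡ true) → Conn T W → Conn T′ W′
conn-cong {T = T} {T′} {W} {W′} to from eq c = mkConn triv′
  where
  triv′ : ∀ π → Resp T′ W′ π → Triv W′ π
  triv′ π resp with triv c π resp′
    where
    resp′ : Resp T W π
    resp′ v Wv Tv with v ≟V 𝟘
    ... | yes refl = inj₁ (ap-𝟘 π)
    ... | no v≢𝟘   = resp v (to v Wv) (eq v v≢𝟘 Wv Tv)
  ... | inj₁ z = inj₁ λ v Wv → z v (from v Wv)
  ... | inj₂ f = inj₂ λ v Wv → f v (from v Wv)

-- A triangle u, w, u ⊕ w whose third side is killed: u and w then have the same image. If both were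
-- fixed they would coincide; if w is killed, so is u.
kill-two : (π : n ⊸ n) {u w : V n} → Cls π u → Cls π w → u ≢ w → ap π (u ⊕ w) ≡ 𝟘 → ap π u ≡ 𝟘
kill-two π (inj₁ z) _        u≢w eq = z
kill-two π {u} {w} (inj₂ f) (inj₁ z) u≢w eq = trans (⊕-≡𝟘 (trans (sym (add π u w)) eq)) z
kill-two π {u} {w} (inj₂ f) (inj₂ g) u≢w eq =
  contradiction (trans (sym f) (trans (⊕-≡𝟘 (trans (sym (add π u w)) eq)) g)) u≢w

-- A 4-circuit with u killed. If v were fixed, it would be the sum of the images of w and t, hence
-- one of 𝟘, w, t, w ⊕ t; the last value equals u ⊕ v and forces u to vanish.
kill-four : (π : n ⊸ n) {u v w t : V n} → Cls π v → Cls π w → Cls π t →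
  u ⊕ v ≡ w ⊕ t → u ≢ 𝟘 → v ≢ w → v ≢ t → ap π u ≡ 𝟘 → ap π v ≡ 𝟘
kill-four π {u} {v} {w} {t} (inj₁ z) _ _ _ _ _ _ _ = z
kill-four π {u} {v} {w} {t} (inj₂ f) cw ct eq u≢𝟘 v≢w v≢t zu = go cw ct
  where
  v≡ : v ≡ ap π w ⊕ ap π t
  v≡ = begin
    v                   ≡⟨ ⊕-idˡ v ⟨
    𝟘 ⊕ v               ≡⟨ cong₂ _⊕_ zu f ⟨
    ap π u ⊕ ap π v     ≡⟨ add π u v ⟨
    ap π (u ⊕ v)        ≡⟨ cong (ap π) eq ⟩
    ap π (w ⊕ t)        ≡⟨ add π w t ⟩
    ap π w ⊕ ap π t     ∎
    where open ≡-Reasoning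
  u⊕v≢v : u ⊕ v ≢ v
  u⊕v≢v e = u≢𝟘 (trans (xor-solve (u ∷ v ∷ []) x₀ ((x₀ :+ x₁) :+ x₁) refl) (trans (cong (_⊕ v) e) (⊕-self v)))
  go : Cls π w → Cls π t → ap π v ≡ 𝟘
  go (inj₁ a) (inj₁ b) = trans f (trans v≡ (trans (cong₂ _⊕_ a b) (⊕-idˡ 𝟘)))
  go (inj₁ a) (inj₂ b) = ⊥-elim $ v≢t (trans v≡ (trans (cong₂ _⊕_ a b) (⊕-idˡ t)))
  go (inj₂ a) (inj₁ b) = ⊥-elim $ v≢w (trans v≡ (trans (cong₂ _⊕_ a b) (⊕-idʳ w)))
  go (inj₂ a) (inj₂ b) = ⊥-elim $ u⊕v≢v (trans eq (sym (trans v≡ (cong₂ _⊕_ a b))))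

-- One more dimension costs two vectors of the colour in the same coset of F: their sum lies in F,
-- and `kill-two` applies.
conn-two : {T : Colouring n} {F W : V n → Set} {u w : V n} → Conn T F → (∀ v → F v → W v) →
  W u → W w → T u ≡ true → T w ≡ true → u ≢ w → F (u ⊕ w) → (∀ v → W v → F v ⊎ F (v ⊕ u)) → Conn T W
conn-two {u = u} {w} cF F⊆W Wu Ww Tu Tw u≢w Fuw cover = conn-extend cF F⊆W λ π resp kF v Wv →
  let ku = kill-two π (resp u Wu Tu) (resp w Ww Tw) u≢w (kF (u ⊕ w) Fuw) in
  [ kF v , (λ Fvu → trans (cong (ap π) (xor-solve (v ∷ u ∷ []) x₀ ((x₀ :+ x₁) :+ x₁) refl))
       (trans (add π (v ⊕ u) u) (trans (cong₂ _⊕_ (kF _ Fvu) ku) (⊕-idˡ 𝟘)))) ]′ (cover v Wv)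

Resp-matrix : {T : Colouring n} {W : V n → Set} (π : n ⊸ n) → Resp T W π → Resp T W (lin (matrix π))
Resp-matrix π resp v Wv Tv = Sum.map (trans (comb-matrix π v)) (trans (comb-matrix π v)) (resp v Wv Tv)

module _ (T : Colouring n) {W : V n → Set} (W? : ∀ v → Dec (W v)) where

  Triv? : (π : n ⊸ n) → Dec (Triv W π)
  Triv? π = all-V? (λ v → W? v →-dec (ap π v ≟V 𝟘))
          ⊎-dec all-V? (λ v → W? v →-dec (ap π v ≟V v))

  Resp? : (π : n ⊸ n) → Dec (Resp T W π)
  Resp? π = all-V? λ v → W? v →-dec ((T v Bool.≟ true) →-dec Cls? π v)

  -- Only finitely many matrices have to be tried; `comb-matrix` transfers the outcome to all maps.
  conn-or-split : Conn T W ⊎ ∃[ π ] (Resp T W π × ¬ Triv W π)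
  conn-or-split with search-Mat (λ M → Resp? (lin M) ×-dec ¬? (Triv? (lin M)))
  ... | yes (M , resp , ¬triv) = inj₂ (lin M , resp , ¬triv)
  ... | no none = inj₁ $ mkConn λ π resp →
    Sum.map (λ z v Wv → trans (sym (comb-matrix π v)) (z v Wv)) (λ f v Wv → trans (sym (comb-matrix π v)) (f v Wv))
      (decidable-stable (Triv? (lin (matrix π))) λ ¬t → none (matrix π , Resp-matrix {T = T} {W} π resp , ¬t))

-- The projection onto ⟨φ⟩ along ⟨c⟩ would respect T without being trivial, since both parts are
-- nonzero.
cut : {T : Colouring n} {c : Mat q n} {φ : Mat r n} (X : Coord c φ) → ∃[ s ] (s ≢ 𝟘 {q}) → ∃[ y ] (y ≢ 𝟘 {r}) → Conn T Whole →
  ¬ (∀ v → T v ≡ true → ap (Coord.α X) v ≡ 𝟘 ⊎ ap (Coord.β X) v ≡ 𝟘)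
cut {n = n} {T = T} {c} {φ} X (s , s≢𝟘) (y , y≢𝟘) conn split = go (triv conn π resp)
  where
  open Coord X
  π : n ⊸ n
  π = lin φ ∘L β
  resp : Resp T Whole π
  resp v _ Tv with split v Tv
  ... | inj₁ αz = inj₂ (trans (trans (sym (⊕-idˡ _)) (cong (_⊕ comb φ (ap β v)) (sym (trans (cong (comb c) αz) (comb-𝟘 c))))) (expand v))
  ... | inj₂ βz = inj₁ (trans (cong (comb φ) βz) (comb-𝟘 φ))
  go : Triv Whole π → ⊥
  go (inj₁ z) = y≢𝟘 (proj₂ (unique 𝟘 y (trans (cong (_⊕ _) (comb-𝟘 c))
    (trans (⊕-idˡ _) (trans (sym (cong (comb φ) (β-φ y))) (z (comb φ y) tt))))))
  go (inj₂ f) = s≢𝟘 (proj₁ (unique s 𝟘 (trans (cong₂ _⊕_ (trans (sym (f (comb c s) tt))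
    (trans (cong (comb φ) (β-c s)) (comb-𝟘 φ))) (comb-𝟘 φ)) (⊕-idˡ 𝟘))))

-- A map π of coordinates is tested as g π β, a map of the whole space, where β is a retraction onto
-- the coordinates along a chosen complement.
conn-absolute : {T : Colouring n} {g : Mat r n} → Inj g → Conn T (_∈im g) → Conn (T ∘ comb g) Whole
conn-absolute {n} {r} {T} {g} gi conn with q , c , X ← frame g gi = mkConn triv′
  where
  open Coord X
  triv′ : ∀ π → Resp (T ∘ comb g) Whole π → Triv Whole π
  triv′ π resp = Sum.map
    (λ z v _ → ker gi _ (trans (sym (π̂-g v)) (z (comb g v) (v , refl))))
    (λ f v _ → Inj-≡ gi (trans (sym (π̂-g v)) (f (comb g v) (v , refl))))
    (triv conn π̂ resp̂)
    where
    π̂ : n ⊸ n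
    π̂ = lin g ∘L (π ∘L β)
    π̂-g : ∀ v → ap π̂ (comb g v) ≡ comb g (ap π v)
    π̂-g v = cong (comb g ∘ ap π) (β-φ v)
    resp̂ : Resp T (_∈im g) π̂
    resp̂ _ (v , refl) Tv = Sum.map (λ z → trans (π̂-g v) (trans (cong (comb g) z) (comb-𝟘 g)))
      (λ f → trans (π̂-g v) (cong (comb g) f)) (resp v tt Tv)

abstract
  avoid-two : 2 ≤ n → (x : V n) → ∃[ w ] (w ≢ 𝟘 × w ≢ x)
  avoid-two 2≤n x with w , w∉ ← outside 2≤n (x ∷ []) =
    w , (λ { refl → w∉ (𝟘 , comb-𝟘 (x ∷ [])) }) , (λ { refl → w∉ (⁅ zero ⁆ , comb-unit (w ∷ []) zero) })

functional : (h : n ⊸ r) (i : Fin r) (w : V n) → n ⊸ n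
functional h i w = record
  { ap  = λ v → lookup (ap h v) i · w
  ; add = λ u v → trans (cong (_· w) (trans (cong (λ a → lookup a i) (add h u v)) (Vecₚ.lookup-zipWith _xor_ i (ap h u) (ap h v))))
                        (·-distrib (lookup (ap h u) i) (lookup (ap h v) i) w) }

≢𝟘-bit : (v : V n) → v ≢ 𝟘 → ∃[ i ] lookup v i ≡ true
≢𝟘-bit []          v≢ = contradiction refl v≢
≢𝟘-bit (true ∷ v)  v≢ = zero , refl
≢𝟘-bit (false ∷ v) v≢ = let i , eq = ≢𝟘-bit v (λ e → v≢ (cong (false ∷_) e)) in suc i , eq

lookup-𝟘 : (i : Fin n) → lookup 𝟘 i ≡ false
lookup-𝟘 i = Vecₚ.lookup-replicate i false

-- A connected colour class spans.
span-kill : 2 ≤ n → {T : Colouring n} → Conn T Whole → (h : n ⊸ r) → (∀ v → T v ≡ true → ap h v ≡ 𝟘) → ∀ v → ap h v ≡ 𝟘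
span-kill 2≤n {T} conn h hT u with ap h u ≟V 𝟘
... | yes eq = eq
-- A map of rank one that annihilates T and sends u to w, which is neither 𝟘 nor u; such a w exists
-- because the dimension is at least 2.
... | no hu≢𝟘 with i , eq ← ≢𝟘-bit (ap h u) hu≢𝟘 | w , w≢𝟘 , w≢u ← avoid-two 2≤n u
  = ⊥-elim (go (triv conn (functional h i w) λ v _ Tv → inj₁ (cong (_· w) (trans (cong (λ a → lookup a i) (hT v Tv)) (lookup-𝟘 i)))))
  where
  πu : lookup (ap h u) i · w ≡ w
  πu = cong (_· w) eq
  go : Triv Whole (functional h i w) → ⊥
  go (inj₁ z) = w≢𝟘 (trans (sym πu) (z u tt))
  go (inj₂ f) = w≢u (trans (sym πu) (f u tt))

-- A map tested on the image of g may lead out of it, so only its compression π₀ = β π g is known to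
-- be trivial. If π₀ vanishes, a green vector fixed by π is 𝟘, so π kills all green vectors, and
-- these span by `span-kill`. If π₀ is the identity, the same argument applies to id + π.
conn-relative : 2 ≤ r → {T : Colouring n} {g : Mat r n} → Inj g → Conn (T ∘ comb g) Whole → Conn T (_∈im g)
conn-relative {r} {n} 2≤r {T} {g} gi conn with q , c , X ← frame g gi = mkConn triv′
  where
  open Coord X
  triv′ : ∀ π → Resp T (_∈im g) π → Triv (_∈im g) π
  triv′ π resp = Sum.map
    (λ z → λ { _ (v , refl) → span-kill 2≤r conn (π ∘L lin g) (λ w Tw → [ id , (λ f → bad₁ z w f) ]′ (resp _ (w , refl) Tw)) v })
    (λ f → λ { _ (v , refl) → sym (⊕-≡𝟘 (span-kill 2≤r conn (lin g +L (π ∘L lin g))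
        (λ w Tw → [ (λ z → bad₂ f w z) , co-fixed π ]′ (resp _ (w , refl) Tw)) v)) })
    (triv conn π₀ resp₀)
    where
    π₀ : r ⊸ r
    π₀ = β ∘L (π ∘L lin g)
    resp₀ : Resp (T ∘ comb g) Whole π₀
    resp₀ v _ Tv = Sum.map (λ z → trans (cong (ap β) z) (ap-𝟘 β)) (λ f → trans (cong (ap β) f) (β-φ v)) (resp (comb g v) (v , refl) Tv)
    bad₁ : (∀ v → ⊤ → ap π₀ v ≡ 𝟘) → ∀ w → ap π (comb g w) ≡ comb g w → ap π (comb g w) ≡ 𝟘
    bad₁ z w f = trans f (trans (cong (comb g) (trans (sym (β-φ w)) (trans (cong (ap β) (sym f)) (z w tt)))) (comb-𝟘 g))
    bad₂ : (∀ v → ⊤ → ap π₀ v ≡ v) → ∀ w → ap π (comb g w) ≡ 𝟘 → comb g w ⊕ ap π (comb g w) ≡ 𝟘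
    bad₂ f w z = trans (cong₂ _⊕_ (trans (cong (comb g) (trans (sym (f w tt)) (trans (cong (ap β) z) (ap-𝟘 β)))) (comb-𝟘 g)) z) (⊕-idˡ 𝟘)

-- Sums of subspaces and decompositions

∈im-⊕ : {φ : Mat r n} {u v : V n} → u ∈im φ → v ∈im φ → u ⊕ v ∈im φ
∈im-⊕ {φ = φ} (x , refl) (y , refl) = x ⊕ y , comb-⊕ φ x y

∈im-rows : {φ : Mat r n} (ψ : Mat k n) → (∀ i → lookup ψ i ∈im φ) → ∀ {v} → v ∈im ψ → v ∈im φ
∈im-rows {φ = φ} []      _ ([] , refl) = 𝟘 , comb-𝟘 φ
∈im-rows {φ = φ} (v ∷ ψ) rows (b ∷ x , refl) = ∈im-⊕ (scaled b) (∈im-rows ψ (rows ∘ suc) (x , refl))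
  where
  scaled : ∀ b → b · v ∈im φ
  scaled true  = rows zero
  scaled false = 𝟘 , comb-𝟘 φ

∈im-++ : (c : Mat q n) (φ : Mat r n) {v : V n} → v ∈im (c ++ φ) → ∃[ s ] ∃[ y ] comb c s ⊕ comb φ y ≡ v
∈im-++ {q} c φ (x , refl) = take q x , drop q x , trans (sym (comb-++ c φ _ _)) (cong (comb (c ++ φ)) (Vecₚ.take++drop≡id q x))

∈im-++⁺ : (c : Mat q n) (φ : Mat r n) (s : V q) (y : V r) → comb c s ⊕ comb φ y ∈im (c ++ φ)
∈im-++⁺ c φ s y = s ++ y , comb-++ c φ s y

Inj-++ : (c : Mat q n) (φ : Mat r n) → (∀ s y → comb c s ⊕ comb φ y ≡ 𝟘 → s ≡ 𝟘 × y ≡ 𝟘) → Inj (c ++ φ)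
Inj-++ {q} c φ f = mkInj λ x eq →
  let s≡ , y≡ = f (take q x) (drop q x) (trans (sym (comb-++ c φ _ _)) (trans (cong (comb (c ++ φ)) (Vecₚ.take++drop≡id q x)) eq))
  in trans (sym (Vecₚ.take++drop≡id q x)) (trans (cong₂ _++_ s≡ y≡) (++-𝟘 q))

Inj-split : (c : Mat q n) (φ : Mat r n) → Inj (c ++ φ) → ∀ s y → comb c s ⊕ comb φ y ≡ 𝟘 → s ≡ 𝟘 × y ≡ 𝟘
Inj-split c φ inj s y eq = ++-≡𝟘 s y (ker inj (s ++ y) (trans (comb-++ c φ s y) eq))

Inj-swap : (c : Mat q n) (φ : Mat r n) → Inj (c ++ φ) → Inj (φ ++ c)
Inj-swap c φ inj = Inj-++ φ c λ y s eq →
  let s≡ , y≡ = Inj-split c φ inj s y (trans (⊕-comm _ _) eq) in y≡ , s≡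

∈im-swap : (c : Mat q n) (φ : Mat r n) {v : V n} → v ∈im (c ++ φ) → v ∈im (φ ++ c)
∈im-swap c φ v∈ = let s , y , eq = ∈im-++ c φ v∈ in subst (_∈im (φ ++ c)) (trans (⊕-comm _ _) eq) (∈im-++⁺ φ c y s)

Inj-assoc : (a : Mat k n) (b : Mat l n) (c : Mat q n) → Inj (a ++ (b ++ c)) → Inj ((a ++ b) ++ c)
Inj-assoc {k} a b c inj = Inj-++ (a ++ b) c λ s y eq →
  let s₁ = take k s; s₂ = drop k s
      p , r = Inj-split a (b ++ c) inj s₁ (s₂ ++ y) (trans (cong (comb a s₁ ⊕_) (comb-++ b c s₂ y))
        (trans (sym (⊕-assoc _ _ _)) (trans (cong (_⊕ comb c y) (trans (sym (comb-++ a b s₁ s₂)) (cong (comb (a ++ b)) (Vecₚ.take++drop≡id k s)))) eq)))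
      p₂ , p₃ = Inj-split b c (inner inj) s₂ y (trans (sym (comb-++ b c s₂ y)) (trans (cong (comb (b ++ c)) r) (comb-𝟘 (b ++ c))))
  in trans (sym (Vecₚ.take++drop≡id k s)) (trans (cong₂ _++_ p p₂) (++-𝟘 k)) , p₃
  where
  inner : Inj (a ++ (b ++ c)) → Inj (b ++ c)
  inner inj = mkInj λ x eq → proj₂ (Inj-split a (b ++ c) inj 𝟘 x (trans (cong (_⊕ _) (comb-𝟘 a)) (trans (⊕-idˡ _) eq)))

factor : (ψ : Mat k n) (φ : Mat r n) → (∀ i → lookup φ i ∈im ψ) → Σ (Mat r k) λ M → ∀ x → comb φ x ≡ comb ψ (comb M x)
factor ψ []      _    = [] , λ { [] → sym (comb-𝟘 ψ) }
factor ψ (v ∷ φ) rows with a , e ← rows zero | M , eqs ← factor ψ φ (rows ∘ suc) =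
  a ∷ M , λ { (b ∷ x) → trans (cong₂ _⊕_ (trans (cong (b ·_) (sym e)) (sym (ap-· (lin ψ) b a))) (eqs x)) (sym (comb-⊕ ψ (b · a) (comb M x))) }

Inj-im-size : {ψ : Mat k n} {φ : Mat r n} → Inj φ → (∀ i → lookup φ i ∈im ψ) → r ≤ k
Inj-im-size {ψ = ψ} {φ} inj rows with M , eqs ← factor ψ φ rows =
  Inj-size {φ = M} (mkInj λ x eq → ker inj x (trans (eqs x) (trans (cong (comb ψ) eq) (comb-𝟘 ψ))))

-- A decomposition of the opposite colour, recorded by what it forces on S: `sums` says that the
-- opposite colour is confined to ⟨C⟩ and ⟨D⟩.
record Join {n} (S : Colouring n) (W : V n → Set) : Set where
  field
    {a b}   : ℕ
    C       : Mat a n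
    D       : Mat b n
    1≤a     : 1 ≤ a
    1≤b     : 1 ≤ b
    inj     : Inj (C ++ D)
    spans   : ∀ v → W v → v ∈im (C ++ D)
    inside  : ∀ v → v ∈im (C ++ D) → W v
    sums    : ∀ x y → x ≢ 𝟘 → y ≢ 𝟘 → S (comb C x ⊕ comb D y) ≡ true

Join-swap : {S : Colouring n} {W : V n → Set} → Join S W → Join S W
Join-swap {S = S} J = record
  { C = D ; D = C ; 1≤a = 1≤b ; 1≤b = 1≤a ; inj = Inj-swap C D inj
  ; spans = λ v Wv → ∈im-swap C D (spans v Wv) ; inside = λ v v∈ → inside v (∈im-swap D C v∈)
  ; sums = λ x y x≢ y≢ → trans (cong S (⊕-comm (comb D x) (comb C y))) (sums y x y≢ x≢) }
  where open Join J

module _ {S : Colouring n} {φ : Mat r n} (φ-inj : Inj φ) (2≤r : 2 ≤ r) (π : n ⊸ n)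
         (resp : Resp (opp S) (_∈im φ) π) (¬triv : ¬ Triv (_∈im φ) π) where

  private
    assemble : ∀ {j i} (C : Mat j n) (D : Mat i n) → 1 ≤ j → 1 ≤ i → Inj (C ++ D) →
      (∀ v → v ∈im φ → v ∈im (C ++ D)) → (∀ v → v ∈im (C ++ D) → v ∈im φ) →
      (∀ x y → x ≢ 𝟘 → y ≢ 𝟘 → comb C x ⊕ comb D y ∈im φ → ¬ Cls π (comb C x ⊕ comb D y)) → Join S (_∈im φ)
    assemble C D 1≤j 1≤i inj sp ins bad = record
      { C = C ; D = D ; 1≤a = 1≤j ; 1≤b = 1≤i ; inj = inj ; spans = sp ; inside = ins
      ; sums = λ x y x≢ y≢ → decided (S _) λ ¬S → let ∈φ = ins _ (∈im-++⁺ C D x y) in bad x y x≢ y≢ ∈φ (resp _ ∈φ (cong not ¬S)) }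
      where
      decided : ∀ b → ¬ (b ≡ false) → b ≡ true
      decided true  _ = refl
      decided false f = contradiction refl f

    K F : V n → Set
    K v = v ∈im φ × ap π v ≡ 𝟘
    F v = v ∈im φ × ap π v ≡ v

    kill : ∀ {i} (P : Mat i n) → (∀ k → K (lookup P k)) → ∀ x → ap π (comb P x) ≡ 𝟘
    kill []      _  []      = ap-𝟘 π
    kill (v ∷ P) KP (b ∷ x) = trans (add π (b · v) (comb P x)) (trans (cong₂ _⊕_ (trans (ap-· π b v) (z b)) (kill P (KP ∘ suc) x)) (⊕-idˡ 𝟘))
      where
      z : ∀ b → b · ap π v ≡ 𝟘
      z true  = proj₂ (KP zero)
      z false = refl
    fix : ∀ {j} (Q : Mat j n) → (∀ k → F (lookup Q k)) → ∀ x → ap π (comb Q x) ≡ comb Q x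
    fix []      _  []      = ap-𝟘 π
    fix (v ∷ Q) FQ (b ∷ x) = trans (add π (b · v) (comb Q x)) (cong₂ _⊕_ (trans (ap-· π b v) (cong (b ·_) (proj₂ (FQ zero)))) (fix Q (FQ ∘ suc) x))

    unpad : ∀ {i} {P : Mat i n} {v} → v ∈im (P ++ []) → v ∈im P
    unpad {P = P} v∈ with s , [] , eq ← ∈im-++ P [] v∈ = s , trans (sym (⊕-idʳ _)) eq

    Inj-unpad : ∀ {i} {P : Mat i n} → Inj (P ++ []) → Inj P
    Inj-unpad Pi = mkInj λ x eq → proj₁ (Inj-split _ [] Pi x [] (trans (⊕-idʳ _) eq))

    rows-++ : ∀ {k j} (U : Mat k n) (Q : Mat j n) → (∀ t → lookup U t ∈im φ) → (∀ t → lookup Q t ∈im φ) → ∀ t → lookup (U ++ Q) t ∈im φ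
    rows-++ []      Q _  rQ t       = rQ t
    rows-++ (u ∷ U) Q rU rQ zero    = rU zero
    rows-++ (u ∷ U) Q rU rQ (suc t) = rows-++ U Q (rU ∘ suc) rQ t

    no-rows : ∀ {w} (M : Mat w n) → w ≡ 0 → ∀ s → comb M s ≡ 𝟘
    no-rows [] _ [] = refl

    -- P and Q are bases of the killed and of the fixed vectors, and U completes them. If P is
    -- nonempty, it is one part and `U ++ Q` the other; if only Q is nonempty, the parts are U and
    -- Q. The first part is then nonempty because π is not trivial. If both are empty, no nonzero
    -- vector of the subspace has the opposite colour, and the first row may be separated from the
    -- rest.
    build : ∀ {i j k} (P : Mat i n) (Q : Mat j n) (U : Mat k n) → (∀ t → K (lookup P t)) → (∀ t → F (lookup Q t)) → (∀ t → lookup U t ∈im φ) →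
      (∀ v → K v → v ∈im P) → (∀ v → F v → v ∈im Q) → Inj (U ++ (Q ++ P)) → (∀ v → v ∈im φ → v ∈im (U ++ (Q ++ P))) → Join S (_∈im φ)
    build {zero} {zero} {k} [] [] U KP FQ rU P-im Q-im inj sp = discrete U rU (Inj-unpad {P = U} inj) (λ v v∈ → unpad {P = U} (sp v v∈))
      where
      only-𝟘 : ∀ {v : V n} → v ∈im [] → v ≡ 𝟘
      only-𝟘 ([] , e) = sym e
      is-zero : ∀ {v} → v ∈im φ → Cls π v → v ≡ 𝟘
      is-zero v∈ (inj₁ z) = only-𝟘 (P-im _ (v∈ , z))
      is-zero v∈ (inj₂ f) = only-𝟘 (Q-im _ (v∈ , f))
      discrete : ∀ {k} (U : Mat k n) → (∀ t → lookup U t ∈im φ) → Inj U → (∀ v → v ∈im φ → v ∈im U) → Join S (_∈im φ)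
      discrete []       _  _    sp′ = ⊥-elim (ℕₚ.<⇒≱ 2≤r (≤-trans (Inj-im-size φ-inj (λ i → sp′ _ (_ , comb-unit φ i))) z≤n))
      discrete (_ ∷ []) _  _    sp′ = ⊥-elim (ℕₚ.<⇒≱ 2≤r (Inj-im-size φ-inj (λ i → sp′ _ (_ , comb-unit φ i))))
      discrete (u ∷ U@(_ ∷ _)) rU′ inj′ sp′ =
        assemble (u ∷ []) U (s≤s z≤n) (s≤s z≤n) inj′ sp′ (λ v → ∈im-rows (u ∷ U) rU′) λ x y x≢ _ ∈φ cls →
          x≢ (proj₁ (Inj-split (u ∷ []) U inj′ x y (is-zero ∈φ cls)))
    build {zero} {suc j} {k} [] Q U KP FQ rU P-im Q-im inj sp =
      assemble U Q (ℕₚ.≮⇒≥ λ lt → ¬triv (inj₂ λ v v∈ →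
          let s , y , e = ∈im-++ U Q (sp′ v v∈)
              e′ = trans (sym (trans (cong (_⊕ comb Q y) (no-rows U (ℕₚ.n<1⇒n≡0 lt) s)) (⊕-idˡ _))) e
          in trans (cong (ap π) (sym e′)) (trans (fix Q FQ y) e′)))
        (s≤s z≤n) injUQ sp′
        (λ v → ∈im-rows (U ++ Q) (rows-++ U Q rU (proj₁ ∘ FQ))) bad
      where
      injUQ : Inj (U ++ Q)
      injUQ = Inj-++ U Q λ s y eq →
        let p , r = Inj-split U (Q ++ []) inj s (y ++ []) (trans (cong (comb U s ⊕_) (trans (comb-++ Q [] y []) (⊕-idʳ _))) eq)
        in p , proj₁ (++-≡𝟘 y [] r)
      sp′ : ∀ v → v ∈im φ → v ∈im (U ++ Q)
      sp′ v v∈ = let s , y , e = ∈im-++ U (Q ++ []) (sp v v∈); y′ , e′ = unpad {P = Q} (y , refl)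
                 in s ++ y′ , trans (comb-++ U Q s y′) (trans (cong (comb U s ⊕_) e′) e)
      bad : ∀ x y → x ≢ 𝟘 → y ≢ 𝟘 → comb U x ⊕ comb Q y ∈im φ → ¬ Cls π (comb U x ⊕ comb Q y)
      bad x y x≢ y≢ ∈φ (inj₁ z) with [] , e ← P-im _ (∈φ , z) = x≢ (proj₁ (Inj-split U Q injUQ x y (sym e)))
      bad x y x≢ y≢ ∈φ (inj₂ f) with t , e ← Q-im _ (∈φ , f) =
        x≢ (proj₁ (Inj-split U Q injUQ x (y ⊕ t) (trans (cong (comb U x ⊕_) (trans (comb-⊕ Q y t) (cong (comb Q y ⊕_) e)))
             (trans (sym (⊕-assoc (comb U x) (comb Q y) _)) (⊕-self _)))))
    build {suc i} {j} {k} P Q U KP FQ rU P-im Q-im inj sp =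
      assemble (U ++ Q) P (ℕₚ.≮⇒≥ λ lt → ¬triv (inj₁ λ v v∈ →
          let s , y , e = ∈im-++ (U ++ Q) P (sp′ v v∈) in
          trans (cong (ap π) (trans (sym e) (trans (cong (_⊕ comb P y) (no-rows (U ++ Q) (ℕₚ.n<1⇒n≡0 lt) s)) (⊕-idˡ _)))) (kill P KP y)))
        (s≤s z≤n) inj′ sp′ (λ v → ∈im-rows ((U ++ Q) ++ P) (rows-++ (U ++ Q) P (rows-++ U Q rU (proj₁ ∘ FQ)) (proj₁ ∘ KP))) bad
      where
      inj′ : Inj ((U ++ Q) ++ P)
      inj′ = Inj-assoc U Q P inj
      sp′ : ∀ v → v ∈im φ → v ∈im ((U ++ Q) ++ P)
      sp′ v v∈ with s , y , refl ← ∈im-++ U (Q ++ P) (sp v v∈) with s′ , y′ , e ← ∈im-++ Q P (y , refl) =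
        subst (_∈im ((U ++ Q) ++ P)) (trans (cong (_⊕ comb P y′) (comb-++ U Q s s′)) (trans (⊕-assoc _ _ _) (cong (comb U s ⊕_) e)))
          (∈im-++⁺ (U ++ Q) P (s ++ s′) y′)
      bad : ∀ x y → x ≢ 𝟘 → y ≢ 𝟘 → comb (U ++ Q) x ⊕ comb P y ∈im φ → ¬ Cls π (comb (U ++ Q) x ⊕ comb P y)
      bad x y x≢ y≢ ∈φ (inj₁ z) with t , e ← P-im _ (∈φ , z) =
        x≢ (proj₁ (Inj-split (U ++ Q) P inj′ x (y ⊕ t) (trans (cong (comb (U ++ Q) x ⊕_) (trans (comb-⊕ P y t) (cong (comb P y ⊕_) e)))
             (trans (sym (⊕-assoc _ _ _)) (⊕-self _)))))
      bad x y x≢ y≢ ∈φ (inj₂ f) with t , e ← Q-im _ (∈φ , f) =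
        y≢ (proj₂ (Inj-split (U ++ Q) P inj′ (x ⊕ (𝟘 ++ t)) y (begin
          comb (U ++ Q) (x ⊕ (𝟘 ++ t)) ⊕ comb P y
            ≡⟨ cong (_⊕ comb P y) (trans (comb-⊕ (U ++ Q) x (𝟘 ++ t)) (cong (comb (U ++ Q) x ⊕_)
                 (trans (comb-++ U Q 𝟘 t) (trans (cong (_⊕ comb Q t) (comb-𝟘 U)) (trans (⊕-idˡ _) e))))) ⟩
          (comb (U ++ Q) x ⊕ (comb (U ++ Q) x ⊕ comb P y)) ⊕ comb P y
            ≡⟨ xor-solve (comb (U ++ Q) x ∷ comb P y ∷ []) ((x₀ :+ (x₀ :+ x₁)) :+ x₁) :0 refl ⟩
          𝟘 ∎)))
        where open ≡-Reasoning

  -- π need not be a projection: killed and fixed vectors are independent of each other but may span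
  -- less than the subspace, which is why a third block U appears.
  split⇒join : Join S (_∈im φ)
  split⇒join = bases
    (complete-dec [] (mkInj λ { [] _ → refl }) (λ v → (v ∈im? φ) ×-dec (ap π v ≟V 𝟘)))
    (complete-dec [] (mkInj λ { [] _ → refl }) (λ v → (v ∈im? φ) ×-dec (ap π v ≟V v)))
    where
    bases : Completion [] K K → Completion [] F F → Join S (_∈im φ)
    bases (i , P , KP , Pi , P-sp) (j , Q , FQ , Qi , Q-sp) = rest (complete-dec (Q ++ P) QP (λ v → v ∈im? φ))
      where
      QP : Inj (Q ++ P)
      QP = Inj-++ Q P λ s y eq →
        let e : comb Q s ≡ 𝟘
            e = trans (sym (fix Q FQ s)) (trans (cong (ap π) (⊕-≡𝟘 eq)) (kill P KP y))
        in ker (Inj-unpad {P = Q} Qi) s e , ker (Inj-unpad {P = P} Pi) y (trans (sym (⊕-idˡ _)) (trans (cong (_⊕ comb P y) (sym e)) eq))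
      rest : Completion (Q ++ P) (_∈im φ) (_∈im φ) → Join S (_∈im φ)
      rest (k , U , rU , UQP , sp) = build P Q U KP FQ rU (λ v Kv → unpad {P = P} (P-sp v Kv)) (λ v Fv → unpad {P = Q} (Q-sp v Fv)) UQP sp

module _ {T : Colouring n} {W : V n → Set} (J : Join T W) where
  open Join J

  private
    s : V a → V b → V n
    s x y = comb C x ⊕ comb D y

    s-inj : ∀ {x y x′ y′} → s x y ≡ s x′ y′ → x ≡ x′ × y ≡ y′
    s-inj {x} {y} {x′} {y′} eq =
      let p , r = Inj-split C D inj (x ⊕ x′) (y ⊕ y′) (trans (cong₂ _⊕_ (comb-⊕ C x x′) (comb-⊕ D y y′))
            (trans (⊕-interchange _ _ _ _) (trans (cong (_⊕ s x′ y′) eq) (⊕-self _))))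
      in ⊕-≡𝟘 p , ⊕-≡𝟘 r

    s-𝟘 : ∀ {x y} → x ≢ 𝟘 → s x y ≢ 𝟘
    s-𝟘 x≢ eq = x≢ (proj₁ (Inj-split C D inj _ _ eq))

  -- Two rows of the grid of sums c + d give 4-circuits; with a single row, 4-circuits c + d, c + d′, c + d″, c + d + d′ + d″.
  join-conn : 4 ≤ a + b → 2 ≤ b → Conn T W
  join-conn 4≤a+b 2≤b = conn-anchored (s x* y*) (λ π resp → cls π resp x*≢ y*≢) kill-all
    where
    first : ∀ {k} → 1 ≤ k → ∃[ x ] (x ≢ 𝟘 {k})
    first (s≤s z≤n) = ⁅ zero ⁆ , λ ()
    x* = proj₁ (first 1≤a)
    x*≢ = proj₂ (first 1≤a)
    y* = proj₁ (first 1≤b)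
    y*≢ = proj₂ (first 1≤b)
    cls : ∀ π → Resp T W π → ∀ {x y} → x ≢ 𝟘 → y ≢ 𝟘 → Cls π (s x y)
    cls π resp {x} {y} x≢ y≢ = resp _ (inside _ (∈im-++⁺ C D x y)) (sums x y x≢ y≢)
    module _ (π : n ⊸ n) (resp : Resp T W π) where
      row : 2 ≤ a → ∀ {x y y′} → x ≢ 𝟘 → y ≢ 𝟘 → y′ ≢ 𝟘 → ap π (s x y) ≡ 𝟘 → y ≢ y′ → ap π (s x y′) ≡ 𝟘
      row 2≤a {x} {y} {y′} x≢ y≢ y′≢ z y≢y′ with x″ , x″≢ , x″≢x ← avoid-two 2≤a x =
        kill-four π {s x y} {s x y′} {s x″ y} {s x″ y′} (cls π resp x≢ y′≢) (cls π resp x″≢ y≢) (cls π resp x″≢ y′≢)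
          (xor-solve (comb C x ∷ comb C x″ ∷ comb D y ∷ comb D y′ ∷ []) ((x₀ :+ x₂) :+ (x₀ :+ x₃)) ((x₁ :+ x₂) :+ (x₁ :+ x₃)) refl)
          (s-𝟘 x≢) (λ e → x″≢x (sym (proj₁ (s-inj e)))) (λ e → x″≢x (sym (proj₁ (s-inj e)))) z
      col : ∀ {x x′ y} → x ≢ 𝟘 → x′ ≢ 𝟘 → y ≢ 𝟘 → ap π (s x y) ≡ 𝟘 → x ≢ x′ → ap π (s x′ y) ≡ 𝟘
      col {x} {x′} {y} x≢ x′≢ y≢ z x≢x′ with y″ , y″≢ , y″≢y ← avoid-two 2≤b y =
        kill-four π {s x y} {s x′ y} {s x y″} {s x′ y″} (cls π resp x′≢ y≢) (cls π resp x≢ y″≢) (cls π resp x′≢ y″≢)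
          (xor-solve (comb C x ∷ comb C x′ ∷ comb D y ∷ comb D y″ ∷ []) ((x₀ :+ x₂) :+ (x₁ :+ x₂)) ((x₀ :+ x₃) :+ (x₁ :+ x₃)) refl)
          (s-𝟘 x≢) (λ e → y″≢y (sym (proj₂ (s-inj e)))) (λ e → y″≢y (sym (proj₂ (s-inj e)))) z
      row₁ : 3 ≤ b → ∀ {x y y′} → x ≢ 𝟘 → y ≢ 𝟘 → y′ ≢ 𝟘 → ap π (s x y) ≡ 𝟘 → y ≢ y′ → ap π (s x y′) ≡ 𝟘
      row₁ 3≤b {x} {y} {y′} x≢ y≢ y′≢ z y≢y′ with y″ , y″∉ ← outside 3≤b (y ∷ y′ ∷ []) =
        kill-four π {s x y} {s x y′} {s x y″} {s x ((y ⊕ y′) ⊕ y″)} (cls π resp x≢ y′≢)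
          (cls π resp x≢ λ e → not-in (𝟘) (trans (comb-𝟘 (y ∷ y′ ∷ [])) (sym e)))
          (cls π resp x≢ λ e → not-in (true ∷ true ∷ []) (trans (cong (y ⊕_) (⊕-idʳ y′)) (⊕-≡𝟘 e)))
          (trans (xor-solve (comb C x ∷ comb D y ∷ comb D y′ ∷ comb D y″ ∷ []) ((x₀ :+ x₁) :+ (x₀ :+ x₂)) ((x₀ :+ x₃) :+ (x₀ :+ ((x₁ :+ x₂) :+ x₃))) refl)
            (cong (λ t → s x y″ ⊕ (comb C x ⊕ t)) (sym (trans (comb-⊕ D (y ⊕ y′) y″) (cong (_⊕ comb D y″) (comb-⊕ D y y′))))))
          (s-𝟘 x≢) (λ e → not-in (false ∷ true ∷ []) (trans (⊕-idˡ _) (trans (⊕-idʳ y′) (proj₂ (s-inj e)))))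
          (λ e → not-in (true ∷ false ∷ []) (trans (cong (y ⊕_) (⊕-idˡ 𝟘)) (trans (⊕-idʳ y) (⊕-≡𝟘
            (trans (xor-solve (y ∷ y′ ∷ y″ ∷ []) (x₀ :+ x₂) (x₁ :+ ((x₀ :+ x₁) :+ x₂)) refl) (trans (cong (_⊕ ((y ⊕ y′) ⊕ y″)) (proj₂ (s-inj e))) (⊕-self _))))))) z
        where
        not-in : ∀ t → comb (y ∷ y′ ∷ []) t ≢ y″
        not-in t e = y″∉ (t , e)
      along : ∀ {x y y′} → x ≢ 𝟘 → y ≢ 𝟘 → y′ ≢ 𝟘 → ap π (s x y) ≡ 𝟘 → ap π (s x y′) ≡ 𝟘
      along {x} {y} {y′} x≢ y≢ y′≢ z with y ≟V y′
      ... | yes refl = z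
      ... | no y≢y′ with 2 ℕ.≤? a
      ...   | yes 2≤a = row 2≤a x≢ y≢ y′≢ z y≢y′
      ...   | no ¬2≤a = row₁ (ℕₚ.+-cancelˡ-≤ 1 3 b (≤-trans 4≤a+b (ℕₚ.+-monoˡ-≤ b (ℕₚ.≤-pred (ℕₚ.≰⇒> ¬2≤a))))) x≢ y≢ y′≢ z y≢y′
      every : ap π (s x* y*) ≡ 𝟘 → ∀ {x y} → x ≢ 𝟘 → y ≢ 𝟘 → ap π (s x y) ≡ 𝟘
      every z {x} {y} x≢ y≢ with x* ≟V x
      ... | yes refl = along x≢ y*≢ y≢ z
      ... | no x*≢x  = along x≢ y*≢ y≢ (col x*≢ x≢ y*≢ z x*≢x)
      D-part : ap π (s x* y*) ≡ 𝟘 → ∀ y → ap π (comb D y) ≡ 𝟘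
      D-part z y with y ≟V 𝟘
      ... | yes refl = trans (cong (ap π) (comb-𝟘 D)) (ap-𝟘 π)
      ... | no y≢ with y″ , y″≢ , y″≢y ← avoid-two 2≤b y =
        trans (cong (ap π) (trans (xor-solve (comb C x* ∷ comb D y ∷ comb D y″ ∷ []) x₁ ((x₀ :+ x₂) :+ (x₀ :+ (x₁ :+ x₂))) refl)
               (cong (λ t → s x* y″ ⊕ (comb C x* ⊕ t)) (sym (comb-⊕ D y y″)))))
          (trans (add π _ _) (trans (cong₂ _⊕_ (every z x*≢ y″≢) (every z x*≢ λ e → y″≢y (sym (⊕-≡𝟘 e)))) (⊕-idˡ 𝟘)))
      C-part : ap π (s x* y*) ≡ 𝟘 → ∀ x → ap π (comb C x) ≡ 𝟘
      C-part z x with x ≟V 𝟘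
      ... | yes refl = trans (cong (ap π) (comb-𝟘 C)) (ap-𝟘 π)
      ... | no x≢ = trans (cong (ap π) (xor-solve (comb C x ∷ comb D y* ∷ []) x₀ ((x₀ :+ x₁) :+ x₁) refl))
          (trans (add π _ _) (trans (cong₂ _⊕_ (every z x≢ y*≢) (D-part z y*)) (⊕-idˡ 𝟘)))
      kill-all : ap π (s x* y*) ≡ 𝟘 → ∀ v → W v → ap π v ≡ 𝟘
      kill-all z v Wv with x , y , refl ← ∈im-++ C D (spans v Wv) = trans (add π _ _) (trans (cong₂ _⊕_ (C-part z x) (D-part z y)) (⊕-idˡ 𝟘))

-- If one colour is disconnected, the other contains all sums c + d across the decomposition, hence is connected.
conn-of-split : {T : Colouring n} {φ : Mat r n} → Inj φ → 4 ≤ r → (π : n ⊸ n) → Resp (opp T) (_∈im φ) π → ¬ Triv (_∈im φ) π → Conn T (_∈im φ)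
conn-of-split {T = T} {φ} φi 4≤r π resp ¬triv = go (split⇒join {S = T} φi (≤-trans (s≤s (s≤s z≤n)) 4≤r) π resp ¬triv)
  where
  go : Join T (_∈im φ) → Conn T (_∈im φ)
  go J with 2 ℕ.≤? Join.b J
  ... | yes 2≤b = join-conn J (≤-trans 4≤r (Inj-im-size φi (λ i → Join.spans J _ (_ , comb-unit φ i)))) 2≤b
  ... | no ¬2≤b = join-conn (Join-swap J) (≤-trans 4≤a+b (≤-reflexive (ℕₚ.+-comm a b)))
    (≤-trans (s≤s (s≤s z≤n)) (ℕₚ.+-cancelʳ-≤ 1 3 a (≤-trans 4≤a+b (ℕₚ.+-monoʳ-≤ a (ℕₚ.≤-pred (ℕₚ.≰⇒> ¬2≤b))))))
    where
    open Join J
    4≤a+b : 4 ≤ a + b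
    4≤a+b = ≤-trans 4≤r (Inj-im-size φi (λ i → spans _ (_ , comb-unit φ i)))

-- Sums indexed by subsets

vsum-comb : (φ : Fin r → V n) (Y : Subset r) → vsum φ Y ≡ comb (tabulate φ) Y
vsum-comb {zero}  φ []      = refl
vsum-comb {suc r} φ (b ∷ Y) = cong (b · φ zero ⊕_) (vsum-comb (φ ∘ suc) Y)

comb-vsum : (M : Mat r n) (Y : Subset r) → comb M Y ≡ vsum (lookup M) Y
comb-vsum M Y = trans (cong (λ N → comb N Y) (sym (tabulate∘lookup M))) (sym (vsum-comb (lookup M) Y))

ap-vsum : (h : n ⊸ k) (φ : Fin r → V n) (Y : Subset r) → ap h (vsum φ Y) ≡ vsum (ap h ∘ φ) Y
ap-vsum h φ Y = trans (cong (ap h) (vsum-comb φ Y)) (trans (ap-comb h (tabulate φ) Y)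
  (trans (cong (λ M → comb M Y) (sym (Vecₚ.tabulate-∘ (ap h) φ))) (sym (vsum-comb (ap h ∘ φ) Y))))

vsum-⊕ : (φ : Fin r → V n) (X Y : Subset r) → vsum φ (X ⊕ Y) ≡ vsum φ X ⊕ vsum φ Y
vsum-⊕ φ X Y = trans (vsum-comb φ (X ⊕ Y)) (trans (comb-⊕ (tabulate φ) X Y) (sym (cong₂ _⊕_ (vsum-comb φ X) (vsum-comb φ Y))))

vsum-𝟘 : (φ : Fin r → V n) → vsum φ 𝟘 ≡ 𝟘
vsum-𝟘 φ = trans (vsum-comb φ 𝟘) (comb-𝟘 (tabulate φ))

vsum-unit : (φ : Fin r → V n) (i : Fin r) → vsum φ ⁅ i ⁆ ≡ φ i
vsum-unit φ i = trans (vsum-comb φ ⁅ i ⁆) (trans (comb-unit (tabulate φ) i) (lookup∘tabulate φ i))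

vsum-cong : {φ ψ : Fin r → V n} → (∀ i → φ i ≡ ψ i) → ∀ Y → vsum φ Y ≡ vsum ψ Y
vsum-cong {φ = φ} {ψ} eq Y = trans (vsum-comb φ Y) (trans (cong (λ M → comb M Y) (tabulate-cong eq)) (sym (vsum-comb ψ Y)))

vsum-lookup-units : (Y : Subset r) → vsum (lookup (units r)) Y ≡ Y
vsum-lookup-units Y = trans (sym (comb-vsum (units _) Y)) (comb-units Y)

∈⇒true : {Y : Subset r} {i : Fin r} → i ∈ₛ Y → lookup Y i ≡ true
∈⇒true = Vecₚ.[]=⇒lookup

true⇒∈ : {Y : Subset r} {i : Fin r} → lookup Y i ≡ true → i ∈ₛ Y
true⇒∈ = Vecₚ.lookup⇒[]= _ _

Nonempty⇒≢𝟘 : {Y : Subset r} → Nonempty Y → Y ≢ 𝟘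
Nonempty⇒≢𝟘 (i , i∈Y) refl = contradiction (trans (sym (∈⇒true i∈Y)) (lookup-𝟘 i)) λ ()

≢𝟘⇒Nonempty : {Y : Subset r} → Y ≢ 𝟘 → Nonempty Y
≢𝟘⇒Nonempty {Y = Y} Y≢𝟘 = let i , eq = ≢𝟘-bit Y Y≢𝟘 in i , true⇒∈ eq

-- An excluded flat read off the colouring alone: `closed` is flatness, as it leaves no nonzero
-- green vector in the span besides the `w i`.
record Pat {n} (T : Colouring n) : Set where
  field
    X      : Excluded
    w      : Fin (size (excluded X)) → V n
    w-inj  : ∀ {i j} → w i ≡ w j → i ≡ j
    w≢𝟘    : ∀ i → w i ≢ 𝟘
    green  : ∀ i → T (w i) ≡ true
    ind    : ∀ Y → Indep (excluded X) Y ⇔ LinIndep w Y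
    closed : ∀ Y → vsum w Y ≢ 𝟘 → T (vsum w Y) ≡ true → ∃[ i ] w i ≡ vsum w Y

-- A coordinate matrix for each excluded matroid in which the unit vectors occur among the rows.
-- Patterns then arise from an independent matrix by `pat-std`, and the connectedness of the
-- excluded flats can be studied on `W`.
record Std (X : Excluded) : Set where
  field
    d       : ℕ
    W       : Mat (size (excluded X)) d
    W-inj   : ∀ {i j} → lookup W i ≡ lookup W j → i ≡ j
    W≢𝟘     : ∀ i → lookup W i ≢ 𝟘
    ind     : ∀ Y → Indep (excluded X) Y ⇔ LinIndep (lookup W) Y
    basis   : Fin d → Fin (size (excluded X))
    W-basis : ∀ j → lookup W (basis j) ≡ ⁅ j ⁆

LinIndep-∘ : {B : Mat k n} → Inj B → (φ : Fin r → V k) (Y : Subset r) → LinIndep φ Y ⇔ LinIndep (comb B ∘ φ) Y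
LinIndep-∘ {B = B} Bi φ Y = mk⇔
  (λ li Z Z⊆ ne eq → li Z Z⊆ ne (ker Bi _ (trans (ap-vsum (lin B) φ Z) eq)))
  (λ li Z Z⊆ ne eq → li Z Z⊆ ne (trans (sym (ap-vsum (lin B) φ Z)) (trans (cong (comb B) eq) (comb-𝟘 B))))

_⇔-∘_ : {A B C : Set} → A ⇔ B → B ⇔ C → A ⇔ C
f ⇔-∘ g = mk⇔ (Equivalence.to g ∘ Equivalence.to f) (Equivalence.from f ∘ Equivalence.from g)

pat-std : {T : Colouring n} {X : Excluded} (S : Std X) (B : Mat (Std.d S) n) → Inj B →
  (∀ i → T (comb B (lookup (Std.W S) i)) ≡ true) →
  (∀ x → x ≢ 𝟘 → T (comb B x) ≡ true → ∃[ i ] lookup (Std.W S) i ≡ x) → Pat T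
pat-std {T = T} {X} S B Bi gr cl = record
  { X = X ; w = comb B ∘ lookup W ; w-inj = W-inj ∘ Inj-≡ Bi ; w≢𝟘 = λ i eq → W≢𝟘 i (ker Bi _ eq) ; green = gr
  ; ind = λ Y → ind Y ⇔-∘ LinIndep-∘ Bi (lookup W) Y
  ; closed = λ Y ≢0 Tv → let i , eq = cl (vsum (lookup W) Y) (λ e → ≢0 (trans (sym (ap-vsum (lin B) (lookup W) Y)) (trans (cong (comb B) e) (comb-𝟘 B))))
                                        (trans (cong T (ap-vsum (lin B) (lookup W) Y)) Tv)
                         in i , trans (cong (comb B) eq) (ap-vsum (lin B) (lookup W) Y) }
  where open Std S

-- Boolean tests that evaluate

isZero : V n → Bool
isZero []      = true
isZero (b ∷ v) = if b then false else isZero v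

isZero-sound : (v : V n) → isZero v ≡ true → v ≡ 𝟘
isZero-sound []          _  = refl
isZero-sound (false ∷ v) eq = cong (false ∷_) (isZero-sound v eq)

isZero-𝟘 : ∀ n → isZero (𝟘 {n}) ≡ true
isZero-𝟘 zero    = refl
isZero-𝟘 (suc n) = isZero-𝟘 n

allB : ∀ n → (V n → Bool) → Bool
allB zero    f = f []
allB (suc n) f = if allB n (f ∘ (false ∷_)) then allB n (f ∘ (true ∷_)) else false

if-true : ∀ {a b} → (if a then b else false) ≡ true → a ≡ true × b ≡ true
if-true {true} eq = refl , eq

allB-sound : ∀ n {f : V n → Bool} → allB n f ≡ true → ∀ v → f v ≡ true
allB-sound zero    eq []          = eq
allB-sound (suc n) eq (false ∷ v) = allB-sound n (proj₁ (if-true eq)) v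
allB-sound (suc n) {f} eq (true ∷ v) = allB-sound n (proj₂ (if-true {allB n (f ∘ (false ∷_))} eq)) v

eqB : (u v : V n) → Bool
eqB u v = isZero (u ⊕ v)

eqB-sound : (u v : V n) → eqB u v ≡ true → u ≡ v
eqB-sound u v eq = ⊕-≡𝟘 (isZero-sound (u ⊕ v) eq)

-- Cycle matroids through the incidence matrix over GF(2)

module Cycles (G : Graph) where
  private
    e# = Graph.m G
    v# = Graph.v G

  boundary : Fin e# → V v#
  boundary e = let a , b = lookup (ends G) e in ⁅ a ⁆ ⊕ ⁅ b ⁆

  private
    Walk : Subset e# → List (Fin v#) → Set
    Walk X = Linked (Adj G X)

    -- Edges are added modulo 2, so that the boundary telescopes along the walk. A repeated edge
    -- would cancel; the survival of the first edge of a cycle is therefore a separate matter,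
    -- settled by `fresh`.
    edges : ∀ {X ℓ} → Walk X ℓ → Subset e#
    edges []                = 𝟘
    edges [-]               = 𝟘
    edges ((e , _) ∷ walk) = ⁅ e ⁆ ⊕ edges walk

    end : Fin v# → List (Fin v#) → Fin v#
    end x []       = x
    end x (y ∷ ys) = end y ys

    boundary-adj : ∀ {a b} e → lookup (ends G) e ≡ (a , b) ⊎ lookup (ends G) e ≡ (b , a) → boundary e ≡ ⁅ a ⁆ ⊕ ⁅ b ⁆
    boundary-adj e (inj₁ eq) = cong (λ (a , b) → ⁅ a ⁆ ⊕ ⁅ b ⁆) eq
    boundary-adj e (inj₂ eq) = trans (cong (λ (a , b) → ⁅ a ⁆ ⊕ ⁅ b ⁆) eq) (⊕-comm _ _)

    edges-boundary : ∀ {X x ℓ} (walk : Walk X (x ∷ ℓ)) → vsum boundary (edges walk) ≡ ⁅ x ⁆ ⊕ ⁅ end x ℓ ⁆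
    edges-boundary {x = x} [-] = trans (vsum-𝟘 boundary) (sym (⊕-self ⁅ x ⁆))
    edges-boundary {x = x} {y ∷ ℓ} ((e , _ , adj) ∷ walk) = begin
      vsum boundary (⁅ e ⁆ ⊕ edges walk)                  ≡⟨ vsum-⊕ boundary ⁅ e ⁆ (edges walk) ⟩
      vsum boundary ⁅ e ⁆ ⊕ vsum boundary (edges walk)    ≡⟨ cong₂ _⊕_ (trans (vsum-unit boundary e) (boundary-adj e adj)) (edges-boundary walk) ⟩
      (⁅ x ⁆ ⊕ ⁅ y ⁆) ⊕ (⁅ y ⁆ ⊕ ⁅ end y ℓ ⁆)              ≡⟨ xor-solve (⁅ x ⁆ ∷ ⁅ y ⁆ ∷ ⁅ end y ℓ ⁆ ∷ []) ((x₀ :+ x₁) :+ (x₁ :+ x₂)) (x₀ :+ x₂) refl ⟩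
      ⁅ x ⁆ ⊕ ⁅ end y ℓ ⁆                                  ∎
      where open ≡-Reasoning

    xor-true : ∀ a b → a xor b ≡ true → a ≡ true ⊎ b ≡ true
    xor-true true  b _  = inj₁ refl
    xor-true false b eq = inj₂ eq

    edges-⊆ : ∀ {X ℓ} (walk : Walk X ℓ) → edges walk ⊆ₛ X
    edges-⊆ []  i∈ = contradiction refl (Nonempty⇒≢𝟘 (_ , i∈))
    edges-⊆ [-] i∈ = contradiction refl (Nonempty⇒≢𝟘 (_ , i∈))
    edges-⊆ ((e , e∈X , _) ∷ walk) {i} i∈ with xor-true _ _ (trans (sym (Vecₚ.lookup-zipWith _xor_ i ⁅ e ⁆ (edges walk))) (∈⇒true i∈))
    ... | inj₁ t rewrite Subₚ.x∈⁅y⁆⇒x≡y e (true⇒∈ {Y = ⁅ e ⁆} t) = e∈X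
    ... | inj₂ t = edges-⊆ walk (true⇒∈ t)

    other : ∀ {a b x y} e f → lookup (ends G) e ≡ (a , b) ⊎ lookup (ends G) e ≡ (b , a) →
      lookup (ends G) f ≡ (x , y) ⊎ lookup (ends G) f ≡ (y , x) → x ≢ a → x ≢ b → lookup ⁅ f ⁆ e ≡ false
    other e f adj adj′ x≢a x≢b with lookup ⁅ f ⁆ e in eq
    ... | false = refl
    ... | true with refl ← Subₚ.x∈⁅y⁆⇒x≡y f (true⇒∈ {Y = ⁅ f ⁆} eq) with adj | adj′
    ...   | inj₁ p | inj₁ q = contradiction (cong proj₁ (trans (sym q) p)) x≢a
    ...   | inj₁ p | inj₂ q = contradiction (cong proj₂ (trans (sym q) p)) x≢b
    ...   | inj₂ p | inj₁ q = contradiction (cong proj₁ (trans (sym q) p)) x≢b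
    ...   | inj₂ p | inj₂ q = contradiction (cong proj₂ (trans (sym q) p)) x≢a

    -- The first edge x₀x₁ of a cycle is not repeated: no later step lies inside {x₀, x₁}.
    fresh : ∀ {X a b z} e → lookup (ends G) e ≡ (a , b) ⊎ lookup (ends G) e ≡ (b , a) → ∀ x ℓ → All (λ y → y ≢ a × y ≢ b) (x ∷ ℓ) →
      (walk : Walk X ((x ∷ ℓ) List.++ z ∷ [])) → lookup (edges walk) e ≡ false
    fresh e adj x []      ((x≢a , x≢b) ∷ []) ((f , _ , adj′) ∷ [-]) = trans (Vecₚ.lookup-zipWith _xor_ e ⁅ f ⁆ 𝟘)
      (cong₂ _xor_ (other e f adj adj′ x≢a x≢b) (lookup-𝟘 e))
    fresh {X} {a} {b} {z} e adj x (y ∷ ℓ) (x≢ ∷ ℓ≢) (step ∷ walk) = trans (Vecₚ.lookup-zipWith _xor_ e ⁅ proj₁ step ⁆ (edges walk))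
      (cong₂ _xor_ first (fresh e adj y ℓ ℓ≢ walk))
      where
      first : lookup ⁅ proj₁ step ⁆ e ≡ false
      first = trans (sym (trans (Vecₚ.lookup-zipWith _xor_ e ⁅ proj₁ step ⁆ 𝟘) (trans (cong (lookup ⁅ proj₁ step ⁆ e xor_) (lookup-𝟘 e)) (Boolₚ.xor-identityʳ _))))
                (fresh e adj x [] (x≢ ∷ []) (step ∷ [-]))

    end-snoc : ∀ x ℓ z → end x (ℓ List.++ z ∷ []) ≡ z
    end-snoc x []      z = refl
    end-snoc x (y ∷ ℓ) z = end-snoc y ℓ z

  -- The edge sum of a closed walk has zero boundary, and it is nonempty: the second edge reaches a
  -- third vertex and so differs from the first, and the later steps avoid the first edge by
  -- `fresh`.
  cycle⇒dependent : ∀ {X} → HasCycle G X → ¬ LinIndep boundary X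
  cycle⇒dependent (x , [] , () , _)
  cycle⇒dependent (x , y ∷ [] , s≤s () , _)
  cycle⇒dependent {X} (x , y ∷ z ∷ ℓ , _ , ((x≢y ∷ x≢z ∷ x≢ℓ) ∷ (y≢z ∷ y≢ℓ) ∷ _) , walk@((e , _ , adj) ∷ (f , f∈ , adj′) ∷ rest)) li =
    li (edges walk) (edges-⊆ walk) (e , true⇒∈ e∈) (trans (edges-boundary walk) (trans (cong (λ t → ⁅ x ⁆ ⊕ ⁅ t ⁆) (end-snoc x (y ∷ z ∷ ℓ) x)) (⊕-self ⁅ x ⁆)))
    where
    avoid : ∀ {z ℓ} → x ≢ z → All (x ≢_) ℓ → y ≢ z → All (y ≢_) ℓ → All (λ t → t ≢ x × t ≢ y) (z ∷ ℓ)
    avoid x≢z []       y≢z []       = (x≢z ∘ sym , y≢z ∘ sym) ∷ []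
    avoid x≢z (p ∷ ps) y≢z (q ∷ qs) = (x≢z ∘ sym , y≢z ∘ sym) ∷ avoid p ps q qs
    e≢f : lookup ⁅ f ⁆ e ≡ false
    e≢f = other e f adj (Sum.swap adj′) (x≢z ∘ sym) (y≢z ∘ sym)
    e∈ : lookup (edges walk) e ≡ true
    e∈ = trans (Vecₚ.lookup-zipWith _xor_ e ⁅ e ⁆ _) (cong₂ _xor_ (∈⇒true (Subₚ.x∈⁅x⁆ e))
      (trans (Vecₚ.lookup-zipWith _xor_ e ⁅ f ⁆ (edges rest)) (cong₂ _xor_ e≢f (fresh e adj z ℓ (avoid x≢z x≢ℓ y≢z y≢ℓ) rest))))

  HasCycle-⊆ : ∀ {X Y} → X ⊆ₛ Y → HasCycle G X → HasCycle G Y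
  HasCycle-⊆ X⊆Y (x , xs , long , uniq , walk) = x , xs , long , uniq , Linked.map (λ (e , e∈ , adj) → e , X⊆Y e∈ , adj) walk

  isCycle? : ∀ Y x xs → Dec (2 ≤ length xs × Unique (x ∷ xs) × Linked (Adj G Y) (x ∷ xs List.++ x ∷ []))
  isCycle? Y x xs = (2 ℕ.≤? length xs) ×-dec (unique? (x ∷ xs) ×-dec Linked.linked? adj? (x ∷ xs List.++ x ∷ []))
    where
    open import Data.List.Relation.Unary.Unique.DecPropositional Finₚ._≟_ using (unique?)
    pair? : (p q : Fin v# × Fin v#) → Dec (p ≡ q)
    pair? = Productₚ.≡-dec Finₚ._≟_ Finₚ._≟_
    adj? : ∀ a b → Dec (Adj G Y a b)
    adj? a b = Finₚ.any? λ e → (e Subₚ.∈? Y) ×-dec (pair? (lookup (ends G) e) (a , b) ⊎-dec pair? (lookup (ends G) e) (b , a))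

  -- Both the boundary map and the coordinates W must have the same zero sums, each containing a listed cycle.
  consistent : Mat e# n → List (Fin v# × List (Fin v#)) → Bool
  consistent W cycles = allB e# λ Y → if isZero Y then true else
    (if isZero (comb W Y) then (if isZero (vsum boundary Y) then ⌊ Any.any? (λ (x , xs) → isCycle? Y x xs) cycles ⌋ else false)
                          else not (isZero (vsum boundary Y)))

  -- The listed cycles serve one direction only: a dependency of W inside X yields a cycle in X. The
  -- other direction goes from a cycle to a zero boundary by `cycle⇒dependent` and from there to W.
  consistent⇒ind : ∀ {n} (W : Mat e# n) (cycles : List (Fin v# × List (Fin v#))) → consistent W cycles ≡ true →
    ∀ Y → Indep (CycleMatroid G) Y ⇔ LinIndep (lookup W) Y
  consistent⇒ind {n} W cycles ok X = mk⇔ to from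
    where
    to : ¬ HasCycle G X → LinIndep (lookup W) X
    from : LinIndep (lookup W) X → ¬ HasCycle G X
    zero-sum : ∀ Y → Y ≢ 𝟘 → comb W Y ≡ 𝟘 → vsum boundary Y ≡ 𝟘 × HasCycle G Y
    zero-sum Y Y≢𝟘 W≡𝟘 with isZero Y in eY | isZero (comb W Y) in eW | isZero (vsum boundary Y) in eB
                           | Any.any? (λ (x , xs) → isCycle? Y x xs) cycles | allB-sound e# ok Y
    ... | true  | _     | _    | _     | _  = contradiction (isZero-sound Y eY) Y≢𝟘
    ... | false | false | _    | _     | _  = contradiction (trans (sym (isZero-𝟘 n)) (trans (cong isZero (sym W≡𝟘)) eW)) λ ()
    ... | false | true  | true | yes c | _  = isZero-sound _ eB , (let (x , xs) , cyc = Any.satisfied c in x , xs , cyc)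
    nonzero : ∀ Y → Y ≢ 𝟘 → vsum boundary Y ≡ 𝟘 → comb W Y ≡ 𝟘
    nonzero Y Y≢𝟘 B≡𝟘 with isZero Y in eY | isZero (comb W Y) in eW | isZero (vsum boundary Y) in eB | allB-sound e# ok Y
    ... | true  | _     | _     | _  = contradiction (isZero-sound Y eY) Y≢𝟘
    ... | false | true  | _     | _  = isZero-sound _ eW
    ... | false | false | false | _  = contradiction (trans (sym (isZero-𝟘 v#)) (trans (cong isZero (sym B≡𝟘)) eB)) λ ()
    to acyclic Y Y⊆X ne eq = acyclic (HasCycle-⊆ {Y} {X} (λ {i} → Y⊆X {i}) (proj₂ (zero-sum Y (Nonempty⇒≢𝟘 ne) (trans (comb-vsum W Y) eq))))
    from li cyc = cycle⇒dependent cyc λ Y Y⊆X ne eq → li Y Y⊆X ne (trans (sym (comb-vsum W Y)) (nonzero Y (Nonempty⇒≢𝟘 ne) eq))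

-- Coordinates of the excluded matroids

pattern O = false
pattern I = true

distinct? : (W : Mat r n) → Dec ((∀ i j → lookup W i ≡ lookup W j → i ≡ j) × (∀ i → lookup W i ≢ 𝟘))
distinct? W = Finₚ.all? (λ i → Finₚ.all? (λ j → Dec.map′ (λ f → f) (λ f → f) ((lookup W i ≟V lookup W j) →-dec (i Finₚ.≟ j))))
              ×-dec Finₚ.all? (λ i → ¬? (lookup W i ≟V 𝟘))

-- A circuit is represented by the unit vectors together with their sum.
std-circuit : ∀ k (ok : 6 ≤ suc k) → Std (circuit (suc k) ok)
std-circuit k ok = record
  { d = k ; W = W ; W-inj = λ {i} {j} → inj-W i j ; W≢𝟘 = W≢ ; ind = ind-W ; basis = suc ; W-basis = λ j → lookup∘tabulate ⁅_⁆ j }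
  where
  W : Mat (suc k) k
  W = full ∷ units k
  unit-inj : ∀ {k} {i j : Fin k} → ⁅ i ⁆ ≡ ⁅ j ⁆ → i ≡ j
  unit-inj {i = i} {j} eq = Subₚ.x∈⁅y⁆⇒x≡y j (subst (i ∈ₛ_) eq (Subₚ.x∈⁅x⁆ i))
  row : ∀ i → lookup (units k) i ≡ ⁅ i ⁆
  row = lookup∘tabulate ⁅_⁆
  full≢ : ∀ j → full ≢ ⁅ j ⁆
  full≢ j eq = ℕₚ.<⇒≢ (ℕₚ.≤-trans (s≤s (s≤s z≤n)) (ℕₚ.≤-pred ok)) (trans (sym (Subₚ.∣⁅x⁆∣≡1 j)) (trans (cong ∣_∣ (sym eq)) (Subₚ.∣⊤∣≡n k)))
  inj-W : ∀ i j → lookup W i ≡ lookup W j → i ≡ j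
  inj-W zero    zero    _  = refl
  inj-W zero    (suc j) eq = contradiction (trans eq (row j)) (full≢ j)
  inj-W (suc i) zero    eq = contradiction (trans (sym eq) (row i)) (full≢ i)
  inj-W (suc i) (suc j) eq = cong suc (unit-inj (trans (sym (row i)) (trans eq (row j))))
  W≢ : ∀ i → lookup W i ≢ 𝟘
  W≢ zero    eq = ℕₚ.<⇒≢ (ℕₚ.≤-trans (s≤s z≤n) (ℕₚ.≤-pred ok)) (trans (sym (Subₚ.∣⊥∣≡0 k)) (trans (cong ∣_∣ (sym eq)) (Subₚ.∣⊤∣≡n k)))
  W≢ (suc i) eq = Nonempty⇒≢𝟘 (i , Subₚ.x∈⁅x⁆ i) (trans (sym (row i)) eq)
  sum-W : ∀ b Y → vsum (lookup W) (b ∷ Y) ≡ b · full ⊕ Y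
  sum-W b Y = cong (b · full ⊕_) (vsum-lookup-units Y)
  ind-W : ∀ X → ∣ X ∣ ≤ k ⇔ LinIndep (lookup W) X
  ind-W X = mk⇔ to from
    where
    to : ∣ X ∣ ≤ k → LinIndep (lookup W) X
    to le (false ∷ Y) Y⊆ ne eq = Nonempty⇒≢𝟘 ne (cong (false ∷_) (trans (sym (⊕-idˡ Y)) (trans (sym (sum-W false Y)) eq)))
    to le (true ∷ Y)  Y⊆ ne eq with refl ← ⊕-≡𝟘 (trans (sym (sum-W true Y)) eq) =
      ℕₚ.<⇒≱ (≤-trans (≤-reflexive (sym (Subₚ.∣⊤∣≡n (suc k)))) (Subₚ.p⊆q⇒∣p∣≤∣q∣ Y⊆)) le
    from : LinIndep (lookup W) X → ∣ X ∣ ≤ k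
    from li = ℕₚ.≮⇒≥ λ lt → li full
      (subst (full ⊆ₛ_) (sym (Subₚ.∣p∣≡n⇒p≡⊤ (ℕₚ.≤-antisym (Subₚ.∣p∣≤n X) lt))) Subₚ.⊆-refl)
      (zero , Vec.here) (trans (sum-W true full) (⊕-self full))

first-rows : (d : ℕ) (M : Mat r d) (j : Fin d) → lookup (units d ++ M) (j ↑ˡ r) ≡ ⁅ j ⁆
first-rows d M j = trans (Vecₚ.lookup-++ˡ (units d) M j) (lookup∘tabulate ⁅_⁆ j)

-- The first four edges of each graph (five for `PUU`) form a spanning tree and receive the unit
-- vectors. Each further edge is the sum of the tree edges on its fundamental cycle; these sums are
-- the extra rows.
extra-c5 : Mat 1 4
extra-c5 = full ∷ []
extra-c5c : Mat 2 4
extra-c5c = full ∷ (I ∷ I ∷ O ∷ O ∷ []) ∷ []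
extra-meet extra-disj : Mat 3 4
extra-meet = full ∷ (I ∷ I ∷ O ∷ O ∷ []) ∷ (I ∷ I ∷ I ∷ O ∷ []) ∷ []
extra-disj = full ∷ (I ∷ I ∷ O ∷ O ∷ []) ∷ (O ∷ I ∷ I ∷ O ∷ []) ∷ []
extra-k23 : Mat 2 4
extra-k23 = (I ∷ I ∷ O ∷ I ∷ []) ∷ (I ∷ O ∷ I ∷ I ∷ []) ∷ []
extra-k23e : Mat 3 4
extra-k23e = (I ∷ I ∷ O ∷ I ∷ []) ∷ (I ∷ O ∷ I ∷ I ∷ []) ∷ (I ∷ O ∷ O ∷ I ∷ []) ∷ []
extra-pUU : Mat 2 5
extra-pUU = full ∷ (I ∷ I ∷ I ∷ O ∷ O ∷ []) ∷ []

private
  decided : {A : Set} (a? : Dec A) → ⌊ a? ⌋ ≡ true → A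
  decided (yes a) _ = a

  pattern v₀ = zero
  pattern v₁ = suc zero
  pattern v₂ = suc (suc zero)
  pattern v₃ = suc (suc (suc zero))
  pattern v₄ = suc (suc (suc (suc zero)))
  pattern v₅ = suc (suc (suc (suc (suc zero))))

-- The cycle lists need not exhaust the even edge sets: in `C5-2chords-meet` the union of the two
-- triangles without a common edge, and in `K23+e` the set of all edges, contain listed triangles.
std : ∀ X → Std X
std (circuit (suc k) ok) = std-circuit k ok
std c5 = record
  { W = units 4 ++ extra-c5 ; W-inj = λ {i} {j} → proj₁ distinct i j ; W≢𝟘 = proj₂ distinct
  ; ind = Cycles.consistent⇒ind C5 (units 4 ++ extra-c5)
      ((v₀ , v₁ ∷ v₂ ∷ v₃ ∷ v₄ ∷ []) ∷ []) refl
  ; basis = _↑ˡ _ ; W-basis = first-rows 4 extra-c5 }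
  where distinct = decided (distinct? (units 4 ++ extra-c5)) refl
std c5c = record
  { W = units 4 ++ extra-c5c ; W-inj = λ {i} {j} → proj₁ distinct i j ; W≢𝟘 = proj₂ distinct
  ; ind = Cycles.consistent⇒ind C5-chord (units 4 ++ extra-c5c)
      ((v₀ , v₁ ∷ v₂ ∷ []) ∷ (v₀ , v₂ ∷ v₃ ∷ v₄ ∷ []) ∷ (v₀ , v₁ ∷ v₂ ∷ v₃ ∷ v₄ ∷ []) ∷ []) refl
  ; basis = _↑ˡ _ ; W-basis = first-rows 4 extra-c5c }
  where distinct = decided (distinct? (units 4 ++ extra-c5c)) refl
std c5cc-meet = record
  { W = units 4 ++ extra-meet ; W-inj = λ {i} {j} → proj₁ distinct i j ; W≢𝟘 = proj₂ distinct
  ; ind = Cycles.consistent⇒ind C5-2chords-meet (units 4 ++ extra-meet)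
      ((v₀ , v₁ ∷ v₂ ∷ []) ∷ (v₀ , v₂ ∷ v₃ ∷ []) ∷ (v₀ , v₃ ∷ v₄ ∷ []) ∷ (v₀ , v₁ ∷ v₂ ∷ v₃ ∷ []) ∷ (v₀ , v₂ ∷ v₃ ∷ v₄ ∷ []) ∷ (v₀ , v₁ ∷ v₂ ∷ v₃ ∷ v₄ ∷ []) ∷ []) refl
  ; basis = _↑ˡ _ ; W-basis = first-rows 4 extra-meet }
  where distinct = decided (distinct? (units 4 ++ extra-meet)) refl
std c5cc-disj = record
  { W = units 4 ++ extra-disj ; W-inj = λ {i} {j} → proj₁ distinct i j ; W≢𝟘 = proj₂ distinct
  ; ind = Cycles.consistent⇒ind C5-2chords-disjoint (units 4 ++ extra-disj)
      ((v₀ , v₁ ∷ v₂ ∷ []) ∷ (v₁ , v₂ ∷ v₃ ∷ []) ∷ (v₀ , v₂ ∷ v₃ ∷ v₄ ∷ []) ∷ (v₀ , v₁ ∷ v₃ ∷ v₄ ∷ []) ∷ (v₀ , v₁ ∷ v₃ ∷ v₂ ∷ []) ∷ (v₀ , v₁ ∷ v₂ ∷ v₃ ∷ v₄ ∷ []) ∷ (v₀ , v₂ ∷ v₁ ∷ v₃ ∷ v₄ ∷ []) ∷ []) refl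
  ; basis = _↑ˡ _ ; W-basis = first-rows 4 extra-disj }
  where distinct = decided (distinct? (units 4 ++ extra-disj)) refl
std k23 = record
  { W = units 4 ++ extra-k23 ; W-inj = λ {i} {j} → proj₁ distinct i j ; W≢𝟘 = proj₂ distinct
  ; ind = Cycles.consistent⇒ind K23 (units 4 ++ extra-k23)
      ((v₀ , v₂ ∷ v₁ ∷ v₃ ∷ []) ∷ (v₀ , v₂ ∷ v₁ ∷ v₄ ∷ []) ∷ (v₀ , v₃ ∷ v₁ ∷ v₄ ∷ []) ∷ []) refl
  ; basis = _↑ˡ _ ; W-basis = first-rows 4 extra-k23 }
  where distinct = decided (distinct? (units 4 ++ extra-k23)) refl
std k23e = record
  { W = units 4 ++ extra-k23e ; W-inj = λ {i} {j} → proj₁ distinct i j ; W≢𝟘 = proj₂ distinct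
  ; ind = Cycles.consistent⇒ind K23+e (units 4 ++ extra-k23e)
      ((v₀ , v₂ ∷ v₁ ∷ []) ∷ (v₀ , v₃ ∷ v₁ ∷ []) ∷ (v₀ , v₄ ∷ v₁ ∷ []) ∷ (v₀ , v₂ ∷ v₁ ∷ v₃ ∷ []) ∷ (v₀ , v₂ ∷ v₁ ∷ v₄ ∷ []) ∷ (v₀ , v₃ ∷ v₁ ∷ v₄ ∷ []) ∷ []) refl
  ; basis = _↑ˡ _ ; W-basis = first-rows 4 extra-k23e }
  where distinct = decided (distinct? (units 4 ++ extra-k23e)) refl
std pUU = record
  { W = units 5 ++ extra-pUU ; W-inj = λ {i} {j} → proj₁ distinct i j ; W≢𝟘 = proj₂ distinct
  ; ind = Cycles.consistent⇒ind PUU (units 5 ++ extra-pUU)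
      ((v₀ , v₁ ∷ v₂ ∷ v₃ ∷ []) ∷ (v₀ , v₃ ∷ v₄ ∷ v₅ ∷ []) ∷ (v₀ , v₁ ∷ v₂ ∷ v₃ ∷ v₄ ∷ v₅ ∷ []) ∷ []) refl
  ; basis = _↑ˡ _ ; W-basis = first-rows 5 extra-pUU }
  where distinct = decided (distinct? (units 5 ++ extra-pUU)) refl

-- Ear decomposition: a connected hyperplane from rank 4 on

Ones Zeros : Subset q → Subset q → Set
Ones  s u = ∀ i → lookup s i ≡ true → lookup u i ≡ true
Zeros s u = ∀ i → lookup s i ≡ true → lookup u i ≡ false

private
  lookup-full : (i : Fin n) → lookup full i ≡ true
  lookup-full i = Vecₚ.lookup-replicate i true

  ext : {u v : V n} → (∀ i → lookup u i ≡ lookup v i) → u ≡ v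
  ext {u = u} {v} eq = trans (sym (tabulate∘lookup u)) (trans (tabulate-cong eq) (tabulate∘lookup v))

  clash : {b : Bool} → b ≡ true → b ≡ false → ⊥
  clash refl ()

  unit-bit : {i j : Fin n} → lookup ⁅ i ⁆ j ≡ true → j ≡ i
  unit-bit {i = i} eq = Subₚ.x∈⁅y⁆⇒x≡y i (true⇒∈ eq)

  unit-self : (i : Fin n) → lookup ⁅ i ⁆ i ≡ true
  unit-self i = ∈⇒true (Subₚ.x∈⁅x⁆ i)

  unit≢𝟘 : (i : Fin n) → ⁅ i ⁆ ≢ 𝟘
  unit≢𝟘 i = Nonempty⇒≢𝟘 (i , Subₚ.x∈⁅x⁆ i)

kill-comb : (π : n ⊸ n) (c : Mat q n) (u : V q) → (∀ i → lookup u i ≡ true → ap π (lookup c i) ≡ 𝟘) → ap π (comb c u) ≡ 𝟘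
kill-comb π []      []          _ = ap-𝟘 π
kill-comb π (v ∷ c) (true ∷ u)  f = trans (add π v (comb c u)) (trans (cong₂ _⊕_ (f zero refl) (kill-comb π c u (f ∘ suc))) (⊕-idˡ 𝟘))
kill-comb π (v ∷ c) (false ∷ u) f = trans (cong (ap π) (⊕-idˡ _)) (kill-comb π c u (f ∘ suc))

-- ε marks the rows in the support of s that π fixes; the remaining rows of the support are killed.
-- Proofs of connectedness aim at ε = 𝟘.
classes : (π : n ⊸ n) (c : Mat q n) (s : V q) → (∀ i → lookup s i ≡ true → Cls π (lookup c i)) →
  ∃[ ε ] (ap π (comb c s) ≡ comb c ε × Ones ε s × (∀ i → lookup s i ≡ true → lookup ε i ≡ false → ap π (lookup c i) ≡ 𝟘))
classes π []      []      _   = [] , ap-𝟘 π , (λ ()) , λ ()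
classes π (v ∷ c) (b ∷ s) cls with ε , e , ε≤s , kill ← classes π c s (cls ∘ suc) = go b (cls zero)
  where
  go : ∀ b → (b ≡ true → Cls π v) → ∃[ ε ] (ap π (b · v ⊕ comb c s) ≡ comb (v ∷ c) ε × Ones ε (b ∷ s) ×
         (∀ i → lookup (b ∷ s) i ≡ true → lookup ε i ≡ false → ap π (lookup (v ∷ c) i) ≡ 𝟘))
  go false _ = false ∷ ε , trans (add π 𝟘 (comb c s)) (cong₂ _⊕_ (ap-𝟘 π) e) ,
    (λ { (suc i) → ε≤s i }) , λ { (suc i) → kill i }
  go true f with f refl
  ... | inj₁ z = false ∷ ε , trans (add π v (comb c s)) (cong₂ _⊕_ z e) ,
    (λ { (suc i) → ε≤s i }) , λ { zero _ _ → z ; (suc i) → kill i }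
  ... | inj₂ g = true ∷ ε , trans (add π v (comb c s)) (cong₂ _⊕_ g e) ,
    (λ { zero _ → refl ; (suc i) → ε≤s i }) , λ { (suc i) → kill i }

select : {A : Set} → Vec A k → (t : Subset k) → Vec A ∣ t ∣
select []      []          = []
select (a ∷ v) (true ∷ t)  = a ∷ select v t
select (a ∷ v) (false ∷ t) = select v t

select-sum : (Z : Mat k n) (t : Subset k) → comb (select Z t) full ≡ comb Z t
select-sum []      []          = refl
select-sum (v ∷ Z) (true ∷ t)  = cong (v ⊕_) (select-sum Z t)
select-sum (v ∷ Z) (false ∷ t) = trans (select-sum Z t) (sym (⊕-idˡ _))

select-all : {P : V n → Set} (Z : Mat k n) (t : Subset k) → (∀ i → P (lookup Z i)) → ∀ i → P (lookup (select Z t) i)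
select-all (v ∷ Z) (true ∷ t)  f zero    = f zero
select-all {P = P} (v ∷ Z) (true ∷ t)  f (suc i) = select-all {P = P} Z t (f ∘ suc) i
select-all {P = P} (v ∷ Z) (false ∷ t) f i       = select-all {P = P} Z t (f ∘ suc) i

co-size : (t : Subset k) → ∣ full ⊕ t ∣ + ∣ t ∣ ≡ k
co-size []          = refl
co-size (true ∷ t)  = trans (ℕₚ.+-suc _ _) (cong suc (co-size t))
co-size (false ∷ t) = cong suc (co-size t)

few : (t : Subset k) → ∣ t ∣ < 2 → t ≡ 𝟘 ⊎ ∃[ i ] t ≡ ⁅ i ⁆
few []          _  = inj₁ refl
few (false ∷ t) lt = Sum.map (cong (false ∷_)) (λ (i , eq) → suc i , cong (false ∷_) eq) (few t lt)
few (true ∷ t)  lt = inj₂ (zero , cong (true ∷_) (Subₚ-empty t (ℕₚ.≤-pred (ℕₚ.≤-pred lt))))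
  where
  Subₚ-empty : ∀ {k} (t : Subset k) → ∣ t ∣ ≤ 0 → t ≡ 𝟘
  Subₚ-empty []          _  = refl
  Subₚ-empty (false ∷ t) le = cong (false ∷_) (Subₚ-empty t le)

minimal : {P : ℕ → Set} → (∀ z → P z → (∀ y → y < z → ¬ P y) → ⊥) → ∀ k → ¬ P k
minimal {P} f = <-rec (λ k → ¬ P k) λ k rec Pk → f k Pk λ y y<k → rec y<k

-- With k independent rows and their sum the circuit has k + 1 elements: for k = 4 it is the matroid
-- of `C5`, beyond that a member of the family `circuit`.
circuit-pat : {T : Colouring n} (B : Mat k n) → Inj B → 4 ≤ k → (∀ i → T (lookup B i) ≡ true) → T (comb B full) ≡ true →
  (∀ x → x ≢ 𝟘 → T (comb B x) ≡ true → (∃[ i ] ⁅ i ⁆ ≡ x) ⊎ full ≡ x) → Pat T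
circuit-pat {k = suc (suc (suc (suc zero)))} {T} B Bi _ gr sum-gr only = pat-std (std c5) B Bi
  (λ { zero → g zero ; (suc zero) → g (suc zero) ; (suc (suc zero)) → g (suc (suc zero)) ; (suc (suc (suc zero))) → g (suc (suc (suc zero)))
     ; (suc (suc (suc (suc zero)))) → sum-gr })
  λ x x≢ Tx → [ (λ (i , e) → i ↑ˡ 1 , trans (first-rows 4 extra-c5 i) e) , (λ e → suc (suc (suc (suc zero))) , e) ]′ (only x x≢ Tx)
  where
  g : ∀ i → T (comb B ⁅ i ⁆) ≡ true
  g i = trans (cong T (comb-unit B i)) (gr i)
circuit-pat {k = suc (suc (suc (suc (suc k))))} {T} B Bi _ gr sum-gr only =
  pat-std (std-circuit (5 + k) (s≤s (s≤s (s≤s (s≤s (s≤s (s≤s z≤n))))))) B Bi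
  (λ { zero → sum-gr ; (suc i) → trans (cong (T ∘ comb B) (lookup∘tabulate ⁅_⁆ i)) (trans (cong T (comb-unit B i)) (gr i)) })
  λ x x≢ Tx → [ (λ (i , e) → suc i , trans (lookup∘tabulate ⁅_⁆ i) e) , (λ e → zero , e) ]′ (only x x≢ Tx)
circuit-pat {k = suc (suc (suc zero))} B Bi (s≤s (s≤s (s≤s ())))
circuit-pat {k = suc (suc zero)}       B Bi (s≤s (s≤s ()))
circuit-pat {k = suc zero}             B Bi (s≤s ())

private
  full-++ : ∀ z {k} → full {z} ++ full {k} ≡ full {z + k}
  full-++ zero    = refl
  full-++ (suc z) = cong (true ∷_) (full-++ z)

  unit-++ˡ : ∀ {z k} (i : Fin z) → ⁅ i ↑ˡ k ⁆ ≡ ⁅ i ⁆ ++ 𝟘 {k}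
  unit-++ˡ {suc z} {k} zero = cong (true ∷_) (sym (++-𝟘 {l = k} z))
  unit-++ˡ (suc i) = cong (false ∷_) (unit-++ˡ i)

  unit-++ʳ : ∀ z {k} (i : Fin k) → ⁅ z ↑ʳ i ⁆ ≡ 𝟘 {z} ++ ⁅ i ⁆
  unit-++ʳ zero    i = refl
  unit-++ʳ (suc z) i = cong (false ∷_) (unit-++ʳ z i)

  unit-row : ∀ {d r} (M : Mat r d) (i : Fin d) {x : V d} → ⁅ i ⁆ ≡ x → lookup (units d ++ M) (i ↑ˡ r) ≡ x
  unit-row {d} M i e = trans (first-rows d M i) e

-- All rows and their sum form a circuit, and the sum of Z is a chord of it. The chord makes one
-- circuit with Z and another with c and the total sum: a triangle and a 4-circuit if z = 2, which
-- is `C5-chord`, two 4-circuits if z = 3, which is `PUU`.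
chord-pat : {T : Colouring n} {z q : ℕ} (Z : Mat z n) (c : Mat (suc (suc q)) n) → z ≡ 2 ⊎ z ≡ 3 → q ≡ 0 → Inj (Z ++ c) →
  (∀ i → T (lookup (Z ++ c) i) ≡ true) → T (comb (Z ++ c) full) ≡ true → T (comb (Z ++ c) (full {z} ++ 𝟘)) ≡ true →
  ((J : V z) (s : V (suc (suc q))) → J ++ s ≢ 𝟘 → T (comb (Z ++ c) (J ++ s)) ≡ true →
    (∃[ i ] (⁅ i ⁆ ≡ J × s ≡ 𝟘)) ⊎ (∃[ i ] (J ≡ 𝟘 × ⁅ i ⁆ ≡ s)) ⊎ (J ≡ full × s ≡ full) ⊎ (J ≡ full × s ≡ 𝟘 × ⊤)) → Pat T
chord-pat {T = T} Z c (inj₁ refl) refl Zi rows sum-gr chord-gr only = pat-std (std c5c) (Z ++ c) Zi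
  (λ { zero → g zero ; (suc zero) → g (suc zero) ; (suc (suc zero)) → g (suc (suc zero)) ; (suc (suc (suc zero))) → g (suc (suc (suc zero)))
     ; (suc (suc (suc (suc zero)))) → sum-gr ; (suc (suc (suc (suc (suc zero))))) → chord-gr })
  closed
  where
  closed : (x : V 4) → x ≢ 𝟘 → T (comb (Z ++ c) x) ≡ true → ∃[ i ] lookup (Std.W (std c5c)) i ≡ x
  g : ∀ i → T (comb (Z ++ c) ⁅ i ⁆) ≡ true
  g i = trans (cong T (comb-unit (Z ++ c) i)) (rows i)
  cl : (J s : V 2) → (∃[ i ] (⁅ i ⁆ ≡ J × s ≡ 𝟘)) ⊎ (∃[ i ] (J ≡ 𝟘 × ⁅ i ⁆ ≡ s)) ⊎ (J ≡ full × s ≡ full) ⊎ (J ≡ full × s ≡ 𝟘 × ⊤) → ∃[ i ] lookup (Std.W (std c5c)) i ≡ J ++ s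
  cl J s (inj₁ (i , refl , refl)) = (i ↑ˡ 2) ↑ˡ 2 , unit-row {4} extra-c5c (i ↑ˡ 2) (unit-++ˡ i)
  cl J s (inj₂ (inj₁ (i , refl , refl))) = (2 ↑ʳ i) ↑ˡ 2 , unit-row {4} extra-c5c (2 ↑ʳ i) (unit-++ʳ 2 i)
  cl J s (inj₂ (inj₂ (inj₁ (refl , refl)))) = suc (suc (suc (suc zero))) , refl
  cl J s (inj₂ (inj₂ (inj₂ (refl , refl , _)))) = suc (suc (suc (suc (suc zero)))) , refl
  closed (a ∷ b ∷ s) x≢ Tx = cl (a ∷ b ∷ []) s (only (a ∷ b ∷ []) s x≢ Tx)
chord-pat {T = T} Z c (inj₂ refl) refl Zi rows sum-gr chord-gr only = pat-std (std pUU) (Z ++ c) Zi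
  (λ { zero → g zero ; (suc zero) → g (suc zero) ; (suc (suc zero)) → g (suc (suc zero)) ; (suc (suc (suc zero))) → g (suc (suc (suc zero)))
     ; (suc (suc (suc (suc zero)))) → g (suc (suc (suc (suc zero))))
     ; (suc (suc (suc (suc (suc zero))))) → sum-gr ; (suc (suc (suc (suc (suc (suc zero)))))) → chord-gr })
  closed
  where
  closed : (x : V 5) → x ≢ 𝟘 → T (comb (Z ++ c) x) ≡ true → ∃[ i ] lookup (Std.W (std pUU)) i ≡ x
  g : ∀ i → T (comb (Z ++ c) ⁅ i ⁆) ≡ true
  g i = trans (cong T (comb-unit (Z ++ c) i)) (rows i)
  cl : (J : V 3) (s : V 2) → (∃[ i ] (⁅ i ⁆ ≡ J × s ≡ 𝟘)) ⊎ (∃[ i ] (J ≡ 𝟘 × ⁅ i ⁆ ≡ s)) ⊎ (J ≡ full × s ≡ full) ⊎ (J ≡ full × s ≡ 𝟘 × ⊤) → ∃[ i ] lookup (Std.W (std pUU)) i ≡ J ++ s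
  cl J s (inj₁ (i , refl , refl)) = (i ↑ˡ 2) ↑ˡ 2 , unit-row {5} extra-pUU (i ↑ˡ 2) (unit-++ˡ i)
  cl J s (inj₂ (inj₁ (i , refl , refl))) = (3 ↑ʳ i) ↑ˡ 2 , unit-row {5} extra-pUU (3 ↑ʳ i) (unit-++ʳ 3 i)
  cl J s (inj₂ (inj₂ (inj₁ (refl , refl)))) = suc (suc (suc (suc (suc zero)))) , refl
  cl J s (inj₂ (inj₂ (inj₂ (refl , refl , _)))) = suc (suc (suc (suc (suc (suc zero))))) , refl
  closed (a ∷ b ∷ d ∷ s) x≢ Tx = cl (a ∷ b ∷ d ∷ []) s (only (a ∷ b ∷ d ∷ []) s x≢ Tx)

record Hyper {n} (T : Colouring n) : Set where
  field
    {rk} : ℕ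
    φ    : Mat rk n
    z    : V n
    φz   : Coord (z ∷ []) φ
    z∈T  : T z ≡ true
    conn : Conn T (_∈im φ)

-- Let F be a maximal proper connected subspace and extend it by green vectors c to the whole space.
-- A green vector with nonzero parts in both F and ⟨c⟩ closes a circuit over F; by maximality it involves all of c.
-- If c has at least two rows, maximality leaves no further green vectors outside F.
module Ear {n r q} {T : Colouring n} (noPat : ¬ Pat T) (4≤n : 4 ≤ n) (connV : Conn T Whole)
  {c : Mat (suc (suc q)) n} {φ : Mat r n} (X : Coord c φ) (φ-nonzero : ∃[ y ] (y ≢ 𝟘 {r}))
  (c-green : ∀ i → T (lookup c i) ≡ true) where
  open Coord X

  F : V n → Set
  F v = ap α v ≡ 𝟘

  module _ (connF : Conn T F)
    (maximal : (P : V (suc (suc q)) → Set) → (∀ s → Dec (P s)) → P 𝟘 → (∀ s t → P s → P t → P (s ⊕ t)) →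
       Conn T (P ∘ ap α) → ∀ s → P s → s ≢ 𝟘 → ∀ t → P t) where

    private
      αc : ∀ i → ap α (lookup c i) ≡ ⁅ i ⁆
      αc i = trans (cong (ap α) (sym (comb-unit c i))) (α-c ⁅ i ⁆)

      Fφ : ∀ y → F (comb φ y)
      Fφ = α-φ

    -- The vector v, its rows c i with i in the support s of α v, and its part in F form a circuit
    -- over F, so F together with these rows is connected. Maximality makes the support everything.
    ear : ∀ v → T v ≡ true → ap α v ≢ 𝟘 → ap β v ≢ 𝟘 → ap α v ≡ full
    ear v Tv s≢ y≢ = ext λ i → trans (all-s full i (lookup-full i)) (sym (lookup-full i))
      where
      s = ap α v
      P : V (suc (suc q)) → Set
      P u = Ones u s
      P-conn : Conn T (P ∘ ap α)
      P-conn = conn-extend connF (λ u Fu i t → contradiction (trans (sym (cong (λ a → lookup a i) Fu)) t) (λ e → clash e (lookup-𝟘 i))) kill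
        where
        kill : ∀ π → Resp T (P ∘ ap α) π → (∀ u → F u → ap π u ≡ 𝟘) → ∀ u → P (ap α u) → ap π u ≡ 𝟘
        kill π resp kF u Pu with classes π c s (λ i si → resp _ (λ j t → subst (λ a → lookup s a ≡ true) (sym (unit-bit (trans (cong (λ a → lookup a j) (sym (αc i))) t))) si) (c-green i))
        ... | ε , e , ε≤s , killc = trans (cong (ap π) (sym (expand u))) (trans (add π _ _)
            (trans (cong₂ _⊕_ (kill-comb π c (ap α u) λ i ui → killc i (Pu i ui) (trans (cong (λ a → lookup a i) ε≡𝟘) (lookup-𝟘 i))) (kF _ (Fφ _))) (⊕-idˡ 𝟘)))
          where
          πv : ap π v ≡ comb c ε
          πv = trans (cong (ap π) (sym (expand v))) (trans (add π _ _) (trans (cong₂ _⊕_ e (kF _ (Fφ _))) (⊕-idʳ _)))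
          -- Once F is killed, π v has no component in F, whereas v has one; so v is not fixed, is
          -- therefore killed, and no row in the support is fixed.
          ε≡𝟘 : ε ≡ 𝟘
          ε≡𝟘 with resp v (λ i t → t) Tv
          ... | inj₁ z = proj₁ (unique ε 𝟘 (trans (cong₂ _⊕_ (trans (sym πv) z) (comb-𝟘 φ)) (⊕-idˡ 𝟘)))
          ... | inj₂ f = contradiction (sym (proj₂ (unique₂ (trans (cong (comb c ε ⊕_) (comb-𝟘 φ)) (trans (⊕-idʳ _) (trans (sym πv) (trans f (sym (expand v))))))))) y≢
      all-s : ∀ t → Ones t s
      all-s = maximal P (λ u → Finₚ.all? λ i → (lookup u i Bool.≟ true) →-dec (lookup s i Bool.≟ true))
        (λ i t → contradiction (lookup-𝟘 i) (clash t))
        (λ u u′ Pu Pu′ i t → Sum.[ Pu i , Pu′ i ] (xor-true _ _ (trans (sym (bit-xor u u′ i)) t)))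
        P-conn s (λ i t → t) s≢
        where
        xor-true : ∀ a b → a xor b ≡ true → a ≡ true ⊎ b ≡ true
        xor-true true  b _  = inj₁ refl
        xor-true false b eq = inj₂ eq

    -- Two such vectors with different parts in F would make F ⊕ ⟨v⟩ connected by `conn-two`, and
    -- this is proper because c has at least two rows.
    apex-unique : ∀ v w → T v ≡ true → T w ≡ true → ap α v ≡ full → ap α w ≡ full → ap β v ≡ ap β w
    apex-unique v w Tv Tw αv αw = decidable-stable (ap β v ≟V ap β w) λ β≢ → second-unit
      (maximal P (λ s → (s ≟V 𝟘) ⊎-dec (s ≟V full)) (inj₁ refl) closed
        (conn-two {u = v} {w} connF (λ _ → inj₁) (inj₂ αv) (inj₂ αw) Tv Tw (λ { refl → β≢ refl })
          (trans (add α v w) (trans (cong₂ _⊕_ αv αw) (⊕-self full)))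
          λ u → [ inj₁ , (λ e → inj₂ (trans (add α u v) (trans (cong₂ _⊕_ e αv) (⊕-self full)))) ]′)
        full (inj₂ refl) (λ ()) ⁅ zero ⁆)
      where
      P : V (suc (suc q)) → Set
      P s = s ≡ 𝟘 ⊎ s ≡ full
      closed : ∀ s t → P s → P t → P (s ⊕ t)
      closed s t (inj₁ refl) Pt          = subst P (sym (⊕-idˡ t)) Pt
      closed s t (inj₂ refl) (inj₁ refl) = inj₂ (⊕-idʳ full)
      closed s t (inj₂ refl) (inj₂ refl) = inj₁ (⊕-self full)
      second-unit : ¬ P ⁅ zero ⁆
      second-unit (inj₁ ())
      second-unit (inj₂ ())

    module Apex (v₀ : V n) (Tv₀ : T v₀ ≡ true) (αv₀ : ap α v₀ ≡ full) (x≢𝟘 : ap β v₀ ≢ 𝟘) where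
      private
        x = ap β v₀
        X₀ = comb φ x
        v₀≡ : v₀ ≡ comb c full ⊕ X₀
        v₀≡ = trans (sym (expand v₀)) (cong (λ s → comb c s ⊕ X₀) αv₀)

      -- The apex `v₀` still closes a circuit over F when the rows in the support of w are replaced
      -- by w. So F together with all combinations whose coefficients are constant on that support
      -- is connected; by maximality the support is a single index.
      flat : ∀ w → T w ≡ true → ap α w ≢ 𝟘 → ap β w ≡ 𝟘 → ∃[ i ] ap α w ≡ ⁅ i ⁆
      flat w Tw s≢ βw = let i , si = ≢𝟘-bit s s≢ in i , ext λ j → sym (from-P i si (P-all ⁅ i ⁆) j)
        where
        s = ap α w
        P : V (suc (suc q)) → Set
        P u = Zeros s u ⊎ Ones s u
        closed : ∀ u u′ → P u → P u′ → P (u ⊕ u′)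
        closed u u′ (inj₁ a) (inj₁ b) = inj₁ λ i t → trans (bit-xor u u′ i) (cong₂ _xor_ (a i t) (b i t))
        closed u u′ (inj₁ a) (inj₂ b) = inj₂ λ i t → trans (bit-xor u u′ i) (cong₂ _xor_ (a i t) (b i t))
        closed u u′ (inj₂ a) (inj₁ b) = inj₂ λ i t → trans (bit-xor u u′ i) (cong₂ _xor_ (a i t) (b i t))
        closed u u′ (inj₂ a) (inj₂ b) = inj₁ λ i t → trans (bit-xor u u′ i) (cong₂ _xor_ (a i t) (b i t))
        s⊕full : ∀ i → lookup (full ⊕ s) i ≡ true → lookup s i ≡ false
        s⊕full i t with lookup s i | trans (sym (trans (bit-xor full s i) (cong (_xor lookup s i) (lookup-full i)))) t
        ... | false | _ = refl
        ... | true  | ()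
        not-s : ∀ i → lookup s i ≡ false → lookup (full ⊕ s) i ≡ true
        not-s i e = trans (bit-xor full s i) (cong₂ _xor_ (lookup-full i) e)
        w≡ : w ≡ comb c s
        w≡ = trans (sym (expand w)) (trans (cong (λ y → comb c s ⊕ comb φ y) βw) (trans (cong (comb c s ⊕_) (comb-𝟘 φ)) (⊕-idʳ _)))
        P-conn : Conn T (P ∘ ap α)
        P-conn = conn-extend connF (λ u Fu → inj₁ λ i _ → trans (cong (λ a → lookup a i) Fu) (lookup-𝟘 i)) kill
          where
          kill : ∀ π → Resp T (P ∘ ap α) π → (∀ u → F u → ap π u ≡ 𝟘) → ∀ u → P (ap α u) → ap π u ≡ 𝟘
          kill π resp kF u Pu with classes π c (full ⊕ s) (λ i t → resp _ (inj₁ λ j sj → [ (λ e → ⊥-elim (clash sj (subst (λ a → lookup s a ≡ false)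
                                      (sym (unit-bit (trans (cong (λ a → lookup a j) (sym (αc i))) e))) (s⊕full i t)))) , id ]′ (true-or-false _)) (c-green i))
          ... | ε , e , ε≤ , killc = trans (cong (ap π) (sym (expand u))) (trans (add π _ _) (trans (cong₂ _⊕_ (kc Pu) (kF _ (Fφ _))) (⊕-idˡ 𝟘)))
            where
            δ : Σ Bool λ b → ap π w ≡ comb c (b · s)
            δ with resp w (inj₂ λ i t → t) Tw
            ... | inj₁ z = false , trans z (sym (comb-𝟘 c))
            ... | inj₂ f = true , trans f w≡
            b = proj₁ δ
            πv₀ : ap π v₀ ≡ comb c (b · s ⊕ ε)
            πv₀ = begin
              ap π v₀                                              ≡⟨ cong (ap π) v₀≡ ⟩
              ap π (comb c full ⊕ X₀)                              ≡⟨ add π _ _ ⟩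
              ap π (comb c full) ⊕ ap π X₀                         ≡⟨ cong₂ _⊕_ (cong (ap π ∘ comb c) (xor-solve (full ∷ s ∷ []) x₀ (x₁ :+ (x₀ :+ x₁)) refl)) (kF _ (Fφ _)) ⟩
              ap π (comb c (s ⊕ (full ⊕ s))) ⊕ 𝟘                   ≡⟨ ⊕-idʳ _ ⟩
              ap π (comb c (s ⊕ (full ⊕ s)))                       ≡⟨ cong (ap π) (comb-⊕ c s (full ⊕ s)) ⟩
              ap π (comb c s ⊕ comb c (full ⊕ s))                  ≡⟨ add π _ _ ⟩
              ap π (comb c s) ⊕ ap π (comb c (full ⊕ s))           ≡⟨ cong₂ _⊕_ (trans (cong (ap π) (sym w≡)) (proj₂ δ)) e ⟩
              comb c (b · s) ⊕ comb c ε                            ≡⟨ comb-⊕ c (b · s) ε ⟨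
              comb c (b · s ⊕ ε)                                   ∎
              where open ≡-Reasoning
            bs⊕ε : b · s ⊕ ε ≡ 𝟘
            bs⊕ε with resp v₀ (inj₂ λ i _ → trans (cong (λ a → lookup a i) αv₀) (lookup-full i)) Tv₀
            ... | inj₁ z = proj₁ (unique (b · s ⊕ ε) 𝟘 (trans (cong₂ _⊕_ (trans (sym πv₀) z) (comb-𝟘 φ)) (⊕-idˡ 𝟘)))
            ... | inj₂ f = contradiction (sym (proj₂ (unique₂ (trans (cong (comb c (b · s ⊕ ε) ⊕_) (comb-𝟘 φ)) (trans (⊕-idʳ _) (trans (sym πv₀) (trans f (sym (expand v₀))))))))) x≢𝟘
            both : ∀ b → b · s ⊕ ε ≡ 𝟘 → b · s ≡ 𝟘 × ε ≡ 𝟘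
            both false e = refl , trans (sym (⊕-idˡ ε)) e
            both true  e = let i , si = ≢𝟘-bit s s≢ in
              ⊥-elim (clash si (s⊕full i (ε≤ i (trans (cong (λ a → lookup a i) (sym (⊕-≡𝟘 e))) si))))
            kill-off : ∀ u → Zeros s u → ap π (comb c u) ≡ 𝟘
            kill-off u off = kill-comb π c u λ i ui → killc i (not-s i ([ (λ t → ⊥-elim (clash ui (off i t))) , id ]′ (true-or-false _)))
              (trans (cong (λ a → lookup a i) (proj₂ (both b bs⊕ε))) (lookup-𝟘 i))
            kc : P (ap α u) → ap π (comb c (ap α u)) ≡ 𝟘
            kc (inj₁ off) = kill-off (ap α u) off
            kc (inj₂ on)  = trans (cong (ap π ∘ comb c) (xor-solve (s ∷ ap α u ∷ []) x₁ (x₀ :+ (x₀ :+ x₁)) refl))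
              (trans (cong (ap π) (comb-⊕ c s (s ⊕ ap α u))) (trans (add π _ _) (trans (cong₂ _⊕_
                (trans (cong (ap π) (sym w≡)) (trans (proj₂ δ) (trans (cong (comb c) (proj₁ (both b bs⊕ε))) (comb-𝟘 c))))
                (kill-off (s ⊕ ap α u) λ i t → trans (bit-xor s (ap α u) i) (cong₂ _xor_ t (on i t)))) (⊕-idˡ 𝟘))))
        P-all : ∀ t → P t
        P-all = maximal P (λ u → Finₚ.all? (λ i → (lookup s i Bool.≟ true) →-dec (lookup u i Bool.≟ false))
                         ⊎-dec Finₚ.all? (λ i → (lookup s i Bool.≟ true) →-dec (lookup u i Bool.≟ true)))
          (inj₁ λ i _ → lookup-𝟘 i) closed P-conn s (inj₂ λ i t → t) s≢
        from-P : ∀ i → lookup s i ≡ true → P ⁅ i ⁆ → ∀ j → lookup ⁅ i ⁆ j ≡ lookup s j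
        from-P i si (inj₁ off) j = ⊥-elim (clash (unit-self i) (off i si))
        from-P i si (inj₂ on)  j with true-or-false (lookup s j)
        ... | inj₁ sj = trans (on j sj) (sym sj)
        ... | inj₂ sj = trans ([ (λ t → ⊥-elim (clash (subst (λ a → lookup s a ≡ true) (sym (unit-bit t)) si) sj)) , id ]′ (true-or-false _)) (sym sj)

      -- Outside F there remain only the rows of c and `v₀`. Together with `X₀`, the part of `v₀` in
      -- F, they form a circuit; whether `X₀` is green decides what happens next.
      greens : ∀ v → T v ≡ true → F v ⊎ (∃[ i ] (ap α v ≡ ⁅ i ⁆ × ap β v ≡ 𝟘)) ⊎ (ap α v ≡ full × ap β v ≡ x)
      greens v Tv with ap α v ≟V 𝟘 | ap β v ≟V 𝟘
      ... | yes e | _      = inj₁ e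
      ... | no s≢ | yes βv = let i , e = flat v Tv s≢ βv in inj₂ (inj₁ (i , e , βv))
      ... | no s≢ | no y≢  = let e = ear v Tv s≢ y≢ in inj₂ (inj₂ (e , apex-unique v v₀ Tv Tv₀ e αv₀))

      X₀≢𝟘 : X₀ ≢ 𝟘
      X₀≢𝟘 e = x≢𝟘 (trans (sym (β-φ x)) (trans (cong (ap β) e) (ap-𝟘 β)))

      F-β : ∀ {u} → F u → comb φ (ap β u) ≡ u
      F-β {u} Fu = trans (sym (trans (cong (λ s → comb c s ⊕ comb φ (ap β u)) Fu) (trans (cong (_⊕ _) (comb-𝟘 c)) (⊕-idˡ _)))) (expand u)

      greens-at : ∀ {f s} → F f → T (f ⊕ comb c s) ≡ true →
        (s ≡ 𝟘 × T f ≡ true) ⊎ (∃[ i ] (s ≡ ⁅ i ⁆ × f ≡ 𝟘)) ⊎ (s ≡ full × f ≡ X₀)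
      greens-at {f} {s} Ff Tv = Sum.map
        (λ e → let s≡ = trans (sym αs) e in s≡ , trans (cong T (sym (trans (cong (λ t → f ⊕ comb c t) s≡) (trans (cong (f ⊕_) (comb-𝟘 c)) (⊕-idʳ f))))) Tv)
        (Sum.map (λ (i , e , βe) → i , trans (sym αs) e , trans (sym (F-β Ff)) (trans (cong (comb φ) (trans (sym βf) βe)) (comb-𝟘 φ)))
                 (λ (e , βe) → trans (sym αs) e , trans (sym (F-β Ff)) (cong (comb φ) (trans (sym βf) βe))))
        (greens (f ⊕ comb c s) Tv)
        where
        αs : ap α (f ⊕ comb c s) ≡ s
        αs = trans (add α f _) (trans (cong₂ _⊕_ Ff (α-c s)) (⊕-idˡ s))
        βf : ap β (f ⊕ comb c s) ≡ ap β f
        βf = trans (add β f _) (trans (cong (ap β f ⊕_) (β-c s)) (⊕-idʳ _))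

      apex-green : T (X₀ ⊕ comb c full) ≡ true
      apex-green = trans (cong T (trans (⊕-comm X₀ (comb c full)) (sym v₀≡))) Tv₀

      -- Candidates for expressing `X₀` by other green vectors of F, so as to complete the rows of c
      -- and `v₀` to an excluded circuit inside the green vectors.
      Term : V n → Set
      Term v = F v × T v ≡ true × v ≢ X₀

      Rep : ℕ → Set
      Rep k = Σ (Mat k n) λ Z → (∀ i → Term (lookup Z i)) × comb Z full ≡ X₀

      Term? : ∀ v → Dec (Term v)
      Term? v = (ap α v ≟V 𝟘) ×-dec ((T v Bool.≟ true) ×-dec ¬? (v ≟V X₀))

      terms : Completion [] Term Term
      terms = complete-dec [] (mkInj λ { [] _ → refl }) Term?

      -- If `X₀` is outside the span of the terms, a functional is 1 at `X₀` and 0 on all terms;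
      -- multiplied by w it gives a test map for the connectedness of F.
      no-rep : ¬ (∃[ k ] Rep k) → (w : V n) → Σ (n ⊸ n) λ π →
        ap π X₀ ≡ w × (∀ v → Term v → ap π v ≡ 𝟘) × (∀ v → ∃[ b ] ap π v ≡ b · w)
      no-rep none w = (record { ap = λ v → h v · w ; add = λ u v → trans (cong (_· w) (h-add u v)) (·-distrib (h u) (h v) w) })
          , cong (_· w) hX , (λ v Tv → cong (_· w) (hZ v (Z-sp v Tv))) , λ v → h v , refl
        where
        Z = proj₁ (proj₂ terms)
        Z-term = proj₁ (proj₂ (proj₂ terms))
        Z-sp : ∀ v → Term v → v ∈im Z
        Z-sp v Tv with s , [] , eq ← ∈im-++ Z [] (proj₂ (proj₂ (proj₂ (proj₂ terms))) v Tv) = s , trans (sym (⊕-idʳ _)) eq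
        Z-inj : Inj Z
        Z-inj = mkInj λ s eq → proj₁ (Inj-split Z [] (proj₁ (proj₂ (proj₂ (proj₂ terms)))) s [] (trans (⊕-idʳ _) eq))
        X∉ : ¬ X₀ ∈im Z
        X∉ (t , eq) = none (∣ t ∣ , select Z t , select-all {P = Term} Z t Z-term , trans (select-sum Z t) eq)
        fr = frame (X₀ ∷ Z) (Inj-∷ Z-inj X∉)
        module C′ = Coord (proj₂ (proj₂ fr))
        h : V n → Bool
        h v = Vec.head (ap C′.β v)
        head-⊕ : ∀ {k} (u v : V (suc k)) → Vec.head (u ⊕ v) ≡ Vec.head u xor Vec.head v
        head-⊕ (a ∷ u) (b ∷ v) = refl
        h-add : ∀ u v → h (u ⊕ v) ≡ h u xor h v
        h-add u v = trans (cong Vec.head (add C′.β u v)) (head-⊕ (ap C′.β u) (ap C′.β v))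
        hX : h X₀ ≡ true
        hX = trans (cong h (sym (comb-unit (X₀ ∷ Z) zero))) (cong Vec.head (C′.β-φ ⁅ zero ⁆))
        hZ : ∀ v → v ∈im Z → h v ≡ false
        hZ v (t , refl) = trans (cong h (sym (⊕-idˡ _))) (cong Vec.head (C′.β-φ (false ∷ t)))

      -- `X₀`, the at least three rows of c and `v₀` form a circuit of at least five elements, and
      -- `greens` leaves no other green vector in its span.
      big-circuit : T X₀ ≡ true → 2 ≤ q + 1 → ⊥
      big-circuit TX 2≤ = noPat (circuit-pat (X₀ ∷ c) inj (s≤s (≤-trans (s≤s 2≤) (≤-reflexive (cong suc (ℕₚ.+-comm q 1)))))
          (λ { zero → TX ; (suc i) → c-green i }) apex-green only)
        where
        FX : ∀ b → F (b · X₀)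
        FX true  = Fφ x
        FX false = ap-𝟘 α
        scalar : ∀ b → b · X₀ ≡ 𝟘 → b ≡ false
        scalar false _ = refl
        scalar true  e = contradiction e X₀≢𝟘
        inj : Inj (X₀ ∷ c)
        inj = mkInj λ { (b ∷ s) eq →
          let s≡ : s ≡ 𝟘
              s≡ = trans (sym (trans (add α (b · X₀) (comb c s)) (trans (cong₂ _⊕_ (FX b) (α-c s)) (⊕-idˡ s)))) (trans (cong (ap α) eq) (ap-𝟘 α))
          in cong₂ _∷_ (scalar b (trans (sym (trans (cong (λ t → b · X₀ ⊕ comb c t) s≡) (trans (cong (b · X₀ ⊕_) (comb-𝟘 c)) (⊕-idʳ _)))) eq)) s≡ }
        only : ∀ y → y ≢ 𝟘 → T (comb (X₀ ∷ c) y) ≡ true → (∃[ i ] ⁅ i ⁆ ≡ y) ⊎ full ≡ y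
        only (b ∷ s) y≢ Ty with greens-at (FX b) Ty
        only (true ∷ s)  y≢ Ty | inj₁ (refl , _) = inj₁ (zero , refl)
        only (false ∷ s) y≢ Ty | inj₁ (refl , _) = contradiction refl y≢
        ... | inj₂ (inj₁ (i , refl , e)) = inj₁ (suc i , cong (_∷ ⁅ i ⁆) (sym (scalar b e)))
        only (true ∷ s)  y≢ Ty | inj₂ (inj₂ (refl , _)) = inj₂ refl
        only (false ∷ s) y≢ Ty | inj₂ (inj₂ (refl , e)) = contradiction (sym e) X₀≢𝟘

      module Minimal (z : ℕ) (rep : Rep z) (least : ∀ y → y < z → ¬ Rep y) where
        private
          Z = proj₁ rep
          Zt = proj₁ (proj₂ rep)
          Zsum = proj₂ (proj₂ rep)

          shorter : ∀ J → comb Z J ≡ X₀ → ¬ (∣ J ∣ < z)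
          shorter J e lt = least ∣ J ∣ lt (select Z J , select-all {P = Term} Z J Zt , trans (select-sum Z J) e)

          co-sum : ∀ J → comb Z (full ⊕ J) ≡ X₀ ⊕ comb Z J
          co-sum J = trans (comb-⊕ Z full J) (cong (_⊕ comb Z J) Zsum)

          |J|>0 : ∀ {k} (J : Subset k) → J ≢ 𝟘 → 0 < ∣ J ∣
          |J|>0 []          J≢ = contradiction refl J≢
          |J|>0 (true ∷ J)  J≢ = s≤s z≤n
          |J|>0 (false ∷ J) J≢ = |J|>0 J λ e → J≢ (cong (false ∷_) e)

          -- A vanishing subsum could be dropped from the representation, which is shortest.
          Z-inj : Inj Z
          Z-inj = mkInj λ J e → decidable-stable (J ≟V 𝟘) λ J≢ → shorter (full ⊕ J) (trans (co-sum J) (trans (cong (X₀ ⊕_) e) (⊕-idʳ X₀)))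
            (≤-trans (≤-reflexive (ℕₚ.+-comm 1 _)) (≤-trans (ℕₚ.+-monoʳ-≤ ∣ full ⊕ J ∣ (|J|>0 J J≢)) (≤-reflexive (co-size J))))

          Z-X : ∀ J → comb Z J ≡ X₀ → J ≡ full
          Z-X J e = sym (⊕-≡𝟘 (ker Z-inj (full ⊕ J) (trans (co-sum J) (trans (cong (X₀ ⊕_) e) (⊕-self X₀)))))

          FZ : ∀ J → F (comb Z J)
          FZ J = trans (ap-comb α Z J) (zero-rows (map (ap α) Z) (λ i → trans (lookup-map i (ap α) Z) (proj₁ (Zt i))) J)
            where
            zero-rows : ∀ {k m} (M : Mat k m) → (∀ i → lookup M i ≡ 𝟘) → ∀ J → comb M J ≡ 𝟘
            zero-rows []      _ []          = refl
            zero-rows (v ∷ M) f (true ∷ J)  = trans (cong₂ _⊕_ (f zero) (zero-rows M (f ∘ suc) J)) (⊕-idˡ 𝟘)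
            zero-rows (v ∷ M) f (false ∷ J) = trans (⊕-idˡ _) (zero-rows M (f ∘ suc) J)

          -- A green subsum of two or more terms other than `X₀` is itself a term and could replace
          -- them, shortening the representation.
          Z-green : ∀ J → J ≢ 𝟘 → T (comb Z J) ≡ true → comb Z J ≢ X₀ → ∃[ i ] ⁅ i ⁆ ≡ J
          Z-green J J≢ TI ≢X with ∣ J ∣ ℕ.<? 2
          ... | yes lt = [ (λ e → contradiction e J≢) , (λ (i , e) → i , sym e) ]′ (few J lt)
          ... | no ≮2 = contradiction
            ((comb Z J ∷ select Z (full ⊕ J)) , (λ { zero → FZ J , TI , ≢X ; (suc i) → select-all {P = Term} Z (full ⊕ J) Zt i }) ,
              trans (cong (comb Z J ⊕_) (trans (select-sum Z (full ⊕ J)) (co-sum J))) (xor-solve (comb Z J ∷ X₀ ∷ []) (x₀ :+ (x₁ :+ x₀)) x₁ refl))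
            (least (suc ∣ full ⊕ J ∣) (≤-trans (≤-reflexive (ℕₚ.+-comm 2 _)) (≤-trans (ℕₚ.+-monoʳ-≤ ∣ full ⊕ J ∣ (ℕₚ.≮⇒≥ ≮2)) (≤-reflexive (co-size J)))))

          Zc-inj : Inj (Z ++ c)
          Zc-inj = Inj-++ Z c λ J s e →
            let s≡ : s ≡ 𝟘
                s≡ = trans (sym (trans (add α (comb Z J) (comb c s)) (trans (cong₂ _⊕_ (FZ J) (α-c s)) (⊕-idˡ s)))) (trans (cong (ap α) e) (ap-𝟘 α))
            in ker Z-inj J (trans (sym (trans (cong (λ t → comb Z J ⊕ comb c t) s≡) (trans (cong (comb Z J ⊕_) (comb-𝟘 c)) (⊕-idʳ _)))) e) , s≡

          -- In the span of Z and c the green vectors are the rows, the sum of all rows and possibly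
          -- `X₀`, the sum of Z: a circuit, with or without one chord.
          Zc-green : (J : V z) (s : V (suc (suc q))) → J ++ s ≢ 𝟘 → T (comb (Z ++ c) (J ++ s)) ≡ true →
            (∃[ i ] (⁅ i ⁆ ≡ J × s ≡ 𝟘)) ⊎ (∃[ i ] (J ≡ 𝟘 × ⁅ i ⁆ ≡ s)) ⊎ (J ≡ full × s ≡ full) ⊎ (J ≡ full × s ≡ 𝟘 × T X₀ ≡ true)
          Zc-green J s ≢0 Tv with greens-at (FZ J) (trans (cong T (sym (comb-++ Z c J s))) Tv)
          ... | inj₂ (inj₁ (i , s≡ , e)) = inj₂ (inj₁ (i , ker Z-inj J e , sym s≡))
          ... | inj₂ (inj₂ (s≡ , e)) = inj₂ (inj₂ (inj₁ (Z-X J e , s≡)))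
          ... | inj₁ (s≡ , TI) with comb Z J ≟V X₀
          ...   | yes e = inj₂ (inj₂ (inj₂ (Z-X J e , s≡ , trans (cong T (sym e)) TI)))
          ...   | no ≢X = let i , e = Z-green J (λ { refl → ≢0 (trans (cong (𝟘 ++_) s≡) (zeros-++ z)) }) TI ≢X in inj₁ (i , e , s≡)
            where
            zeros-++ : ∀ z {k} → zeros z ++ zeros k ≡ zeros (z + k)
            zeros-++ zero    = refl
            zeros-++ (suc z) = cong (false ∷_) (zeros-++ z)

          row-green : ∀ i → T (lookup (Z ++ c) i) ≡ true
          row-green i with Fin.splitAt z i in eq
          ... | inj₁ j rewrite sym (Finₚ.splitAt⁻¹-↑ˡ {z} eq) = trans (cong T (Vecₚ.lookup-++ˡ Z c j)) (proj₁ (proj₂ (Zt j)))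
          ... | inj₂ j rewrite sym (Finₚ.splitAt⁻¹-↑ʳ {z} eq) = trans (cong T (Vecₚ.lookup-++ʳ Z c j)) (c-green j)

          Zc-sum : T (comb (Z ++ c) full) ≡ true
          Zc-sum = trans (cong T (trans (cong (comb (Z ++ c)) (sym (full-++ z))) (trans (comb-++ Z c full full) (cong (_⊕ comb c full) Zsum)))) apex-green

          2≤z : 2 ≤ z
          2≤z = go Z Zt Zsum
            where
            go : ∀ {z} (Z : Mat z n) → (∀ i → Term (lookup Z i)) → comb Z full ≡ X₀ → 2 ≤ z
            go []          _  e = contradiction (sym e) X₀≢𝟘
            go (v ∷ [])    Zt e = contradiction (trans (sym (⊕-idʳ v)) e) (proj₂ (proj₂ (Zt zero)))
            go (_ ∷ _ ∷ _) _  _ = s≤s (s≤s z≤n)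

        red-case : T X₀ ≢ true → ⊥
        red-case X-red = noPat (circuit-pat (Z ++ c) Zc-inj (ℕₚ.+-mono-≤ 2≤z (s≤s (s≤s z≤n))) row-green Zc-sum only)
          where
          only : ∀ y → y ≢ 𝟘 → T (comb (Z ++ c) y) ≡ true → (∃[ i ] ⁅ i ⁆ ≡ y) ⊎ full ≡ y
          only y y≢ Ty with Zc-green (take z y) (drop z y) (λ e → y≢ (trans (sym (Vecₚ.take++drop≡id z y)) e))
                              (trans (cong (T ∘ comb (Z ++ c)) (Vecₚ.take++drop≡id z y)) Ty)
          ... | inj₁ (i , e , e′) = inj₁ (i ↑ˡ _ , trans (unit-++ˡ i) (trans (cong₂ _++_ e (sym e′)) (Vecₚ.take++drop≡id z y)))
          ... | inj₂ (inj₁ (i , e , e′)) = inj₁ (z ↑ʳ i , trans (unit-++ʳ z i) (trans (cong₂ _++_ (sym e) e′) (Vecₚ.take++drop≡id z y)))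
          ... | inj₂ (inj₂ (inj₁ (e , e′))) = inj₂ (trans (sym (full-++ z)) (trans (cong₂ _++_ (sym e) (sym e′)) (Vecₚ.take++drop≡id z y)))
          ... | inj₂ (inj₂ (inj₂ (_ , _ , TX))) = contradiction TX X-red

        -- With four or more terms, Z and `X₀` are already an excluded circuit. With two or three
        -- terms the whole of Z, c and `v₀` is kept and `X₀` is its chord.
        green-case : q ≡ 0 → T X₀ ≡ true → ⊥
        green-case q≡0 TX with 4 ℕ.≤? z
        ... | yes 4≤z = noPat (circuit-pat Z Z-inj 4≤z (λ i → proj₁ (proj₂ (Zt i))) (trans (cong T Zsum) TX) only)
          where
          only : ∀ y → y ≢ 𝟘 → T (comb Z y) ≡ true → (∃[ i ] ⁅ i ⁆ ≡ y) ⊎ full ≡ y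
          only y y≢ Ty with comb Z y ≟V X₀
          ... | yes e = inj₂ (sym (Z-X y e))
          ... | no ≢X = inj₁ (Z-green y y≢ Ty ≢X)
        ... | no ¬4≤z = noPat (chord-pat Z c (two-or-three z 2≤z (ℕₚ.≰⇒> ¬4≤z)) q≡0 Zc-inj row-green Zc-sum
            (trans (cong T (trans (comb-++ Z c full 𝟘) (trans (cong₂ _⊕_ Zsum (comb-𝟘 c)) (⊕-idʳ X₀)))) TX)
            λ J s ≢0 Tv → Sum.map id (Sum.map id (Sum.map id λ (a , b , _) → a , b , tt)) (Zc-green J s ≢0 Tv))
          where
          two-or-three : ∀ z → 2 ≤ z → z < 4 → z ≡ 2 ⊎ z ≡ 3
          two-or-three (suc (suc zero))       _ _ = inj₁ refl
          two-or-three (suc (suc (suc zero))) _ _ = inj₂ refl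
          two-or-three (suc zero) (s≤s ()) _
          two-or-three (suc (suc (suc (suc _)))) _ (s≤s (s≤s (s≤s (s≤s ()))))

      impossible : ⊥
      impossible with T X₀ Bool.≟ true
      ... | no X-red = go (triv connF π resp)
        where
        -- As w lies outside F, the map neither kills nor fixes `X₀`; being red, `X₀` imposes no
        -- condition on a map that respects T.
        w = comb c ⁅ zero ⁆
        rep = no-rep (λ (k , r) → minimal {Rep} (λ z rep least → Minimal.red-case z rep least X-red) k r) w
        π = proj₁ rep
        resp : Resp T F π
        resp v Fv Tv = inj₁ (proj₁ (proj₂ (proj₂ rep)) v (Fv , Tv , λ { refl → X-red Tv }))
        αw : ap α w ≡ ⁅ zero ⁆
        αw = α-c ⁅ zero ⁆
        go : Triv F π → ⊥
        go (inj₁ kill) = unit≢𝟘 zero (trans (sym αw) (trans (cong (ap α) (trans (sym (proj₁ (proj₂ rep))) (kill X₀ (Fφ x)))) (ap-𝟘 α)))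
        go (inj₂ fix)  = unit≢𝟘 zero (trans (sym αw) (trans (cong (ap α) (trans (sym (proj₁ (proj₂ rep))) (fix X₀ (Fφ x)))) (Fφ x)))
      ... | yes TX with q ℕ.≟ 0
      ...   | no q≢0 = big-circuit TX (ℕₚ.+-monoˡ-≤ 1 (ℕₚ.n≢0⇒n>0 q≢0))
      ...   | yes q≡0 = go (triv connF π resp)
        where
        -- Here `X₀` is green and must be killed or fixed, so the map is made to fix it.
        rep = no-rep (λ (k , r) → minimal {Rep} (λ z rep least → Minimal.green-case z rep least q≡0 TX) k r) X₀
        π = proj₁ rep
        resp : Resp T F π
        resp v Fv Tv with v ≟V X₀
        ... | yes refl = inj₂ (proj₁ (proj₂ rep))
        ... | no v≢X   = inj₁ (proj₁ (proj₂ (proj₂ rep)) v (Fv , Tv , v≢X))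
        go : Triv F π → ⊥
        go (inj₁ kill) = X₀≢𝟘 (trans (sym (proj₁ (proj₂ rep))) (kill X₀ (Fφ x)))
        -- The image of π is the line of `X₀`. Fixing F makes F this line, and with the two rows of
        -- c the rank would be at most 3.
        go (inj₂ fix)  = ℕₚ.<⇒≱ 4≤n (≤-trans (spanning-size {φ = X₀ ∷ c} λ v →
          let b , e = proj₂ (proj₂ (proj₂ rep)) (comb φ (ap β v))
          in b ∷ ap α v , trans (cong (_⊕ comb c (ap α v)) (trans (sym e) (fix _ (Fφ _)))) (trans (⊕-comm _ _) (expand v)))
          (≤-reflexive (cong (3 +_) q≡0)))

ear-hyper : {T : Colouring n} → 4 ≤ n → Conn T Whole → ¬ Pat T → ¬ Hyper T → ⊥
ear-hyper {n} {T} 4≤n connV noPat noHyper = start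
  where
  Green : V n → Set
  Green v = T v ≡ true

  -- Maximality is not established by a search. A larger connected subspace that is still proper is
  -- refuted by `climb` with less fuel, so every subspace met on the way may be treated as maximal.
  maximal-of : ∀ {r q} (fuel : ℕ) (φ : Mat r n) → 1 ≤ r → Inj φ → {c : Mat (suc (suc q)) n} (X : Coord c φ) → n ≤ fuel + r →
    (P : V (suc (suc q)) → Set) → (∀ s → Dec (P s)) → P 𝟘 → (∀ s t → P s → P t → P (s ⊕ t)) →
    Conn T (P ∘ ap (Coord.α X)) → ∀ s → P s → s ≢ 𝟘 → ∀ t → P t

  climb : (fuel : ℕ) (φ : Mat r n) → 1 ≤ r → Inj φ → Conn T (_∈im φ) → ∃[ v ] ¬ v ∈im φ → n ≤ fuel + r → ⊥
  climb {r = r} fuel φ 1≤r φi connφ (v , v∉) le = extended (complete φ φi step)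
    where
    step : ∀ {j} (ψ : Mat j n) → (∀ i → Green (lookup ψ i)) → Inj (ψ ++ φ) →
      (∃[ v ] (Green v × ¬ v ∈im (ψ ++ φ))) ⊎ (∀ v → ⊤ → v ∈im (ψ ++ φ))
    step {j} ψ _ inj with search-V (λ v → (T v Bool.≟ true) ×-dec ¬? (v ∈im? (ψ ++ φ)))
    ... | yes found = inj₁ found
    ... | no none = inj₂ λ v _ → decidable-stable (v ∈im? (ψ ++ φ)) λ v∉ → separated v v∉ (frame (ψ ++ φ) inj)
      where
      separated : ∀ v → ¬ v ∈im (ψ ++ φ) → ∃[ q ] Σ (Mat q n) (λ c → Coord c (ψ ++ φ)) → ⊥
      separated v v∉ (q , c , X) = cut X (ap α v , λ e → v∉ (im v e)) (⁅ j ↑ʳ Fin.fromℕ< 1≤r ⁆ , unit≢𝟘 _) connV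
        λ w Tw → inj₁ (α-im (decidable-stable (w ∈im? (ψ ++ φ)) λ w∉ → none (w , Tw , w∉)))
        where
        open Coord X
        im : ∀ u → ap α u ≡ 𝟘 → u ∈im (ψ ++ φ)
        im u e = ap β u , trans (sym (trans (cong (λ s → comb c s ⊕ comb (ψ ++ φ) (ap β u)) e) (trans (cong (_⊕ _) (comb-𝟘 c)) (⊕-idˡ _)))) (expand u)
        α-im : ∀ {u} → u ∈im (ψ ++ φ) → ap α u ≡ 𝟘
        α-im (y , refl) = α-φ y
    extended : Completion φ Green Whole → ⊥
    extended (zero , [] , _ , _ , sp) = v∉ (sp v tt)
    extended (suc zero , z ∷ [] , gr , inj , sp) = noHyper record
      { φ = φ ; z = z ; φz = coord (z ∷ []) φ inj (λ v → sp v tt) ; z∈T = gr zero ; conn = connφ }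
    extended (suc (suc q) , c , gr , inj , sp) = finish (search-V λ v → (T v Bool.≟ true) ×-dec (¬? (ap α v ≟V 𝟘) ×-dec ¬? (ap β v ≟V 𝟘)))
      where
      X = coord c φ inj (λ v → sp v tt)
      open Coord X
      y₀ : ∃[ y ] (y ≢ 𝟘 {r})
      y₀ = ⁅ Fin.fromℕ< 1≤r ⁆ , unit≢𝟘 _
      module E = Ear noPat 4≤n connV X y₀ gr
      connF : Conn T E.F
      connF = conn-cong (λ { _ (y , refl) → α-φ y })
        (λ u e → ap β u , trans (sym (trans (cong (λ s → comb c s ⊕ comb φ (ap β u)) e) (trans (cong (_⊕ comb φ (ap β u)) (comb-𝟘 c)) (⊕-idˡ _)))) (expand u))
        (λ _ _ _ → id) connφ
      finish : Dec (∃[ v ] (T v ≡ true × ap α v ≢ 𝟘 × ap β v ≢ 𝟘)) → ⊥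
      -- No green vector mixes F with ⟨c⟩, so T is split between the two.
      finish (no none) = cut X (⁅ zero ⁆ , unit≢𝟘 zero) y₀ connV λ v Tv → either (ap α v ≟V 𝟘) (ap β v ≟V 𝟘) (λ a b → none (v , Tv , a , b))
        where
        either : {A B : Set} → Dec A → Dec B → (¬ A → ¬ B → ⊥) → A ⊎ B
        either (yes a) _       _ = inj₁ a
        either (no _)  (yes b) _ = inj₂ b
        either (no ¬a) (no ¬b) f = ⊥-elim (f ¬a ¬b)
      finish (yes (v , Tv , s≢ , y≢)) = E.Apex.impossible connF max v Tv (E.ear connF max v Tv s≢ y≢) y≢
        where
        max = maximal-of fuel φ 1≤r φi X le

  -- Without fuel the rank of φ would be at least n, but c supplies two further independent rows.
  maximal-of {r} zero φ 1≤r φi {c} X le P P? P𝟘 P⊕ connP s Ps s≢ t =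
    ⊥-elim (ℕₚ.<⇒≱ (≤-trans (s≤s (ℕₚ.m≤n+m r _)) (Inj-size (Inj-++ c φ (Coord.unique X)))) le)
  maximal-of {r} {q} (suc fuel) φ 1≤r φi {c} X le P P? P𝟘 P⊕ connP s Ps s≢ t = decidable-stable (P? t) λ ¬Pt →
    larger ¬Pt (complete-dec φ φi {P ∘ ap α} (λ v → P? (ap α v)))
    where
    open Coord X
    P-rows : ∀ {k} (c′ : Mat k n) → (∀ i → P (ap α (lookup c′ i))) → ∀ x → P (ap α (comb c′ x))
    P-rows []       _  []          = subst P (sym (ap-𝟘 α)) P𝟘
    P-rows (v ∷ c′) Pc (true ∷ x)  = subst P (sym (add α v _)) (P⊕ _ _ (Pc zero) (P-rows c′ (Pc ∘ suc) x))
    P-rows (v ∷ c′) Pc (false ∷ x) = subst P (cong (ap α) (sym (⊕-idˡ _))) (P-rows c′ (Pc ∘ suc) x)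
    larger : ¬ P t → Completion φ (P ∘ ap α) (P ∘ ap α) → ⊥
    larger ¬Pt (zero , [] , _ , _ , sp) = s≢ (trans (sym (α-c s)) (in-φ (sp (comb c s) (subst P (sym (α-c s)) Ps))))
      where
      in-φ : ∀ {u} → u ∈im φ → ap α u ≡ 𝟘
      in-φ (y , refl) = α-φ y
    larger ¬Pt (suc j , c′ , Pc , inj , sp) = climb fuel (c′ ++ φ) (s≤s z≤n) inj
      (conn-cong sp (λ u → inside) (λ _ _ _ → id) connP)
      (comb c t , λ t∈ → ¬Pt (subst P (α-c t) (inside t∈)))
      (≤-trans le (≤-trans (≤-reflexive (sym (ℕₚ.+-suc fuel r))) (ℕₚ.+-monoʳ-≤ fuel (s≤s (ℕₚ.m≤n+m r j)))))
      where
      inside : ∀ {u} → u ∈im (c′ ++ φ) → P (ap α u)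
      inside u∈ = let a , b , e = ∈im-++ c′ φ u∈ in
        subst (P ∘ ap α) e (subst P (sym (trans (add α _ _) (trans (cong (ap α (comb c′ a) ⊕_) (α-φ b)) (⊕-idʳ _)))) (P-rows c′ Pc a))

  start : ⊥
  start with search-V (λ v → (T v Bool.≟ true) ×-dec ¬? (v ≟V 𝟘))
  ... | yes (v , Tv , v≢𝟘) = climb n (v ∷ []) (s≤s z≤n) (Inj-∷ (mkInj λ { [] _ → refl }) λ { ([] , e) → v≢𝟘 (sym e) })
      (conn-anchored v (λ π resp → resp v (⁅ zero ⁆ , comb-unit (v ∷ []) zero) Tv)
        λ { π resp z _ (x , refl) → trans (ap-comb π (v ∷ []) x) (trans (cong (λ u → comb (u ∷ []) x) z) (z-row x)) })
      (outside (≤-trans (s≤s (s≤s z≤n)) 4≤n) (v ∷ [])) (ℕₚ.m≤m+n n 1)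
    where
    z-row : ∀ x → comb (𝟘 {n} ∷ []) x ≡ 𝟘
    z-row (true ∷ [])  = ⊕-idˡ 𝟘
    z-row (false ∷ []) = ⊕-idˡ 𝟘
  ... | no none with v , v∉ ← outside (≤-trans (s≤s z≤n) 4≤n) [] = v∉ ([] , sym (span-kill (≤-trans (s≤s (s≤s z≤n)) 4≤n) connV idL
      (λ u Tu → decidable-stable (u ≟V 𝟘) λ u≢ → none (u , Tu , u≢)) v))

-- Two connected hyperplanes from rank 6 on

zero? : (v : V n) → Dec (v ≡ 𝟘)
zero? v = v ≟V 𝟘

record Subspace {n} (W : V n → Set) : Set where
  field
    mem? : ∀ v → Dec (W v)
    has𝟘 : W 𝟘
    has⊕ : ∀ u v → W u → W v → W (u ⊕ v)

  in-rows : (c : Mat k n) → (∀ i → W (lookup c i)) → ∀ {v} → v ∈im c → W v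
  in-rows []      _  ([] , refl)        = has𝟘
  in-rows (u ∷ c) Wc (true ∷ x , refl)  = has⊕ _ _ (Wc zero) (in-rows c (Wc ∘ suc) (x , refl))
  in-rows (u ∷ c) Wc (false ∷ x , refl) = subst W (sym (⊕-idˡ _)) (in-rows c (Wc ∘ suc) (x , refl))

record Basis {n} (W : V n → Set) : Set where
  field
    {size′} : ℕ
    rows    : Mat size′ n
    inj     : Inj rows
    spans   : ∀ v → W v → v ∈im rows
    inside  : ∀ v → v ∈im rows → W v

abstract
  basis-of : {W : V n → Set} → Subspace W → Basis W
  basis-of {W = W} sub with j , c , Wc , inj , sp ← complete-dec [] (mkInj λ { [] _ → refl }) {W} (Subspace.mem? sub) = record
    { rows = c ; inj = mkInj λ x e → proj₁ (Inj-split c [] inj x [] (trans (⊕-idʳ _) e))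
    ; spans = λ v Wv → unpad (sp v Wv) ; inside = λ v → Subspace.in-rows sub c Wc }
    where
    unpad : ∀ {n i} {P : Mat i n} {v : V n} → v ∈im (P ++ []) → v ∈im P
    unpad {P = P} v∈ with s , [] , eq ← ∈im-++ P [] v∈ = s , trans (sym (⊕-idʳ _)) eq

-- The induction hypothesis on smaller ranks, in the form of minimality: no proper nonzero subspace
-- is connected in both colours.
NoBi : Colouring n → Set₁
NoBi {n} T = ∀ {W : V n → Set} → Subspace W → ∃[ u ] (W u × u ≢ 𝟘) → ∃[ v ] ¬ W v → ¬ BiConn T W

opp-conn : {T : Colouring n} {W : V n → Set} → Conn T W → Conn (opp (opp T)) W
opp-conn {T = T} = conn-cong (λ _ → id) (λ _ → id) λ v _ _ e → trans (Boolₚ.not-involutive (T v)) e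

NoBi-opp : {T : Colouring n} → NoBi T → NoBi (opp T)
NoBi-opp {T = T} noBi sub ne out (c , c′) =
  noBi sub ne out (conn-cong (λ _ → id) (λ _ → id) (λ v _ _ e → trans (sym (Boolₚ.not-involutive (T v))) e) c′ , c)

im-subspace : (φ : Mat r n) → Subspace (_∈im φ)
im-subspace φ = record { mem? = _∈im? φ ; has𝟘 = 𝟘 , comb-𝟘 φ ; has⊕ = λ _ _ → ∈im-⊕ }

hyper-size : {T : Colouring n} (H : Hyper T) → suc (Hyper.rk H) ≡ n
hyper-size {n} H = ℕₚ.≤-antisym (Inj-size (Inj-++ (z ∷ []) φ (Coord.unique φz)))
  (spanning-size {φ = z ∷ φ} λ v → ap (Coord.α φz) v ++ ap (Coord.β φz) v , trans (comb-++ (z ∷ []) φ (ap (Coord.α φz) v) (ap (Coord.β φz) v)) (Coord.expand φz v))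
  where open Hyper H

V₁-sum : (u v : V 1) → u ≢ 𝟘 → v ≢ 𝟘 → u ⊕ v ≡ 𝟘
V₁-sum (true ∷ [])  (true ∷ [])  _ _  = refl
V₁-sum (false ∷ []) _            u≢ _ = contradiction refl u≢
V₁-sum (true ∷ [])  (false ∷ []) _ v≢ = contradiction refl v≢

Zero : (n ⊸ 1) → V n → Set
Zero h v = ap h v ≡ 𝟘

module HyperSide {n} {T : Colouring n} (connV : Conn T Whole) (noBi : NoBi T) (H : Hyper T) (3≤n : 3 ≤ n) where
  open Hyper H public
  open Coord φz public

  α-im : ∀ {v} → v ∈im φ → ap α v ≡ 𝟘
  α-im (y , refl) = α-φ y

  im-α : ∀ {v} → ap α v ≡ 𝟘 → v ∈im φ
  im-α {v} e = ap β v , trans (sym (trans (cong (λ s → comb (z ∷ []) s ⊕ comb φ (ap β v)) e) (trans (cong (_⊕ comb φ (ap β v)) (comb-𝟘 (z ∷ []))) (⊕-idˡ _)))) (expand v)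

  αz : ap α z ≡ ⁅ zero ⁆
  αz = trans (cong (ap α) (sym (comb-unit (z ∷ []) zero))) (α-c ⁅ zero ⁆)

  z∉ : ap α z ≢ 𝟘
  z∉ e = contradiction (trans (sym αz) e) λ ()

  1≤rk : 1 ≤ rk
  1≤rk = ℕₚ.≤-pred (≤-trans (s≤s (s≤s z≤n)) (≤-trans 3≤n (≤-reflexive (sym (hyper-size H)))))

  abstract
    -- If z were the only green vector outside the hyperplane, T would be split into z and the
    -- hyperplane.
    second : ∃[ w ] (T w ≡ true × ap α w ≢ 𝟘 × w ≢ z)
    second with search-V (λ w → (T w Bool.≟ true) ×-dec (¬? (ap α w ≟V 𝟘) ×-dec ¬? (w ≟V z)))
    ... | yes found = found
    ... | no none = ⊥-elim (cut φz (⁅ zero ⁆ , λ ()) (⁅ Fin.fromℕ< 1≤rk ⁆ , Nonempty⇒≢𝟘 (_ , Subₚ.x∈⁅x⁆ _)) connV alone)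
      where
      alone : ∀ v → T v ≡ true → ap α v ≡ 𝟘 ⊎ ap β v ≡ 𝟘
      alone v Tv with zero? (ap α v) | v ≟V z
      ... | yes e | _        = inj₁ e
      ... | no _  | yes refl = inj₂ (trans (cong (ap β) (sym (comb-unit (z ∷ []) zero))) (β-c ⁅ zero ⁆))
      ... | no α≢ | no v≢z   = contradiction (v , Tv , α≢ , v≢z) none

    -- The hyperplane is connected in T, so minimality leaves the opposite colour disconnected on
    -- it.
    separation : ∃[ π ] (Resp (opp T) (_∈im φ) π × ¬ Triv (_∈im φ) π)
    separation with conn-or-split (opp T) {_∈im φ} (_∈im? φ)
    ... | inj₂ s = s
    ... | inj₁ c = ⊥-elim (noBi (im-subspace φ)
      (comb φ ⁅ Fin.fromℕ< 1≤rk ⁆ , (_ , refl) , λ e → Nonempty⇒≢𝟘 (_ , Subₚ.x∈⁅x⁆ _) (trans (sym (β-φ _)) (trans (cong (ap β) e) (ap-𝟘 β))))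
      (z , λ z∈ → z∉ (α-im z∈)) (conn , c))

  z′ = proj₁ second
  z′∈T = proj₁ (proj₂ second)
  z′∉ = proj₁ (proj₂ (proj₂ second))
  z′≢z = proj₂ (proj₂ (proj₂ second))
  π = proj₁ separation
  π-resp = proj₁ (proj₂ separation)
  π-cuts = proj₂ (proj₂ separation)

  Meet : (n ⊸ 1) → V n → Set
  Meet h v = v ∈im φ × ap h v ≡ 𝟘

  Meet-sub : ∀ h → Subspace (Meet h)
  Meet-sub h = record
    { mem? = λ v → (v ∈im? φ) ×-dec (ap h v ≟V 𝟘) ; has𝟘 = (𝟘 , comb-𝟘 φ) , ap-𝟘 h
    ; has⊕ = λ u v (u∈ , hu) (v∈ , hv) → ∈im-⊕ u∈ v∈ , trans (add h u v) (trans (cong₂ _⊕_ hu hv) (⊕-idˡ 𝟘)) }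

  abstract
    shift : (h : n ⊸ 1) → ap h z ≡ 𝟘 → ∀ v → ∃[ t ] (t ∈im φ × ap h t ≡ ap h v × (t ≡ v ⊎ t ≡ v ⊕ z))
    shift h hz v with zero? (ap α v)
    ... | yes e = v , im-α e , refl , inj₁ refl
    ... | no α≢ = v ⊕ z , im-α (trans (add α v z) (V₁-sum _ _ α≢ z∉)) ,
      trans (add h v z) (trans (cong (ap h v ⊕_) hz) (⊕-idʳ _)) , inj₂ refl

  -- π still separates the opposite colour on this section. Its dimension is at least 4: z and one
  -- vector of the hyperplane off the kernel of h complete it to a spanning family, and n is at
  -- least 6.
  meet-conn : 6 ≤ n → ∀ h → ap h z ≡ 𝟘 → ∃[ v ] ap h v ≢ 𝟘 → ¬ Triv (Meet h) π → Conn T (Meet h)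
  meet-conn 6≤n h hz (v , hv) nt = conn-cong inside spans (λ _ _ _ → id)
    (conn-of-split {T = T} inj 4≤k π (λ u u∈ → π-resp u (proj₁ (inside u u∈))) λ t → nt (Sum.map (λ f u m → f u (spans u m)) (λ f u m → f u (spans u m)) t))
    where
    open Basis (basis-of (Meet-sub h))
    t : V n
    t = proj₁ (shift h hz v)
    t∈ : t ∈im φ
    t∈ = proj₁ (proj₂ (shift h hz v))
    ht : ap h t ≢ 𝟘
    ht e = hv (trans (sym (proj₁ (proj₂ (proj₂ (shift h hz v))))) e)
    span₁ : ∀ u → u ∈im φ → u ∈im (t ∷ rows)
    span₁ u u∈ with zero? (ap h u)
    ... | yes e with x , ev ← spans u (u∈ , e) = false ∷ x , trans (⊕-idˡ _) ev
    ... | no hu with x , ev ← spans (t ⊕ u) (∈im-⊕ t∈ u∈ , trans (add h t u) (V₁-sum _ _ ht hu)) =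
      true ∷ x , trans (cong (t ⊕_) ev) (⊕-cancel t u)
    span₂ : ∀ u → u ∈im (z ∷ t ∷ rows)
    span₂ u with zero? (ap α u)
    ... | yes e with x , ev ← span₁ u (im-α e) = false ∷ x , trans (⊕-idˡ _) ev
    ... | no α≢ with x , ev ← span₁ (z ⊕ u) (im-α (trans (add α z u) (V₁-sum _ _ z∉ α≢))) = true ∷ x , trans (cong (z ⊕_) ev) (⊕-cancel z u)
    4≤k : 4 ≤ size′
    4≤k = ℕₚ.≤-pred (ℕₚ.≤-pred (≤-trans 6≤n (spanning-size {φ = z ∷ t ∷ rows} span₂)))

  -- The section has index 2 in the kernel of h, and z and z′ are the two green vectors that
  -- `conn-two` asks for.
  zero-conn : 6 ≤ n → ∀ h → ap h z ≡ 𝟘 → ap h z′ ≡ 𝟘 → ∃[ v ] ap h v ≢ 𝟘 → ¬ Triv (Meet h) π → Conn T (Zero h)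
  zero-conn 6≤n h hz hz′ out nt = conn-two {u = z} {z′} (meet-conn 6≤n h hz out nt) (λ v → proj₂) hz hz′ z∈T z′∈T (z′≢z ∘ sym)
    (im-α (trans (add α z z′) (V₁-sum _ _ z∉ z′∉)) , trans (add h z z′) (trans (cong₂ _⊕_ hz hz′) (⊕-idˡ 𝟘))) cover
    where
    cover : ∀ v → Zero h v → Meet h v ⊎ Meet h (v ⊕ z)
    cover v hv with zero? (ap α v)
    ... | yes e = inj₁ (im-α e , hv)
    ... | no α≢ = inj₂ (im-α (trans (add α v z) (V₁-sum _ _ α≢ z∉)) , trans (add h v z) (trans (cong₂ _⊕_ hv hz) (⊕-idˡ 𝟘)))

  -- Two different hyperplane sections of H span H and meet in a nonzero vector, so π cannot be trivial on both.
  not-both : 6 ≤ n → ∀ h h′ → ap h z ≡ 𝟘 → ap h′ z ≡ 𝟘 → ∃[ v ] (ap h v ≡ 𝟘 × ap h′ v ≢ 𝟘) → Triv (Meet h) π → Triv (Meet h′) π → ⊥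
  not-both 6≤n h h′ hz h′z (v , hv , h′v) = go
    where
    moved : ∃[ t ] (t ∈im φ × ap h t ≡ ap h v × (t ≡ v ⊎ t ≡ v ⊕ z))
    moved = shift h hz v
    t : V n
    t = proj₁ moved
    t∈ : t ∈im φ
    t∈ = proj₁ (proj₂ moved)
    ht : ap h t ≡ 𝟘
    ht = trans (proj₁ (proj₂ (proj₂ moved))) hv
    h′-same : t ≡ v ⊎ t ≡ v ⊕ z → ap h′ t ≡ ap h′ v
    h′-same (inj₁ e) = cong (ap h′) e
    h′-same (inj₂ e) = trans (cong (ap h′) e) (trans (add h′ v z) (trans (cong (ap h′ v ⊕_) h′z) (⊕-idʳ _)))
    h′t : ap h′ t ≢ 𝟘
    h′t e = h′v (trans (sym (h′-same (proj₂ (proj₂ (proj₂ moved))))) e)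
    together : (ρ : n ⊸ n) → (∀ u → Meet h u → ap ρ u ≡ 𝟘) → (∀ u → Meet h′ u → ap ρ u ≡ 𝟘) → ∀ u → u ∈im φ → ap ρ u ≡ 𝟘
    together ρ k k′ u u∈ with zero? (ap h′ u)
    ... | yes e = k′ u (u∈ , e)
    ... | no h′u = trans (cong (ap ρ) (xor-solve (t ∷ u ∷ []) x₁ (x₀ :+ (x₀ :+ x₁)) refl)) (trans (add ρ t (t ⊕ u))
      (trans (cong₂ _⊕_ (k t (t∈ , ht)) (k′ (t ⊕ u) (∈im-⊕ t∈ u∈ , trans (add h′ t u) (V₁-sum _ _ h′t h′u)))) (⊕-idˡ 𝟘)))
    common : ∃[ u ] (u ≢ 𝟘 × Meet h u × Meet h′ u)
    common = let x , x≢ , e = kernel {3} {n} (≤-trans (s≤s (s≤s (s≤s (s≤s z≤n)))) 6≤n) (matrix g)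
                 e′ = trans (sym (comb-matrix g x)) e
             in x , x≢ , (im-α (part₁ e′) , part₂ e′) , (im-α (part₁ e′) , part₃ e′)
      where
      g : n ⊸ 3
      g = record { ap = λ u → ap α u ++ (ap h u ++ ap h′ u)
                 ; add = λ u w → trans (cong₂ _++_ (add α u w) (cong₂ _++_ (add h u w) (add h′ u w)))
                                   (sym (trans (++-⊕ (ap α u) (ap α w) (ap h u ++ ap h′ u) (ap h w ++ ap h′ w)) (cong ((ap α u ⊕ ap α w) ++_) (++-⊕ (ap h u) (ap h w) (ap h′ u) (ap h′ w))))) }
      pieces : (a b c : V 1) → a ++ (b ++ c) ≡ 𝟘 → a ≡ 𝟘 × b ≡ 𝟘 × c ≡ 𝟘
      pieces (false ∷ []) (false ∷ []) (false ∷ []) _ = refl , refl , refl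
      part₁ : ∀ {x} → ap g x ≡ 𝟘 → ap α x ≡ 𝟘
      part₁ {x} e = proj₁ (pieces (ap α x) (ap h x) (ap h′ x) e)
      part₂ : ∀ {x} → ap g x ≡ 𝟘 → ap h x ≡ 𝟘
      part₂ {x} e = proj₁ (proj₂ (pieces (ap α x) (ap h x) (ap h′ x) e))
      part₃ : ∀ {x} → ap g x ≡ 𝟘 → ap h′ x ≡ 𝟘
      part₃ {x} e = proj₂ (proj₂ (pieces (ap α x) (ap h x) (ap h′ x) e))
    go : Triv (Meet h) π → Triv (Meet h′) π → ⊥
    go (inj₁ k) (inj₁ k′) = π-cuts (inj₁ (together π k k′))
    go (inj₂ f) (inj₂ f′) = π-cuts (inj₂ λ u u∈ → co-unfix π (together (coL π) (λ w m → co-fixed π (f w m)) (λ w m → co-fixed π (f′ w m)) u u∈))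
    go (inj₁ k) (inj₂ f′) = let u , u≢ , m , m′ = common in u≢ (trans (sym (f′ u m′)) (k u m))
    go (inj₂ f) (inj₁ k′) = let u , u≢ , m , m′ = common in u≢ (trans (sym (f u m)) (k′ u m′))

coordL : Fin q → q ⊸ 1
coordL i = record { ap = λ s → lookup s i ∷ [] ; add = λ s t → cong (_∷ []) (Vecₚ.lookup-zipWith _xor_ i s t) }

module TwoHypers {n} {T : Colouring n} (6≤n : 6 ≤ n) (conn-T : Conn T Whole) (conn-R : Conn (opp T) Whole)
  (noBi : NoBi T) (HT : Hyper T) (HR : Hyper (opp T)) where
  private
    3≤n : 3 ≤ n
    3≤n = ≤-trans (s≤s (s≤s (s≤s z≤n))) 6≤n
    module A = HyperSide conn-T noBi HT 3≤n
    module B = HyperSide conn-R (NoBi-opp noBi) HR 3≤n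

    four : Mat 4 n
    four = A.z ∷ A.z′ ∷ B.z ∷ B.z′ ∷ []

    module U = Basis (basis-of (im-subspace four))

    fr = frame U.rows U.inj
    module X = Coord (proj₂ (proj₂ fr))

    2≤q : 2 ≤ proj₁ fr
    2≤q = ℕₚ.+-cancelʳ-≤ 4 2 (proj₁ fr) (≤-trans 6≤n (≤-trans
      (spanning-size {φ = proj₁ (proj₂ fr) ++ U.rows} λ v → ap X.α v ++ ap X.β v , trans (comb-++ (proj₁ (proj₂ fr)) U.rows (ap X.α v) (ap X.β v)) (X.expand v))
      (ℕₚ.+-monoʳ-≤ (proj₁ fr) (Inj-im-size U.inj λ i → U.inside _ (_ , comb-unit U.rows i)))))

  -- The functionals vanishing on `four` include the three nonzero ones f₁, f₂ and f₁ + f₂. By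
  -- minimality the kernel of each fails to be connected in some colour, so the section is spoilt on
  -- side A or on side B. Two of the three are spoilt on the same side, against `not-both`.
  contradictory : ⊥
  contradictory = two (proj₁ fr) (proj₁ (proj₂ fr)) X.α X.α-c 2≤q kills
    where
    kills : ∀ i → ap X.α (lookup four i) ≡ 𝟘
    kills i with x , e ← U.spans (lookup four i) (⁅ i ⁆ , comb-unit four i) = trans (cong (ap X.α) (sym e)) (X.α-φ x)
    two : ∀ q (c : Mat q n) (α : n ⊸ q) → (∀ s → ap α (comb c s) ≡ s) → 2 ≤ q → (∀ i → ap α (lookup four i) ≡ 𝟘) → ⊥
    two (suc zero) _ _ _ (s≤s ())
    two (suc (suc q)) c α α-c _ kills = pigeon (bad f₁ ok₁) (bad f₂ ok₂) (bad f₃ ok₃)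
      where
      f₁ f₂ f₃ : n ⊸ 1
      f₁ = coordL zero ∘L α
      f₂ = coordL (suc zero) ∘L α
      f₃ = f₁ +L f₂
      val : (h : suc (suc q) ⊸ 1) (s : V (suc (suc q))) → ap (h ∘L α) (comb c s) ≡ ap h s
      val h s = cong (ap h) (α-c s)
      e₀ e₁ : V (suc (suc q))
      e₀ = ⁅ zero ⁆
      e₁ = ⁅ suc zero ⁆
      v₁₀ : ∀ {b : V 1} → b ≡ true ∷ [] → b ≢ 𝟘
      v₁₀ refl ()
      z₁ : ∀ i → ap f₁ (lookup four i) ≡ 𝟘
      z₁ i = cong (ap (coordL zero)) (kills i)
      z₂ : ∀ i → ap f₂ (lookup four i) ≡ 𝟘
      z₂ i = cong (ap (coordL (suc zero))) (kills i)
      z₃ : ∀ i → ap f₃ (lookup four i) ≡ 𝟘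
      z₃ i = cong₂ _⊕_ (z₁ i) (z₂ i)
      ok₁ : (∀ i → ap f₁ (lookup four i) ≡ 𝟘) × ∃[ v ] ap f₁ v ≢ 𝟘
      ok₁ = z₁ , comb c e₀ , v₁₀ (val (coordL zero) e₀)
      ok₂ : (∀ i → ap f₂ (lookup four i) ≡ 𝟘) × ∃[ v ] ap f₂ v ≢ 𝟘
      ok₂ = z₂ , comb c e₁ , v₁₀ (val (coordL (suc zero)) e₁)
      ok₃ : (∀ i → ap f₃ (lookup four i) ≡ 𝟘) × ∃[ v ] ap f₃ v ≢ 𝟘
      ok₃ = z₃ , comb c e₁ , v₁₀ (val (coordL zero +L coordL (suc zero)) e₁)
      Bad : (n ⊸ 1) → Set
      Bad h = Triv (A.Meet h) A.π ⊎ Triv (B.Meet h) B.π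
      bad : ∀ h → (∀ i → ap h (lookup four i) ≡ 𝟘) × ∃[ v ] ap h v ≢ 𝟘 → Bad h
      bad h (hz , out) with Triv? T (Subspace.mem? (A.Meet-sub h)) A.π | Triv? T (Subspace.mem? (B.Meet-sub h)) B.π
      ... | yes t | _     = inj₁ t
      ... | no _  | yes t = inj₂ t
      ... | no a  | no b  = ⊥-elim (noBi zero-sub (A.z , hz zero , λ e → A.z∉ (trans (cong (ap A.α) e) (ap-𝟘 A.α))) out
        (A.zero-conn 6≤n h (hz zero) (hz (suc zero)) out a , B.zero-conn 6≤n h (hz (suc (suc zero))) (hz (suc (suc (suc zero)))) out b))
        where
        zero-sub : Subspace (Zero h)
        zero-sub = record { mem? = λ v → ap h v ≟V 𝟘 ; has𝟘 = ap-𝟘 h ; has⊕ = λ u v hu hv → trans (add h u v) (trans (cong₂ _⊕_ hu hv) (⊕-idˡ 𝟘)) }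
      d₁₂ : ∃[ v ] (ap f₁ v ≡ 𝟘 × ap f₂ v ≢ 𝟘)
      d₁₂ = comb c e₁ , val (coordL zero) e₁ , v₁₀ (val (coordL (suc zero)) e₁)
      d₁₃ : ∃[ v ] (ap f₁ v ≡ 𝟘 × ap f₃ v ≢ 𝟘)
      d₁₃ = comb c e₁ , val (coordL zero) e₁ , v₁₀ (val (coordL zero +L coordL (suc zero)) e₁)
      d₂₃ : ∃[ v ] (ap f₂ v ≡ 𝟘 × ap f₃ v ≢ 𝟘)
      d₂₃ = comb c e₀ , val (coordL (suc zero)) e₀ , v₁₀ (val (coordL zero +L coordL (suc zero)) e₀)
      i₀ i₂ : Fin 4
      i₀ = zero
      i₂ = suc (suc zero)
      pigeon : Bad f₁ → Bad f₂ → Bad f₃ → ⊥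
      pigeon (inj₁ a) (inj₁ b) _        = A.not-both 6≤n f₁ f₂ (z₁ i₀) (z₂ i₀) d₁₂ a b
      pigeon (inj₁ a) (inj₂ _) (inj₁ b) = A.not-both 6≤n f₁ f₃ (z₁ i₀) (z₃ i₀) d₁₃ a b
      pigeon (inj₁ _) (inj₂ a) (inj₂ b) = B.not-both 6≤n f₂ f₃ (z₂ i₂) (z₃ i₂) d₂₃ a b
      pigeon (inj₂ a) (inj₂ b) _        = B.not-both 6≤n f₁ f₂ (z₁ i₂) (z₂ i₂) d₁₂ a b
      pigeon (inj₂ a) (inj₁ _) (inj₂ b) = B.not-both 6≤n f₁ f₃ (z₁ i₂) (z₃ i₂) d₁₃ a b
      pigeon (inj₂ _) (inj₁ a) (inj₁ b) = A.not-both 6≤n f₂ f₃ (z₂ i₀) (z₃ i₀) d₂₃ a b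

-- Transport along changes of basis

pat-map : {T : Colouring n} {g : Mat r n} → Inj g → Pat (T ∘ comb g) → Pat T
pat-map {T = T} {g} gi P = record
  { X = X ; w = comb g ∘ w ; w-inj = w-inj ∘ Inj-≡ gi ; w≢𝟘 = λ i e → w≢𝟘 i (ker gi _ e) ; green = green
  ; ind = λ Y → ind Y ⇔-∘ LinIndep-∘ gi w Y
  ; closed = λ Y ≢0 Tv → let i , e = closed Y (λ e → ≢0 (trans (sym (ap-vsum (lin g) w Y)) (trans (cong (comb g) e) (comb-𝟘 g))))
                                            (trans (cong T (ap-vsum (lin g) w Y)) Tv)
                         in i , trans (cong (comb g) e) (ap-vsum (lin g) w Y) }
  where open Pat P

conn-iso : {T : Colouring k} {W : V k → Set} (g : k ⊸ n) (ι : n ⊸ k) → (∀ v → ap g (ap ι v) ≡ v) → (∀ x → ap ι (ap g x) ≡ x) →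
  Conn T W → Conn (T ∘ ap ι) (W ∘ ap ι)
conn-iso {n = n} {T = T} {W} g ι gι ιg conn = mkConn triv′
  where
  triv′ : ∀ π → Resp (T ∘ ap ι) (W ∘ ap ι) π → Triv (W ∘ ap ι) π
  triv′ π resp = Sum.map
    (λ f v Wv → trans (sym (gι _)) (trans (cong (ap g ∘ ap ι ∘ ap π) (sym (gι v))) (trans (cong (ap g) (f (ap ι v) Wv)) (ap-𝟘 g))))
    (λ f v Wv → trans (sym (gι _)) (trans (cong (ap g ∘ ap ι ∘ ap π) (sym (gι v))) (trans (cong (ap g) (f (ap ι v) Wv)) (gι v))))
    (triv conn (ι ∘L (π ∘L g)) λ x Wx Tx → Sum.map
      (λ e → trans (cong (ap ι) e) (ap-𝟘 ι)) (λ e → trans (cong (ap ι) e) (ιg x))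
      (resp (ap g x) (subst W (sym (ιg x)) Wx) (trans (cong T (ιg x)) Tx)))

module Rebase {n} (T : Colouring n) (B : Mat n n) (Bi : Inj B) where
  abstract
    onto : ∀ v → v ∈im B
    onto v = decidable-stable (v ∈im? B) λ v∉ → ℕₚ.<⇒≱ (Inj-size (Inj-∷ Bi v∉)) ≤-refl

  ι : n ⊸ n
  ι = inverse B Bi onto

  T′ : Colouring n
  T′ = T ∘ comb B

  conn′ : Conn T Whole → Conn T′ Whole
  conn′ c = conn-absolute Bi (conn-cong (λ v _ → onto v) (λ _ _ → tt) (λ _ _ _ → id) c)

  noBi′ : NoBi T → NoBi T′
  noBi′ noBi {W} sub (u , Wu , u≢) (v , Wv) (c , c′) = noBi sub-ι
    (comb B u , subst W (sym (ιB u)) Wu , λ e → u≢ (ker Bi u e)) (comb B v , λ w → Wv (subst W (ιB v) w))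
    (conn-cong (λ _ → id) (λ _ → id) (λ v _ _ e → trans (cong T (sym (eval (onto v)))) e) (conn-iso (lin B) ι (λ v → eval (onto v)) ιB c) ,
     conn-cong (λ _ → id) (λ _ → id) (λ v _ _ e → trans (cong (opp T) (sym (eval (onto v)))) e) (conn-iso (lin B) ι (λ v → eval (onto v)) ιB c′))
    where
    open Subspace sub
    ιB : ∀ x → ap ι (comb B x) ≡ x
    ιB x = Inj-≡ Bi (eval (onto (comb B x)))
    sub-ι : Subspace (W ∘ ap ι)
    sub-ι = record { mem? = mem? ∘ ap ι ; has𝟘 = subst W (sym (ap-𝟘 ι)) has𝟘 ; has⊕ = λ u v a b → subst W (sym (add ι u v)) (has⊕ _ _ a b) }

-- Counting and listing the vectors of a colour

indicator : Bool → ℕ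
indicator b = if b then 1 else 0

card : ∀ n → Colouring n → ℕ
card zero    T = indicator (T [])
card (suc n) T = card n (T ∘ (false ∷_)) + card n (T ∘ (true ∷_))

card₀ : ∀ n → Colouring n → ℕ
card₀ zero    T = 0
card₀ (suc n) T = card₀ n (T ∘ (false ∷_)) + card n (T ∘ (true ∷_))

indicator-≤ : ∀ {a b} → (a ≡ true → b ≡ true) → indicator a ≤ indicator b
indicator-≤ {false}        f = z≤n
indicator-≤ {true} {b}     f rewrite f refl = ≤-refl

card-≤ : ∀ n {S T : Colouring n} → (∀ v → S v ≡ true → T v ≡ true) → card n S ≤ card n T
card-≤ zero    f = indicator-≤ (f [])
card-≤ (suc n) f = ℕₚ.+-mono-≤ (card-≤ n (f ∘ (false ∷_))) (card-≤ n (f ∘ (true ∷_)))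

card₀-≤ : ∀ n {S T : Colouring n} → (∀ v → v ≢ 𝟘 → S v ≡ true → T v ≡ true) → card₀ n S ≤ card₀ n T
card₀-≤ zero    f = z≤n
card₀-≤ (suc n) f = ℕₚ.+-mono-≤ (card₀-≤ n λ v v≢ → f (false ∷ v) λ e → v≢ (cong Vec.tail e)) (card-≤ n λ v → f (true ∷ v) λ ())

+-swap : ∀ a b c d → (a + b) + (c + d) ≡ (a + c) + (b + d)
+-swap a b c d = trans (ℕₚ.+-assoc a b (c + d)) (trans (cong (a +_) (trans (sym (ℕₚ.+-assoc b c d))
  (trans (cong (_+ d) (ℕₚ.+-comm b c)) (ℕₚ.+-assoc c b d)))) (sym (ℕₚ.+-assoc a c (b + d))))

card-opp : ∀ n (T : Colouring n) → card n T + card n (opp T) ≡ 2 ^ n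
card-opp zero    T with T []
... | true  = refl
... | false = refl
card-opp (suc n) T = trans (+-swap (card n (T ∘ (false ∷_))) (card n (T ∘ (true ∷_))) _ _)
  (trans (cong₂ _+_ (card-opp n (T ∘ (false ∷_))) (card-opp n (T ∘ (true ∷_)))) (cong (2 ^ n +_) (sym (ℕₚ.+-identityʳ _))))

-- The number of nonzero vectors is odd, so one colour is the minority, with at most 7 vectors in
-- rank 4 and at most 15 in rank 5. The finite checks treat a minority colour.
card₀-opp : ∀ n (T : Colouring n) → suc (card₀ n T + card₀ n (opp T)) ≡ 2 ^ n
card₀-opp zero    T = refl
card₀-opp (suc n) T = trans (cong suc (+-swap (card₀ n (T ∘ (false ∷_))) (card n (T ∘ (true ∷_))) _ _))
  (trans (cong₂ _+_ (card₀-opp n (T ∘ (false ∷_))) (card-opp n (T ∘ (true ∷_)))) (cong (2 ^ n +_) (sym (ℕₚ.+-identityʳ _))))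

enum : ∀ n (T : Colouring n) → Fin (card₀ n T) → V n
enum-all : ∀ n (T : Colouring n) → Fin (card n T) → V n
enum (suc n) T i = [ (false ∷_) ∘ enum n _ , (true ∷_) ∘ enum-all n _ ]′ (Fin.splitAt (card₀ n (T ∘ (false ∷_))) i)
enum-all zero    T i = []
enum-all (suc n) T i = [ (false ∷_) ∘ enum-all n _ , (true ∷_) ∘ enum-all n _ ]′ (Fin.splitAt (card n (T ∘ (false ∷_))) i)

enum-all-green : ∀ n (T : Colouring n) i → T (enum-all n T i) ≡ true
enum-all-green zero T i with T []
... | true = refl
enum-all-green (suc n) T i with Fin.splitAt (card n (T ∘ (false ∷_))) i
... | inj₁ j = enum-all-green n _ j
... | inj₂ j = enum-all-green n _ j

enum-green : ∀ n (T : Colouring n) i → T (enum n T i) ≡ true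
enum-green (suc n) T i with Fin.splitAt (card₀ n (T ∘ (false ∷_))) i
... | inj₁ j = enum-green n _ j
... | inj₂ j = enum-all-green n _ j

enum-≢𝟘 : ∀ n (T : Colouring n) i → enum n T i ≢ 𝟘
enum-≢𝟘 (suc n) T i with Fin.splitAt (card₀ n (T ∘ (false ∷_))) i
... | inj₁ j = λ e → enum-≢𝟘 n _ j (cong Vec.tail e)
... | inj₂ j = λ ()

enum-all-index : ∀ n (T : Colouring n) v → T v ≡ true → ∃[ i ] enum-all n T i ≡ v
enum-all-index zero T [] Tv with T []
... | true = zero , refl
enum-all-index (suc n) T (false ∷ v) Tv = let i , e = enum-all-index n _ v Tv in
  i ↑ˡ _ , trans (cong [ (false ∷_) ∘ enum-all n _ , (true ∷_) ∘ enum-all n _ ]′ (Finₚ.splitAt-↑ˡ _ i _)) (cong (false ∷_) e)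
enum-all-index (suc n) T (true ∷ v) Tv = let i , e = enum-all-index n _ v Tv in
  _ ↑ʳ i , trans (cong [ (false ∷_) ∘ enum-all n _ , (true ∷_) ∘ enum-all n _ ]′ (Finₚ.splitAt-↑ʳ (card n (T ∘ (false ∷_))) _ i)) (cong (true ∷_) e)

enum-index : ∀ n (T : Colouring n) v → v ≢ 𝟘 → T v ≡ true → ∃[ i ] enum n T i ≡ v
enum-index zero    T []          v≢ Tv = contradiction refl v≢
enum-index (suc n) T (false ∷ v) v≢ Tv = let i , e = enum-index n _ v (λ e → v≢ (cong (false ∷_) e)) Tv in
  i ↑ˡ _ , trans (cong [ (false ∷_) ∘ enum n _ , (true ∷_) ∘ enum-all n _ ]′ (Finₚ.splitAt-↑ˡ _ i _)) (cong (false ∷_) e)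
enum-index (suc n) T (true ∷ v) v≢ Tv = let i , e = enum-all-index n _ v Tv in
  _ ↑ʳ i , trans (cong [ (false ∷_) ∘ enum n _ , (true ∷_) ∘ enum-all n _ ]′ (Finₚ.splitAt-↑ʳ (card₀ n (T ∘ (false ∷_))) _ i)) (cong (true ∷_) e)

enum-all-inj : ∀ n (T : Colouring n) {i j} → enum-all n T i ≡ enum-all n T j → i ≡ j
enum-all-inj zero T {i} {j} e with T []
enum-all-inj zero T {zero} {zero} e | true = refl
enum-all-inj (suc n) T {i} {j} e with Fin.splitAt (card n (T ∘ (false ∷_))) i in p | Fin.splitAt (card n (T ∘ (false ∷_))) j in q
... | inj₁ a | inj₁ b = trans (sym (Finₚ.splitAt⁻¹-↑ˡ p)) (trans (cong (_↑ˡ _) (enum-all-inj n _ (cong Vec.tail e))) (Finₚ.splitAt⁻¹-↑ˡ q))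
... | inj₂ a | inj₂ b = trans (sym (Finₚ.splitAt⁻¹-↑ʳ p)) (trans (cong (_ ↑ʳ_) (enum-all-inj n _ (cong Vec.tail e))) (Finₚ.splitAt⁻¹-↑ʳ q))
enum-all-inj (suc n) T {i} {j} () | inj₁ a | inj₂ b
enum-all-inj (suc n) T {i} {j} () | inj₂ a | inj₁ b

enum-inj : ∀ n (T : Colouring n) {i j} → enum n T i ≡ enum n T j → i ≡ j
enum-inj (suc n) T {i} {j} e with Fin.splitAt (card₀ n (T ∘ (false ∷_))) i in p | Fin.splitAt (card₀ n (T ∘ (false ∷_))) j in q
... | inj₁ a | inj₁ b = trans (sym (Finₚ.splitAt⁻¹-↑ˡ p)) (trans (cong (_↑ˡ _) (enum-inj n _ (cong Vec.tail e))) (Finₚ.splitAt⁻¹-↑ˡ q))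
... | inj₂ a | inj₂ b = trans (sym (Finₚ.splitAt⁻¹-↑ʳ p)) (trans (cong (_ ↑ʳ_) (enum-all-inj n _ (cong Vec.tail e))) (Finₚ.splitAt⁻¹-↑ʳ q))
enum-inj (suc n) T {i} {j} () | inj₁ a | inj₂ b
enum-inj (suc n) T {i} {j} () | inj₂ a | inj₁ b

card₀-rebase : {T : Colouring n} {B : Mat n n} → Inj B → card₀ n (T ∘ comb B) ≤ card₀ n T
card₀-rebase {n} {T} {B} Bi = Finₚ.injective⇒≤ {f = f} λ {i} {j} e →
  enum-inj n (T ∘ comb B) (Inj-≡ Bi (trans (sym (proj₂ (image′ i))) (trans (cong (enum n T) e) (proj₂ (image′ j)))))
  where
  image′ : ∀ i → ∃[ j ] enum n T j ≡ comb B (enum n (T ∘ comb B) i)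
  image′ i = enum-index n T _ (λ e → enum-≢𝟘 n (T ∘ comb B) i (ker Bi _ e)) (enum-green n (T ∘ comb B) i)
  f : Fin (card₀ n (T ∘ comb B)) → Fin (card₀ n T)
  f i = proj₁ (image′ i)

-- Connectivity of the vectors κ, tested in the coordinates of a basis b contained in κ: a map acting on κ by 0 or 1 is
-- diagonal in b, with diagonal ε, and no coordinate vector of κ may be split by ε.
_∩_ : V n → V n → V n
_∩_ = zipWith _∧_

halves : (x ε : V n) → Bool
halves x ε = if isZero (x ∩ ε) then false else not (eqB (x ∩ ε) x)

anyB : ∀ n → (V n → Bool) → Bool
anyB zero    f = f []
anyB (suc n) f = if anyB n (f ∘ (false ∷_)) then true else anyB n (f ∘ (true ∷_))

anyB-sound : ∀ n {f : V n → Bool} → anyB n f ≡ true → ∃[ v ] f v ≡ true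
anyB-sound zero        e = [] , e
anyB-sound (suc n) {f} e with anyB n (f ∘ (false ∷_)) in eq
... | true  = let v , fv = anyB-sound n eq in false ∷ v , fv
... | false = let v , fv = anyB-sound n e in true ∷ v , fv

independentB : Mat r n → Bool
independentB {r} b = allB r λ x → if isZero (comb b x) then isZero x else true

independentB-sound : ∀ {r n} (b : Mat r n) → independentB b ≡ true → Inj b
independentB-sound {r} {n} b ok = mkInj λ x e → isZero-sound x (go x e (allB-sound r ok x))
  where
  go : ∀ x → comb b x ≡ 𝟘 → (if isZero (comb b x) then isZero x else true) ≡ true → isZero x ≡ true
  go x e h rewrite e | isZero-𝟘 n = h

rowsB : (V n → Bool) → Mat r n → Bool
rowsB κ []      = true
rowsB κ (v ∷ b) = if κ v then rowsB κ b else false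

rowsB-sound : (κ : V n → Bool) (b : Mat r n) → rowsB κ b ≡ true → ∀ i → κ (lookup b i) ≡ true
rowsB-sound κ (v ∷ b) ok zero    = proj₁ (if-true ok)
rowsB-sound κ (v ∷ b) ok (suc i) = rowsB-sound κ b (proj₂ (if-true {κ v} ok)) i

collect : ∀ n → (V n → Bool) → List (V n)
collect zero    f = if f [] then [] ∷ [] else []
collect (suc n) f = List.map (false ∷_) (collect n (f ∘ (false ∷_))) List.++ List.map (true ∷_) (collect n (f ∘ (true ∷_)))

collect-sound : ∀ n (f : V n → Bool) {x} → x ∈ₗ collect n f → f x ≡ true
collect-sound zero f x∈ with f [] in eq
collect-sound zero f (Any.here refl) | true = eq
collect-sound (suc n) f x∈ with ∈-++⁻ (List.map (false ∷_) (collect n (f ∘ (false ∷_)))) x∈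
... | inj₁ x∈ˡ with y , y∈ , refl ← ∈-map⁻ (false ∷_) x∈ˡ = collect-sound n (f ∘ (false ∷_)) y∈
... | inj₂ x∈ʳ with y , y∈ , refl ← ∈-map⁻ (true ∷_) x∈ʳ = collect-sound n (f ∘ (true ∷_)) y∈

anyL : {A : Set} → (A → Bool) → List A → Bool
anyL f []       = false
anyL f (a ∷ as) = if f a then true else anyL f as

anyL-sound : {A : Set} {f : A → Bool} (as : List A) → anyL f as ≡ true → ∃[ a ] (a ∈ₗ as × f a ≡ true)
anyL-sound {f = f} (a ∷ as) ok with f a in eq
... | true  = a , Any.here refl , eq
... | false = let b , b∈ , e = anyL-sound as ok in b , Any.there b∈ , e

unsplitB : List (V n) → Bool
unsplitB {n} xs = allB n λ ε → if isZero ε then true else (if eqB ε full then true else anyL (λ x → halves x ε) xs)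

connB : (κ : V n → Bool) → Mat n n → Bool
connB {n} κ b = if independentB b then (if rowsB κ b then unsplitB (collect n (κ ∘ comb b)) else false) else false

-- A second map g stands beside π because π takes values in the larger space, where the coordinates
-- have to be embedded for comparison.
∩-scale : (b : Mat r n) (ε x : V r) (π : n ⊸ k) (g : n ⊸ k) → (∀ i → ap π (lookup b i) ≡ lookup ε i · ap g (lookup b i)) →
  ap π (comb b x) ≡ ap g (comb b (x ∩ ε))
∩-scale []      []      []      π g f = trans (ap-𝟘 π) (sym (ap-𝟘 g))
∩-scale (v ∷ b) (e ∷ ε) (a ∷ x) π g f = trans (add π (a · v) (comb b x)) (trans (cong₂ _⊕_ (head a) (∩-scale b ε x π g (f ∘ suc))) (sym (add g _ _)))
  where
  head : ∀ a → ap π (a · v) ≡ ap g ((a ∧ e) · v)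
  head true  = trans (f zero) (sym (ap-· g e v))
  head false = trans (ap-𝟘 π) (sym (ap-𝟘 g))

connB-sound : {T : Colouring n} (κ : V r → Bool) (b : Mat r r) (g : Mat r n) → connB κ b ≡ true → Inj g →
  (∀ x → κ x ≡ true → T (comb g x) ≡ true) → Conn T (_∈im g)
connB-sound {n} {r} {T} κ b g ok gi col with if-true {independentB b} ok
... | ind , ok₁ with if-true {rowsB κ b} ok₁
... | rows , ok₂ = mkConn triv′
  where
  bi = independentB-sound b ind
  onto : ∀ x → x ∈im b
  onto = Rebase.onto {r} (λ _ → true) b bi
  triv′ : ∀ π → Resp T (_∈im g) π → Triv (_∈im g) π
  triv′ π resp = Sum.map
    (λ e → λ { v (x , refl) → let y , ey = onto x in trans (trans (cong (ap πg) (sym ey)) (trans (scale y) (cong (comb g ∘ comb b) (trans (cong (y ∩_) e) (∩-𝟘 y))))) (trans (cong (comb g) (comb-𝟘 b)) (comb-𝟘 g)) })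
    (λ e → λ { v (x , refl) → let y , ey = onto x in trans (trans (cong (ap πg) (sym ey)) (trans (scale y) (cong (comb g ∘ comb b) (trans (cong (y ∩_) e) (∩-full y))))) (cong (comb g) ey) })
    (decide (allB-sound r ok₂ ε))
    where
    πg : r ⊸ n
    πg = π ∘L lin g
    cls : ∀ x → κ x ≡ true → ap πg x ≡ 𝟘 ⊎ ap πg x ≡ comb g x
    cls x κx = resp (comb g x) (x , refl) (col x κx)
    bitOf : ∀ i → Σ Bool λ e → ap πg (lookup b i) ≡ e · comb g (lookup b i)
    bitOf i with cls (lookup b i) (rowsB-sound κ b rows i)
    ... | inj₁ z = false , z
    ... | inj₂ f = true , f
    ε : V r
    ε = tabulate (proj₁ ∘ bitOf)
    scale : ∀ y → ap πg (comb b y) ≡ comb g (comb b (y ∩ ε))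
    scale y = ∩-scale b ε y πg (lin g) λ i → trans (proj₂ (bitOf i)) (cong (_· comb g (lookup b i)) (sym (lookup∘tabulate (proj₁ ∘ bitOf) i)))
    ∩-𝟘 : ∀ {n} (y : V n) → y ∩ 𝟘 ≡ 𝟘
    ∩-𝟘 []      = refl
    ∩-𝟘 (b ∷ y) = cong₂ _∷_ (Boolₚ.∧-zeroʳ b) (∩-𝟘 y)
    ∩-full : ∀ {n} (y : V n) → y ∩ full ≡ y
    ∩-full []      = refl
    ∩-full (b ∷ y) = cong₂ _∷_ (Boolₚ.∧-identityʳ b) (∩-full y)
    not-halved : ∀ y → κ (comb b y) ≡ true → halves y ε ≡ true → ⊥
    not-halved y κy h with cls (comb b y) κy
    ... | inj₁ z = bad h (ker bi (y ∩ ε) (ker gi _ (trans (sym (scale y)) z)))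
      where
      bad : halves y ε ≡ true → y ∩ ε ≡ 𝟘 → ⊥
      bad h e rewrite e | isZero-𝟘 r = contradiction h λ ()
    ... | inj₂ f = bad h (Inj-≡ bi (Inj-≡ gi (trans (sym (scale y)) f)))
      where
      bad : halves y ε ≡ true → y ∩ ε ≡ y → ⊥
      bad h e with isZero (y ∩ ε) | h
      ... | false | h′ = contradiction (trans (sym (trans (cong (not ∘ isZero) (trans (cong (_⊕ y) e) (⊕-self y))) (cong not (isZero-𝟘 r)))) h′) λ ()
    decide : (if isZero ε then true else (if eqB ε full then true else anyL (λ x → halves x ε) (collect r (κ ∘ comb b)))) ≡ true →
      ε ≡ 𝟘 ⊎ ε ≡ full
    decide h with isZero ε in e₁ | eqB ε full in e₂
    ... | true  | _     = inj₁ (isZero-sound ε e₁)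
    ... | false | true  = inj₂ (eqB-sound ε full e₂)
    ... | false | false = let y , y∈ , e = anyL-sound (collect r (κ ∘ comb b)) h in ⊥-elim (not-halved y (collect-sound r (κ ∘ comb b) y∈) e)

-- Certificates for the finite checks

bits : ∀ n → ℕ → V n
bits zero    _ = []
bits (suc n) k = (k ℕ.% 2 ℕ.≡ᵇ 1) ∷ bits n (k ℕ./ 2)

points : Vec ℕ r → Mat r n
points = map (bits _)

Partial : ℕ → Set
Partial n = V n → Maybe Bool

known : Partial n → Bool → V n → Bool
known ρ b v = is (ρ v)
  where
  is : Maybe Bool → Bool
  is nothing  = false
  is (just c) = not (c xor b)

Agree : Partial n → Colouring n → Set
Agree ρ T = ∀ v b → ρ v ≡ just b → T v ≡ b

known-sound : {ρ : Partial n} {T : Colouring n} → Agree ρ T → ∀ b v → known ρ b v ≡ true → T v ≡ b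
known-sound {ρ = ρ} {T} ag b v e with ρ v in eq
... | just c = trans (ag v c eq) (same c b e)
  where
  same : ∀ c b → not (c xor b) ≡ true → c ≡ b
  same true  true  _ = refl
  same false false _ = refl

update : Partial n → V n → Bool → Partial n
update ρ p b v = if eqB v p then just b else ρ v

update-agree : {ρ : Partial n} {T : Colouring n} (p : V n) → Agree ρ T → Agree (update ρ p (T p)) T
update-agree p ag v b e with eqB v p in eq
update-agree p ag v b refl | true rewrite eqB-sound v p eq = refl
update-agree p ag v b e    | false = ag v b e

memberB : Mat r n → V n → Bool
memberB []      x = false
memberB (v ∷ M) x = if eqB v x then true else memberB M x

memberB-sound : (M : Mat r n) (x : V n) → memberB M x ≡ true → ∃[ i ] lookup M i ≡ x
memberB-sound (v ∷ M) x e with eqB v x in eq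
... | true  = zero , eqB-sound v x eq
... | false = let i , e′ = memberB-sound M x e in suc i , e′

-- Certificates: a case distinction on the colour of a point, too many green points, a linear map separating one colour,
-- or an excluded flat in a basis (points are written in binary, least significant coordinate first).
data Tree (n : ℕ) : Set where
  node          : ℕ → Tree n → Tree n → Tree n
  many          : Tree n
  splitT splitR : Vec ℕ n → Tree n
  pat           : (X : Excluded) → Vec ℕ (Std.d (std X)) → Tree n

-- Points whose colour is still open count as having colour b, so the separation holds for every
-- completion of the partial colouring.
separatesB : Partial n → Bool → Mat n n → Bool
separatesB {n} ρ b M =
  if anyB n (λ v → not (isZero (comb M v))) then
    (if anyB n (λ v → not (eqB (comb M v) v)) then
      allB n (λ v → if known ρ (not b) v then true else (if isZero (comb M v) then true else eqB (comb M v) v)) else false) else false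

patB : Partial n → (X : Excluded) → Mat (Std.d (std X)) n → Bool
patB ρ X B = if independentB B then (if rowsB (known ρ true ∘ comb B) (Std.W (std X)) then
  allB (Std.d (std X)) (λ x → if isZero x then true else (if memberB (Std.W (std X)) x then true else known ρ false (comb B x))) else false) else false

verify : ℕ → Partial n → Tree n → Bool
verify {n} K ρ (node p t₀ t₁) = if verify K (update ρ (bits n p) false) t₀ then verify K (update ρ (bits n p) true) t₁ else false
verify {n} K ρ many           = K ℕ.<ᵇ card₀ n (known ρ true)
verify K ρ (splitT M)         = separatesB ρ true (points M)
verify K ρ (splitR M)         = separatesB ρ false (points M)
verify K ρ (pat X B)          = patB ρ X (points B)

separatesB-sound : {ρ : Partial n} {S : Colouring n} (b : Bool) (M : Mat n n) → (∀ v → S v ≡ true → known ρ (not b) v ≡ false) →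
  separatesB ρ b M ≡ true → ¬ Conn S Whole
separatesB-sound {n} {ρ} {S} b M S-b ok conn with if-true {anyB n (λ v → not (isZero (comb M v)))} ok
... | nz , ok₁ with if-true {anyB n (λ v → not (eqB (comb M v) v))} ok₁
... | nf , ok₂ = go (triv conn (lin M) resp)
  where
  resp : Resp S Whole (lin M)
  resp v _ Sv with known ρ (not b) v | S-b v Sv | isZero (comb M v) in e₁ | eqB (comb M v) v in e₂ | allB-sound n ok₂ v
  ... | false | _ | true  | _    | _ = inj₁ (isZero-sound _ e₁)
  ... | false | _ | false | true | _ = inj₂ (eqB-sound _ _ e₂)
  go : Triv Whole (lin M) → ⊥
  go (inj₁ z) with v , e ← anyB-sound n nz = contradiction (trans (sym (cong not (trans (cong isZero (z v tt)) (isZero-𝟘 n)))) e) λ ()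
  go (inj₂ f) with v , e ← anyB-sound n nf = contradiction (trans (sym (cong not (trans (cong (λ u → isZero (u ⊕ v)) (f v tt)) (trans (cong isZero (⊕-self v)) (isZero-𝟘 n))))) e) λ ()

patB-sound : {ρ : Partial n} {T : Colouring n} → Agree ρ T → (X : Excluded) (B : Mat (Std.d (std X)) n) → patB ρ X B ≡ true → Pat T
patB-sound {n} {ρ} {T} ag X B ok with if-true {independentB B} ok
... | ind , ok₁ with if-true {rowsB (known ρ true ∘ comb B) (Std.W (std X))} ok₁
... | rows , ok₂ = pat-std (std X) B (independentB-sound B ind)
  (λ i → known-sound ag true _ (rowsB-sound (known ρ true ∘ comb B) (Std.W (std X)) rows i))
  λ x x≢ Tx → closed x x≢ Tx (allB-sound (Std.d (std X)) ok₂ x)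
  where
  closed : ∀ x → x ≢ 𝟘 → T (comb B x) ≡ true → (if isZero x then true else (if memberB (Std.W (std X)) x then true else known ρ false (comb B x))) ≡ true →
    ∃[ i ] lookup (Std.W (std X)) i ≡ x
  closed x x≢ Tx h with isZero x in e | memberB (Std.W (std X)) x in e₁
  ... | true  | _     = contradiction (isZero-sound x e) x≢
  ... | false | true  = memberB-sound (Std.W (std X)) x e₁
  ... | false | false = contradiction (trans (sym Tx) (known-sound ag false _ h)) λ ()

verify-sound : ∀ {K} {T : Colouring n} → Conn T Whole → Conn (opp T) Whole → ¬ Pat T → card₀ n T ≤ K →
  (t : Tree n) {ρ : Partial n} → Agree ρ T → verify K ρ t ≡ true → ⊥
verify-sound {n} {K} {T} cT cR noPat small = go
  where
  go : (t : Tree n) {ρ : Partial n} → Agree ρ T → verify K ρ t ≡ true → ⊥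
  go (node p t₀ t₁) {ρ} ag ok with T (bits n p) in eq
  ... | false = go t₀ (subst (λ b → Agree (update ρ (bits n p) b) T) eq (update-agree (bits n p) ag)) (proj₁ (if-true ok))
  ... | true  = go t₁ (subst (λ b → Agree (update ρ (bits n p) b) T) eq (update-agree (bits n p) ag))
                  (proj₂ (if-true {verify K (update ρ (bits n p) false) t₀} ok))
  go many {ρ} ag ok = ℕₚ.<⇒≱ (ℕₚ.<ᵇ⇒< K _ (subst Bool.T (sym ok) tt)) (≤-trans (card₀-≤ n λ v _ → known-sound ag true v) small)
  go (splitT M) {ρ} ag ok = separatesB-sound {ρ = ρ} true (points M) (λ v Tv → no-known v Tv) ok cT
    where
    no-known : ∀ v → T v ≡ true → known ρ false v ≡ false
    no-known v Tv with known ρ false v in e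
    ... | false = refl
    ... | true  = contradiction (trans (sym Tv) (known-sound ag false v e)) λ ()
  go (splitR M) {ρ} ag ok = separatesB-sound {ρ = ρ} false (points M) (λ v Tv → no-known v Tv) ok cR
    where
    no-known : ∀ v → not (T v) ≡ true → known ρ true v ≡ false
    no-known v Tv with known ρ true v in e
    ... | false = refl
    ... | true  = contradiction (trans (sym Tv) (cong not (known-sound ag true v e))) λ ()
  go (pat X B) ag ok = noPat (patB-sound ag X (points B) ok)

abstract
  -- The basis can be chosen green because a connected colour spans: by `span-kill` the coordinates
  -- complementary to the green rows vanish everywhere.
  green-basis : 2 ≤ n → {T : Colouring n} → Conn T Whole → Σ (Mat n n) λ B → Inj B × (∀ i → T (lookup B i) ≡ true)
  green-basis {n} 2≤n {T} conn = square (complete [] (mkInj λ { [] _ → refl }) step)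
    where
    step : ∀ {j} (ψ : Mat j n) → (∀ i → T (lookup ψ i) ≡ true) → Inj (ψ ++ []) →
      (∃[ v ] (T v ≡ true × ¬ v ∈im (ψ ++ []))) ⊎ (∀ v → ⊤ → v ∈im (ψ ++ []))
    step ψ _ inj with search-V (λ v → (T v Bool.≟ true) ×-dec ¬? (v ∈im? (ψ ++ [])))
    ... | yes found = inj₁ found
    ... | no none = inj₂ λ v _ → covers (frame (ψ ++ []) inj) v
      where
      covers : ∃[ q ] Σ (Mat q n) (λ c → Coord c (ψ ++ [])) → ∀ v → v ∈im (ψ ++ [])
      covers (q , c , X) v = ap β v , trans (sym (trans (cong (λ s → comb c s ⊕ comb (ψ ++ []) (ap β v)) α≡) (trans (cong (_⊕ comb (ψ ++ []) (ap β v)) (comb-𝟘 c)) (⊕-idˡ _)))) (expand v)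
        where
        open Coord X
        in-α : ∀ {u} → u ∈im (ψ ++ []) → ap α u ≡ 𝟘
        in-α (y , refl) = α-φ y
        α≡ : ap α v ≡ 𝟘
        α≡ = span-kill 2≤n conn α (λ u Tu → in-α (decidable-stable (u ∈im? (ψ ++ [])) λ u∉ → none (u , Tu , u∉))) v
    square : Completion [] (λ v → T v ≡ true) Whole → Σ (Mat n n) λ B → Inj B × (∀ i → T (lookup B i) ≡ true)
    square (q , c , gr , inj , sp) = resize (ℕₚ.≤-antisym (Inj-size inj′) (spanning-size {φ = c} (λ v → unpad (sp v tt)))) c inj′ gr
      where
      inj′ : Inj c
      inj′ = mkInj λ x e → proj₁ (Inj-split c [] inj x [] (trans (⊕-idʳ _) e))
      unpad : ∀ {v} → v ∈im (c ++ []) → v ∈im c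
      unpad v∈ with s , [] , e ← ∈im-++ c [] v∈ = s , trans (sym (⊕-idʳ _)) e
      resize : ∀ {q} → q ≡ n → (c : Mat q n) → Inj c → (∀ i → T (lookup c i) ≡ true) → Σ (Mat n n) λ B → Inj B × (∀ i → T (lookup B i) ≡ true)
      resize refl c i g = c , i , g

start : Partial n
start v = if memberB (units _) v then just true else nothing

-- In coordinates of a green basis all unit vectors are green, as recorded by `start`, so the tree
-- does not branch on them. The change of basis does not increase the number of green vectors.
by-certificate : ∀ {K} {T : Colouring n} → 2 ≤ n → Conn T Whole → Conn (opp T) Whole → ¬ Pat T → card₀ n T ≤ K →
  (t : Tree n) → verify K start t ≡ true → ⊥
by-certificate {n} {K} {T} 2≤n cT cR noPat small t ok with B , Bi , gr ← green-basis 2≤n cT =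
  verify-sound (conn-absolute Bi (whole cT)) (conn-absolute Bi (whole cR)) (noPat ∘ pat-map Bi) (≤-trans (card₀-rebase Bi) small) t agree ok
  where
  whole : ∀ {S} → Conn S Whole → Conn S (_∈im B)
  whole = conn-cong (λ v _ → Rebase.onto T B Bi v) (λ _ _ → tt) (λ _ _ _ → id)
  agree : Agree start (T ∘ comb B)
  agree v b e with memberB (units n) v in eq
  agree v b refl | true with i , refl ← memberB-sound (units n) v eq =
    trans (cong (T ∘ comb B) (lookup∘tabulate ⁅_⁆ i)) (trans (cong T (comb-unit B i)) (gr i))

-- Ranks 2, 3 and 4

card-bound : (T : Colouring n) → card₀ n T ≤ 2 ^ n
card-bound {n} T = ≤-trans (ℕₚ.m≤m+n _ _) (≤-trans (ℕₚ.n≤1+n _) (≤-reflexive (card₀-opp n T)))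

-- Only the sum of the two green unit vectors can be red. The certificate maps both unit vectors to
-- the first one and kills that sum.
rank₂ : {T : Colouring 2} → Conn T Whole → Conn (opp T) Whole → ¬ Pat T → ⊥
rank₂ {T} cT cR noPat = by-certificate ≤-refl cT cR noPat (card-bound T) (splitR (1 ∷ 1 ∷ [])) refl

-- The certificate maps each unit vector to the sum of the other two. Vectors of weight 2 are then
-- fixed, the one of weight 3 is killed, and no other vector can be red.
rank₃ : {T : Colouring 3} → Conn T Whole → Conn (opp T) Whole → ¬ Pat T → ⊥
rank₃ {T} cT cR noPat = by-certificate (s≤s (s≤s z≤n)) cT cR noPat (card-bound T) (splitR (6 ∷ 5 ∷ 3 ∷ [])) refl

-- Branches on the eleven vectors other than the unit vectors, in increasing binary order, with the
-- red branch first. `many` closes a branch with more than seven green vectors, the minority bound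
-- of `rank₄`.
rank₄-tree : Tree 4
rank₄-tree =
  node 3 (node 5 (node 6 (node 7 (node 9 (node 10 (node 11 (node 12 (node 13 (node 14 (node 15 (splitT (1 ∷ 0 ∷ 0 ∷ 0 ∷ [])) (pat c5 (1 ∷ 2 ∷ 4 ∷ 8 ∷
  []))) (node 15 (splitT (1 ∷ 0 ∷ 0 ∷ 0 ∷ [])) (pat c5c (1 ∷ 15 ∷ 2 ∷ 4 ∷ [])))) (node 14 (node 15 (splitT (1 ∷ 0 ∷ 4 ∷ 8 ∷ [])) (pat c5c (2 ∷ 15 ∷ 1 ∷
  4 ∷ []))) (node 15 (pat k23 (1 ∷ 2 ∷ 4 ∷ 13 ∷ [])) (pat c5cc-disj (1 ∷ 15 ∷ 2 ∷ 4 ∷ []))))) (node 13 (node 14 (node 15 (splitT (1 ∷ 0 ∷ 0 ∷ 0 ∷ []))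
  (pat c5c (4 ∷ 8 ∷ 1 ∷ 2 ∷ []))) (node 15 (splitT (1 ∷ 0 ∷ 0 ∷ 0 ∷ [])) (pat c5cc-meet (1 ∷ 15 ∷ 2 ∷ 4 ∷ [])))) (node 14 (node 15 (splitT (1 ∷ 0 ∷ 4 ∷
  8 ∷ [])) (pat c5cc-meet (2 ∷ 15 ∷ 1 ∷ 4 ∷ []))) (node 15 (pat k23e (1 ∷ 2 ∷ 4 ∷ 13 ∷ [])) many)))) (node 12 (node 13 (node 14 (node 15 (splitT (1 ∷ 2
  ∷ 0 ∷ 8 ∷ [])) (pat c5c (4 ∷ 15 ∷ 1 ∷ 2 ∷ []))) (node 15 (pat k23 (1 ∷ 2 ∷ 4 ∷ 11 ∷ [])) (pat c5cc-disj (1 ∷ 15 ∷ 4 ∷ 2 ∷ [])))) (node 14 (node 15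
  (pat k23 (1 ∷ 2 ∷ 4 ∷ 8 ∷ [])) (pat c5cc-disj (2 ∷ 15 ∷ 4 ∷ 1 ∷ []))) (splitR (6 ∷ 5 ∷ 3 ∷ 15 ∷ [])))) (node 13 (node 14 (node 15 (pat c5c (4 ∷ 12 ∷ 1
  ∷ 2 ∷ [])) (pat c5cc-disj (8 ∷ 4 ∷ 15 ∷ 1 ∷ []))) (node 15 (pat c5cc-disj (2 ∷ 12 ∷ 4 ∷ 1 ∷ [])) many)) (node 14 (node 15 (pat c5cc-disj (1 ∷ 12 ∷ 4 ∷
  2 ∷ [])) many) many)))) (node 11 (node 12 (node 13 (node 14 (node 15 (splitT (1 ∷ 0 ∷ 0 ∷ 0 ∷ [])) (pat c5c (2 ∷ 8 ∷ 1 ∷ 4 ∷ []))) (node 15 (splitT (1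
  ∷ 0 ∷ 0 ∷ 0 ∷ [])) (pat c5cc-meet (1 ∷ 15 ∷ 4 ∷ 2 ∷ [])))) (node 14 (node 15 (pat c5c (2 ∷ 10 ∷ 1 ∷ 4 ∷ [])) (pat c5cc-disj (8 ∷ 2 ∷ 15 ∷ 1 ∷ [])))
  (node 15 (pat c5cc-disj (2 ∷ 10 ∷ 4 ∷ 1 ∷ [])) many))) (node 13 (node 14 (node 15 (splitT (1 ∷ 0 ∷ 0 ∷ 0 ∷ [])) (pat c5cc-disj (2 ∷ 8 ∷ 4 ∷ 1 ∷ [])))
  (node 15 (splitT (1 ∷ 0 ∷ 0 ∷ 0 ∷ [])) many)) (node 14 (node 15 (pat c5cc-meet (1 ∷ 13 ∷ 4 ∷ 2 ∷ [])) many) many))) (node 12 (node 13 (node 14 (node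
  15 (splitT (1 ∷ 2 ∷ 0 ∷ 8 ∷ [])) (pat c5cc-meet (2 ∷ 8 ∷ 1 ∷ 4 ∷ []))) (node 15 (pat k23e (1 ∷ 2 ∷ 4 ∷ 11 ∷ [])) many)) (node 14 (node 15 (pat
  c5cc-disj (1 ∷ 10 ∷ 2 ∷ 4 ∷ [])) many) many)) (node 13 (node 14 (node 15 (pat c5cc-meet (1 ∷ 11 ∷ 2 ∷ 4 ∷ [])) many) many) many)))) (node 10 (node 11
  (node 12 (node 13 (node 14 (node 15 (splitT (1 ∷ 0 ∷ 0 ∷ 8 ∷ [])) (pat c5c (1 ∷ 8 ∷ 2 ∷ 4 ∷ []))) (node 15 (pat c5c (1 ∷ 9 ∷ 2 ∷ 4 ∷ [])) (pat
  c5cc-disj (8 ∷ 1 ∷ 15 ∷ 2 ∷ [])))) (node 14 (node 15 (splitT (1 ∷ 0 ∷ 4 ∷ 8 ∷ [])) (pat c5cc-meet (1 ∷ 8 ∷ 4 ∷ 2 ∷ []))) (node 15 (pat c5cc-disj (1 ∷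
  9 ∷ 4 ∷ 2 ∷ [])) many))) (node 13 (node 14 (node 15 (splitT (1 ∷ 0 ∷ 4 ∷ 8 ∷ [])) (pat c5cc-disj (1 ∷ 8 ∷ 4 ∷ 2 ∷ []))) (node 15 (pat c5cc-meet (1 ∷ 9
  ∷ 4 ∷ 2 ∷ [])) many)) (node 14 (node 15 (splitT (1 ∷ 0 ∷ 4 ∷ 8 ∷ [])) many) many))) (node 12 (node 13 (node 14 (node 15 (splitT (1 ∷ 2 ∷ 0 ∷ 8 ∷ []))
  (pat c5cc-meet (1 ∷ 8 ∷ 2 ∷ 4 ∷ []))) (node 15 (pat c5cc-disj (1 ∷ 9 ∷ 2 ∷ 4 ∷ [])) many)) (node 14 (node 15 (pat k23e (1 ∷ 2 ∷ 4 ∷ 8 ∷ [])) many)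
  many)) (node 13 (node 14 (node 15 (pat c5cc-meet (2 ∷ 11 ∷ 1 ∷ 4 ∷ [])) many) many) many))) (node 11 (node 12 (node 13 (node 14 (node 15 (splitT (1 ∷
  2 ∷ 0 ∷ 8 ∷ [])) (pat c5cc-disj (1 ∷ 8 ∷ 2 ∷ 4 ∷ []))) (node 15 (pat c5cc-meet (1 ∷ 9 ∷ 2 ∷ 4 ∷ [])) many)) (node 14 (node 15 (pat c5cc-meet (2 ∷ 10 ∷
  1 ∷ 4 ∷ [])) many) many)) (node 13 (node 14 (node 15 (pat k23e (1 ∷ 2 ∷ 4 ∷ 9 ∷ [])) many) many) many)) (node 12 (node 13 (node 14 (node 15 (splitT (1
  ∷ 2 ∷ 0 ∷ 8 ∷ [])) many) many) many) many)))) (node 9 (node 10 (node 11 (node 12 (node 13 (node 14 (node 15 (splitT (1 ∷ 2 ∷ 4 ∷ 0 ∷ [])) (pat c5c (8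
  ∷ 15 ∷ 1 ∷ 2 ∷ []))) (node 15 (pat k23 (1 ∷ 2 ∷ 8 ∷ 7 ∷ [])) (pat c5cc-disj (1 ∷ 15 ∷ 8 ∷ 2 ∷ [])))) (node 14 (node 15 (pat k23 (1 ∷ 2 ∷ 8 ∷ 4 ∷ []))
  (pat c5cc-disj (2 ∷ 15 ∷ 8 ∷ 1 ∷ []))) (splitR (10 ∷ 9 ∷ 15 ∷ 3 ∷ [])))) (node 13 (node 14 (node 15 (pat c5c (8 ∷ 12 ∷ 1 ∷ 2 ∷ [])) (pat c5cc-disj (4
  ∷ 8 ∷ 15 ∷ 1 ∷ []))) (node 15 (pat c5cc-disj (2 ∷ 12 ∷ 8 ∷ 1 ∷ [])) many)) (node 14 (node 15 (pat c5cc-disj (1 ∷ 12 ∷ 8 ∷ 2 ∷ [])) many) many))) (node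
  12 (node 13 (node 14 (node 15 (pat k23 (1 ∷ 4 ∷ 8 ∷ 2 ∷ [])) (pat c5cc-disj (4 ∷ 15 ∷ 8 ∷ 1 ∷ []))) (splitR (12 ∷ 15 ∷ 9 ∷ 5 ∷ []))) (splitR (15 ∷ 12
  ∷ 10 ∷ 6 ∷ []))) (node 13 (node 14 (node 15 (pat c5cc-disj (4 ∷ 12 ∷ 11 ∷ 1 ∷ [])) many) many) many))) (node 11 (node 12 (node 13 (node 14 (node 15
  (pat c5c (8 ∷ 10 ∷ 1 ∷ 4 ∷ [])) (pat c5cc-disj (2 ∷ 8 ∷ 15 ∷ 1 ∷ []))) (node 15 (pat c5cc-disj (2 ∷ 10 ∷ 14 ∷ 1 ∷ [])) many)) (node 14 (node 15 (pat
  c5cc-disj (2 ∷ 10 ∷ 13 ∷ 1 ∷ [])) many) many)) (node 13 (node 14 (node 15 (pat c5cc-disj (2 ∷ 8 ∷ 12 ∷ 1 ∷ [])) many) many) many)) (node 12 (node 13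
  (node 14 (node 15 (pat c5cc-disj (1 ∷ 10 ∷ 8 ∷ 4 ∷ [])) many) many) many) many))) (node 10 (node 11 (node 12 (node 13 (node 14 (node 15 (pat c5c (8 ∷
  9 ∷ 2 ∷ 4 ∷ [])) (pat c5cc-disj (1 ∷ 8 ∷ 15 ∷ 2 ∷ []))) (node 15 (pat c5cc-disj (1 ∷ 9 ∷ 14 ∷ 2 ∷ [])) many)) (node 14 (node 15 (pat c5cc-disj (1 ∷ 9
  ∷ 13 ∷ 2 ∷ [])) many) many)) (node 13 (node 14 (node 15 (pat c5cc-disj (1 ∷ 8 ∷ 12 ∷ 2 ∷ [])) many) many) many)) (node 12 (node 13 (node 14 (node 15
  (pat c5cc-disj (1 ∷ 9 ∷ 11 ∷ 4 ∷ [])) many) many) many) many)) (node 11 (node 12 (node 13 (node 14 (node 15 (pat c5cc-disj (1 ∷ 8 ∷ 10 ∷ 4 ∷ []))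
  many) many) many) many) many)))) (node 7 (node 9 (node 10 (node 11 (node 12 (node 13 (node 14 (node 15 (splitT (1 ∷ 0 ∷ 0 ∷ 0 ∷ [])) (pat c5c (2 ∷ 4 ∷
  1 ∷ 8 ∷ []))) (node 15 (splitT (1 ∷ 0 ∷ 0 ∷ 0 ∷ [])) (pat c5cc-meet (1 ∷ 15 ∷ 8 ∷ 2 ∷ [])))) (node 14 (node 15 (pat c5c (2 ∷ 6 ∷ 1 ∷ 8 ∷ [])) (pat
  c5cc-disj (4 ∷ 2 ∷ 15 ∷ 1 ∷ []))) (node 15 (pat c5cc-disj (2 ∷ 6 ∷ 8 ∷ 1 ∷ [])) many))) (node 13 (node 14 (node 15 (splitT (1 ∷ 0 ∷ 0 ∷ 0 ∷ [])) (pat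
  c5cc-disj (2 ∷ 4 ∷ 8 ∷ 1 ∷ []))) (node 15 (splitT (1 ∷ 0 ∷ 0 ∷ 0 ∷ [])) many)) (node 14 (node 15 (pat c5cc-meet (1 ∷ 13 ∷ 8 ∷ 2 ∷ [])) many) many)))
  (node 12 (node 13 (node 14 (node 15 (pat c5c (4 ∷ 6 ∷ 1 ∷ 8 ∷ [])) (pat c5cc-disj (2 ∷ 4 ∷ 15 ∷ 1 ∷ []))) (node 15 (pat c5cc-disj (2 ∷ 6 ∷ 14 ∷ 1 ∷
  [])) many)) (node 14 (node 15 (pat c5cc-disj (2 ∷ 6 ∷ 13 ∷ 1 ∷ [])) many) many)) (node 13 (node 14 (node 15 (pat c5cc-disj (2 ∷ 4 ∷ 12 ∷ 1 ∷ []))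
  many) many) many))) (node 11 (node 12 (node 13 (node 14 (node 15 (splitT (1 ∷ 0 ∷ 0 ∷ 0 ∷ [])) (pat c5cc-disj (4 ∷ 2 ∷ 8 ∷ 1 ∷ []))) (node 15 (splitT
  (1 ∷ 0 ∷ 0 ∷ 0 ∷ [])) many)) (node 14 (node 15 (pat c5cc-disj (4 ∷ 2 ∷ 10 ∷ 1 ∷ [])) many) many)) (node 13 (node 14 (node 15 (splitT (1 ∷ 0 ∷ 0 ∷ 0 ∷
  [])) many) many) many)) (node 12 (node 13 (node 14 (node 15 (pat c5cc-meet (1 ∷ 11 ∷ 8 ∷ 4 ∷ [])) many) many) many) many))) (node 10 (node 11 (node 12
  (node 13 (node 14 (node 15 (splitT (1 ∷ 0 ∷ 0 ∷ 8 ∷ [])) (pat c5cc-meet (1 ∷ 8 ∷ 15 ∷ 2 ∷ []))) (node 15 (pat c5cc-meet (1 ∷ 9 ∷ 14 ∷ 2 ∷ [])) many))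
  (node 14 (node 15 (pat c5cc-meet (1 ∷ 8 ∷ 13 ∷ 2 ∷ [])) many) many)) (node 13 (node 14 (node 15 (pat c5cc-meet (1 ∷ 9 ∷ 12 ∷ 2 ∷ [])) many) many)
  many)) (node 12 (node 13 (node 14 (node 15 (pat c5cc-meet (1 ∷ 8 ∷ 11 ∷ 4 ∷ [])) many) many) many) many)) (node 11 (node 12 (node 13 (node 14 (node 15
  (pat c5cc-meet (1 ∷ 9 ∷ 10 ∷ 4 ∷ [])) many) many) many) many) many))) (node 9 (node 10 (node 11 (node 12 (node 13 (node 14 (node 15 (splitT (1 ∷ 2 ∷ 4
  ∷ 0 ∷ [])) (pat c5cc-meet (2 ∷ 4 ∷ 1 ∷ 8 ∷ []))) (node 15 (pat k23e (1 ∷ 2 ∷ 8 ∷ 7 ∷ [])) many)) (node 14 (node 15 (pat c5cc-disj (1 ∷ 6 ∷ 2 ∷ 8 ∷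
  [])) many) many)) (node 13 (node 14 (node 15 (pat c5cc-meet (1 ∷ 7 ∷ 2 ∷ 8 ∷ [])) many) many) many)) (node 12 (node 13 (node 14 (node 15 (pat
  c5cc-disj (1 ∷ 6 ∷ 4 ∷ 8 ∷ [])) many) many) many) many)) (node 11 (node 12 (node 13 (node 14 (node 15 (pat c5cc-meet (1 ∷ 7 ∷ 4 ∷ 8 ∷ [])) many) many)
  many) many) many)) (node 10 (node 11 (node 12 (node 13 (node 14 (node 15 (pat c5cc-meet (2 ∷ 4 ∷ 7 ∷ 8 ∷ [])) many) many) many) many) many) many))))
  (node 6 (node 7 (node 9 (node 10 (node 11 (node 12 (node 13 (node 14 (node 15 (splitT (1 ∷ 0 ∷ 4 ∷ 0 ∷ [])) (pat c5c (1 ∷ 4 ∷ 2 ∷ 8 ∷ []))) (node 15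
  (pat c5c (1 ∷ 5 ∷ 2 ∷ 8 ∷ [])) (pat c5cc-disj (4 ∷ 1 ∷ 15 ∷ 2 ∷ [])))) (node 14 (node 15 (splitT (1 ∷ 0 ∷ 4 ∷ 8 ∷ [])) (pat c5cc-meet (1 ∷ 4 ∷ 8 ∷ 2 ∷
  []))) (node 15 (pat c5cc-disj (1 ∷ 5 ∷ 8 ∷ 2 ∷ [])) many))) (node 13 (node 14 (node 15 (splitT (1 ∷ 0 ∷ 4 ∷ 8 ∷ [])) (pat c5cc-disj (1 ∷ 4 ∷ 8 ∷ 2 ∷
  []))) (node 15 (pat c5cc-meet (1 ∷ 5 ∷ 8 ∷ 2 ∷ [])) many)) (node 14 (node 15 (splitT (1 ∷ 0 ∷ 4 ∷ 8 ∷ [])) many) many))) (node 12 (node 13 (node 14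
  (node 15 (pat c5c (4 ∷ 5 ∷ 2 ∷ 8 ∷ [])) (pat c5cc-disj (1 ∷ 4 ∷ 15 ∷ 2 ∷ []))) (node 15 (pat c5cc-disj (1 ∷ 5 ∷ 14 ∷ 2 ∷ [])) many)) (node 14 (node 15
  (pat c5cc-disj (1 ∷ 5 ∷ 13 ∷ 2 ∷ [])) many) many)) (node 13 (node 14 (node 15 (pat c5cc-disj (1 ∷ 4 ∷ 12 ∷ 2 ∷ [])) many) many) many))) (node 11 (node
  12 (node 13 (node 14 (node 15 (splitT (1 ∷ 0 ∷ 4 ∷ 0 ∷ [])) (pat c5cc-meet (1 ∷ 4 ∷ 15 ∷ 2 ∷ []))) (node 15 (pat c5cc-meet (1 ∷ 5 ∷ 14 ∷ 2 ∷ []))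
  many)) (node 14 (node 15 (pat c5cc-meet (1 ∷ 4 ∷ 13 ∷ 2 ∷ [])) many) many)) (node 13 (node 14 (node 15 (pat c5cc-meet (1 ∷ 5 ∷ 12 ∷ 2 ∷ [])) many)
  many) many)) (node 12 (node 13 (node 14 (node 15 (pat c5cc-meet (2 ∷ 8 ∷ 11 ∷ 4 ∷ [])) many) many) many) many))) (node 10 (node 11 (node 12 (node 13
  (node 14 (node 15 (splitT (1 ∷ 0 ∷ 4 ∷ 8 ∷ [])) (pat c5cc-disj (4 ∷ 1 ∷ 8 ∷ 2 ∷ []))) (node 15 (pat c5cc-disj (4 ∷ 1 ∷ 9 ∷ 2 ∷ [])) many)) (node 14
  (node 15 (splitT (1 ∷ 0 ∷ 4 ∷ 8 ∷ [])) many) many)) (node 13 (node 14 (node 15 (splitT (1 ∷ 0 ∷ 4 ∷ 8 ∷ [])) many) many) many)) (node 12 (node 13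
  (node 14 (node 15 (pat c5cc-meet (2 ∷ 11 ∷ 8 ∷ 4 ∷ [])) many) many) many) many)) (node 11 (node 12 (node 13 (node 14 (node 15 (pat c5cc-meet (2 ∷ 10 ∷
  9 ∷ 4 ∷ [])) many) many) many) many) many))) (node 9 (node 10 (node 11 (node 12 (node 13 (node 14 (node 15 (splitT (1 ∷ 2 ∷ 4 ∷ 0 ∷ [])) (pat
  c5cc-meet (1 ∷ 4 ∷ 2 ∷ 8 ∷ []))) (node 15 (pat c5cc-disj (1 ∷ 5 ∷ 2 ∷ 8 ∷ [])) many)) (node 14 (node 15 (pat k23e (1 ∷ 2 ∷ 8 ∷ 4 ∷ [])) many) many))
  (node 13 (node 14 (node 15 (pat c5cc-meet (2 ∷ 7 ∷ 1 ∷ 8 ∷ [])) many) many) many)) (node 12 (node 13 (node 14 (node 15 (pat c5cc-disj (1 ∷ 5 ∷ 7 ∷ 8 ∷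
  [])) many) many) many) many)) (node 11 (node 12 (node 13 (node 14 (node 15 (pat c5cc-meet (1 ∷ 4 ∷ 7 ∷ 8 ∷ [])) many) many) many) many) many)) (node
  10 (node 11 (node 12 (node 13 (node 14 (node 15 (pat c5cc-meet (2 ∷ 7 ∷ 4 ∷ 8 ∷ [])) many) many) many) many) many) many))) (node 7 (node 9 (node 10
  (node 11 (node 12 (node 13 (node 14 (node 15 (splitT (1 ∷ 2 ∷ 4 ∷ 0 ∷ [])) (pat c5cc-disj (1 ∷ 4 ∷ 2 ∷ 8 ∷ []))) (node 15 (pat c5cc-meet (1 ∷ 5 ∷ 2 ∷
  8 ∷ [])) many)) (node 14 (node 15 (pat c5cc-meet (2 ∷ 6 ∷ 1 ∷ 8 ∷ [])) many) many)) (node 13 (node 14 (node 15 (pat k23e (1 ∷ 2 ∷ 8 ∷ 5 ∷ [])) many)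
  many) many)) (node 12 (node 13 (node 14 (node 15 (pat c5cc-disj (1 ∷ 4 ∷ 6 ∷ 8 ∷ [])) many) many) many) many)) (node 11 (node 12 (node 13 (node 14
  (node 15 (pat c5cc-meet (1 ∷ 5 ∷ 6 ∷ 8 ∷ [])) many) many) many) many) many)) (node 10 (node 11 (node 12 (node 13 (node 14 (node 15 (pat c5cc-meet (2 ∷
  6 ∷ 5 ∷ 8 ∷ [])) many) many) many) many) many) many)) (node 9 (node 10 (node 11 (node 12 (node 13 (node 14 (node 15 (splitT (1 ∷ 2 ∷ 4 ∷ 0 ∷ []))
  many) many) many) many) many) many) many)))) (node 5 (node 6 (node 7 (node 9 (node 10 (node 11 (node 12 (node 13 (node 14 (node 15 (splitT (1 ∷ 2 ∷ 0
  ∷ 0 ∷ [])) (pat c5c (1 ∷ 2 ∷ 4 ∷ 8 ∷ []))) (node 15 (pat c5c (1 ∷ 3 ∷ 4 ∷ 8 ∷ [])) (pat c5cc-disj (2 ∷ 1 ∷ 15 ∷ 4 ∷ [])))) (node 14 (node 15 (pat c5c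
  (2 ∷ 3 ∷ 4 ∷ 8 ∷ [])) (pat c5cc-disj (1 ∷ 2 ∷ 15 ∷ 4 ∷ []))) (node 15 (pat c5cc-disj (1 ∷ 3 ∷ 14 ∷ 4 ∷ [])) many))) (node 13 (node 14 (node 15 (splitT
  (1 ∷ 2 ∷ 0 ∷ 0 ∷ [])) (pat c5cc-meet (1 ∷ 2 ∷ 15 ∷ 4 ∷ []))) (node 15 (pat c5cc-meet (1 ∷ 3 ∷ 14 ∷ 4 ∷ [])) many)) (node 14 (node 15 (pat c5cc-meet (2
  ∷ 3 ∷ 13 ∷ 4 ∷ [])) many) many))) (node 12 (node 13 (node 14 (node 15 (splitT (1 ∷ 2 ∷ 0 ∷ 8 ∷ [])) (pat c5cc-meet (1 ∷ 2 ∷ 8 ∷ 4 ∷ []))) (node 15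
  (pat c5cc-disj (1 ∷ 3 ∷ 8 ∷ 4 ∷ [])) many)) (node 14 (node 15 (pat c5cc-disj (1 ∷ 3 ∷ 11 ∷ 4 ∷ [])) many) many)) (node 13 (node 14 (node 15 (pat
  c5cc-meet (1 ∷ 2 ∷ 11 ∷ 4 ∷ [])) many) many) many))) (node 11 (node 12 (node 13 (node 14 (node 15 (splitT (1 ∷ 2 ∷ 0 ∷ 8 ∷ [])) (pat c5cc-disj (1 ∷ 2
  ∷ 8 ∷ 4 ∷ []))) (node 15 (pat c5cc-meet (1 ∷ 3 ∷ 8 ∷ 4 ∷ [])) many)) (node 14 (node 15 (pat c5cc-disj (1 ∷ 2 ∷ 10 ∷ 4 ∷ [])) many) many)) (node 13
  (node 14 (node 15 (pat c5cc-meet (1 ∷ 3 ∷ 10 ∷ 4 ∷ [])) many) many) many)) (node 12 (node 13 (node 14 (node 15 (splitT (1 ∷ 2 ∷ 0 ∷ 8 ∷ [])) many)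
  many) many) many))) (node 10 (node 11 (node 12 (node 13 (node 14 (node 15 (splitT (1 ∷ 2 ∷ 0 ∷ 8 ∷ [])) (pat c5cc-disj (2 ∷ 1 ∷ 8 ∷ 4 ∷ []))) (node 15
  (pat c5cc-disj (2 ∷ 1 ∷ 9 ∷ 4 ∷ [])) many)) (node 14 (node 15 (pat c5cc-meet (2 ∷ 3 ∷ 8 ∷ 4 ∷ [])) many) many)) (node 13 (node 14 (node 15 (pat
  c5cc-meet (2 ∷ 3 ∷ 9 ∷ 4 ∷ [])) many) many) many)) (node 12 (node 13 (node 14 (node 15 (splitT (1 ∷ 2 ∷ 0 ∷ 8 ∷ [])) many) many) many) many)) (node 11
  (node 12 (node 13 (node 14 (node 15 (splitT (1 ∷ 2 ∷ 0 ∷ 8 ∷ [])) many) many) many) many) many))) (node 9 (node 10 (node 11 (node 12 (node 13 (node 14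
  (node 15 (splitT (1 ∷ 2 ∷ 4 ∷ 0 ∷ [])) (pat c5cc-meet (1 ∷ 2 ∷ 4 ∷ 8 ∷ []))) (node 15 (pat c5cc-disj (1 ∷ 3 ∷ 4 ∷ 8 ∷ [])) many)) (node 14 (node 15
  (pat c5cc-disj (1 ∷ 3 ∷ 7 ∷ 8 ∷ [])) many) many)) (node 13 (node 14 (node 15 (pat c5cc-meet (1 ∷ 2 ∷ 7 ∷ 8 ∷ [])) many) many) many)) (node 12 (node 13
  (node 14 (node 15 (pat k23e (1 ∷ 4 ∷ 8 ∷ 2 ∷ [])) many) many) many) many)) (node 11 (node 12 (node 13 (node 14 (node 15 (pat c5cc-meet (4 ∷ 7 ∷ 1 ∷ 8
  ∷ [])) many) many) many) many) many)) (node 10 (node 11 (node 12 (node 13 (node 14 (node 15 (pat c5cc-meet (4 ∷ 7 ∷ 2 ∷ 8 ∷ [])) many) many) many)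
  many) many) many))) (node 7 (node 9 (node 10 (node 11 (node 12 (node 13 (node 14 (node 15 (splitT (1 ∷ 2 ∷ 4 ∷ 0 ∷ [])) (pat c5cc-disj (1 ∷ 2 ∷ 4 ∷ 8
  ∷ []))) (node 15 (pat c5cc-meet (1 ∷ 3 ∷ 4 ∷ 8 ∷ [])) many)) (node 14 (node 15 (pat c5cc-disj (1 ∷ 2 ∷ 6 ∷ 8 ∷ [])) many) many)) (node 13 (node 14
  (node 15 (pat c5cc-meet (1 ∷ 3 ∷ 6 ∷ 8 ∷ [])) many) many) many)) (node 12 (node 13 (node 14 (node 15 (pat c5cc-meet (4 ∷ 6 ∷ 1 ∷ 8 ∷ [])) many) many)
  many) many)) (node 11 (node 12 (node 13 (node 14 (node 15 (pat k23e (1 ∷ 4 ∷ 8 ∷ 3 ∷ [])) many) many) many) many) many)) (node 10 (node 11 (node 12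
  (node 13 (node 14 (node 15 (pat c5cc-meet (4 ∷ 6 ∷ 3 ∷ 8 ∷ [])) many) many) many) many) many) many)) (node 9 (node 10 (node 11 (node 12 (node 13 (node
  14 (node 15 (splitT (1 ∷ 2 ∷ 4 ∷ 0 ∷ [])) many) many) many) many) many) many) many))) (node 6 (node 7 (node 9 (node 10 (node 11 (node 12 (node 13
  (node 14 (node 15 (splitT (1 ∷ 2 ∷ 4 ∷ 0 ∷ [])) (pat c5cc-disj (2 ∷ 1 ∷ 4 ∷ 8 ∷ []))) (node 15 (pat c5cc-disj (2 ∷ 1 ∷ 5 ∷ 8 ∷ [])) many)) (node 14
  (node 15 (pat c5cc-meet (2 ∷ 3 ∷ 4 ∷ 8 ∷ [])) many) many)) (node 13 (node 14 (node 15 (pat c5cc-meet (2 ∷ 3 ∷ 5 ∷ 8 ∷ [])) many) many) many)) (node 12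
  (node 13 (node 14 (node 15 (pat c5cc-meet (4 ∷ 5 ∷ 2 ∷ 8 ∷ [])) many) many) many) many)) (node 11 (node 12 (node 13 (node 14 (node 15 (pat c5cc-meet
  (4 ∷ 5 ∷ 3 ∷ 8 ∷ [])) many) many) many) many) many)) (node 10 (node 11 (node 12 (node 13 (node 14 (node 15 (pat k23e (2 ∷ 4 ∷ 8 ∷ 3 ∷ [])) many) many)
  many) many) many) many)) (node 9 (node 10 (node 11 (node 12 (node 13 (node 14 (node 15 (splitT (1 ∷ 2 ∷ 4 ∷ 0 ∷ [])) many) many) many) many) many)
  many) many)) (node 7 (node 9 (node 10 (node 11 (node 12 (node 13 (node 14 (node 15 (splitT (1 ∷ 2 ∷ 4 ∷ 0 ∷ [])) many) many) many) many) many) many)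
  many) many)))

rank₄ : {T : Colouring 4} → Conn T Whole → Conn (opp T) Whole → ¬ Pat T → ¬ Pat (opp T) → ⊥
rank₄ {T} cT cR noT noR with card₀ 4 T ℕ.≤? 7
... | yes ≤7 = by-certificate (s≤s (s≤s z≤n)) cT cR noT ≤7 rank₄-tree refl
... | no ≰7  = by-certificate (s≤s (s≤s z≤n)) cR (opp-conn cT) noR
  (ℕₚ.+-cancelˡ-≤ 8 _ 7 (≤-trans (ℕₚ.+-monoˡ-≤ _ (ℕₚ.≰⇒> ≰7)) (≤-reflexive (ℕₚ.suc-injective (card₀-opp 4 T))))) rank₄-tree refl

-- Rank 5: enumeration over a split hyperplane

Tab : Set → ℕ → Set
Tab A zero    = A
Tab A (suc n) = Tab A n × Tab A n

at : {A : Set} → Tab A n → V n → A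
at {zero}  t       []          = t
at {suc n} (t , _) (false ∷ v) = at {n} t v
at {suc n} (_ , t) (true ∷ v)  = at {n} t v

tab : {A : Set} → (V n → A) → Tab A n
tab {zero}  f = f []
tab {suc n} f = tab (f ∘ (false ∷_)) , tab (f ∘ (true ∷_))

at-tab : {A : Set} (f : V n → A) (v : V n) → at {n} (tab f) v ≡ f v
at-tab {zero}  f []          = refl
at-tab {suc n} f (false ∷ v) = at-tab (f ∘ (false ∷_)) v
at-tab {suc n} f (true ∷ v)  = at-tab (f ∘ (true ∷_)) v

either : ∀ {a b : Bool} → (if a then true else b) ≡ true → a ≡ true ⊎ b ≡ true
either {true}  _ = inj₁ refl
either {false} h = inj₂ h

implied : ∀ {a b : Bool} → a ≡ true → (if a then b else true) ≡ true → b ≡ true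
implied refl h = h

refuted : ∀ {a b : Bool} → a ≢ true → (if a then true else b) ≡ true → b ≡ true
refuted {true}  a≢ _ = contradiction refl a≢
refuted {false} _  h = h

-- The enumeration is confined by a budget k of green entries, and f also receives what is left of
-- it. In rank 5 at most 15 vectors are green, 9 or 7 of which are already fixed as sums across the
-- split.
allTab : ∀ n → ℕ → (Tab Bool n → ℕ → Bool) → Bool
allTab zero    zero    f = f false zero
allTab zero    (suc k) f = if f false (suc k) then f true k else false
allTab (suc n) k       f = allTab n k λ s j → allTab n j λ t → f (s , t)

count : ∀ n → Tab Bool n → ℕ → ℕ
count zero    true  k = suc k
count zero    false k = k
count (suc n) (s , t) k = count n t (count n s k)

-- four coordinates of a hyperplane: z + ⟨u, e, e′⟩ carries the colours ρ
record Place : Set where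
  constructor place
  field
    s u e e′ : V 4

  dirs : Mat 3 4
  dirs = u ∷ e ∷ e′ ∷ []

  cells : Tab (V 4) 3
  cells = tab (λ x → s ⊕ comb dirs x)

  frame₄ : Mat 4 5
  frame₄ = (true ∷ s) ∷ map (false ∷_) dirs
open Place using (dirs; cells; frame₄)

mapTab : ∀ n {A B : Set} → (A → B) → Tab A n → Tab B n
mapTab zero    f t       = f t
mapTab (suc n) f (s , t) = mapTab n f s , mapTab n f t

at-map : {A B : Set} (f : A → B) (t : Tab A n) (v : V n) → at {n} (mapTab n f t) v ≡ f (at {n} t v)
at-map {zero}  f t       []          = refl
at-map {suc n} f (t , _) (false ∷ v) = at-map {n} f t v
at-map {suc n} f (_ , t) (true ∷ v)  = at-map {n} f t v

allTab-sound : ∀ n k {f : Tab Bool n → ℕ → Bool} → allTab n k f ≡ true → (T : Colouring n) → card n T ≤ k → f (tab T) (k ∸ card n T) ≡ true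
allTab-sound zero zero    ok T le with T []
allTab-sound zero zero    ok T le | false = ok
allTab-sound zero (suc k) {f} ok T le with T []
... | false = proj₁ (if-true ok)
... | true  = proj₂ (if-true {f false (suc k)} ok)
allTab-sound (suc n) k {f} ok T le = subst (λ j → f (tab T) j ≡ true) (ℕₚ.∸-+-assoc k a b)
  (allTab-sound n (k ∸ a) (allTab-sound n k ok (T ∘ (false ∷_)) (≤-trans (ℕₚ.m≤m+n a b) le)) (T ∘ (true ∷_))
    (ℕₚ.m+n≤o⇒m≤o∸n b (≤-trans (≤-reflexive (ℕₚ.+-comm b a)) le)))
  where
  a = card n (T ∘ (false ∷_))
  b = card n (T ∘ (true ∷_))

-- The greedy choice needs no correctness proof: connB checks the basis it returns.
pick : (V n → Bool) → Mat n n
pick {n} κ = pad n (go (2 ℕ.^ n) [] (𝟘 ∷ []))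
  where
  inL : V n → List (V n) → Bool
  inL v = anyL (eqB v)
  go : ℕ → List (V n) → List (V n) → List (V n)
  go zero    b sp = b
  go (suc j) b sp with bits n j
  ... | v = if (if κ v then not (inL v sp) else false) then go j (v ∷ b) (sp List.++ List.map (v ⊕_) sp) else go j b sp
  pad : ∀ r → List (V n) → Mat r n
  pad zero    _       = []
  pad (suc r) []      = 𝟘 ∷ pad r []
  pad (suc r) (v ∷ b) = v ∷ pad r b

opaque
  autoB : (V n → Bool) → Bool
  autoB {n} κ = shared (tab κ)
    where
    shared : Tab Bool n → Bool
    shared t = connB (at t) (pick (at t))

  autoB-sound : {T : Colouring n} (κ : V r → Bool) (g : Mat r n) → autoB κ ≡ true → Inj g →
    (∀ x → κ x ≡ true → T (comb g x) ≡ true) → Conn T (_∈im g)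
  autoB-sound {r = r} κ g ok gi f = connB-sound (at {r} (tab κ)) (pick (at {r} (tab κ))) g ok gi λ x e → f x (trans (sym (at-tab κ x)) e)

-- In the hyperplane of a place, u + ⟨e, e′⟩ is green, z + ⟨u, e, e′⟩ is coloured by ρ, and ⟨e, e′⟩ is red if δ holds.
-- Two green vectors over an affine plane of ρ suffice, or at least two in all but at most two in each half if δ holds.
green-at red-at : Bool → Tab Bool 3 → V 4 → Bool
green-at δ ρ (true ∷ x)          = at {3} ρ x
green-at δ ρ (false ∷ true ∷ _)  = true
green-at δ ρ (false ∷ false ∷ _) = false
red-at δ ρ (true ∷ x)            = not (at {3} ρ x)
red-at δ ρ (false ∷ true ∷ _)    = false
red-at δ ρ (false ∷ false ∷ y)   = if isZero y then false else δ

opaque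
  sure : Bool → Tab Bool 3 → Bool
  sure δ (s , t) = test (count 2 s 0) (count 2 t 0)
    where
    test : ℕ → ℕ → Bool
    test a b = if a + b ℕ.≡ᵇ 2 then true else (if δ then (if 1 ℕ.<ᵇ a + b then (if a ℕ.<ᵇ 3 then b ℕ.<ᵇ 3 else false) else false) else false)

Sums : Set
Sums = V 4 → Bool

opaque
  -- The affine plane u + ⟨e, e′⟩ must consist of sums across the split, which are green whatever
  -- the rest of the colouring is.
  soundPlaceB : Sums → Place → Bool
  soundPlaceB S p = if independentB (frame₄ p) then allB 2 (λ y → S (comb (dirs p) (true ∷ y))) else false

  soundPlaceB-sound : ∀ S p → soundPlaceB S p ≡ true → Inj (frame₄ p) × (∀ y → S (comb (dirs p) (true ∷ y)) ≡ true)
  soundPlaceB-sound S p ok = independentB-sound (frame₄ p) (proj₁ (if-true ok)) , allB-sound 2 (proj₂ (if-true {independentB (frame₄ p)} ok))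

colours : Tab Bool 4 → Place → Tab Bool 3
colours G p = mapTab 3 (at {4} G) (cells p)

v4 : ℕ → V 4
v4 = bits 4

places : List (ℕ × ℕ × ℕ × ℕ) → List Place
places = List.map λ (u , e , e′ , s) → place (v4 s) (v4 u) (v4 e) (v4 e′)

opaque
  -- The case in which z is the only green vector outside the hyperplane; it is ruled out by
  -- `second`.
  lone : Tab Bool 4 → Bool
  lone G = allB 4 λ s → if isZero s then true else not (at {4} G s)

  lone-sound : ∀ G → lone G ≡ true → ∀ s → s ≢ 𝟘 → not (at {4} G s) ≡ true
  lone-sound G e s s≢ = refuted (λ z → s≢ (isZero-sound s z)) (allB-sound 4 {λ s → if isZero s then true else not (at {4} G s)} e s)

-- Coordinates of the hyperplane, C before D, for the two shapes of its decomposition: dimensions 2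
-- + 2 and 1 + 3.
sums₂₂ sums₁₃ : Sums
sums₂₂ (a ∷ b ∷ y) = if isZero (a ∷ b ∷ []) then false else not (isZero y)
sums₁₃ (a ∷ y)     = if a then not (isZero y) else false

-- For 2 + 2, e runs over the nonzero vectors of ⟨C⟩ and e′ over those of ⟨D⟩, nine pairs; for 1 +
-- 3, ⟨e, e′⟩ runs over the seven planes of ⟨D⟩. In each case u completes them to an affine plane of
-- sums, and the two values of s represent both cosets of ⟨u, e, e′⟩.
places₂₂ places₁₃ : List Place
places₂₂ = places
  ((5 , 2 , 8 , 0) ∷ (5 , 2 , 8 , 1) ∷ (6 , 1 , 8 , 0) ∷ (6 , 1 , 8 , 2) ∷ (5 , 3 , 8 , 0) ∷ (5 , 3 , 8 , 1) ∷ (9 , 2 , 4 , 0) ∷ (9 , 2 , 4 , 1) ∷ (10 , 1 , 4 , 0) ∷ (10 , 1 , 4 , 2) ∷ (9 , 3 , 4 , 0) ∷ (9 , 3 , 4 , 1) ∷ (5 , 2 , 12 , 0) ∷ (5 , 2 , 12 , 1) ∷ (6 , 1 , 12 , 0) ∷ (6 , 1 , 12 , 2) ∷ (5 , 3 , 12 , 0) ∷ (5 , 3 , 12 , 1) ∷ [])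
places₁₃ = places
  ((3 , 4 , 8 , 0) ∷ (3 , 4 , 8 , 1) ∷ (5 , 2 , 8 , 0) ∷ (5 , 2 , 8 , 1) ∷ (3 , 6 , 8 , 0) ∷ (3 , 6 , 8 , 1) ∷ (9 , 2 , 4 , 0) ∷ (9 , 2 , 4 , 1) ∷ (3 , 4 , 10 , 0) ∷ (3 , 4 , 10 , 1) ∷ (5 , 2 , 12 , 0) ∷ (5 , 2 , 12 , 1) ∷ (3 , 6 , 10 , 0) ∷ (3 , 6 , 10 , 1) ∷ [])

-- In the 1 + 3 shape everything is determined by G outside the hyperplane, by D on ⟨D⟩ and by the
-- colour c of the generator of ⟨C⟩; the sums are green.
colour₁₃ : Tab Bool 3 → Bool → Tab Bool 4 → Colouring 5
colour₁₃ D c G (true ∷ s)          = at {4} G s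
colour₁₃ D c G (false ∷ false ∷ y) = at {3} D y
colour₁₃ D c G (false ∷ true ∷ y)  = if isZero y then c else true

redVector : Tab Bool 3 → V 4 → Bool
redVector D (a ∷ y) = if a then false else not (at {3} D y)

opaque
  redB : Tab Bool 3 → Place → Bool
  redB D p = red (Place.e p) (Place.e′ p)
    where
    red₁ : V 4 → Bool
    red₁ = redVector D
    red : V 4 → V 4 → Bool
    red e e′ = if red₁ e then (if red₁ e′ then red₁ (e ⊕ e′) else false) else false

  redB-sound : ∀ D p → redB D p ≡ true → redVector D (Place.e p) ≡ true × redVector D (Place.e′ p) ≡ true × redVector D (Place.e p ⊕ Place.e′ p) ≡ true
  redB-sound D p ok with if-true {redVector D (Place.e p)} ok
  ... | a , h with if-true {redVector D (Place.e′ p)} h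
  ... | b , c = a , b , c

opaque
  biB : Colouring 5 → Mat 4 5 → Bool
  biB T B = if independentB B then (if autoB (T ∘ comb B) then autoB (opp T ∘ comb B) else false) else false

  biB-sound : ∀ T B → biB T B ≡ true → Inj B × autoB (T ∘ comb B) ≡ true × autoB (opp T ∘ comb B) ≡ true
  biB-sound T B ok = independentB-sound B (proj₁ (if-true ok)) , if-true (proj₂ (if-true {independentB B} ok))

opaque
  sepB : Colouring 5 → Mat 5 5 → Bool
  sepB T = separatesB (just ∘ T) false

  sepB-sound : ∀ T M → sepB T M ≡ true → ¬ Conn (opp T) Whole
  sepB-sound T M ok = separatesB-sound {ρ = just ∘ T} {S = opp T} false M (λ v → red (T v)) ok
    where
    red : ∀ b → not b ≡ true → not (b xor true) ≡ false
    red false _ = refl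

-- The binary digits, lowest first, stand for z, the generator of ⟨C⟩ and three generators of ⟨D⟩.
-- These hyperplanes are tried when no place is sure.
hyperplanes : List (Mat 4 5)
hyperplanes = List.map points
  ((1 ∷ 2 ∷ 8 ∷ 16 ∷ []) ∷ (1 ∷ 2 ∷ 4 ∷ 16 ∷ []) ∷ (1 ∷ 2 ∷ 16 ∷ 12 ∷ []) ∷ (1 ∷ 6 ∷ 8 ∷ 16 ∷ []) ∷ (3 ∷ 5 ∷ 8 ∷ 16 ∷ []) ∷ [])

-- Write c for the generator of ⟨C⟩. Each of the first seven fixes ⟨D⟩ and z ⊕ c and kills z ⊕ w,
-- for one of the seven nonzero w in ⟨D⟩: it applies when c is green and z ⊕ w is at most the only
-- red vector of z + ⟨D⟩. The last fixes c and kills ⟨D⟩ and z ⊕ c, for the case that z + ⟨D⟩ is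
-- green.
separators : List (Mat 5 5)
separators = List.map points
  ((28 ∷ 31 ∷ 4 ∷ 8 ∷ 16 ∷ []) ∷ (24 ∷ 27 ∷ 4 ∷ 8 ∷ 16 ∷ []) ∷ (20 ∷ 23 ∷ 4 ∷ 8 ∷ 16 ∷ []) ∷ (16 ∷ 19 ∷ 4 ∷ 8 ∷ 16 ∷ []) ∷
   (12 ∷ 15 ∷ 4 ∷ 8 ∷ 16 ∷ []) ∷ (8 ∷ 11 ∷ 4 ∷ 8 ∷ 16 ∷ []) ∷ (4 ∷ 7 ∷ 4 ∷ 8 ∷ 16 ∷ []) ∷ (2 ∷ 2 ∷ 0 ∷ 0 ∷ 0 ∷ []) ∷ [])

Cand : Set
Cand = Place × Tab (V 4) 3

cands : List Place → List Cand
cands = List.map λ p → p , cells p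

opaque
  -- Tables that colour 𝟘 green are passed over, as colourings are normalised to be red there.
  settled : List Cand → Bool → Tab Bool 4 → Tab Bool 3 → Bool
  settled cs c G D = if at {3} D 𝟘 then true else (if anyL (λ (p , x) → sure (redB D p) (mapTab 3 (at {4} G) x)) cs then true else
    (if anyL (biB (colour₁₃ D c G)) hyperplanes then true else anyL (sepB (colour₁₃ D c G)) separators))

  settled-sound : ∀ {cs c G D} → settled cs c G D ≡ true → at {3} D 𝟘 ≢ true →
    (∃[ x ] (x ∈ₗ cs × sure (redB D (proj₁ x)) (mapTab 3 (at {4} G) (proj₂ x)) ≡ true)) ⊎
    (∃[ B ] biB (colour₁₃ D c G) B ≡ true) ⊎ (∃[ M ] sepB (colour₁₃ D c G) M ≡ true)
  settled-sound {cs} {c} {G} {D} ok D𝟘 = Sum.map (anyL-sound cs)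
    (λ h → Sum.map (λ h → let B , _ , e = anyL-sound {f = biB (colour₁₃ D c G)} hyperplanes h in B , e)
                   (λ h → let M , _ , e = anyL-sound {f = sepB (colour₁₃ D c G)} separators h in M , e)
      (either {anyL (biB (colour₁₃ D c G)) hyperplanes} {anyL (sepB (colour₁₃ D c G)) separators} h))
    (either {anyL (λ (p , x) → sure (redB D p) (mapTab 3 (at {4} G) x)) cs} (refuted D𝟘 ok))

opaque
  test₂₂ : List (Tab (V 4) 3) → Tab Bool 4 → ℕ → Bool
  test₂₂ cs G _ = if at {4} G 𝟘 then (if lone G then true else anyL (λ c → sure false (mapTab 3 (at {4} G) c)) cs) else true

  test₂₂-sound : ∀ {cs G k} → test₂₂ cs G k ≡ true → at {4} G 𝟘 ≡ true → lone G ≢ true →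
    ∃[ x ] (x ∈ₗ cs × sure false (mapTab 3 (at {4} G) x) ≡ true)
  test₂₂-sound {cs} ok G𝟘 not-lone = anyL-sound cs (refuted not-lone (implied G𝟘 ok))

less : ℕ → (ℕ → Bool) → Bool
less zero    f = true
less (suc j) f = f j

opaque
  -- G is examined first: a place that is sure with δ = false settles it for all colourings of ⟨D⟩.
  -- Only otherwise is D enumerated, with the whole remaining budget if the generator of ⟨C⟩ is red
  -- and with one less if it is green; with an empty budget it cannot be green.
  test₁₃ : List Cand → Tab Bool 4 → ℕ → Bool
  test₁₃ cs G k = if at {4} G 𝟘 then (if lone G then true else
    (if anyL (λ (p , x) → sure false (mapTab 3 (at {4} G) x)) cs then true else
      (if allTab 3 k (λ D _ → settled cs false G D) then less k (λ j → allTab 3 j (λ D _ → settled cs true G D)) else false))) else true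

  test₁₃-sound : ∀ {cs G k} → test₁₃ cs G k ≡ true → at {4} G 𝟘 ≡ true → lone G ≢ true →
    (∃[ x ] (x ∈ₗ cs × sure false (mapTab 3 (at {4} G) (proj₂ x)) ≡ true)) ⊎
    (allTab 3 k (λ D _ → settled cs false G D) ≡ true × less k (λ j → allTab 3 j (λ D _ → settled cs true G D)) ≡ true)
  test₁₃-sound {cs} ok G𝟘 not-lone = Sum.map (anyL-sound cs) if-true (either (refuted not-lone (implied G𝟘 ok)))

opaque
  sure-test : Bool → Tab Bool 3 → ℕ → Bool
  sure-test δ ρ _ = if sure δ ρ then (if autoB (green-at δ ρ) then autoB (red-at δ ρ) else false) else true

  sure-test-sound : ∀ {δ ρ k} → sure-test δ ρ k ≡ true → sure δ ρ ≡ true → autoB (green-at δ ρ) ≡ true × autoB (red-at δ ρ) ≡ true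
  sure-test-sound ok e = if-true (implied e ok)

opaque
  Every : ∀ n → ℕ → (Tab Bool n → ℕ → Bool) → Set
  Every n k f = allTab n k f ≡ true

  every : ∀ {n k f} → Every n k f → (T : Colouring n) → card n T ≤ k → f (tab T) (k ∸ card n T) ≡ true
  every {n} {k} = allTab-sound n k

allL : {A : Set} → (A → Bool) → List A → Bool
allL f []       = true
allL f (a ∷ as) = if f a then allL f as else false

allL-sound : {A : Set} (f : A → Bool) (as : List A) → allL f as ≡ true → ∀ {a} → a ∈ₗ as → f a ≡ true
allL-sound f (a ∷ as) ok (Any.here refl) = proj₁ (if-true ok)
allL-sound f (a ∷ as) ok (Any.there a∈)  = allL-sound f as (proj₂ (if-true {f a} ok)) a∈

opaque
  unfolding soundPlaceB

  sound₂₂ : allL (soundPlaceB sums₂₂) places₂₂ ≡ true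
  sound₂₂ = refl

  sound₁₃ : allL (soundPlaceB sums₁₃) places₁₃ ≡ true
  sound₁₃ = refl

opaque
  unfolding Every sure-test sure autoB

  -- A budget of 8 for eight cells is no restriction: all 256 tables are checked, and this justifies
  -- the counting rule in `sure`.
  every-sure : ∀ δ → Every 3 8 (sure-test δ)
  every-sure true  = refl
  every-sure false = refl

opaque
  unfolding Every test₂₂ lone sure

  -- Of at most 15 green vectors the 3 · 3 sums take nine, leaving six outside the hyperplane.
  every₂₂ : Every 4 6 (test₂₂ (List.map cells places₂₂))
  every₂₂ = refl

tab-at : {A : Set} (t : Tab A n) → tab (at {n} t) ≡ t
tab-at {zero}  t       = refl
tab-at {suc n} (s , t) = cong₂ _,_ (tab-at {n} s) (tab-at {n} t)

card-≤-2^ : ∀ n (T : Colouring n) → card n T ≤ 2 ^ n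
card-≤-2^ n T = ≤-trans (ℕₚ.m≤m+n _ _) (≤-reflexive (card-opp n T))

card-card₀ : ∀ n {T : Colouring n} → T 𝟘 ≡ false → card n T ≡ card₀ n T
card-card₀ zero    {T} e rewrite e = refl
card-card₀ (suc n) {T} e = cong (_+ card n (T ∘ (true ∷_))) (card-card₀ n e)

module Coordinates₅ {T : Colouring 5} (T𝟘 : T 𝟘 ≡ false) (noBi : NoBi T) (connR : Conn (opp T) Whole) (small : card₀ 5 T ≤ 15)
  (first : T (true ∷ 𝟘) ≡ true) (another : ∃[ s ] (s ≢ 𝟘 × T (true ∷ s) ≡ true)) where

  G₀ : Colouring 4
  G₀ = T ∘ (true ∷_)

  G : Tab Bool 4
  G = tab G₀

  no-bi : (B : Mat 4 5) → Inj B → ¬ BiConn T (_∈im B)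
  no-bi B Bi = noBi (im-subspace B) (comb B ⁅ zero ⁆ , (⁅ zero ⁆ , refl) , λ e → contradiction (ker Bi _ e) λ ()) (outside ≤-refl B)

  frame-eval : ∀ p b y → comb (frame₄ p) (b ∷ y) ≡ b · (true ∷ Place.s p) ⊕ (false ∷ comb (dirs p) y)
  frame-eval p b y = cong (b · (true ∷ Place.s p) ⊕_) (comb-map-false (dirs p) y)

  H-value : ∀ p y → T (comb (frame₄ p) (false ∷ y)) ≡ T (false ∷ comb (dirs p) y)
  H-value p y = cong T (trans (frame-eval p false y) (cong (false ∷_) (⊕-idˡ _)))

  z-value : ∀ p y → T (comb (frame₄ p) (true ∷ y)) ≡ at {3} (colours G p) y
  z-value p y = trans (cong T (frame-eval p true y)) (sym (trans (at-map {3} (at {4} G) (cells p) y)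
    (trans (cong (at {4} G) (at-tab (λ x → Place.s p ⊕ comb (dirs p) x) y)) (at-tab G₀ _))))

  -- The frame of a place spans a hyperplane of the five-dimensional space. By `sure` it is
  -- connected in both colours, against minimality.
  place-impossible : (S : Sums) → (∀ y → S y ≡ true → T (false ∷ y) ≡ true) → ∀ p → soundPlaceB S p ≡ true →
    ∀ δ → (δ ≡ true → ∀ y → y ≢ 𝟘 → T (false ∷ comb (dirs p) (false ∷ y)) ≡ false) → sure δ (colours G p) ≡ true → ⊥
  place-impossible S S-green p ok δ red sure-ρ = no-bi (frame₄ p) (proj₁ sp)
    (autoB-sound (green-at δ ρ) (frame₄ p) (proj₁ both) (proj₁ sp) greens , autoB-sound (red-at δ ρ) (frame₄ p) (proj₂ both) (proj₁ sp) reds)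
    where
    ρ = colours G p
    sp : Inj (frame₄ p) × (∀ y → S (comb (dirs p) (true ∷ y)) ≡ true)
    sp = soundPlaceB-sound S p ok
    both : autoB (green-at δ ρ) ≡ true × autoB (red-at δ ρ) ≡ true
    both = sure-test-sound (subst (λ t → sure-test δ t (8 ∸ card 3 (at {3} ρ)) ≡ true) (tab-at {3} ρ)
      (every (every-sure δ) (at {3} ρ) (card-≤-2^ 3 (at {3} ρ)))) sure-ρ
    greens : ∀ x → green-at δ ρ x ≡ true → T (comb (frame₄ p) x) ≡ true
    greens (true ∷ x)          e = trans (z-value p x) e
    greens (false ∷ true ∷ y)  _ = trans (H-value p (true ∷ y)) (S-green _ (proj₂ sp y))
    reds : ∀ x → red-at δ ρ x ≡ true → opp T (comb (frame₄ p) x) ≡ true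
    reds (true ∷ x)          e = trans (cong not (z-value p x)) e
    reds (false ∷ false ∷ y) e with isZero y in ey
    ... | false = cong not (trans (H-value p (false ∷ y)) (red e y λ { refl → contradiction (trans (sym (isZero-𝟘 2)) ey) λ () }))

  not-lone : lone G ≡ true → ⊥
  not-lone e = let s , s≢ , Ts = another in
    contradiction (trans (sym (cong not (trans (at-tab G₀ s) Ts))) (lone-sound G e s s≢)) λ ()

  G𝟘 : at {4} G 𝟘 ≡ true
  G𝟘 = trans (at-tab G₀ 𝟘) first

  two-two : (∀ y → sums₂₂ y ≡ true → T (false ∷ y) ≡ true) → (cs : List (Tab (V 4) 3)) →
    (∀ {x} → x ∈ₗ cs → ∃[ p ] (soundPlaceB sums₂₂ p ≡ true × x ≡ cells p)) → Every 4 6 (test₂₂ cs) → ⊥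
  two-two S-green cs sound ok = found (test₂₂-sound (every ok G₀ few-greens) G𝟘 not-lone)
    where
    few-greens : card 4 G₀ ≤ 6
    few-greens = ℕₚ.+-cancelˡ-≤ 9 _ 6 (≤-trans (ℕₚ.+-monoˡ-≤ _ (card₀-≤ 4 {sums₂₂} λ y _ → S-green y)) small)
    found : ∃[ c ] (c ∈ₗ cs × sure false (mapTab 3 (at {4} G) c) ≡ true) → ⊥
    found (c , c∈ , e) = at-place (sound c∈) e
      where
      at-place : ∃[ p ] (soundPlaceB sums₂₂ p ≡ true × c ≡ cells p) → sure false (mapTab 3 (at {4} G) c) ≡ true → ⊥
      at-place (p , p-ok , refl) = place-impossible sums₂₂ S-green p p-ok false (λ ())

  module OneThree (S-green : ∀ y → sums₁₃ y ≡ true → T (false ∷ y) ≡ true) (cs : List Cand)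
    (sound : ∀ {x} → x ∈ₗ cs → soundPlaceB sums₁₃ (proj₁ x) ≡ true × proj₂ x ≡ cells (proj₁ x)) where
    D₀ : Colouring 3
    D₀ = T ∘ (false ∷_) ∘ (false ∷_)
    D : Tab Bool 3
    D = tab D₀
    c = T (false ∷ true ∷ 𝟘)

    colour-eq : ∀ v → colour₁₃ D c G v ≡ T v
    colour-eq (true ∷ s)          = at-tab G₀ s
    colour-eq (false ∷ false ∷ y) = at-tab D₀ y
    colour-eq (false ∷ true ∷ y) with isZero y in e
    ... | true  = cong (λ t → T (false ∷ true ∷ t)) (sym (isZero-sound y e))
    ... | false = sym (S-green (true ∷ y) (cong not e))

    cand-impossible : ∀ {p x} → (p , x) ∈ₗ cs → ∀ δ → (δ ≡ true → ∀ y → y ≢ 𝟘 → T (false ∷ comb (dirs p) (false ∷ y)) ≡ false) →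
      sure δ (mapTab 3 (at {4} G) x) ≡ true → ⊥
    cand-impossible {p} x∈ δ red e with sound x∈
    ... | p-ok , refl = place-impossible sums₁₃ S-green p p-ok δ red e

    redVector-sound : ∀ u → redVector D u ≡ true → T (false ∷ u) ≡ false
    redVector-sound (false ∷ y) e = Boolₚ.not-injective (trans (cong not (sym (at-tab D₀ y))) e)

    red-dirs : ∀ p → redB D p ≡ true → ∀ y → y ≢ 𝟘 → T (false ∷ comb (dirs p) (false ∷ y)) ≡ false
    red-dirs p ok (false ∷ false ∷ []) y≢ = contradiction refl y≢
    red-dirs p ok (true ∷ false ∷ [])  _  = trans (cong (λ t → T (false ∷ t)) (xor-solve (Place.e p ∷ []) (:0 :+ (x₀ :+ (:0 :+ :0))) x₀ refl))
      (redVector-sound _ (proj₁ (redB-sound D p ok)))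
    red-dirs p ok (false ∷ true ∷ [])  _  = trans (cong (λ t → T (false ∷ t)) (xor-solve (Place.e′ p ∷ []) (:0 :+ (:0 :+ (x₀ :+ :0))) x₀ refl))
      (redVector-sound _ (proj₁ (proj₂ (redB-sound D p ok))))
    red-dirs p ok (true ∷ true ∷ [])   _  = trans (cong (λ t → T (false ∷ t)) (xor-solve (Place.e p ∷ Place.e′ p ∷ []) (:0 :+ (x₀ :+ (x₁ :+ :0))) (x₀ :+ x₁) refl))
      (redVector-sound _ (proj₂ (proj₂ (redB-sound D p ok))))

    bi-impossible : ∀ B → biB (colour₁₃ D c G) B ≡ true → ⊥
    bi-impossible B ok = let Bi , gr , rd = biB-sound (colour₁₃ D c G) B ok in no-bi B Bi
      ( autoB-sound (colour₁₃ D c G ∘ comb B) B gr Bi (λ x e → trans (sym (colour-eq _)) e)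
      , autoB-sound (opp (colour₁₃ D c G) ∘ comb B) B rd Bi (λ x e → trans (cong not (sym (colour-eq _))) e))

    settled-impossible : settled cs c G D ≡ true → ⊥
    settled-impossible ok = [ (λ ((p , x) , x∈ , e) → cand-impossible x∈ (redB D p) (red-dirs p) e) ,
      [ (λ (B , e) → bi-impossible B e) ,
        (λ (M , e) → sepB-sound (colour₁₃ D c G) M e
          (conn-cong (λ _ → id) (λ _ → id) (λ v _ _ t → trans (cong not (colour-eq v)) t) connR)) ]′ ]′
      (settled-sound ok λ e → contradiction (trans (sym e) (trans (at-tab D₀ 𝟘) T𝟘)) λ ())

    budget : (card 3 D₀ + card 3 (T ∘ (false ∷_) ∘ (true ∷_))) + card 4 G₀ ≤ 15
    budget = subst (λ t → (t + card 3 (T ∘ (false ∷_) ∘ (true ∷_))) + card 4 G₀ ≤ 15) (sym (card-card₀ 3 {D₀} T𝟘)) small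

    sum-count : card 3 (λ y → not (isZero y)) ≤ card 3 (T ∘ (false ∷_) ∘ (true ∷_))
    sum-count = card-≤ 3 λ y e → S-green (true ∷ y) e

    -- The seven sums are green in any case; j is 1 or 0 according to whether the generator of ⟨C⟩
    -- is green as well. What remains of 15 ∸ 7 after G bounds the green vectors of ⟨D⟩.
    room : ∀ j → 7 + j ≤ card 3 (T ∘ (false ∷_) ∘ (true ∷_)) → j + card 3 D₀ ≤ 8 ∸ card 4 G₀
    room j le = ℕₚ.m+n≤o⇒m≤o∸n (j + card 3 D₀) (ℕₚ.+-cancelˡ-≤ 7 _ 8 (≤-trans (≤-reflexive (rearrange j (card 3 D₀) (card 4 G₀)))
      (≤-trans (ℕₚ.+-monoˡ-≤ (card 4 G₀) (ℕₚ.+-monoʳ-≤ (card 3 D₀) le)) budget)))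
      where
      rearrange : ∀ j d g → 7 + ((j + d) + g) ≡ (d + (7 + j)) + g
      rearrange j d g = trans (sym (ℕₚ.+-assoc 7 (j + d) g)) (cong (_+ g) (trans (sym (ℕₚ.+-assoc 7 j d)) (ℕₚ.+-comm (7 + j) d)))

    greens≤8 : card 4 G₀ ≤ 8
    greens≤8 = ℕₚ.+-cancelˡ-≤ 7 _ 8 (≤-trans (ℕₚ.+-monoˡ-≤ (card 4 G₀) (≤-trans sum-count (ℕₚ.m≤n+m _ (card 3 D₀)))) budget)

    one-three : Every 4 8 (test₁₃ cs) → ⊥
    one-three ok = [ (λ ((p , x) , x∈ , e) → cand-impossible x∈ false (λ ()) e) , (λ (red-c , green-c) → by-c red-c green-c c refl) ]′
      (test₁₃-sound (every ok G₀ greens≤8) G𝟘 not-lone)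
      where
      by-c : allTab 3 (8 ∸ card 4 G₀) (λ D _ → settled cs false G D) ≡ true →
        less (8 ∸ card 4 G₀) (λ j → allTab 3 j (λ D _ → settled cs true G D)) ≡ true → ∀ b → c ≡ b → ⊥
      by-c red-c green-c false eq = settled-impossible (subst (λ b → settled cs b G D ≡ true) (sym eq)
        (allTab-sound 3 (8 ∸ card 4 G₀) red-c D₀ (room 0 sum-count)))
      by-c red-c green-c true eq = settled-impossible (subst (λ b → settled cs b G D ≡ true) (sym eq)
        (fits (8 ∸ card 4 G₀) (room 1 (card-≤ 3 {λ _ → true} all-green)) green-c))
        where
        all-green : ∀ y → true ≡ true → T (false ∷ true ∷ y) ≡ true
        all-green y _ with isZero y in e
        ... | true  = trans (cong (λ t → T (false ∷ true ∷ t)) (isZero-sound y e)) eq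
        ... | false = S-green (true ∷ y) (cong not e)
        fits : ∀ k → 1 + card 3 D₀ ≤ k → less k (λ j → allTab 3 j (λ D _ → settled cs true G D)) ≡ true →
          settled cs true G D ≡ true
        fits (suc j) (s≤s le) ok = allTab-sound 3 j ok D₀ le

opaque
  unfolding Every test₁₃ lone settled sure redB biB sepB autoB

  -- The budget 8 is what the seven sums leave of 15.
  every₁₃ : Every 4 8 (test₁₃ (cands places₁₃))
  every₁₃ = refl

-- The connected hyperplane from `ear-hyper` has rank 4, and red splits on it. A basis C ++ D of the
-- resulting join, preceded by z, gives the coordinates of `Coordinates₅`, with shape 1 + 3 or 2 + 2
-- up to exchange of the parts.
card-lower : {T : Colouring 5} → Conn T Whole → Conn (opp T) Whole → NoBi T → ¬ Pat T → card₀ 5 T ≤ 15 → ⊥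
card-lower {T} cT cR noBi noPat small = ear-hyper (s≤s (s≤s (s≤s (s≤s z≤n)))) cT noPat at-hyper
  where
  at-hyper : Hyper T → ⊥
  at-hyper H = joined (split⇒join {S = T} φ-inj 2≤rk π π-resp π-cuts)
    where
    open HyperSide cT noBi H (s≤s (s≤s (s≤s z≤n)))
    rk≡4 : rk ≡ 4
    rk≡4 = ℕₚ.suc-injective (hyper-size H)
    2≤rk : 2 ≤ rk
    2≤rk = subst (2 ≤_) (sym rk≡4) (s≤s (s≤s z≤n))
    φ-inj : Inj φ
    φ-inj = mkInj λ y e → trans (sym (β-φ y)) (trans (cong (ap β) e) (ap-𝟘 β))
    joined : Join T (_∈im φ) → ⊥
    joined J = shape a b C D a+b≡4 1≤a 1≤b inj spans inside sums
      where
      open Join J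
      a+b≡4 : a + b ≡ 4
      a+b≡4 = trans (ℕₚ.≤-antisym (Inj-im-size inj λ i → inside _ (_ , comb-unit (C ++ D) i)) (Inj-im-size φ-inj λ i → spans _ (_ , comb-unit φ i))) rk≡4
      Shape : ℕ → ℕ → Set
      Shape a b = (C : Mat a 5) (D : Mat b 5) → a + b ≡ 4 → 1 ≤ a → 1 ≤ b → Inj (C ++ D) → (∀ v → v ∈im φ → v ∈im (C ++ D)) →
        (∀ v → v ∈im (C ++ D) → v ∈im φ) → (∀ x y → x ≢ 𝟘 → y ≢ 𝟘 → T (comb C x ⊕ comb D y) ≡ true) → ⊥
      module Standard {E : Mat 4 5} (E-inj : Inj E) (E-spans : ∀ v → v ∈im φ → v ∈im E) (E-inside : ∀ v → v ∈im E → v ∈im φ) where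
        B : Mat 5 5
        B = z ∷ E
        B-inj : Inj B
        B-inj = Inj-∷ E-inj λ z∈ → z∉ (α-im (E-inside z z∈))
        open Rebase T B B-inj using (onto; conn′; noBi′)
        -- The colour at 𝟘 is set to red so that counting over whole tables agrees with counting
        -- nonzero vectors.
        T₁ : Colouring 5
        T₁ v = if isZero v then false else T (comb B v)
        T₁≡ : ∀ v → v ≢ 𝟘 → T₁ v ≡ T (comb B v)
        T₁≡ v v≢ with isZero v in e
        ... | true  = contradiction (isZero-sound v e) v≢
        ... | false = refl
        from₁ : ∀ {W} → Conn T₁ W → Conn (T ∘ comb B) W
        from₁ = conn-cong (λ _ → id) (λ _ → id) λ v v≢ _ e → trans (sym (T₁≡ v v≢)) e
        from₁′ : ∀ {W} → Conn (opp T₁) W → Conn (opp (T ∘ comb B)) W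
        from₁′ = conn-cong (λ _ → id) (λ _ → id) λ v v≢ _ e → trans (sym (cong not (T₁≡ v v≢))) e
        second₁ : ∃[ s ] (s ≢ 𝟘 × T₁ (true ∷ s) ≡ true)
        second₁ = by-coeff (onto z′)
          where
          by-coeff : z′ ∈im B → ∃[ s ] (s ≢ 𝟘 × T₁ (true ∷ s) ≡ true)
          by-coeff (false ∷ s , e) = contradiction (α-im (E-inside z′ (s , trans (sym (⊕-idˡ _)) e))) z′∉
          by-coeff (true ∷ s , e)  = s , (λ { refl → z′≢z (trans (sym e) (comb-unit B zero)) }) , trans (cong T e) z′∈T
        module Std₅ = Coordinates₅ {T₁} refl
          (λ {W} sub ne out (c , c′) → noBi′ noBi sub ne out (from₁ c , from₁′ c′))
          (conn-cong (λ _ → id) (λ _ → id) (λ v v≢ _ e → trans (cong not (T₁≡ v v≢)) e) (conn-absolute B-inj (conn-cong (λ v _ → onto v) (λ _ _ → tt) (λ _ _ _ → id) cR)))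
          (≤-trans (card₀-≤ 5 {T₁} {T ∘ comb B} λ v v≢ e → trans (sym (T₁≡ v v≢)) e) (≤-trans (card₀-rebase {T = T} B-inj) small))
          (trans (cong T (comb-unit B zero)) z∈T) second₁
      one-three : Shape 1 3
      one-three C@(v ∷ []) D _ _ _ inj spans inside sums = Std₅.OneThree.one-three S-green (cands places₁₃) sound every₁₃
        where
        open Standard inj spans inside
        S-green : ∀ y → sums₁₃ y ≡ true → T₁ (false ∷ y) ≡ true
        S-green (true ∷ y) e = trans (cong T (trans (⊕-idˡ _) (cong (_⊕ comb D y) (sym (⊕-idʳ v)))))
          (sums (true ∷ []) y (λ ()) λ { refl → contradiction e λ () })
        sound : ∀ {x} → x ∈ₗ cands places₁₃ → soundPlaceB sums₁₃ (proj₁ x) ≡ true × proj₂ x ≡ cells (proj₁ x)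
        sound x∈ with p , p∈ , refl ← ∈-map⁻ (λ p → p , cells p) x∈ = allL-sound (soundPlaceB sums₁₃) places₁₃ sound₁₃ p∈ , refl
      two-two : Shape 2 2
      two-two C D _ _ _ inj spans inside sums = Std₅.two-two S-green (List.map cells places₂₂) sound every₂₂
        where
        open Standard inj spans inside
        S-green : ∀ y → sums₂₂ y ≡ true → T₁ (false ∷ y) ≡ true
        S-green (a ∷ b ∷ y) e = trans (T₁≡ _ λ q → nz a b e (cong (Vec.tail) q)) (trans (cong T (trans (⊕-idˡ _) (comb-++ C D (a ∷ b ∷ []) y)))
          (sums (a ∷ b ∷ []) y (λ q → x≢ a b e q) λ q → y≢ a b e q))
          where
          x≢ : ∀ a b → sums₂₂ (a ∷ b ∷ y) ≡ true → (a ∷ b ∷ []) ≢ 𝟘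
          x≢ false false () refl
          y≢ : ∀ a b → sums₂₂ (a ∷ b ∷ y) ≡ true → y ≢ 𝟘
          y≢ a b e refl with isZero (a ∷ b ∷ [])
          y≢ a b () refl | true
          y≢ a b () refl | false
          nz : ∀ a b → sums₂₂ (a ∷ b ∷ y) ≡ true → (a ∷ b ∷ y) ≢ 𝟘
          nz a b e q = y≢ a b e (cong (Vec.tail ∘ Vec.tail) q)
        sound : ∀ {x} → x ∈ₗ List.map cells places₂₂ → ∃[ p ] (soundPlaceB sums₂₂ p ≡ true × x ≡ cells p)
        sound x∈ with p , p∈ , refl ← ∈-map⁻ cells x∈ = p , allL-sound (soundPlaceB sums₂₂) places₂₂ sound₂₂ p∈ , refl
      shape : ∀ a b → Shape a b
      shape 1 3 = one-three
      shape 2 2 = two-two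
      shape 3 1 C D _ _ _ inj spans inside sums = one-three D C refl (s≤s z≤n) (s≤s z≤n) (Inj-swap C D inj)
        (λ v v∈ → ∈im-swap C D (spans v v∈)) (λ v v∈ → inside v (∈im-swap D C v∈))
        λ x y x≢ y≢ → trans (cong T (⊕-comm _ _)) (sums y x y≢ x≢)
      shape 0 _ _ _ _ ()
      shape (suc (suc (suc (suc a)))) (suc b) C D e = contradiction (trans (sym (ℕₚ.+-suc a b)) (ℕₚ.suc-injective (ℕₚ.suc-injective (ℕₚ.suc-injective (ℕₚ.suc-injective e))))) λ ()
      shape (suc (suc (suc (suc _)))) 0 _ _ _ _ ()
      shape 1 0 _ _ ()
      shape 1 1 _ _ ()
      shape 1 2 _ _ ()
      shape 1 (suc (suc (suc (suc _)))) _ _ ()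
      shape 2 0 _ _ ()
      shape 2 1 _ _ ()
      shape 2 (suc (suc (suc _))) _ _ ()
      shape 3 0 _ _ ()
      shape 3 (suc (suc _)) _ _ ()

rank₅ : {T : Colouring 5} → Conn T Whole → Conn (opp T) Whole → NoBi T → ¬ Pat T → ¬ Pat (opp T) → ⊥
rank₅ {T} cT cR noBi noT noR with card₀ 5 T ℕ.≤? 15
... | yes le = card-lower cT cR noBi noT le
... | no ≰15 = card-lower cR (opp-conn cT) (NoBi-opp noBi) noR
  (ℕₚ.+-cancelˡ-≤ 16 _ 15 (≤-trans (ℕₚ.+-monoˡ-≤ _ (ℕₚ.≰⇒> ≰15)) (≤-reflexive (ℕₚ.suc-injective (card₀-opp 5 T)))))

-- Induction on the rank

no-biconn : ∀ n → 2 ≤ n → {T : Colouring n} → Conn T Whole → Conn (opp T) Whole → ¬ Pat T → ¬ Pat (opp T) → ⊥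
no-biconn = <-rec _ step
  where
  Claim : ℕ → Set
  Claim n = 2 ≤ n → {T : Colouring n} → Conn T Whole → Conn (opp T) Whole → ¬ Pat T → ¬ Pat (opp T) → ⊥
  step : ∀ n → (∀ {m} → m < n → Claim m) → Claim n
  step n rec 2≤n {T} cT cR noT noR = by-rank n rec 2≤n cT cR noT noR noBi
    where
    noBi : NoBi T
    noBi {W} sub (u , Wu , u≢) (v , ¬Wv) (c , c′) = go _ rows inj spans inside
      where
      open Basis (basis-of sub)
      go : ∀ k (φ : Mat k n) → Inj φ → (∀ v → W v → v ∈im φ) → (∀ v → v ∈im φ → W v) → ⊥
      go zero [] _ sp _ with [] , e ← sp u Wu = u≢ (sym e)
      -- On a line one colour misses the only nonzero vector w and constrains no map there; since n
      -- is at least 2, some map sends w to a vector other than 𝟘 and w.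
      go (suc zero) (w ∷ []) φi sp ins = single (T w) refl
        where
        w≢ : w ≢ 𝟘
        w≢ e = contradiction (ker φi (true ∷ []) (trans (⊕-idʳ w) e)) λ ()
        Ww : W w
        Ww = ins w (⁅ zero ⁆ , comb-unit (w ∷ []) zero)
        moved : ∃[ t ] (t ≢ 𝟘 × t ≢ w)
        moved = avoid-two 2≤n w
        two-points : ∀ {v} → W v → v ≡ 𝟘 ⊎ v ≡ w
        two-points Wv with sp _ Wv
        ... | true ∷ []  , e = inj₂ (trans (sym e) (⊕-idʳ w))
        ... | false ∷ [] , e = inj₁ (trans (sym e) (⊕-idˡ 𝟘))
        i = proj₁ (≢𝟘-bit w w≢)
        π = functional idL i (proj₁ moved)
        πw : ap π w ≡ proj₁ moved
        πw = cong (_· proj₁ moved) (proj₂ (≢𝟘-bit w w≢))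
        vacuous : ∀ {S} → S w ≡ false → Conn S W → ⊥
        vacuous {S} Sw c with triv c π resp
          where
          resp : Resp S W π
          resp v Wv Sv with two-points Wv
          ... | inj₁ refl = inj₁ (ap-𝟘 π)
          ... | inj₂ refl = contradiction (trans (sym Sv) Sw) λ ()
        ... | inj₁ z = proj₁ (proj₂ moved) (trans (sym πw) (z w Ww))
        ... | inj₂ f = proj₂ (proj₂ moved) (trans (sym πw) (f w Ww))
        single : ∀ b → T w ≡ b → ⊥
        single true  e = vacuous (cong not e) c′
        single false e = vacuous e c
      go (suc (suc k)) φ φi sp ins = rec (≤-trans (Inj-size (Inj-∷ φi λ v∈ → ¬Wv (ins v v∈))) ≤-refl) (s≤s (s≤s z≤n))
        (conn-absolute φi (conn-cong sp ins (λ _ _ _ → id) c)) (conn-absolute φi (conn-cong sp ins (λ _ _ _ → id) c′)) (noT ∘ pat-map φi) (noR ∘ pat-map φi)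
    by-rank : ∀ n → (∀ {m} → m < n → Claim m) → 2 ≤ n → {T : Colouring n} → Conn T Whole → Conn (opp T) Whole → ¬ Pat T → ¬ Pat (opp T) → NoBi T → ⊥
    by-rank 0 _ ()
    by-rank 1 _ (s≤s ())
    by-rank 2 _ _ cT cR noT noR _ = rank₂ cT cR noT
    by-rank 3 _ _ cT cR noT noR _ = rank₃ cT cR noT
    by-rank 4 _ _ cT cR noT noR _ = rank₄ cT cR noT noR
    by-rank 5 _ _ cT cR noT noR noBi = rank₅ cT cR noBi noT noR
    by-rank (suc (suc (suc (suc (suc (suc n)))))) _ _ cT cR noT noR noBi =
      ear-hyper (s≤s (s≤s (s≤s (s≤s z≤n)))) cT noT λ HT → ear-hyper (s≤s (s≤s (s≤s (s≤s z≤n)))) cR noR λ HR →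
        TwoHypers.contradictory (s≤s (s≤s (s≤s (s≤s (s≤s (s≤s z≤n)))))) cT cR noBi HT HR

-- Binary matroids and their representations

⊆-bit : {X Y : Subset n} → X ⊆ₛ Y → ∀ {i} → lookup X i ≡ true → lookup Y i ≡ true
⊆-bit X⊆Y e = ∈⇒true (X⊆Y (true⇒∈ e))

⊕-⊆ : {X Y Z : Subset n} → X ⊆ₛ Z → Y ⊆ₛ Z → X ⊕ Y ⊆ₛ Z
⊕-⊆ {X = X} {Y} X⊆ Y⊆ {i} i∈ with true-or-false (lookup X i)
... | inj₁ e = X⊆ (true⇒∈ e)
... | inj₂ e = Y⊆ (true⇒∈ (trans (sym (cong (_xor lookup Y i) e)) (trans (sym (bit-xor X Y i)) (∈⇒true i∈))))

-- For Z ⊆ Y nonempty, Y ⊕ Z is the difference and has fewer elements.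
⊕-smaller : {Y Z : Subset n} → Z ⊆ₛ Y → Z ≢ 𝟘 → ∣ Y ⊕ Z ∣ < ∣ Y ∣
⊕-smaller {Y = Y} {Z} Z⊆Y Z≢ = Subₚ.p⊂q⇒∣p∣<∣q∣ (⊕-⊆ Subₚ.⊆-refl Z⊆Y , i , Z⊆Y (true⇒∈ Zi) ,
  λ i∈ → contradiction (trans (sym (∈⇒true i∈)) (trans (bit-xor Y Z i) (cong₂ _xor_ (⊆-bit Z⊆Y Zi) Zi))) λ ())
  where
  i = proj₁ (≢𝟘-bit Z Z≢)
  Zi = proj₂ (≢𝟘-bit Z Z≢)

proper-smaller : {Y Z : Subset n} → Z ⊆ₛ Y → Z ≢ Y → ∣ Z ∣ < ∣ Y ∣
proper-smaller {Y = Y} {Z} Z⊆Y Z≢Y = subst (λ t → ∣ t ∣ < ∣ Y ∣) (⊕-cancel Y Z)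
  (⊕-smaller {Y = Y} {Y ⊕ Z} (⊕-⊆ Subₚ.⊆-refl Z⊆Y) λ e → Z≢Y (sym (⊕-≡𝟘 e)))

size-induction : (P : Subset n → Set) → (∀ Y → (∀ Z → ∣ Z ∣ < ∣ Y ∣ → P Z) → P Y) → ∀ Y → P Y
size-induction P step Y = <-rec (λ s → ∀ Y → ∣ Y ∣ ≡ s → P Y)
  (λ s rec Y e → step Y λ Z lt → rec (subst (∣ Z ∣ <_) e lt) Z refl) ∣ Y ∣ Y refl

Dependency : (Fin r → V n) → Subset r → Set
Dependency φ X = ∃[ Z ] (Z ⊆ₛ X × Z ≢ 𝟘 × vsum φ Z ≡ 𝟘)

abstract
  dependency? : (φ : Fin r → V n) (X : Subset r) → Dec (Dependency φ X)
  dependency? φ X = search-V λ Z → (Z Subₚ.⊆? X) ×-dec (¬? (Z ≟V 𝟘) ×-dec (vsum φ Z ≟V 𝟘))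

no-dependency : {φ : Fin r → V n} {X : Subset r} → ¬ Dependency φ X → LinIndep φ X
no-dependency none Z Z⊆ ne e = none (Z , Z⊆ , Nonempty⇒≢𝟘 ne , e)

indep⇒none : {φ : Fin r → V n} {X : Subset r} → LinIndep φ X → ¬ Dependency φ X
indep⇒none li (Z , Z⊆ , Z≢ , e) = li Z Z⊆ (≢𝟘⇒Nonempty Z≢) e

LinIndep? : (φ : Fin r → V n) (X : Subset r) → Dec (LinIndep φ X)
LinIndep? φ X = Dec.map′ no-dependency indep⇒none (¬? (dependency? φ X))

LinIndep-⊆ : {φ : Fin r → V n} {X Y : Subset r} → X ⊆ₛ Y → LinIndep φ Y → LinIndep φ X
LinIndep-⊆ X⊆Y li Z Z⊆ = li Z λ z∈ → X⊆Y (Z⊆ z∈)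

-- Uniqueness of binary representations: dependent sets are built up from circuits, and a circuit sums to zero in either representation.
zero-transfer : (φ : Fin r → V n) (ψ : Fin r → V k) → (∀ Y → LinIndep φ Y ⇔ LinIndep ψ Y) → ∀ Y → vsum φ Y ≡ 𝟘 → vsum ψ Y ≡ 𝟘
zero-transfer {r} φ ψ same = size-induction (λ Y → vsum φ Y ≡ 𝟘 → vsum ψ Y ≡ 𝟘) step
  where
  step : ∀ Y → (∀ Z → ∣ Z ∣ < ∣ Y ∣ → vsum φ Z ≡ 𝟘 → vsum ψ Z ≡ 𝟘) → vsum φ Y ≡ 𝟘 → vsum ψ Y ≡ 𝟘
  step Y rec e with search-V (λ Z → (Z Subₚ.⊆? Y) ×-dec (¬? (Z ≟V 𝟘) ×-dec (¬? (Z ≟V Y) ×-dec (vsum φ Z ≟V 𝟘))))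
  ... | yes (Z , Z⊆ , Z≢ , Z≢Y , eZ) = begin
    vsum ψ Y                    ≡⟨ cong (vsum ψ) (xor-solve (Y ∷ Z ∷ []) x₀ (x₁ :+ (x₀ :+ x₁)) refl) ⟩
    vsum ψ (Z ⊕ (Y ⊕ Z))        ≡⟨ vsum-⊕ ψ Z (Y ⊕ Z) ⟩
    vsum ψ Z ⊕ vsum ψ (Y ⊕ Z)   ≡⟨ cong₂ _⊕_ (rec Z (proper-smaller Z⊆ Z≢Y) eZ)
                                      (rec (Y ⊕ Z) (⊕-smaller Z⊆ Z≢) (trans (vsum-⊕ φ Y Z) (trans (cong₂ _⊕_ e eZ) (⊕-idˡ 𝟘)))) ⟩
    𝟘 ⊕ 𝟘                       ≡⟨ ⊕-idˡ 𝟘 ⟩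
    𝟘                           ∎
    where open ≡-Reasoning
  ... | no minimal with Y ≟V 𝟘 | dependency? ψ Y
  ...   | yes refl | _ = vsum-𝟘 ψ
  ...   | no Y≢ | no none = contradiction e (Equivalence.from (same Y) (no-dependency none) Y Subₚ.⊆-refl (≢𝟘⇒Nonempty Y≢))
  ...   | no Y≢ | yes (Z , Z⊆ , Z≢ , eZ) with Z ≟V Y
  ...     | yes refl = eZ
  ...     | no Z≢Y = contradiction eZ (Equivalence.to (same Z)
    (λ Z′ Z′⊆ ne e′ → minimal (Z′ , (λ z∈ → Z⊆ (Z′⊆ z∈)) , Nonempty⇒≢𝟘 ne ,
      (λ { refl → Z≢Y (Subₚ.⊆-antisym Z⊆ Z′⊆) }) , e′)) Z Subₚ.⊆-refl (≢𝟘⇒Nonempty Z≢))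

embed : (X : Subset r) → V ∣ X ∣ → Subset r
embed []          []      = []
embed (true ∷ X)  (b ∷ x) = b ∷ embed X x
embed (false ∷ X) x       = false ∷ embed X x

restrict : (X : Subset r) → Subset r → V ∣ X ∣
restrict []          []      = []
restrict (true ∷ X)  (b ∷ Z) = b ∷ restrict X Z
restrict (false ∷ X) (b ∷ Z) = restrict X Z

comb-embed : (M : Mat r n) (X : Subset r) (x : V ∣ X ∣) → comb (select M X) x ≡ comb M (embed X x)
comb-embed []      []          []      = refl
comb-embed (v ∷ M) (true ∷ X)  (b ∷ x) = cong (b · v ⊕_) (comb-embed M X x)
comb-embed (v ∷ M) (false ∷ X) x       = trans (comb-embed M X x) (sym (⊕-idˡ _))

embed-⊆ : (X : Subset r) (x : V ∣ X ∣) (i : Fin r) → lookup (embed X x) i ≡ true → lookup X i ≡ true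
embed-⊆ (true ∷ X)  (b ∷ x) zero    e = refl
embed-⊆ (true ∷ X)  (b ∷ x) (suc i) e = embed-⊆ X x i e
embed-⊆ (false ∷ X) x       (suc i) e = embed-⊆ X x i e

embed-𝟘 : (X : Subset r) (x : V ∣ X ∣) → embed X x ≡ 𝟘 → x ≡ 𝟘
embed-𝟘 []          []      e = refl
embed-𝟘 (true ∷ X)  (b ∷ x) e = cong₂ _∷_ (cong Vec.head e) (embed-𝟘 X x (cong Vec.tail e))
embed-𝟘 (false ∷ X) x       e = embed-𝟘 X x (cong Vec.tail e)

embed-restrict : (X Z : Subset r) → (∀ i → lookup Z i ≡ true → lookup X i ≡ true) → embed X (restrict X Z) ≡ Z
embed-restrict []          []          _ = refl
embed-restrict (true ∷ X)  (b ∷ Z)     f = cong (b ∷_) (embed-restrict X Z (f ∘ suc))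
embed-restrict (false ∷ X) (false ∷ Z) f = cong (false ∷_) (embed-restrict X Z (f ∘ suc))
embed-restrict (false ∷ X) (true ∷ Z)  f = contradiction (f zero refl) λ ()

module _ (φ : Fin r → V n) where
  rowsOf : (X : Subset r) → Mat ∣ X ∣ n
  rowsOf X = select (tabulate φ) X

  rowsOf-im : {X Z : Subset r} → Z ⊆ₛ X → vsum φ Z ∈im rowsOf X
  rowsOf-im {X} {Z} Z⊆ = restrict X Z , trans (comb-embed (tabulate φ) X _)
    (trans (cong (comb (tabulate φ)) (embed-restrict X Z λ i → ⊆-bit Z⊆)) (sym (vsum-comb φ Z)))

  im-rowsOf : {X : Subset r} {v : V n} → v ∈im rowsOf X → ∃[ Z ] (Z ⊆ₛ X × vsum φ Z ≡ v)
  im-rowsOf {X} (x , e) = embed X x , (λ i∈ → true⇒∈ (embed-⊆ X x _ (∈⇒true i∈))) ,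
    trans (vsum-comb φ (embed X x)) (trans (sym (comb-embed (tabulate φ) X x)) e)

  rowsOf-inj : {X : Subset r} → LinIndep φ X → Inj (rowsOf X)
  rowsOf-inj {X} li = mkInj λ x e → decidable-stable (x ≟V 𝟘) λ x≢ →
    li (embed X x) (λ i∈ → true⇒∈ (embed-⊆ X x _ (∈⇒true i∈))) (≢𝟘⇒Nonempty λ e′ → x≢ (embed-𝟘 X x e′))
      (trans (vsum-comb φ (embed X x)) (trans (sym (comb-embed (tabulate φ) X x)) e))

  element-im : {X : Subset r} {e : Fin r} → e ∈ₛ X → φ e ∈im rowsOf X
  element-im {X} {e} e∈ = subst (_∈im rowsOf X) (vsum-unit φ e) (rowsOf-im λ i∈ → subst (_∈ₛ X) (sym (Subₚ.x∈⁅y⁆⇒x≡y e i∈)) e∈)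

  add-indep : {X : Subset r} {e : Fin r} → LinIndep φ X → ¬ φ e ∈im rowsOf X → LinIndep φ (X ∪ ⁅ e ⁆)
  add-indep {X} {e} li e∉ Z Z⊆ ne eq with true-or-false (lookup Z e)
  ... | inj₂ off = li Z (λ {i} i∈ → within i i∈ (Subₚ.x∈p∪q⁻ X ⁅ e ⁆ (Z⊆ i∈))) ne eq
    where
    within : ∀ i → i ∈ₛ Z → i ∈ₛ X ⊎ i ∈ₛ ⁅ e ⁆ → i ∈ₛ X
    within i i∈Z (inj₁ i∈) = i∈
    within i i∈Z (inj₂ i∈) with refl ← Subₚ.x∈⁅y⁆⇒x≡y e i∈ = contradiction (trans (sym (∈⇒true i∈Z)) off) λ ()
  ... | inj₁ on = e∉ (subst (_∈im rowsOf X) value (rowsOf-im rest⊆))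
    where
    rest⊆ : Z ⊕ ⁅ e ⁆ ⊆ₛ X
    rest⊆ {i} i∈ with i Finₚ.≟ e
    ... | yes refl = contradiction (trans (sym (∈⇒true i∈)) (trans (bit-xor Z ⁅ e ⁆ e) (cong₂ _xor_ on (∈⇒true (Subₚ.x∈⁅x⁆ e))))) λ ()
    ... | no i≢e with true-or-false (lookup ⁅ e ⁆ i)
    ...   | inj₁ t = contradiction (Subₚ.x∈⁅y⁆⇒x≡y e (true⇒∈ t)) i≢e
    ...   | inj₂ f = [ id , (λ i∈e → contradiction (Subₚ.x∈⁅y⁆⇒x≡y e i∈e) i≢e) ]′ (Subₚ.x∈p∪q⁻ X ⁅ e ⁆ (Z⊆ (true⇒∈
      (trans (sym (Boolₚ.xor-identityʳ _)) (trans (cong (lookup Z i xor_) (sym f)) (trans (sym (bit-xor Z ⁅ e ⁆ i)) (∈⇒true i∈)))))))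
    value : vsum φ (Z ⊕ ⁅ e ⁆) ≡ φ e
    value = trans (vsum-⊕ φ Z ⁅ e ⁆) (trans (cong₂ _⊕_ eq (vsum-unit φ e)) (⊕-idˡ _))

  -- If no element of Y left the span of X, the independent rows of Y would lie in the span of fewer
  -- rows.
  steinitz : ∀ X Y → LinIndep φ X → LinIndep φ Y → ∣ X ∣ < ∣ Y ∣ → ∃[ e ] (e ∈ₛ Y × e ∉ₛ X × LinIndep φ (X ∪ ⁅ e ⁆))
  steinitz X Y liX liY lt with Finₚ.any? (λ e → (e Subₚ.∈? Y) ×-dec ¬? (φ e ∈im? rowsOf X))
  ... | yes (e , e∈ , e∉) = e , e∈ , (λ e∈X → e∉ (element-im e∈X)) , add-indep liX e∉
  ... | no none = contradiction (Inj-im-size (rowsOf-inj liY) λ i →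
      let j , j∈ , eq = row Y (tabulate φ) i in subst (_∈im rowsOf X) (sym (trans eq (lookup∘tabulate φ j)))
        (decidable-stable (φ j ∈im? rowsOf X) λ j∉ → none (j , true⇒∈ j∈ , j∉))) (ℕₚ.<⇒≱ lt)
    where
    row : ∀ {r n} (Y : Subset r) (M : Mat r n) (i : Fin ∣ Y ∣) → ∃[ j ] (lookup Y j ≡ true × lookup (select M Y) i ≡ lookup M j)
    row (true ∷ Y)  (v ∷ M) zero    = zero , refl , refl
    row (true ∷ Y)  (v ∷ M) (suc i) = let j , a , b = row Y M i in suc j , a , b
    row (false ∷ Y) (v ∷ M) i       = let j , a , b = row Y M i in suc j , a , b

vectorMatroid : (Fin r → V n) → Matroid
vectorMatroid {r} φ = record
  { sys      = record { size = r ; Indep = LinIndep φ }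
  ; indep-∅  = λ Z Z⊆ (i , i∈) → contradiction (Z⊆ i∈) Subₚ.∉⊥
  ; indep-⊆  = λ X Y → LinIndep-⊆
  ; exchange = steinitz φ }

size-add : (X : Subset r) (e : Fin r) → e ∉ₛ X → ∣ X ∪ ⁅ e ⁆ ∣ ≡ suc ∣ X ∣
size-add (true ∷ X)  zero    e∉ = contradiction Vec.here e∉
size-add (false ∷ X) zero    e∉ = cong suc (cong ∣_∣ (Subₚ.∪-identityʳ X))
size-add (true ∷ X)  (suc e) e∉ = cong suc (size-add X e (e∉ ∘ Vec.there))
size-add (false ∷ X) (suc e) e∉ = size-add X e (e∉ ∘ Vec.there)

-- Independence is decidable through φ, so the largest size of an independent subset is found by
-- descending from `E M`.
rank-exists : (M : Matroid) {φ : Fin (E M) → V k} → Represents M φ → (X : Subset (E M)) → ∃[ r ] RankOf M X r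
rank-exists M {φ} rep X = go (E M) λ J _ _ → Subₚ.∣p∣≤n J
  where
  sized? : ∀ s → Dec (∃[ J ] (J ⊆ₛ X × Ind M J × ∣ J ∣ ≡ s))
  sized? s = search-V λ J → (J Subₚ.⊆? X) ×-dec (Dec.map′ (Equivalence.from (rep J)) (Equivalence.to (rep J)) (LinIndep? φ J) ×-dec (∣ J ∣ ℕ.≟ s))
  go : ∀ s → (∀ J → J ⊆ₛ X → Ind M J → ∣ J ∣ ≤ s) → ∃[ r ] RankOf M X r
  go s bound with sized? s
  go s bound       | yes found = s , found , bound
  go zero bound    | no none   = contradiction (∅ , (λ i∈ → contradiction i∈ Subₚ.∉⊥) , indep-∅ M , Subₚ.∣⊥∣≡0 (E M)) none
  go (suc s) bound | no none   = go s λ J J⊆ ind → ℕₚ.≤-pred (ℕₚ.≤∧≢⇒< (bound J J⊆ ind) λ e → none (J , J⊆ , ind , e))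

rank-≤-dim : (M : Matroid) {φ : Fin (E M) → V k} → Represents M φ → ∀ {s} → RankIs M s → s ≤ k
rank-≤-dim M {φ} rep ((J , _ , ind , refl) , _) = Inj-size (rowsOf-inj φ (Equivalence.to (rep J) ind))

-- The image as a sum of unit vectors, so that `ap-vsum` applies to it; for injective f it agrees
-- with `image`.
push : (Fin r → Fin n) → Subset r → Subset n
push f = vsum (⁅_⁆ ∘ f)

vsum-additive : (φ : Fin r → V n) → r ⊸ n
vsum-additive φ = record { ap = vsum φ ; add = vsum-⊕ φ }

vsum-push : (φ : Fin n → V k) (f : Fin r → Fin n) (Z : Subset r) → vsum φ (push f Z) ≡ vsum (φ ∘ f) Z
vsum-push φ f Z = trans (ap-vsum (vsum-additive φ) (⁅_⁆ ∘ f) Z) (vsum-cong (λ j → vsum-unit φ (f j)) Z)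

push⁻ : (f : Fin r → Fin n) (Z : Subset r) (i : Fin n) → lookup (push f Z) i ≡ true → ∃[ j ] (lookup Z j ≡ true × f j ≡ i)
push⁻ f []      i e = contradiction (trans (sym e) (lookup-𝟘 i)) λ ()
push⁻ f (b ∷ Z) i e with true-or-false (lookup (push (f ∘ suc) Z) i)
... | inj₁ t = let j , a , c = push⁻ (f ∘ suc) Z i t in suc j , a , c
push⁻ f (true ∷ Z) i e | inj₂ off = zero , refl , sym (Subₚ.x∈⁅y⁆⇒x≡y (f zero) (true⇒∈ {Y = ⁅ f zero ⁆}
  (trans (sym (trans (bit-xor ⁅ f zero ⁆ _ i) (trans (cong (lookup ⁅ f zero ⁆ i xor_) off) (Boolₚ.xor-identityʳ _)))) e)))
push⁻ f (false ∷ Z) i e | inj₂ off = contradiction (trans (sym e) (trans (bit-xor 𝟘 _ i) (cong₂ _xor_ (lookup-𝟘 i) off))) λ ()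

push⁺ : (f : Fin r → Fin n) → (∀ {a b} → f a ≡ f b → a ≡ b) → (Z : Subset r) (j : Fin r) → lookup Z j ≡ true → lookup (push f Z) (f j) ≡ true
push⁺ f inj (true ∷ Z) zero e = trans (bit-xor ⁅ f zero ⁆ _ (f zero)) (cong₂ _xor_ (∈⇒true (Subₚ.x∈⁅x⁆ (f zero))) off)
  where
  off : lookup (push (f ∘ suc) Z) (f zero) ≡ false
  off with true-or-false (lookup (push (f ∘ suc) Z) (f zero))
  ... | inj₂ f′ = f′
  ... | inj₁ t with j , _ , c ← push⁻ (f ∘ suc) Z (f zero) t = contradiction (inj c) λ ()
push⁺ f inj (b ∷ Z) (suc j) e = trans (bit-xor (b · ⁅ f zero ⁆) _ (f (suc j))) (cong₂ _xor_ (off b) (push⁺ (f ∘ suc) (Finₚ.suc-injective ∘ inj) Z j e))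
  where
  off : ∀ b → lookup (b · ⁅ f zero ⁆) (f (suc j)) ≡ false
  off false = lookup-𝟘 (f (suc j))
  off true with true-or-false (lookup ⁅ f zero ⁆ (f (suc j)))
  ... | inj₂ f′ = f′
  ... | inj₁ t = contradiction (inj (Subₚ.x∈⁅y⁆⇒x≡y (f zero) (true⇒∈ {Y = ⁅ f zero ⁆} t))) λ ()

bits-ext : {X Y : Subset n} → (∀ i → lookup X i ≡ true → lookup Y i ≡ true) → (∀ i → lookup Y i ≡ true → lookup X i ≡ true) → X ≡ Y
bits-ext f g = Subₚ.⊆-antisym (λ {i} i∈ → true⇒∈ (f i (∈⇒true i∈))) (λ {i} i∈ → true⇒∈ (g i (∈⇒true i∈)))

module _ (f : Fin r → Fin n) (inj : ∀ {a b} → f a ≡ f b → a ≡ b) where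
  image-push : (Z : Subset r) → image f Z ≡ push f Z
  image-push Z = bits-ext forth back
    where
    found? : ∀ i → Dec (∃[ j ] (j ∈ₛ Z × f j ≡ i))
    found? i = Finₚ.any? λ j → (j Subₚ.∈? Z) ×-dec (f j Finₚ.≟ i)
    forth : ∀ i → lookup (image f Z) i ≡ true → lookup (push f Z) i ≡ true
    forth i e with found? i | trans (sym (lookup∘tabulate (λ i → ⌊ found? i ⌋) i)) e
    ... | yes (j , j∈ , refl) | _ = push⁺ f inj Z j (∈⇒true j∈)
    back : ∀ i → lookup (push f Z) i ≡ true → lookup (image f Z) i ≡ true
    back i e with j , a , c ← push⁻ f Z i e = trans (lookup∘tabulate (λ i → ⌊ found? i ⌋) i) (yes-true (found? i) (j , true⇒∈ a , c))
      where
      yes-true : {A : Set} (d : Dec A) → A → ⌊ d ⌋ ≡ true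
      yes-true (yes _) _ = refl
      yes-true (no ¬a) a = contradiction a ¬a

  LinIndep-push : (φ : Fin n → V k) (Z : Subset r) → LinIndep φ (push f Z) ⇔ LinIndep (φ ∘ f) Z
  LinIndep-push φ Z = mk⇔ to from
    where
    to : LinIndep φ (push f Z) → LinIndep (φ ∘ f) Z
    to li Z′ Z′⊆ ne e = li (push f Z′)
      (λ {i} i∈ → let j , a , c = push⁻ f Z′ i (∈⇒true i∈) in true⇒∈ (subst (λ t → lookup (push f Z) t ≡ true) c (push⁺ f inj Z j (⊆-bit Z′⊆ a))))
      (let j , j∈ = ne in f j , true⇒∈ (push⁺ f inj Z′ j (∈⇒true j∈))) (trans (vsum-push φ f Z′) e)
    from : LinIndep (φ ∘ f) Z → LinIndep φ (push f Z)
    from li Y Y⊆ ne e = li (preimage f Y)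
      (λ {j} j∈ → let j′ , a , c = push⁻ f Z (f j) (⊆-bit Y⊆ (trans (sym (lookup∘tabulate _ j)) (∈⇒true j∈)))
                  in true⇒∈ (subst (λ t → lookup Z t ≡ true) (inj c) a))
      (let i , i∈ = ne ; j , a , c = push⁻ f Z i (⊆-bit Y⊆ (∈⇒true i∈))
       in j , true⇒∈ (trans (lookup∘tabulate _ j) (trans (cong (lookup Y) c) (∈⇒true i∈))))
      (trans (sym (vsum-push φ f (preimage f Y))) (trans (cong (vsum φ) push-preimage) e))
      where
      push-preimage : push f (preimage f Y) ≡ Y
      push-preimage = bits-ext
        (λ i e′ → let j , a , c = push⁻ f (preimage f Y) i e′ in trans (cong (lookup Y) (sym c)) (trans (sym (lookup∘tabulate _ j)) a))
        (λ i e′ → let j , a , c = push⁻ f Z i (⊆-bit Y⊆ e′) in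
          subst (λ t → lookup (push f (preimage f Y)) t ≡ true) c (push⁺ f inj (preimage f Y) j (trans (lookup∘tabulate _ j) (trans (cong (lookup Y) c) e′))))

opaque
  imageColour : (Fin r → V n) → Colouring n
  imageColour φ v = ⌊ Finₚ.any? (λ i → φ i ≟V v) ⌋

  imageColour⁻ : (φ : Fin r → V n) {v : V n} → imageColour φ v ≡ true → ∃[ i ] φ i ≡ v
  imageColour⁻ φ {v} e with Finₚ.any? (λ i → φ i ≟V v)
  ... | yes found = found

  imageColour⁺ : (φ : Fin r → V n) (i : Fin r) → imageColour φ (φ i) ≡ true
  imageColour⁺ φ i with Finₚ.any? (λ j → φ j ≟V φ i)
  ... | yes _   = refl
  ... | no none = contradiction (i , refl) none

module _ (M : Matroid) {φ : Fin (E M) → V k} (rep : Represents M φ) where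
  private
    to : ∀ {X} → Ind M X → LinIndep φ X
    to {X} = Equivalence.to (rep X)
    from : ∀ {X} → LinIndep φ X → Ind M X
    from {X} = Equivalence.from (rep X)

  -- `Flat` speaks of ranks only. A largest independent J in F spans F and hence φ e. Were e outside
  -- F, the greater rank of F ∪ ⁅ e ⁆ would extend J by an element of F or by e; the first
  -- contradicts the size of J, the second the span.
  flat-closed : ∀ {F} → Flat M F → ∀ {e Z} → Z ⊆ₛ F → vsum φ Z ≡ φ e → e ∈ₛ F
  flat-closed {F} flat {e} {Z} Z⊆ eq = decidable-stable (e Subₚ.∈? F) λ e∉ → clash′ e∉ (rank-exists M rep F) (rank-exists M rep (F ∪ ⁅ e ⁆))
    where
    clash′ : e ∉ₛ F → ∃[ a ] RankOf M F a → ∃[ b ] RankOf M (F ∪ ⁅ e ⁆) b → ⊥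
    clash′ e∉ (a , rk-a@((J , J⊆ , iJ , refl) , bound)) (b , rk-b@((L , L⊆ , iL , refl) , _)) =
      let x , x∈L , x∉J , ind = steinitz φ J L (to iJ) (to iL) (flat e e∉ a b rk-a rk-b) in
      new x x∉J ind (Subₚ.x∈p∪q⁻ F ⁅ e ⁆ (L⊆ x∈L))
      where
      inside : ∀ z → z ∈ₛ F → φ z ∈im rowsOf φ J
      inside z z∈ = decidable-stable (φ z ∈im? rowsOf φ J) λ z∉ → ℕₚ.<-irrefl refl
        (≤-trans (≤-reflexive (sym (size-add J z λ z∈J → z∉ (element-im φ z∈J))))
          (bound (J ∪ ⁅ z ⁆) (λ i∈ → [ J⊆ , (λ i∈z → subst (_∈ₛ F) (sym (Subₚ.x∈⁅y⁆⇒x≡y z i∈z)) z∈) ]′ (Subₚ.x∈p∪q⁻ J ⁅ z ⁆ i∈)) (from (add-indep φ (to iJ) z∉))))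
      e-inside : φ e ∈im rowsOf φ J
      e-inside = subst (_∈im rowsOf φ J) eq (sums Z λ z z∈ → inside z (Z⊆ z∈))
        where
        sums : ∀ Z → (∀ z → z ∈ₛ Z → φ z ∈im rowsOf φ J) → vsum φ Z ∈im rowsOf φ J
        sums Z f = subst (_∈im rowsOf φ J) (sym (vsum-comb φ Z)) (subst (_∈im rowsOf φ J) (select-sum (tabulate φ) Z)
          (∈im-rows (select (tabulate φ) Z) (λ i → rows Z (tabulate φ) (λ z z∈ → subst (_∈im rowsOf φ J) (sym (lookup∘tabulate φ z)) (f z z∈)) i) (full , refl)))
          where
          rows : ∀ {m} (Z : Subset m) (M : Mat m k) → (∀ z → z ∈ₛ Z → lookup M z ∈im rowsOf φ J) → ∀ i → lookup (select M Z) i ∈im rowsOf φ J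
          rows (true ∷ Z)  (v ∷ M) f zero    = f zero Vec.here
          rows (true ∷ Z)  (v ∷ M) f (suc i) = rows Z M (λ z z∈ → f (suc z) (Vec.there z∈)) i
          rows (false ∷ Z) (v ∷ M) f i       = rows Z M (λ z z∈ → f (suc z) (Vec.there z∈)) i
      new : ∀ x → x ∉ₛ J → LinIndep φ (J ∪ ⁅ x ⁆) → x ∈ₛ F ⊎ x ∈ₛ ⁅ e ⁆ → ⊥
      new x x∉ ind (inj₁ x∈F) = ℕₚ.<-irrefl refl (≤-trans (≤-reflexive (sym (size-add J x x∉)))
        (bound (J ∪ ⁅ x ⁆) (λ i∈ → [ J⊆ , (λ i∈x → subst (_∈ₛ F) (sym (Subₚ.x∈⁅y⁆⇒x≡y x i∈x)) x∈F) ]′ (Subₚ.x∈p∪q⁻ J ⁅ x ⁆ i∈)) (from ind)))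
      new x x∉ ind (inj₂ x∈e) with refl ← Subₚ.x∈⁅y⁆⇒x≡y e x∈e with Z′ , Z′⊆ , eq′ ← im-rowsOf φ e-inside =
        ind (Z′ ⊕ ⁅ x ⁆) (⊕-⊆ (λ i∈ → Subₚ.x∈p∪q⁺ (inj₁ (Z′⊆ i∈))) (λ i∈ → Subₚ.x∈p∪q⁺ (inj₂ i∈)))
          (≢𝟘⇒Nonempty λ z → x∉ (Z′⊆ (subst (x ∈ₛ_) (sym (⊕-≡𝟘 z)) (Subₚ.x∈⁅x⁆ x))))
          (trans (vsum-⊕ φ Z′ ⁅ x ⁆) (trans (cong₂ _⊕_ eq′ (vsum-unit φ x)) (⊕-self (φ x))))

  excluded⇒pat : (∀ {i j} → φ i ≡ φ j → i ≡ j) → (∀ i → φ i ≢ 𝟘) → HasExcludedFlat M → Pat (imageColour φ)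
  excluded⇒pat φ-inj φ≢𝟘 (F , flat , X , f , f-inj , covers , iso) = record
    { X = X ; w = φ ∘ f ; w-inj = f-inj ∘ φ-inj ; w≢𝟘 = φ≢𝟘 ∘ f ; green = imageColour⁺ φ ∘ f
    ; ind = λ Y → iso Y ⇔-∘ (rep (image f Y) ⇔-∘ subst (λ t → LinIndep φ t ⇔ LinIndep (φ ∘ f) Y) (sym (image-push f f-inj Y)) (LinIndep-push f f-inj φ Y))
    ; closed = λ Y _ Tv →
        let i , e = imageColour⁻ φ Tv
            i∈ = flat-closed flat {i} {push f Y}
                   (λ {a} a∈ → let j , _ , c = push⁻ f Y a (∈⇒true a∈) in Equivalence.from (covers a) (j , c))
                   (trans (vsum-push φ f Y) (sym e))
            j , c = Equivalence.to (covers i) i∈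
        in j , trans (cong φ c) e }

  -- F collects all elements in the span of w, which makes the rank grow with any element outside.
  -- `closed` ensures that it collects only the elements `f j`.
  pat⇒excluded : (∀ {i j} → φ i ≡ φ j → i ≡ j) → (∀ i → φ i ≢ 𝟘) → Pat (imageColour φ) → HasExcludedFlat M
  pat⇒excluded φ-inj φ≢𝟘 P = F , flat , X , f , f-inj , covers , iso
    where
    open Pat P
    f : Fin (size (excluded X)) → Fin (E M)
    f j = proj₁ (imageColour⁻ φ (green j))
    φf : ∀ j → φ (f j) ≡ w j
    φf j = proj₂ (imageColour⁻ φ (green j))
    f-inj : ∀ {a b} → f a ≡ f b → a ≡ b
    f-inj {a} {b} e = w-inj (trans (sym (φf a)) (trans (cong φ e) (φf b)))
    Spanned : V k → Set
    Spanned v = ∃[ Y ] vsum w Y ≡ v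
    spanned? : ∀ i → Dec (Spanned (φ i))
    spanned? i = search-V λ Y → vsum w Y ≟V φ i
    F : Subset (E M)
    F = tabulate λ i → ⌊ spanned? i ⌋
    F⁻ : ∀ {i} → i ∈ₛ F → Spanned (φ i)
    F⁻ {i} i∈ with spanned? i | trans (sym (lookup∘tabulate (λ i → ⌊ spanned? i ⌋) i)) (∈⇒true i∈)
    ... | yes s | _ = s
    F⁺ : ∀ {i} → Spanned (φ i) → i ∈ₛ F
    F⁺ {i} s = true⇒∈ (trans (lookup∘tabulate (λ i → ⌊ spanned? i ⌋) i) (decide (spanned? i)))
      where
      decide : (d : Dec (Spanned (φ i))) → ⌊ d ⌋ ≡ true
      decide (yes _) = refl
      decide (no ¬s) = contradiction s ¬s
    covers : ∀ i → i ∈ₛ F ⇔ (∃[ j ] f j ≡ i)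
    covers i = mk⇔ forth λ { (j , refl) → F⁺ (⁅ j ⁆ , trans (vsum-unit w j) (sym (φf j))) }
      where
      forth : i ∈ₛ F → ∃[ j ] f j ≡ i
      forth i∈ with Y , e ← F⁻ i∈ with j , e′ ← closed Y (λ z → φ≢𝟘 i (trans (sym e) z)) (subst (λ t → imageColour φ t ≡ true) (sym e) (imageColour⁺ φ i)) =
        j , φ-inj (trans (φf j) (trans e′ e))
    iso : ∀ Y → Indep (excluded X) Y ⇔ Ind M (image f Y)
    iso Y = ind Y ⇔-∘ (mk⇔ (λ li Z Z⊆ ne e → li Z Z⊆ ne (trans (sym (vsum-cong φf Z)) e)) (λ li Z Z⊆ ne e → li Z Z⊆ ne (trans (vsum-cong φf Z) e))
      ⇔-∘ mk⇔ (λ li → from (subst (LinIndep φ) (sym (image-push f f-inj Y)) (Equivalence.from (LinIndep-push f f-inj φ Y) li)))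
              (λ i → Equivalence.to (LinIndep-push f f-inj φ Y) (subst (LinIndep φ) (image-push f f-inj Y) (to i))))
    flat : Flat M F
    flat e e∉ a b ((J , J⊆ , iJ , refl) , _) (_ , bound) =
      ≤-trans (≤-reflexive (sym (size-add J e λ e∈J → e∉ (J⊆ e∈J))))
        (bound (J ∪ ⁅ e ⁆) (λ i∈ → Subₚ.x∈p∪q⁺ (Sum.map (λ i∈J → J⊆ i∈J) id (Subₚ.x∈p∪q⁻ J ⁅ e ⁆ i∈))) (from (add-indep φ (to iJ) λ e∈ →
          let Z , Z⊆ , eq = im-rowsOf φ e∈ in e∉ (F⁺ (subst Spanned eq (spanned-sum Z λ z z∈ → F⁻ (J⊆ (Z⊆ z∈))))))))
      where
      spanned-sum : ∀ Z → (∀ z → z ∈ₛ Z → Spanned (φ z)) → Spanned (vsum φ Z)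
      spanned-sum = go φ
        where
        go : ∀ {m} (φ : Fin m → V k) (Z : Subset m) → (∀ z → z ∈ₛ Z → Spanned (φ z)) → Spanned (vsum φ Z)
        go φ []          _ = 𝟘 , vsum-𝟘 w
        go φ (true ∷ Z)  g with Y , e ← g zero Vec.here | Y′ , e′ ← go (φ ∘ suc) Z (λ z z∈ → g (suc z) (Vec.there z∈)) =
          Y ⊕ Y′ , trans (vsum-⊕ w Y Y′) (cong₂ _⊕_ e e′)
        go φ (false ∷ Z) g with Y′ , e′ ← go (φ ∘ suc) Z (λ z z∈ → g (suc z) (Vec.there z∈)) = Y′ , trans e′ (sym (⊕-idˡ _))

pat-cong : {S T : Colouring n} → (∀ v → v ≢ 𝟘 → S v ≡ T v) → Pat S → Pat T
pat-cong eq P = record { X = X ; w = w ; w-inj = w-inj ; w≢𝟘 = w≢𝟘 ; ind = ind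
  ; green = λ i → trans (sym (eq (w i) (w≢𝟘 i))) (green i) ; closed = λ Y ≢0 Tv → closed Y ≢0 (trans (eq _ ≢0) Tv) }
  where open Pat P

-- The excluded flats are connected in both colours

memberB-row : (M : Mat r n) (i : Fin r) → memberB M (lookup M i) ≡ true
memberB-row {n = n} (v ∷ M) zero with eqB v v in e
... | true  = refl
... | false = contradiction (trans (sym e) (trans (cong isZero (⊕-self v)) (isZero-𝟘 n))) λ ()
memberB-row (v ∷ M) (suc i) with eqB v (lookup M i)
... | true  = refl
... | false = memberB-row M i

rows-colour : (M : Mat r n) (v : V n) → imageColour (lookup M) v ≡ memberB M v
rows-colour M v with true-or-false (imageColour (lookup M) v)
... | inj₁ t with i , refl ← imageColour⁻ (lookup M) t = trans t (sym (memberB-row M i))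
rows-colour M v | inj₂ f with true-or-false (memberB M v)
... | inj₂ f′ = trans f (sym f′)
... | inj₁ t with i , refl ← memberB-sound M v t = contradiction (trans (sym (imageColour⁺ (lookup M) i)) f) λ ()

auto-biconn : {d : ℕ} (W : Mat r d) → autoB (memberB W) ≡ true → autoB (opp (memberB W)) ≡ true → BiConn (imageColour (lookup W)) Whole
auto-biconn {d = d} W ok ok′ =
  conn-cong (λ _ _ → tt) (λ v _ → v , comb-units v) (λ v _ _ → trans (rows-colour W v))
    (autoB-sound (memberB W) (units d) ok units-inj λ x → trans (cong (memberB W) (comb-units x))) ,
  conn-cong (λ _ _ → tt) (λ v _ → v , comb-units v) (λ v _ _ → trans (cong not (rows-colour W v)))
    (autoB-sound (opp (memberB W)) (units d) ok′ units-inj λ x → trans (cong (opp (memberB W)) (comb-units x)))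
  where
  units-inj : Inj (units d)
  units-inj = mkInj λ x e → trans (sym (comb-units x)) e

module _ (m : ℕ) where
  private
    k′ = 5 + m
    W : Mat (suc k′) k′
    W = full ∷ units k′
    T : Colouring k′
    T = imageColour (lookup W)
    row : ∀ i → lookup W (suc i) ≡ ⁅ i ⁆
    row = lookup∘tabulate ⁅_⁆

    green-full : T full ≡ true
    green-full = imageColour⁺ (lookup W) zero

    green-unit : ∀ i → T ⁅ i ⁆ ≡ true
    green-unit i = subst (λ v → T v ≡ true) (row i) (imageColour⁺ (lookup W) (suc i))

    red : ∀ x → 1 < ∣ x ∣ → ∣ x ∣ < k′ → opp T x ≡ true
    red x lo hi with true-or-false (T x)
    ... | inj₂ f = cong not f
    ... | inj₁ t with imageColour⁻ (lookup W) t
    ...   | zero , refl  = contradiction hi (ℕₚ.<-irrefl (Subₚ.∣⊤∣≡n k′))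
    ...   | suc i , refl = contradiction lo (ℕₚ.<-irrefl (sym (trans (cong ∣_∣ (row i)) (Subₚ.∣⁅x⁆∣≡1 i))))

    kill-units : (π : k′ ⊸ k′) → (∀ i → ap π ⁅ i ⁆ ≡ 𝟘) → ∀ v → ap π v ≡ 𝟘
    kill-units π z v = trans (cong (ap π) (sym (comb-units v)))
      (kill-comb π (units k′) v λ i _ → trans (cong (ap π) (lookup∘tabulate ⁅_⁆ i)) (z i))

    -- The only relation is that the unit vectors add up to `full`. If π kills `full`, the fixed
    -- unit vectors add up to 𝟘, so there are none.
    green-conn : Conn T Whole
    green-conn = conn-anchored full (λ π resp → resp full tt green-full) λ π resp z v _ →
      let ε , e , _ , kills = classes π (units k′) full λ i _ → subst (Cls π) (sym (row i)) (resp ⁅ i ⁆ tt (green-unit i))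
          ε≡𝟘 = trans (sym (comb-units ε)) (trans (sym e) (trans (cong (ap π) (comb-units full)) z))
      in kill-units π (λ i → trans (cong (ap π) (sym (row i)))
           (kills i (Vecₚ.lookup-replicate i true) (trans (cong (λ u → lookup u i) ε≡𝟘) (lookup-𝟘 i)))) v

    triangle : (π : k′ ⊸ k′) {u v w : V k′} → u ⊕ v ≡ w → v ≢ w → Cls π v → Cls π w → ap π u ≡ 𝟘 → ap π v ≡ 𝟘
    triangle π {u} {v} {w} e v≢w cv cw z = kill-two π cv cw v≢w
      (trans (cong (ap π) (trans (cong (v ⊕_) (sym e)) (xor-solve (u ∷ v ∷ []) (x₁ :+ (x₀ :+ x₁)) x₀ refl))) z)

    -- Red vectors have weight between 2 and k′ − 1: the vectors ⁅ 0 ⁆ ⊕ ⁅ l ⁆ and triples reach every unit vector.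
    red-conn : Conn (opp T) Whole
    red-conn = conn-anchored (pair zero) (λ π resp → resp _ tt (red-pair zero)) λ π resp z v _ →
      let cls : ∀ x → 1 < ∣ x ∣ → ∣ x ∣ < k′ → Cls π x
          cls x lo hi = resp x tt (red x lo hi)
          zp : ∀ l → ap π (pair l) ≡ 𝟘
          zp = λ { zero → z ; (suc l) → triangle π {pair zero} {pair (suc l)} (cong (λ u → false ∷ true ∷ u) (⊕-idˡ ⁅ l ⁆)) (λ ()) (resp _ tt (red-pair (suc l))) (cls (false ∷ true ∷ ⁅ l ⁆) (two-lo l) (two-hi l)) z }
          zt = triangle π {pair (suc (suc zero))} {t} {t′} (cong (λ u → false ∷ true ∷ true ∷ true ∷ u) (⊕-idˡ 𝟘)) (λ ()) (cls t three-lo three-hi) (cls t′ three-lo three-hi) (zp (suc (suc zero)))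
          z₀ : ap π ⁅ zero ⁆ ≡ 𝟘
          z₀ = trans (cong (ap π) (sym (e₀ m))) (trans (add π t _) (trans (cong₂ _⊕_ zt (trans (add π (pair zero) (pair (suc zero))) (trans (cong₂ _⊕_ (zp zero) (zp (suc zero))) (⊕-idˡ 𝟘)))) (⊕-idˡ 𝟘)))
      in kill-units π (λ { zero → z₀ ; (suc l) → trans (cong (ap π) {y = pair l ⊕ ⁅ zero ⁆} (cong (false ∷_) (sym (⊕-idʳ ⁅ l ⁆)))) (trans (add π (pair l) ⁅ zero ⁆) (trans (cong₂ _⊕_ (zp l) z₀) (⊕-idˡ 𝟘))) }) v
      where
      pair : Fin (4 + m) → V k′
      pair l = true ∷ ⁅ l ⁆
      red-pair : ∀ l → opp T (pair l) ≡ true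
      red-pair l = red (pair l) (≤-reflexive (cong suc (sym (Subₚ.∣⁅x⁆∣≡1 l)))) (s≤s (≤-trans (≤-reflexive (cong suc (Subₚ.∣⁅x⁆∣≡1 l))) (s≤s (s≤s z≤n))))
      two-lo : ∀ (l : Fin (3 + m)) → 1 < suc ∣ ⁅ l ⁆ ∣
      two-lo l = ≤-reflexive (cong suc (sym (Subₚ.∣⁅x⁆∣≡1 l)))
      two-hi : ∀ (l : Fin (3 + m)) → suc ∣ ⁅ l ⁆ ∣ < k′
      two-hi l = s≤s (≤-trans (≤-reflexive (cong suc (Subₚ.∣⁅x⁆∣≡1 l))) (s≤s (s≤s z≤n)))
      t t′ : V k′
      t  = true ∷ true ∷ true ∷ false ∷ 𝟘
      t′ = false ∷ true ∷ true ∷ true ∷ 𝟘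
      three-lo : 1 < 3 + ∣ 𝟘 {suc m} ∣
      three-lo = s≤s (s≤s z≤n)
      three-hi : 3 + ∣ 𝟘 {suc m} ∣ < k′
      three-hi = s≤s (s≤s (s≤s (s≤s (≤-trans (≤-reflexive (Subₚ.∣⊥∣≡0 (suc m))) z≤n))))
      e₀ : ∀ m → (true ∷ true ∷ true ∷ false ∷ 𝟘 {suc m}) ⊕ ((true ∷ ⁅ zero ⁆) ⊕ (true ∷ ⁅ suc zero ⁆)) ≡ ⁅ zero ⁆
      e₀ m = cong (λ u → true ∷ false ∷ false ∷ false ∷ u) (trans (⊕-idˡ _) (⊕-idˡ 𝟘))

  circuit-biconn : BiConn (imageColour (lookup (full ∷ units (5 + m)))) Whole
  circuit-biconn = green-conn , red-conn

opaque
  unfolding autoB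

  -- Only the circuits form an infinite family and require an argument; the other seven matroids are
  -- settled by evaluation.
  std-biconn : ∀ X → BiConn (imageColour (lookup (Std.W (std X)))) Whole
  std-biconn (circuit (suc (suc (suc (suc (suc (suc m)))))) _) = circuit-biconn m
  std-biconn (circuit (suc (suc (suc (suc (suc zero))))) (s≤s (s≤s (s≤s (s≤s (s≤s ()))))))
  std-biconn (circuit (suc (suc (suc (suc zero)))) (s≤s (s≤s (s≤s (s≤s ())))))
  std-biconn (circuit (suc (suc (suc zero))) (s≤s (s≤s (s≤s ()))))
  std-biconn (circuit (suc (suc zero)) (s≤s (s≤s ())))
  std-biconn (circuit (suc zero) (s≤s ()))
  std-biconn pUU       = auto-biconn (units 5 ++ extra-pUU) refl refl
  std-biconn c5        = auto-biconn (units 4 ++ extra-c5) refl refl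
  std-biconn c5c       = auto-biconn (units 4 ++ extra-c5c) refl refl
  std-biconn c5cc-meet = auto-biconn (units 4 ++ extra-meet) refl refl
  std-biconn c5cc-disj = auto-biconn (units 4 ++ extra-disj) refl refl
  std-biconn k23       = auto-biconn (units 4 ++ extra-k23) refl refl
  std-biconn k23e      = auto-biconn (units 4 ++ extra-k23e) refl refl

2≤std : ∀ X → 2 ≤ Std.d (std X)
2≤std (circuit (suc (suc (suc _))) _) = s≤s (s≤s z≤n)
2≤std (circuit (suc (suc zero)) (s≤s (s≤s ())))
2≤std (circuit (suc zero) (s≤s ()))
2≤std pUU       = s≤s (s≤s z≤n)
2≤std c5        = s≤s (s≤s z≤n)
2≤std c5c       = s≤s (s≤s z≤n)
2≤std c5cc-meet = s≤s (s≤s z≤n)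
2≤std c5cc-disj = s≤s (s≤s z≤n)
2≤std k23       = s≤s (s≤s z≤n)
2≤std k23e      = s≤s (s≤s z≤n)

-- Colourings with no subspace connected in both colours

HS : Colouring n → Set
HS {n} T = ∀ {d} (g : Mat d n) → Inj g → 2 ≤ d → ¬ BiConn T (_∈im g)

biconn-transfer : {S : Colouring n} {T : Colouring k} {g : Mat r n} {h : Mat r k} → 2 ≤ r → Inj g → Inj h →
  (∀ x → x ≢ 𝟘 → S (comb g x) ≡ T (comb h x)) → BiConn S (_∈im g) → BiConn T (_∈im h)
biconn-transfer {S = S} {T} {g} {h} 2≤r gi hi eq (c , c′) = one S T eq c , one (opp S) (opp T) (λ x x≢ → cong not (eq x x≢)) c′
  where
  one : ∀ S T → (∀ x → x ≢ 𝟘 → S (comb g x) ≡ T (comb h x)) → Conn S (_∈im g) → Conn T (_∈im h)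
  one S T eq c = conn-relative 2≤r hi
    (conn-cong (λ _ → id) (λ _ → id) (λ x x≢ _ t → trans (sym (eq x x≢)) t) (conn-absolute gi c))

HS-opp : {S T : Colouring n} → (∀ v → v ≢ 𝟘 → T v ≡ opp S v) → HS S → HS T
HS-opp {S = S} {T} eq hs g gi 2≤d (c , c′) = hs g gi 2≤d
  ( conn-cong (λ _ → id) (λ _ → id) (λ v v≢ _ e → trans (sym (Boolₚ.not-involutive (S v))) (trans (sym (cong not (eq v v≢))) e)) c′
  , conn-cong (λ _ → id) (λ _ → id) (λ v v≢ _ e → trans (sym (eq v v≢)) e) c )

biconn-cong : {T : Colouring n} {W W′ : V n → Set} → (∀ v → W v → W′ v) → (∀ v → W′ v → W v) → BiConn T W → BiConn T W′
biconn-cong to from (c , c′) = conn-cong to from (λ _ _ _ → id) c , conn-cong to from (λ _ _ _ → id) c′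

module _ (φ : Fin r → V n) (ψ : Fin r → V k) (same : ∀ Y → LinIndep φ Y ⇔ LinIndep ψ Y) where
  private
    to-ψ : ∀ {Y} → vsum φ Y ≡ 𝟘 → vsum ψ Y ≡ 𝟘
    to-ψ = zero-transfer φ ψ same _
    to-φ : ∀ {Y} → vsum ψ Y ≡ 𝟘 → vsum φ Y ≡ 𝟘
    to-φ = zero-transfer ψ φ (λ Y → mk⇔ (Equivalence.from (same Y)) (Equivalence.to (same Y))) _

    comb-push : ∀ {m d} (χ : Fin r → V m) (J : Fin d → Fin r) x → comb (tabulate (χ ∘ J)) x ≡ vsum χ (push J x)
    comb-push χ J x = trans (sym (vsum-comb (χ ∘ J) x)) (sym (vsum-push χ J x))

    member : ∀ {a b d} (α : Fin r → V a) (β : Fin r → V b) → (∀ Y → vsum α Y ≡ 𝟘 → vsum β Y ≡ 𝟘) → (J : Fin d → Fin r) → ∀ x →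
      imageColour α (comb (tabulate (α ∘ J)) x) ≡ true → imageColour β (comb (tabulate (β ∘ J)) x) ≡ true
    member α β to J x e =
      let i , eq = imageColour⁻ α e
          eq′ = ⊕-≡𝟘 (trans (sym (cong₂ _⊕_ (vsum-unit β i) refl)) (trans (sym (vsum-⊕ β ⁅ i ⁆ (push J x)))
                  (to (⁅ i ⁆ ⊕ push J x) (trans (vsum-⊕ α ⁅ i ⁆ (push J x)) (trans (cong₂ _⊕_ (trans (vsum-unit α i) eq) (sym (comb-push α J x))) (⊕-self _))))))
      in trans (cong (imageColour β) (trans (comb-push β J x) (sym eq′))) (imageColour⁺ β i)

  rep-inj : ∀ {d} (J : Fin d → Fin r) → Inj (tabulate (φ ∘ J)) → Inj (tabulate (ψ ∘ J))
  rep-inj J gi = mkInj λ x e → ker gi x (trans (comb-push φ J x) (to-φ (trans (sym (comb-push ψ J x)) e)))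

  rep-biconn : ∀ {d} (J : Fin d → Fin r) → 2 ≤ d → Inj (tabulate (φ ∘ J)) →
    BiConn (imageColour φ) (_∈im tabulate (φ ∘ J)) → BiConn (imageColour ψ) (_∈im tabulate (ψ ∘ J))
  rep-biconn J 2≤d gi = biconn-transfer 2≤d gi (rep-inj J gi) λ x _ → agree x
    where
    agree : ∀ x → imageColour φ (comb (tabulate (φ ∘ J)) x) ≡ imageColour ψ (comb (tabulate (ψ ∘ J)) x)
    agree x with true-or-false (imageColour φ (comb (tabulate (φ ∘ J)) x)) | true-or-false (imageColour ψ (comb (tabulate (ψ ∘ J)) x))
    ... | inj₁ t | _      = trans t (sym (member φ ψ (λ _ → to-ψ) J x t))
    ... | inj₂ f | inj₂ g = trans f (sym g)
    ... | inj₂ f | inj₁ t = contradiction (trans (sym (member ψ φ (λ _ → to-φ) J x t)) f) λ ()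

  -- A subspace of one representing space has a counterpart in the other only if elements span it. A
  -- connected colour spans, so a subspace connected in both colours has a basis of green vectors,
  -- that is of elements, and these can be read in the other representation.
  rep-HS : HS (imageColour ψ) → HS (imageColour φ)
  rep-HS hs {d} g gi 2≤d bc@(c , _) = by-basis (green-basis 2≤d (conn-absolute gi c))
    where
    by-basis : Σ (Mat d d) (λ B → Inj B × (∀ i → imageColour φ (comb g (lookup B i)) ≡ true)) → ⊥
    by-basis (B , Bi , gr) = hs (tabulate (ψ ∘ J)) (rep-inj J h-inj) 2≤d (rep-biconn J 2≤d h-inj
        (biconn-cong (λ { v (x , refl) → let y , e = Rebase.onto (imageColour φ ∘ comb g) B Bi x in y , trans (h≡ y) (cong (comb g) e) })
                     (λ { v (y , refl) → comb B y , sym (h≡ y) }) bc))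
      where
      J : Fin d → Fin r
      J i = proj₁ (imageColour⁻ φ (gr i))
      h≡ : ∀ y → comb (tabulate (φ ∘ J)) y ≡ comb g (comb B y)
      h≡ y = trans (cong (λ M → comb M y) (trans (tabulate-cong λ i → trans (proj₂ (imageColour⁻ φ (gr i))) (sym (lookup-map i (comb g) B)))
        (tabulate∘lookup (map (comb g) B)))) (sym (ap-comb (lin g) B y))
      h-inj : Inj (tabulate (φ ∘ J))
      h-inj = mkInj λ y e → ker Bi y (ker gi _ (trans (sym (h≡ y)) e))

-- w and the standard matrix represent the same matroid, so connectedness carries over from the
-- latter. By `closed`, T agrees off 𝟘 on the span of w with the colouring given by w alone.
pat⇒biconn : {T : Colouring n} → Pat T → ¬ HS T
pat⇒biconn {T = T} P hs = hs g g-inj (2≤std X) (one , two)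
  where
  open Pat P
  open Std (std X) using (W; basis; W-basis)
  same : ∀ Y → LinIndep (lookup W) Y ⇔ LinIndep w Y
  same Y = mk⇔ (Equivalence.to (ind Y) ∘ Equivalence.from (Std.ind (std X) Y)) (Equivalence.to (Std.ind (std X) Y) ∘ Equivalence.from (ind Y))
  g = tabulate (w ∘ basis)
  units≡ : tabulate (lookup W ∘ basis) ≡ units _
  units≡ = tabulate-cong W-basis
  W-inj′ : Inj (tabulate (lookup W ∘ basis))
  W-inj′ = subst Inj (sym units≡) (mkInj λ x e → trans (sym (comb-units x)) e)
  g-inj : Inj g
  g-inj = rep-inj (lookup W) w same basis W-inj′
  agree : ∀ v → v ≢ 𝟘 → v ∈im g → imageColour w v ≡ T v
  agree v v≢ (x , e) with true-or-false (imageColour w v) | true-or-false (T v)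
  ... | inj₂ a | inj₂ b = trans a (sym b)
  ... | inj₁ a | _ = let i , eq = imageColour⁻ w a in trans a (trans (sym (green i)) (cong T eq))
  ... | inj₂ a | inj₁ b =
    let s : vsum w (push basis x) ≡ v
        s = trans (vsum-push w basis x) (trans (vsum-comb (w ∘ basis) x) e)
        i , eq = closed (push basis x) (λ z → v≢ (trans (sym s) z)) (trans (cong T s) b)
    in contradiction (trans (sym (imageColour⁺ w i)) (trans (cong (imageColour w) (trans eq s)) a)) λ ()
  bc : BiConn (imageColour w) (_∈im g)
  bc = rep-biconn (lookup W) w same basis (2≤std X) W-inj′
    (biconn-cong (λ v _ → subst (v ∈im_) (sym units≡) (v , comb-units v)) (λ _ _ → tt) (std-biconn X))
  one : Conn T (_∈im g)
  one = conn-cong (λ _ → id) (λ _ → id) (λ v v≢ v∈ e → trans (sym (agree v v≢ v∈)) e) (proj₁ bc)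
  two : Conn (opp T) (_∈im g)
  two = conn-cong (λ _ → id) (λ _ → id) (λ v v≢ v∈ e → trans (cong not (sym (agree v v≢ v∈))) e) (proj₂ bc)

HSMatroid : Matroid → Set
HSMatroid M = ∃[ k ] Σ (Fin (E M) → V k) λ φ → Represents M φ × HS (imageColour φ)

HS-any : ∀ {M} → HSMatroid M → {φ : Fin (E M) → V n} → Represents M φ → HS (imageColour φ)
HS-any (_ , ψ , repψ , hs) {φ} rep = rep-HS φ ψ
  (λ Y → mk⇔ (Equivalence.to (repψ Y) ∘ Equivalence.from (rep Y)) (Equivalence.to (rep Y) ∘ Equivalence.from (repψ Y))) hs

-- Direct sums and complements preserve the property

take-++ : ∀ k (u : V k) (v : V l) → take k (u ++ v) ≡ u
take-++ zero    []      v = refl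
take-++ (suc k) (b ∷ u) v = cong (b ∷_) (take-++ k u v)

drop-++ : ∀ k (u : V k) (v : V l) → drop k (u ++ v) ≡ v
drop-++ zero    []      v = refl
drop-++ (suc k) (b ∷ u) v = drop-++ k u v

-- The projection of a block sum to a summand acts on each green vector by 0 or the identity, so a connected subspace lies in one summand.
module _ {a b k l} (φ₁ : Fin a → V k) (φ₂ : Fin b → V l) where
  block : Fin (a + b) → V (k + l)
  block = [ (λ i → φ₁ i ++ 𝟘) , (λ j → 𝟘 ++ φ₂ j) ]′ ∘ Fin.splitAt a

  vsum-block : ∀ (Y : Subset a) (Z : Subset b) → vsum block (Y ++ Z) ≡ vsum φ₁ Y ++ vsum φ₂ Z
  vsum-block Y Z = trans (vsum-comb block (Y ++ Z)) (trans (cong (λ M → comb M (Y ++ Z)) rows)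
    (trans (comb-++ (tabulate λ i → φ₁ i ++ 𝟘) (tabulate λ j → 𝟘 ++ φ₂ j) Y Z) (trans (cong₂ _⊕_ (trans (sym (vsum-comb _ Y)) (sym (ap-vsum padʳ φ₁ Y))) (trans (sym (vsum-comb _ Z)) (sym (ap-vsum padˡ φ₂ Z))))
    (trans (++-⊕ (vsum φ₁ Y) 𝟘 𝟘 (vsum φ₂ Z)) (cong₂ _++_ (⊕-idʳ (vsum φ₁ Y)) (⊕-idˡ (vsum φ₂ Z)))))))
    where
    padʳ : k ⊸ (k + l)
    padʳ = record { ap = _++ 𝟘 ; add = λ u v → trans (cong ((u ⊕ v) ++_) (sym (⊕-idˡ 𝟘))) (sym (++-⊕ u v 𝟘 𝟘)) }
    padˡ : l ⊸ (k + l)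
    padˡ = record { ap = 𝟘 ++_ ; add = λ u v → trans (cong (_++ (u ⊕ v)) (sym (⊕-idˡ 𝟘))) (sym (++-⊕ 𝟘 𝟘 u v)) }
    rows : tabulate block ≡ tabulate (λ i → φ₁ i ++ 𝟘) ++ tabulate (λ j → 𝟘 ++ φ₂ j)
    rows = sym (trans (sym (tabulate∘lookup _)) (tabulate-cong λ i → trans (Vecₚ.lookup-splitAt a (tabulate λ i → φ₁ i ++ 𝟘) _ i)
      (cases (Fin.splitAt a i))))
      where
      cases : ∀ s → [ lookup (tabulate λ i → φ₁ i ++ 𝟘) , lookup (tabulate λ j → 𝟘 {k} ++ φ₂ j) ]′ s ≡ [ (λ i → φ₁ i ++ 𝟘) , (λ j → 𝟘 ++ φ₂ j) ]′ s
      cases (inj₁ i) = lookup∘tabulate _ i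
      cases (inj₂ j) = lookup∘tabulate _ j

  block-green : ∀ v → imageColour block v ≡ true →
    (drop k v ≡ 𝟘 × imageColour φ₁ (take k v) ≡ true) ⊎ (take k v ≡ 𝟘 × imageColour φ₂ (drop k v) ≡ true)
  block-green v e with i , refl ← imageColour⁻ block e with Fin.splitAt a i
  ... | inj₁ i′ = inj₁ (drop-++ k _ _ , trans (cong (imageColour φ₁) (take-++ k _ _)) (imageColour⁺ φ₁ i′))
  ... | inj₂ j  = inj₂ (take-++ k 𝟘 _ , trans (cong (imageColour φ₂) (drop-++ k 𝟘 _)) (imageColour⁺ φ₂ j))

  block-↑ˡ : ∀ i → block (i ↑ˡ b) ≡ φ₁ i ++ 𝟘
  block-↑ˡ i = cong [ (λ i → φ₁ i ++ 𝟘) , (λ j → 𝟘 ++ φ₂ j) ]′ (Finₚ.splitAt-↑ˡ a i b)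

  block-↑ʳ : ∀ j → block (a ↑ʳ j) ≡ 𝟘 ++ φ₂ j
  block-↑ʳ j = cong [ (λ i → φ₁ i ++ 𝟘) , (λ j → 𝟘 ++ φ₂ j) ]′ (Finₚ.splitAt-↑ʳ a b j)

  block-left : ∀ i → imageColour block (φ₁ i ++ 𝟘) ≡ true
  block-left i = subst (λ v → imageColour block v ≡ true) (block-↑ˡ i) (imageColour⁺ block (i ↑ˡ b))

  block-right : ∀ j → imageColour block (𝟘 ++ φ₂ j) ≡ true
  block-right j = subst (λ v → imageColour block v ≡ true) (block-↑ʳ j) (imageColour⁺ block (a ↑ʳ j))

  LinIndep-block : ∀ Y → LinIndep block Y ⇔ (LinIndep φ₁ (take a Y) × LinIndep φ₂ (drop a Y))
  LinIndep-block Y = mk⇔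
    (λ li → (λ Z Z⊆ ne e → li (Z ++ 𝟘) (sub Y (λ {i} → Z⊆ {i}) (λ i∈ → contradiction i∈ Subₚ.∉⊥)) (≢𝟘⇒Nonempty λ z → Nonempty⇒≢𝟘 ne (trans (sym (take-++ a Z 𝟘)) (trans (cong (take a) z) (ap-𝟘 (takeL a)))))
                (trans (vsum-block Z 𝟘) (trans (cong₂ _++_ e (vsum-𝟘 φ₂)) (++-𝟘 k))))
          , (λ Z Z⊆ ne e → li (𝟘 ++ Z) (sub Y (λ i∈ → contradiction i∈ Subₚ.∉⊥) (λ {i} → Z⊆ {i})) (≢𝟘⇒Nonempty λ z → Nonempty⇒≢𝟘 ne (trans (sym (drop-++ a 𝟘 Z)) (trans (cong (drop a) z) (ap-𝟘 (dropL a)))))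
                (trans (vsum-block 𝟘 Z) (trans (cong₂ _++_ (vsum-𝟘 φ₁) e) (++-𝟘 k)))))
    λ (li₁ , li₂) Z Z⊆ ne e →
      let s : vsum φ₁ (take a Z) ++ vsum φ₂ (drop a Z) ≡ 𝟘
          s = trans (sym (vsum-block (take a Z) (drop a Z))) (trans (cong (vsum block) (Vecₚ.take++drop≡id a Z)) e)
          z₁ = trans (sym (take-++ k _ _)) (trans (cong (take k) s) (ap-𝟘 (takeL k)))
          z₂ = trans (sym (drop-++ k (vsum φ₁ (take a Z)) _)) (trans (cong (drop k) s) (ap-𝟘 (dropL k)))
          Z₁ = decidable-stable (take a Z ≟V 𝟘) λ ≢ → li₁ (take a Z) (λ i∈ → true⇒∈ (take-bit Y (⊆-bit Z⊆ (take-bit⁻ Z (∈⇒true i∈))))) (≢𝟘⇒Nonempty ≢) z₁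
          Z₂ = decidable-stable (drop a Z ≟V 𝟘) λ ≢ → li₂ (drop a Z) (λ i∈ → true⇒∈ (drop-bit Y (⊆-bit Z⊆ (drop-bit⁻ Z (∈⇒true i∈))))) (≢𝟘⇒Nonempty ≢) z₂
      in Nonempty⇒≢𝟘 ne (trans (sym (Vecₚ.take++drop≡id a Z)) (trans (cong₂ _++_ Z₁ Z₂) (++-𝟘 a)))
    where
    at-left : ∀ (Y : Subset (a + b)) i → lookup (take a Y) i ≡ lookup Y (i ↑ˡ b)
    at-left Y i = trans (sym (Vecₚ.lookup-++ˡ (take a Y) (drop a Y) i)) (cong (λ t → lookup t (i ↑ˡ b)) (Vecₚ.take++drop≡id a Y))
    at-right : ∀ (Y : Subset (a + b)) j → lookup (drop a Y) j ≡ lookup Y (a ↑ʳ j)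
    at-right Y j = trans (sym (Vecₚ.lookup-++ʳ (take a Y) (drop a Y) j)) (cong (λ t → lookup t (a ↑ʳ j)) (Vecₚ.take++drop≡id a Y))
    take-bit : ∀ (Y : Subset (a + b)) {i} → lookup Y (i ↑ˡ b) ≡ true → lookup (take a Y) i ≡ true
    take-bit Y e = trans (at-left Y _) e
    take-bit⁻ : ∀ (Y : Subset (a + b)) {i} → lookup (take a Y) i ≡ true → lookup Y (i ↑ˡ b) ≡ true
    take-bit⁻ Y e = trans (sym (at-left Y _)) e
    drop-bit : ∀ (Y : Subset (a + b)) {j} → lookup Y (a ↑ʳ j) ≡ true → lookup (drop a Y) j ≡ true
    drop-bit Y e = trans (at-right Y _) e
    drop-bit⁻ : ∀ (Y : Subset (a + b)) {j} → lookup (drop a Y) j ≡ true → lookup Y (a ↑ʳ j) ≡ true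
    drop-bit⁻ Y e = trans (sym (at-right Y _)) e
    sub : ∀ (Y : Subset (a + b)) {Z₁ : Subset a} {Z₂ : Subset b} → Z₁ ⊆ₛ take a Y → Z₂ ⊆ₛ drop a Y → (Z₁ ++ Z₂) ⊆ₛ Y
    sub Y {Z₁} {Z₂} s₁ s₂ {i} i∈ = true⇒∈ (subst (λ t → lookup t i ≡ true) (Vecₚ.take++drop≡id a Y)
      (trans (Vecₚ.lookup-splitAt a (take a Y) (drop a Y) i) (cases (Fin.splitAt a i) (trans (sym (Vecₚ.lookup-splitAt a Z₁ Z₂ i)) (∈⇒true i∈)))))
      where
      cases : ∀ s → [ lookup Z₁ , lookup Z₂ ]′ s ≡ true → [ lookup (take a Y) , lookup (drop a Y) ]′ s ≡ true
      cases (inj₁ i) e = ⊆-bit s₁ e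
      cases (inj₂ j) e = ⊆-bit s₂ e

  HS-block : HS (imageColour φ₁) → HS (imageColour φ₂) → HS (imageColour block)
  HS-block hs₁ hs₂ {d} g gi 2≤d bc@(c , _) = go (triv c π resp)
    where
    π : (k + l) ⊸ (k + l)
    π = record { ap = λ v → take k v ++ 𝟘
               ; add = λ u v → trans (cong₂ _++_ (add (takeL k) u v) (sym (⊕-idˡ 𝟘))) (sym (++-⊕ (take k u) (take k v) 𝟘 𝟘)) }
    parts : ∀ v → take k v ++ drop k v ≡ v
    parts v = Vecₚ.take++drop≡id k v
    resp : Resp (imageColour block) (_∈im g) π
    resp v _ Tv with block-green v Tv
    ... | inj₁ (z , _) = inj₂ (trans (cong (take k v ++_) (sym z)) (parts v))
    ... | inj₂ (z , _) = inj₁ (trans (cong (_++ 𝟘) z) (++-𝟘 k))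
    agree : ∀ {m} {S : Colouring (k + l)} {T : Colouring m} {u v} → (S u ≡ true → T v ≡ true) → (T v ≡ true → S u ≡ true) → S u ≡ T v
    agree {S = S} {T} {u} {v} f h with true-or-false (S u) | true-or-false (T v)
    ... | inj₁ s | _      = trans s (sym (f s))
    ... | inj₂ s | inj₂ t = trans s (sym t)
    ... | inj₂ s | inj₁ t = contradiction (trans (sym (h t)) s) λ ()
    go : Triv (_∈im g) π → ⊥
    go (inj₁ z) = hs₂ h h-inj 2≤d (biconn-transfer 2≤d gi h-inj same bc)
      where
      h : Mat d l
      h = map (drop k) g
      take-𝟘 : ∀ x → take k (comb g x) ≡ 𝟘
      take-𝟘 x = trans (sym (take-++ k _ _)) (trans (cong (take k) (z (comb g x) (x , refl))) (ap-𝟘 (takeL k)))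
      comb-h : ∀ x → comb h x ≡ drop k (comb g x)
      comb-h x = sym (ap-comb (dropL k) g x)
      value : ∀ x → comb g x ≡ 𝟘 ++ comb h x
      value x = trans (sym (parts _)) (cong₂ _++_ (take-𝟘 x) (sym (comb-h x)))
      h-inj : Inj h
      h-inj = mkInj λ x e → ker gi x (trans (value x) (trans (cong (𝟘 ++_) e) (++-𝟘 k)))
      same : ∀ x → x ≢ 𝟘 → imageColour block (comb g x) ≡ imageColour φ₂ (comb h x)
      same x x≢ = agree {S = imageColour block} {imageColour φ₂}
        (λ t → [ (λ (e , _) → contradiction (ker h-inj x (trans (comb-h x) e)) x≢)
               , (λ (_ , e) → trans (cong (imageColour φ₂) (comb-h x)) e) ]′ (block-green _ t))
        λ t → let j , e = imageColour⁻ φ₂ t in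
          subst (λ v → imageColour block v ≡ true) (trans (cong (𝟘 ++_) e) (sym (value x))) (block-right j)
    go (inj₂ f) = hs₁ h h-inj 2≤d (biconn-transfer 2≤d gi h-inj same bc)
      where
      h : Mat d k
      h = map (take k) g
      comb-h : ∀ x → comb h x ≡ take k (comb g x)
      comb-h x = sym (ap-comb (takeL k) g x)
      value : ∀ x → comb g x ≡ comb h x ++ 𝟘
      value x = trans (sym (f (comb g x) (x , refl))) (cong (_++ 𝟘) (sym (comb-h x)))
      h-inj : Inj h
      h-inj = mkInj λ x e → ker gi x (trans (value x) (trans (cong (_++ 𝟘) e) (++-𝟘 k)))
      same : ∀ x → x ≢ 𝟘 → imageColour block (comb g x) ≡ imageColour φ₁ (comb h x)
      same x x≢ = agree {S = imageColour block} {imageColour φ₁}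
        (λ t → [ (λ (_ , e) → trans (cong (imageColour φ₁) (comb-h x)) e)
               , (λ (e , _) → contradiction (ker h-inj x (trans (comb-h x) e)) x≢) ]′ (block-green _ t))
        λ t → let i , e = imageColour⁻ φ₁ t in
          subst (λ v → imageColour block v ≡ true) (trans (cong (_++ 𝟘) e) (sym (value x))) (block-left i)

LinIndep-≗ : {φ ψ : Fin r → V n} → (∀ i → φ i ≡ ψ i) → ∀ {Y} → LinIndep φ Y → LinIndep ψ Y
LinIndep-≗ eq li Z Z⊆ ne e = li Z Z⊆ ne (trans (vsum-cong eq Z) e)

module _ {σ : Fin r → Fin n} (σ-bij : Bijective _≡_ _≡_ σ) where
  private
    σ-inj : ∀ {i j} → σ i ≡ σ j → i ≡ j
    σ-inj = proj₁ σ-bij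

  unσ : Fin n → Fin r
  unσ e = proj₁ (proj₂ σ-bij e)

  σ-unσ : ∀ e → σ (unσ e) ≡ e
  σ-unσ e = proj₂ (proj₂ σ-bij e) refl

  unσ-σ : ∀ i → unσ (σ i) ≡ i
  unσ-σ i = σ-inj (σ-unσ (σ i))

  push-preimage : ∀ Y → push σ (preimage σ Y) ≡ Y
  push-preimage Y = bits-ext
    (λ i e → let j , a , c = push⁻ σ (preimage σ Y) i e in trans (cong (lookup Y) (sym c)) (trans (sym (lookup∘tabulate _ j)) a))
    (λ i e → subst (λ t → lookup (push σ (preimage σ Y)) t ≡ true) (σ-unσ i)
      (push⁺ σ σ-inj (preimage σ Y) (unσ i) (trans (lookup∘tabulate _ (unσ i)) (trans (cong (lookup Y) (σ-unσ i)) e))))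

  LinIndep-reindex : (χ : Fin n → V k) (ψ : Fin r → V k) → (∀ i → χ (σ i) ≡ ψ i) → ∀ Y → LinIndep χ Y ⇔ LinIndep ψ (preimage σ Y)
  LinIndep-reindex χ ψ eq Y = mk⇔
    (λ li → LinIndep-≗ eq (Equivalence.to (LinIndep-push σ σ-inj χ (preimage σ Y)) (subst (LinIndep χ) (sym (push-preimage Y)) li)))
    (λ li → subst (LinIndep χ) (push-preimage Y) (Equivalence.from (LinIndep-push σ σ-inj χ (preimage σ Y)) (LinIndep-≗ (sym ∘ eq) li)))

same-colour : {φ : Fin r → V n} {ψ : Fin q → V n} → (∀ i → ∃[ j ] ψ j ≡ φ i) → (∀ j → ∃[ i ] φ i ≡ ψ j) → ∀ v → imageColour φ v ≡ imageColour ψ v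
same-colour {φ = φ} {ψ} f g v with true-or-false (imageColour φ v) | true-or-false (imageColour ψ v)
... | inj₂ a | inj₂ b = trans a (sym b)
... | inj₁ a | _ = let i , e = imageColour⁻ φ a ; j , e′ = f i in
  trans a (sym (trans (cong (imageColour ψ) (sym (trans e′ e))) (imageColour⁺ ψ j)))
... | inj₂ a | inj₁ b = let j , e = imageColour⁻ ψ b ; i , e′ = g j in
  contradiction (trans (sym (trans (cong (imageColour φ) (sym (trans e′ e))) (imageColour⁺ φ i))) a) λ ()

complement-colour : {φ : Fin r → V n} {ψ : Fin q → V n} → (∀ i j → φ i ≢ ψ j) →
  (∀ v → v ≢ 𝟘 → (∃[ i ] (φ i ≡ v)) ⊎ (∃[ j ] (ψ j ≡ v))) → ∀ v → v ≢ 𝟘 → imageColour ψ v ≡ opp (imageColour φ) v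
complement-colour {φ = φ} {ψ} disjoint cover v v≢ with cover v v≢
... | inj₂ (j , refl) with true-or-false (imageColour φ (ψ j))
...   | inj₂ f = trans (imageColour⁺ ψ j) (sym (cong not f))
...   | inj₁ t = let i , e = imageColour⁻ φ t in contradiction e (disjoint i j)
complement-colour {φ = φ} {ψ} disjoint cover v v≢ | inj₁ (i , refl) with true-or-false (imageColour ψ (φ i))
...   | inj₂ f = trans f (sym (cong not (imageColour⁺ φ i)))
...   | inj₁ t = let j , e = imageColour⁻ ψ t in contradiction (sym e) (disjoint i j)

-- The recursion builds some representation, but a complement comes with representations of its own.
-- `HS-any`, which rests on the uniqueness of binary representations, moves between them.
comatroid⇒HS : ∀ {M} → Comatroid M → HSMatroid M
comatroid⇒HS (empty M e) = 0 , (λ _ → []) , (λ X → mk⇔ (λ _ _ _ (i , _) _ → absurd i) (λ _ → indep-⊆ M X ∅ (λ {i} _ → absurd i) (indep-∅ M))) ,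
  λ g gi 2≤d → contradiction (≤-trans 2≤d (Inj-size gi)) λ ()
  where
  absurd : ∀ {ℓ} {A : Set ℓ} → Fin (E M) → A
  absurd i with () ← subst Fin e i
comatroid⇒HS (dsum {M} {M₁} {M₂} c₁ c₂ (σ , bij , iso)) with k , φ₁ , rep₁ , hs₁ ← comatroid⇒HS c₁ | l , φ₂ , rep₂ , hs₂ ← comatroid⇒HS c₂ =
  k + l , χ , rep , λ g gi 2≤d bc → HS-block φ₁ φ₂ hs₁ hs₂ g gi 2≤d (biconn-transfer 2≤d gi gi (λ x _ → colour (comb g x)) bc)
  where
  χ : Fin (E M) → V (k + l)
  χ = block φ₁ φ₂ ∘ unσ bij
  rep : Represents M χ
  rep Y = iso Y ⇔-∘ (mk⇔ (λ (i₁ , i₂) → Equivalence.to (rep₁ _) i₁ , Equivalence.to (rep₂ _) i₂) (λ (i₁ , i₂) → Equivalence.from (rep₁ _) i₁ , Equivalence.from (rep₂ _) i₂)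
    ⇔-∘ mk⇔ (λ li → Equivalence.from (reindex Y) (Equivalence.from (LinIndep-block φ₁ φ₂ (preimage σ Y)) li))
            (λ li → Equivalence.to (LinIndep-block φ₁ φ₂ (preimage σ Y)) (Equivalence.to (reindex Y) li)))
    where
    reindex : ∀ Y → LinIndep χ Y ⇔ LinIndep (block φ₁ φ₂) (preimage σ Y)
    reindex = LinIndep-reindex bij χ (block φ₁ φ₂) (λ i → cong (block φ₁ φ₂) (unσ-σ bij i))
  colour : ∀ v → imageColour χ v ≡ imageColour (block φ₁ φ₂) v
  colour = same-colour (λ i → unσ bij i , refl) (λ j → σ j , cong (block φ₁ φ₂) (unσ-σ bij j))
comatroid⇒HS (compl {M} r t c _ _ (φ , ψ , repφ , repψ , _ , _ , _ , _ , disjoint , cover)) =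
  t , ψ , repψ , HS-opp (complement-colour disjoint cover) (HS-any {M = M} (comatroid⇒HS c) repφ)

-- Matroids without excluded flats are comatroids

enum-colour : ∀ d (T : Colouring d) v → v ≢ 𝟘 → imageColour (enum d T) v ≡ T v
enum-colour d T v v≢ with true-or-false (imageColour (enum d T) v) | true-or-false (T v)
... | inj₂ a | inj₂ b = trans a (sym b)
... | inj₁ a | _ = let i , e = imageColour⁻ (enum d T) a in trans a (trans (sym (enum-green d T i)) (cong T e))
... | inj₂ a | inj₁ b = let i , e = enum-index d T v v≢ b in
  contradiction (trans (sym (trans (cong (imageColour (enum d T)) (sym e)) (imageColour⁺ (enum d T) i))) a) λ ()

empty-size : ∀ n → ¬ Fin n → n ≡ 0
empty-size zero    _  = refl
empty-size (suc n) ¬i = contradiction zero ¬i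

enum-rep : ∀ d (T : Colouring d) → Represents (vectorMatroid (enum d T)) (enum d T)
enum-rep d T X = mk⇔ id id

-- The induction runs over the dimension d of the ambient space, which may exceed the rank of M; the
-- absence of patterns is stated for both colours so that it survives complements and restriction to
-- subspaces.
record Embedded (M : Matroid) (d : ℕ) : Set where
  field
    φ     : Fin (E M) → V d
    rep   : Represents M φ
    φ-inj : ∀ {i j} → φ i ≡ φ j → i ≡ j
    φ≢𝟘   : ∀ i → φ i ≢ 𝟘
    noPat : ¬ Pat (imageColour φ)
    noCo  : ¬ Pat (opp (imageColour φ))

enum-embedded : ∀ d (T : Colouring d) → ¬ Pat T → ¬ Pat (opp T) → Embedded (vectorMatroid (enum d T)) d
enum-embedded d T noT noR = record
  { φ = enum d T ; rep = enum-rep d T ; φ-inj = enum-inj d T ; φ≢𝟘 = enum-≢𝟘 d T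
  ; noPat = noT ∘ pat-cong (enum-colour d T) ; noCo = noR ∘ pat-cong (λ v v≢ → cong not (enum-colour d T v v≢)) }

module _ {M : Matroid} {d : ℕ} (emb : Embedded M d) where
  open Embedded emb
  private
    T : Colouring d
    T = imageColour φ

  coMatroid : Matroid
  coMatroid = vectorMatroid (enum d (opp T))

  coEmbedded : Embedded coMatroid d
  coEmbedded = enum-embedded d (opp T) noCo (noPat ∘ pat-cong λ v _ → Boolₚ.not-involutive (T v))

  -- Complementation inside `V d` is an involution, and d is at least the rank of `coMatroid`, so M
  -- is an admissible complement of it.
  from-complement : Comatroid coMatroid → Comatroid M
  from-complement c = let r , rk = rank-exists coMatroid (enum-rep d (opp T)) full in
    compl r d c rk (rank-≤-dim coMatroid (enum-rep d (opp T)) rk)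
      ( enum d (opp T) , φ , enum-rep d (opp T) , rep , enum-inj d (opp T) , φ-inj , enum-≢𝟘 d (opp T) , φ≢𝟘
      , (λ i j e → contradiction (trans (sym (cong not (imageColour⁺ φ j))) (trans (cong (opp T) (sym e)) (enum-green d (opp T) i))) λ ())
      , λ v v≢ → cover v v≢ (true-or-false (T v)) )
    where
    cover : ∀ v → v ≢ 𝟘 → T v ≡ true ⊎ T v ≡ false → (∃[ i ] (enum d (opp T) i ≡ v)) ⊎ (∃[ j ] (φ j ≡ v))
    cover v v≢ (inj₁ t) = inj₂ (imageColour⁻ φ t)
    cover v v≢ (inj₂ f) = inj₁ (enum-index d (opp T) v v≢ (cong not f))

  -- As all sums across are red, the elements of M lie in ⟨C⟩ and ⟨D⟩. M is the direct sum of its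
  -- restrictions to these parts, each listed by `enum` in coordinates of smaller dimension.
  from-join : (∀ {m} → m < d → {N : Matroid} → Embedded N m → Comatroid N) → Join (opp T) (_∈im units d) → Comatroid M
  from-join rec J = dsum (rec a<d emb₁) (rec b<d emb₂) (σ , (σ-inj , σ-surj) , iso)
    where
    open Join J
    T₁ : Colouring a
    T₁ = T ∘ comb C
    T₂ : Colouring b
    T₂ = T ∘ comb D
    C-inj : Inj C
    C-inj = mkInj λ x e → proj₁ (Inj-split C D inj x 𝟘 (trans (cong₂ _⊕_ e (comb-𝟘 D)) (⊕-idˡ 𝟘)))
    D-inj : Inj D
    D-inj = mkInj λ y e → proj₂ (Inj-split C D inj 𝟘 y (trans (cong₂ _⊕_ (comb-𝟘 C) e) (⊕-idˡ 𝟘)))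
    a<d : a < d
    a<d = ≤-trans (≤-trans (≤-reflexive (ℕₚ.+-comm 1 a)) (ℕₚ.+-monoʳ-≤ a 1≤b)) (Inj-size inj)
    b<d : b < d
    b<d = ≤-trans (ℕₚ.+-monoˡ-≤ b 1≤a) (Inj-size inj)
    emb₁ : Embedded (vectorMatroid (enum a T₁)) a
    emb₁ = enum-embedded a T₁ (noPat ∘ pat-map C-inj) (noCo ∘ pat-map C-inj)
    emb₂ : Embedded (vectorMatroid (enum b T₂)) b
    emb₂ = enum-embedded b T₂ (noPat ∘ pat-map D-inj) (noCo ∘ pat-map D-inj)
    left : ∀ x → comb (C ++ D) (x ++ 𝟘) ≡ comb C x
    left x = trans (comb-++ C D x 𝟘) (trans (cong (comb C x ⊕_) (comb-𝟘 D)) (⊕-idʳ _))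
    right : ∀ y → comb (C ++ D) (𝟘 ++ y) ≡ comb D y
    right y = trans (comb-++ C D 𝟘 y) (trans (cong (_⊕ comb D y) (comb-𝟘 C)) (⊕-idˡ _))
    β : Fin (card₀ a T₁ + card₀ b T₂) → V (a + b)
    β = block (enum a T₁) (enum b T₂)
    β-green : ∀ i → T (comb (C ++ D) (β i)) ≡ true
    β-green i = go (Fin.splitAt (card₀ a T₁) i)
      where
      go : ∀ s → T (comb (C ++ D) ([ (λ i → enum a T₁ i ++ 𝟘) , (λ j → 𝟘 ++ enum b T₂ j) ]′ s)) ≡ true
      go (inj₁ i) = trans (cong T (left (enum a T₁ i))) (enum-green a T₁ i)
      go (inj₂ j) = trans (cong T (right (enum b T₂ j))) (enum-green b T₂ j)
    β-inj : ∀ {i j} → β i ≡ β j → i ≡ j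
    β-inj {i} {j} e with Fin.splitAt (card₀ a T₁) i in p | Fin.splitAt (card₀ a T₁) j in q
    ... | inj₁ i′ | inj₁ j′ = trans (sym (Finₚ.splitAt⁻¹-↑ˡ p)) (trans (cong (_↑ˡ _) (enum-inj a T₁ (trans (sym (take-++ a _ _)) (trans (cong (take a) e) (take-++ a _ _))))) (Finₚ.splitAt⁻¹-↑ˡ q))
    ... | inj₂ i′ | inj₂ j′ = trans (sym (Finₚ.splitAt⁻¹-↑ʳ p)) (trans (cong (_ ↑ʳ_) (enum-inj b T₂ (trans (sym (drop-++ a 𝟘 _)) (trans (cong (drop a) e) (drop-++ a 𝟘 _))))) (Finₚ.splitAt⁻¹-↑ʳ q))
    ... | inj₁ i′ | inj₂ j′ = contradiction (trans (sym (take-++ a _ _)) (trans (cong (take a) e) (take-++ a 𝟘 _))) (enum-≢𝟘 a T₁ i′)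
    ... | inj₂ i′ | inj₁ j′ = contradiction (trans (sym (take-++ a _ _)) (trans (cong (take a) (sym e)) (take-++ a 𝟘 _))) (enum-≢𝟘 a T₁ j′)
    σ : Fin (card₀ a T₁ + card₀ b T₂) → Fin (E M)
    σ i = proj₁ (imageColour⁻ φ (β-green i))
    φσ : ∀ i → φ (σ i) ≡ comb (C ++ D) (β i)
    φσ i = proj₂ (imageColour⁻ φ (β-green i))
    σ-inj : ∀ {i j} → σ i ≡ σ j → i ≡ j
    σ-inj {i} {j} e = β-inj (Inj-≡ inj (trans (sym (φσ i)) (trans (cong φ e) (φσ j))))
    hit : ∀ e → ∃[ i ] σ i ≡ e
    hit e = cases (∈im-++ C D (spans (φ e) (φ e , comb-units (φ e))))
      where
      cases : ∃[ x ] ∃[ y ] comb C x ⊕ comb D y ≡ φ e → ∃[ i ] σ i ≡ e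
      cases (x , y , eq) with x ≟V 𝟘 | y ≟V 𝟘
      ... | no x≢ | no y≢ = contradiction (trans (sym (sums x y x≢ y≢)) (cong not (trans (cong T eq) (imageColour⁺ φ e)))) λ ()
      ... | yes refl | _ =
        let eq′ = trans (sym (⊕-idˡ _)) (trans (cong (_⊕ comb D y) (sym (comb-𝟘 C))) eq)
            j , e′ = enum-index b T₂ y (λ { refl → φ≢𝟘 e (trans (sym eq′) (comb-𝟘 D)) }) (trans (cong T eq′) (imageColour⁺ φ e))
        in card₀ a T₁ ↑ʳ j , φ-inj (trans (φσ _) (trans (cong (comb (C ++ D)) (trans (block-↑ʳ (enum a T₁) (enum b T₂) j) (cong (𝟘 ++_) e′))) (trans (right y) eq′)))
      ... | no x≢ | yes refl =
        let eq′ = trans (sym (⊕-idʳ _)) (trans (cong (comb C x ⊕_) (sym (comb-𝟘 D))) eq)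
            i , e′ = enum-index a T₁ x x≢ (trans (cong T eq′) (imageColour⁺ φ e))
        in i ↑ˡ card₀ b T₂ , φ-inj (trans (φσ _) (trans (cong (comb (C ++ D)) (trans (block-↑ˡ (enum a T₁) (enum b T₂) i) (cong (_++ 𝟘) e′))) (trans (left x) eq′)))
    σ-surj : Surjective _≡_ _≡_ σ
    σ-surj e = proj₁ (hit e) , λ { refl → proj₂ (hit e) }
    iso : ∀ Y → Ind M Y ⇔ (LinIndep (enum a T₁) (take (card₀ a T₁) (preimage σ Y)) × LinIndep (enum b T₂) (drop (card₀ a T₁) (preimage σ Y)))
    iso Y = rep Y ⇔-∘ (LinIndep-reindex (σ-inj , σ-surj) φ (comb (C ++ D) ∘ β) φσ Y
      ⇔-∘ (mk⇔ (Equivalence.from (LinIndep-∘ inj β (preimage σ Y))) (Equivalence.to (LinIndep-∘ inj β (preimage σ Y)))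
      ⇔-∘ LinIndep-block (enum a T₁) (enum b T₂) (preimage σ Y)))

  from-split : (∀ {m} → m < d → {N : Matroid} → Embedded N m → Comatroid N) → 2 ≤ d →
    (π : d ⊸ d) → Resp T Whole π → ¬ Triv Whole π → Comatroid M
  from-split rec 2≤d π resp ¬triv = from-join rec (split⇒join (mkInj λ x e → trans (sym (comb-units x)) e) 2≤d π
    (λ v _ e → resp v tt (trans (sym (Boolₚ.not-involutive (T v))) e))
    (¬triv ∘ Sum.map (λ z v _ → z v (v , comb-units v)) (λ f v _ → f v (v , comb-units v))))

embedded⇒comatroid : ∀ d {M} → Embedded M d → Comatroid M
embedded⇒comatroid = <-rec (λ d → ∀ {M} → Embedded M d → Comatroid M) λ d rec emb → step d (λ lt → rec lt) emb
  where
  step : ∀ d → (∀ {m} → m < d → ∀ {N} → Embedded N m → Comatroid N) → ∀ {M} → Embedded M d → Comatroid M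
  step zero rec {M} emb = empty M (empty-size _ λ i → φ≢𝟘 i (unique (φ i)))
    where
    open Embedded emb
    unique : (v : V 0) → v ≡ 𝟘
    unique [] = refl
  step (suc zero) rec {M} emb with true-or-false (imageColour (Embedded.φ emb) (true ∷ []))
  ... | inj₂ f = empty M (empty-size _ λ i → contradiction (trans (sym (imageColour⁺ φ i)) (trans (cong (imageColour φ) (only (φ i) (φ≢𝟘 i))) f)) λ ())
    where
    open Embedded emb
    only : (v : V 1) → v ≢ 𝟘 → v ≡ true ∷ []
    only (true ∷ [])  _  = refl
    only (false ∷ []) v≢ = contradiction refl v≢
  -- In dimension 1 a single element is the complement of the empty matroid.
  ... | inj₁ t = from-complement emb (empty (coMatroid emb) (empty-size _ λ i →
      contradiction (trans (sym (enum-green 1 (opp (imageColour φ)) i)) (cong not (trans (cong (imageColour φ) (only _ (enum-≢𝟘 1 (opp (imageColour φ)) i))) t))) λ ()))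
    where
    open Embedded emb
    only : (v : V 1) → v ≢ 𝟘 → v ≡ true ∷ []
    only (true ∷ [])  _  = refl
    only (false ∷ []) v≢ = contradiction refl v≢
  step d@(suc (suc _)) rec {M} emb = by-split (conn-or-split T (λ _ → yes tt)) (conn-or-split (imageColour (enum d (opp T))) (λ _ → yes tt))
    where
    open Embedded emb
    T = imageColour φ
    2≤d : 2 ≤ d
    2≤d = s≤s (s≤s z≤n)
    by-split : Conn T Whole ⊎ ∃[ π ] (Resp T Whole π × ¬ Triv Whole π) →
      Conn (imageColour (enum d (opp T))) Whole ⊎ ∃[ π ] (Resp (imageColour (enum d (opp T))) Whole π × ¬ Triv Whole π) → Comatroid M
    by-split (inj₂ (π , resp , ¬triv)) _ = from-split emb (λ lt → rec lt) 2≤d π resp ¬triv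
    -- The complement lives in the same dimension d, so the induction hypothesis does not apply to
    -- it; it is split at once, and its parts are smaller.
    by-split (inj₁ _) (inj₂ (π , resp , ¬triv)) = from-complement emb (from-split (coEmbedded emb) (λ lt → rec lt) 2≤d π resp ¬triv)
    by-split (inj₁ c) (inj₁ c′) = ⊥-elim (no-biconn d 2≤d c
      (conn-cong (λ _ _ → tt) (λ _ _ → tt) (λ v v≢ _ e → trans (sym (enum-colour d (opp T) v v≢)) e) c′) noPat noCo)

-- The characterisation

no-excluded : ∀ M {φ : Fin (E M) → V k} → Represents M φ → (∀ {i j} → φ i ≡ φ j → i ≡ j) → (∀ i → φ i ≢ 𝟘) → Comatroid M → ¬ HasExcludedFlat M
no-excluded M {φ} rep φ-inj φ≢𝟘 c ex = pat⇒biconn {T = imageColour φ} (excluded⇒pat M rep φ-inj φ≢𝟘 ex) (HS-any {M = M} (comatroid⇒HS c) rep)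

theorem1p2 : (M : Matroid) → Simple M → Binary M →
  (r : ℕ) → RankIs M r →
  (Mc : Matroid) → IsComplement M Mc r →
  Comatroid M ⇔ (¬ HasExcludedFlat M × ¬ HasExcludedFlat Mc)
theorem1p2 M _ _ r rk Mc comp@(φ , ψ , repφ , repψ , φ-inj , ψ-inj , φ≢𝟘 , ψ≢𝟘 , disjoint , cover) =
  mk⇔ (λ c → no-excluded M repφ φ-inj φ≢𝟘 c , no-excluded Mc repψ ψ-inj ψ≢𝟘 (compl r r c rk ≤-refl comp)) back
  where
  back : ¬ HasExcludedFlat M × ¬ HasExcludedFlat Mc → Comatroid M
  back (noM , noMc) = embedded⇒comatroid r record
    { φ = φ ; rep = repφ ; φ-inj = φ-inj ; φ≢𝟘 = φ≢𝟘
    ; noPat = λ P → noM (pat⇒excluded M repφ φ-inj φ≢𝟘 P)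
    ; noCo  = λ P → noMc (pat⇒excluded Mc repψ ψ-inj ψ≢𝟘 (pat-cong (λ v v≢ → sym (complement-colour disjoint cover v v≢)) P)) }
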